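{- Fix a finite field $\mathbb{F}_q$. For each $n\ge1$ let $g$ be chosen uniformly at random from $\mathrm{GL}_n(\mathbb{F}_q)$ and let $k=k(n)$ be a positive integer. Suppose that $$\sum_{\substack{12\log_q n<d\le n\\ \gcd(k,q^d-1)<q^{d/3}}} \frac1d\;\longrightarrow\;\infty\qquad (n\to\infty),$$ where $d$ runs over integers. Then the distribution of $\mathrm{Tr}(g^k)$ tends to the uniform distribution on $\mathbb{F}_q$ as $n\to\infty$.
   Context: $q$ is a fixed prime power; $\mathrm{GL}_n(\mathbb{F}_q)$ carries the uniform probability measure. -}

module Defs where

open import Data.Nat as ℕ using (ℕ; zero; suc; _≤_; _<_; _^_; _∸_)
open import Data.Nat.GCD using (gcd)
open import Data.Fin using (Fin; zero; suc)
open import Data.Fin.Properties as FinP using ()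
import Data.Fin.Properties
open import Data.List using (List; []; _∷_; length; filter; concatMap; map)
open import Data.List.Relation.Unary.Any as Any using (Any)
open import Data.List.Relation.Unary.Unique.Propositional using (Unique)
open import Data.List.Membership.Propositional using (_∈_)
open import Data.Integer as ℤ using (+_)
open import Data.Rational.Unnormalised as ℚᵘ using (ℚᵘ; 0ℚᵘ)
open import Data.Product using (_×_; ∃)
open import Relation.Binary.PropositionalEquality using (_≡_; _≢_)
open import Relation.Nullary using (Dec; yes; no; ¬_)
open import Relation.Nullary.Decidable using (_×-dec_)
open import Algebra.Structures using (IsCommutativeRing)

record FiniteField : Set₁ where
  infixl 6 _+_
  infixl 7 _*_
  field
    F      : Set
    _+_    : F → F → F
    _*_    : F → F → F
    -_     : F → F
    0#     : F
    1#     : F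
    isCommutativeRing : IsCommutativeRing _≡_ _+_ _*_ -_ 0# 1#
    0≢1    : 0# ≢ 1#
    inverse : ∀ x → x ≢ 0# → ∃ λ y → x * y ≡ 1#
    _≟_    : (x y : F) → Dec (x ≡ y)
    elems  : List F
    elems-unique   : Unique elems
    elems-complete : ∀ x → x ∈ elems

  q : ℕ
  q = length elems

allFuns : {A : Set} → List A → (m : ℕ) → List (Fin m → A)
allFuns xs zero    = (λ ()) ∷ []
allFuns xs (suc m) =
  concatMap (λ x → map (λ f → λ { zero → x ; (suc i) → f i }) (allFuns xs m)) xs

module Matrices (𝔽 : FiniteField) where
  open FiniteField 𝔽

  Mat : ℕ → Set
  Mat n = Fin n → Fin n → F

  Σᶠ : {n : ℕ} → (Fin n → F) → F
  Σᶠ {zero}  f = 0#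
  Σᶠ {suc n} f = f zero + Σᶠ (λ i → f (suc i))

  _*ᴹ_ : {n : ℕ} → Mat n → Mat n → Mat n
  (A *ᴹ B) i j = Σᶠ (λ l → A i l * B l j)

  Iᴹ : {n : ℕ} → Mat n
  Iᴹ i j with i Data.Fin.Properties.≟ j
  ... | yes _ = 1#
  ... | no  _ = 0#

  _^ᴹ_ : {n : ℕ} → Mat n → ℕ → Mat n
  A ^ᴹ zero  = Iᴹ
  A ^ᴹ suc k = A *ᴹ (A ^ᴹ k)

  Tr : {n : ℕ} → Mat n → F
  Tr A = Σᶠ (λ i → A i i)

  _≡ᴹ_ : {n : ℕ} → Mat n → Mat n → Set
  A ≡ᴹ B = ∀ i j → A i j ≡ B i j

  _≟ᴹ_ : {n : ℕ} (A B : Mat n) → Dec (A ≡ᴹ B)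
  A ≟ᴹ B = Data.Fin.Properties.all? (λ i → Data.Fin.Properties.all? (λ j → A i j ≟ B i j))

  allMat : (n : ℕ) → List (Mat n)
  allMat n = allFuns (allFuns elems n) n

  Invertible : {n : ℕ} → Mat n → Set
  Invertible {n} g = Any (λ h → (g *ᴹ h) ≡ᴹ Iᴹ × (h *ᴹ g) ≡ᴹ Iᴹ) (allMat n)

  invertible? : {n : ℕ} (g : Mat n) → Dec (Invertible g)
  invertible? {n} g = Any.any? (λ h → ((g *ᴹ h) ≟ᴹ Iᴹ) ×-dec ((h *ᴹ g) ≟ᴹ Iᴹ)) (allMat n)

  GL : (n : ℕ) → List (Mat n)
  GL n = filter invertible? (allMat n)

  #GL : ℕ → ℕ
  #GL n = length (GL n)

  #TrPow : (n k : ℕ) → F → ℕ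
  #TrPow n k a = length (filter (λ g → Tr (g ^ᴹ k) ≟ a) (GL n))

  -- Convergence of the law of Tr(g^{k(n)}) (g uniform in GL_n(𝔽)) to the
  -- uniform law on 𝔽:  for every ε = 1/(m+1) there is N such that for all
  -- n ≥ N and all a ∈ 𝔽,  | #TrPow n (k n) a / #GL n  -  1/q | < 1/(m+1),
  -- written with denominators cleared:
  --   (m+1) · | q · #TrPow − #GL | < q · #GL.
  TraceLawTendsToUniform : (ℕ → ℕ) → Set
  TraceLawTendsToUniform k =
    ∀ (m : ℕ) → ∃ λ N → ∀ n → N ≤ n → ∀ (a : F) →
      suc m ℕ.* ℕ.∣ q ℕ.* #TrPow n (k n) a - #GL n ∣ < q ℕ.* #GL n

-- The hypothesis  Σ_{12 log_q n < d ≤ n, gcd(k, q^d - 1) < q^{d/3}} 1/d → ∞.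
-- For integers d, n ≥ 1:  12 log_q n < d  ⇔  n^12 < q^d,
-- and gcd(k, q^d-1) < q^{d/3}  ⇔  gcd(k, q^d-1)^3 < q^d.

GoodD : (q k n d : ℕ) → Set
GoodD q k n d = (n ^ 12 < q ^ d) × (gcd k (q ^ d ∸ 1) ^ 3 < q ^ d)

goodD? : (q k n d : ℕ) → Dec (GoodD q k n d)
goodD? q k n d = (suc (n ^ 12) ℕ.≤? q ^ d) ×-dec (suc (gcd k (q ^ d ∸ 1) ^ 3) ℕ.≤? q ^ d)

harmonicGood : (q k n D : ℕ) → ℚᵘ
harmonicGood q k n zero = 0ℚᵘ
harmonicGood q k n (suc D) with goodD? q k n (suc D)
... | yes _ = harmonicGood q k n D ℚᵘ.+ ((+ 1) ℚᵘ./ suc D)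
... | no  _ = harmonicGood q k n D

S : (q : ℕ) (k : ℕ → ℕ) (n : ℕ) → ℚᵘ
S q k n = harmonicGood q (k n) n n

DivergesToInfinity : (ℕ → ℚᵘ) → Set
DivergesToInfinity s = ∀ (M : ℕ) → ∃ λ N → ∀ n → N ≤ n → ((+ M) ℚᵘ./ 1) ℚᵘ.< s n

{-# OPTIONS --safe #-}
module Submission where

-- Let ψ be q times the centred indicator function of a; then Σ_{g ∈ GL_n} ψ (Tr gᵏ) = q · #TrPow − #GL, and this sum has
-- to be small compared with #GL.
--
-- Conjugating step by step, g is brought to the form in which its first columns are those of a companion matrix.  At
-- each step the next column either extends the companion part (all such columns contribute equally) or closes it.  When
-- it closes a block of size m, the block is the companion matrix of a polynomial f with f(0) ≠ 0 that is uniform and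
-- independent of the rest, and Tr gᵏ = τ_k(f) + (trace of the rest), where τ_k(f) is the k-th power sum of the roots of f.
-- Closing a block of size at most n/2 is so rare that the trivial bound suffices.
--
-- For m ≥ n/2 the values τ_k(f) are equidistributed by a second moment argument: weight f by the number of its roots
-- that generate 𝔽_{q^d}, summed over the good d ≤ n/4 with coefficients proportional to 1/d.  The divergence hypothesis
-- makes this weight concentrate around its mean.  On the other hand a root α of degree d splits f as (minimal polynomial
-- of α) · h, so that τ_k(f) = Tr(αᵏ) + τ_k(h), and Tr(αᵏ) is equidistributed on 𝔽_{q^d} because the sum
-- Σ_α ψ (Tr αᵏ) is at most gcd(k, q^d − 1) · q^{(d+3)/2} by the orthogonality relations.

-- Complex additive characters are replaced by the integer-valued `ψ`, and every inequality is
-- cleared of denominators, so all estimates are about finite sums in ℤ. The accuracy is one integer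
-- s: relative errors are 1/s² in the moments and of order 1/s in the conclusions. The weights 1/d
-- are forced by the variance. A random polynomial has on average about one root generating 𝔽_{q^d},
-- but such roots come in sets of d conjugates, so their number has variance about d. With weights
-- c₀/d the variance of the weighted count is about c₀ times its mean μ, which is small against μ²
-- exactly when the harmonic sum μ/c₀ is large. Degrees stop at n/4 so that two minimal polynomials
-- fit into a polynomial of degree n/2; the degrees above n/4 contribute at most 4 to the harmonic
-- sum. Splitting fields and Frobenius are never constructed. Power sums are traces on F[x]/(P), and
-- Euler's formula, which reads the trace of a as the top coefficient of P′(x) a, makes them
-- additive in P. It also shows that a nonzero trace requires P′ ≠ 0; irreducible P with this
-- property are found by counting.

open import Defs
open import Data.Nat as ℕ using (ℕ; zero; suc; _≤_; _<_; z≤n; s≤s; _∸_)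
import Data.Nat.Properties as ℕₚ
open import Data.Integer as ℤ using (ℤ; +_; -[1+_]; 0ℤ; 1ℤ; ∣_∣)
import Data.Integer.Properties as ℤₚ
open import Data.Integer.Tactic.RingSolver using () renaming (solve-∀ to ℤ-solve-∀)
open import Data.Fin using (Fin; zero; suc; toℕ)
import Data.Fin as Fin
import Data.Fin.Properties as Finₚ
open import Data.List using (List; []; _∷_; length; filter; concatMap; map; _++_; downFrom)
open import Data.List.Relation.Unary.All as All using (All; []; _∷_)
open import Data.List.Relation.Unary.AllPairs using ([]; _∷_)
open import Data.List.Relation.Unary.Any as Any using (Any; here; there)
open import Data.List.Relation.Unary.Unique.Propositional using (Unique)
open import Data.List.Membership.Propositional using (_∈_; lose; find)
open import Data.Vec as Vec using (Vec; []; _∷_)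
import Data.Vec.Properties as Vecₚ
open import Data.Product using (_×_; ∃; _,_; proj₁; proj₂)
open import Data.Sum using (_⊎_; inj₁; inj₂)
open import Data.Unit using (⊤; tt)
open import Data.Empty using (⊥; ⊥-elim)
open import Data.Maybe using (Maybe; just; nothing)
open import Function using (_∘_; id)
open import Relation.Binary.PropositionalEquality using (_≡_; _≢_; refl; sym; trans; cong; cong₂; subst; subst₂; module ≡-Reasoning)
open import Relation.Nullary using (Dec; yes; no; ¬_; contradiction)
open import Relation.Nullary.Decidable using (_×-dec_; _⊎-dec_; _→-dec_; ¬?)
import Relation.Nullary.Decidable as Dec
open import Algebra.Bundles using (CommutativeRing; RawRing)
open import Algebra.Structures using (IsCommutativeRing)
import Algebra.Properties.Ring as RingProperties
import Algebra.Properties.Semiring.Mult as Multiples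
import Algebra.Solver.Ring as Solver
open import Algebra.Solver.Ring.AlmostCommutativeRing using (AlmostCommutativeRing; fromCommutativeRing; _-Raw-AlmostCommutative⟶_)
import Relation.Binary.Reasoning.Setoid as SetoidReasoning
import Data.List.Relation.Unary.Any.Properties as Anyₚ
open import Data.Nat.Divisibility using (_∣_; _∣?_; ∣-refl; ∣⇒≤; ∣m∣n⇒∣m+n; ∣m+n∣m⇒∣n)
open import Relation.Binary.Definitions using (tri<; tri≈; tri>)
open import Data.Nat.GCD using (gcd; gcd-GCD; module Bézout)
open import Level using (Level; 0ℓ)
open import Relation.Binary.PropositionalEquality.Properties using () renaming (isEquivalence to ≡-isEquivalence)

-- Integer sums over lists and over finite enumerated types

module Sums where
  open import Data.Integer using (_+_; _*_; -_; _-_) renaming (_≤_ to _≤ᶻ_)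

  ∑ : ∀ {a} {A : Set a} → List A → (A → ℤ) → ℤ
  ∑ []       f = 0ℤ
  ∑ (x ∷ xs) f = f x + ∑ xs f

  private variable
    a b : Level
    A : Set a
    B : Set b

  +ˡ : ∀ a {b c} → b ≡ c → a + b ≡ a + c
  +ˡ a = cong (λ x → a + x)

  ∑-cong : (xs : List A) {f g : A → ℤ} → (∀ x → f x ≡ g x) → ∑ xs f ≡ ∑ xs g
  ∑-cong []       h = refl
  ∑-cong (x ∷ xs) h = cong₂ _+_ (h x) (∑-cong xs h)

  ∑-++ : (xs ys : List A) (f : A → ℤ) → ∑ (xs ++ ys) f ≡ ∑ xs f + ∑ ys f
  ∑-++ []       ys f = sym (ℤₚ.+-identityˡ _)
  ∑-++ (x ∷ xs) ys f = trans (+ˡ (f x) (∑-++ xs ys f)) (sym (ℤₚ.+-assoc (f x) _ _))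

  ∑-map : (h : A → B) (xs : List A) (f : B → ℤ) → ∑ (map h xs) f ≡ ∑ xs (f ∘ h)
  ∑-map h []       f = refl
  ∑-map h (x ∷ xs) f = +ˡ (f (h x)) (∑-map h xs f)

  ∑-concatMap : (h : A → List B) (xs : List A) (f : B → ℤ) →
                ∑ (concatMap h xs) f ≡ ∑ xs (λ x → ∑ (h x) f)
  ∑-concatMap h []       f = refl
  ∑-concatMap h (x ∷ xs) f =
    trans (∑-++ (h x) (concatMap h xs) f) (+ˡ (∑ (h x) f) (∑-concatMap h xs f))

  ∑-0 : (xs : List A) → ∑ xs (λ _ → 0ℤ) ≡ 0ℤ
  ∑-0 []       = refl
  ∑-0 (x ∷ xs) = trans (ℤₚ.+-identityˡ _) (∑-0 xs)

  private
    interchange : ∀ a b c d → (a + b) + (c + d) ≡ (a + c) + (b + d)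
    interchange = ℤ-solve-∀

  ∑-+ : (xs : List A) (f g : A → ℤ) → ∑ xs (λ x → f x + g x) ≡ ∑ xs f + ∑ xs g
  ∑-+ []       f g = refl
  ∑-+ (x ∷ xs) f g = trans (+ˡ (f x + g x) (∑-+ xs f g)) (interchange (f x) _ _ _)

  ∑-*ˡ : (xs : List A) (c : ℤ) (f : A → ℤ) → ∑ xs (λ x → c * f x) ≡ c * ∑ xs f
  ∑-*ˡ []       c f = sym (ℤₚ.*-zeroʳ c)
  ∑-*ˡ (x ∷ xs) c f = trans (+ˡ (c * f x) (∑-*ˡ xs c f)) (sym (ℤₚ.*-distribˡ-+ c (f x) _))

  ∑-*ʳ : (xs : List A) (c : ℤ) (f : A → ℤ) → ∑ xs (λ x → f x * c) ≡ ∑ xs f * c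
  ∑-*ʳ xs c f = trans (∑-cong xs (λ x → ℤₚ.*-comm (f x) c)) (trans (∑-*ˡ xs c f) (ℤₚ.*-comm c _))

  ∑-- : (xs : List A) (f g : A → ℤ) → ∑ xs (λ x → f x - g x) ≡ ∑ xs f - ∑ xs g
  ∑-- xs f g = trans (∑-+ xs f (λ x → - g x)) (+ˡ (∑ xs f) neg)
    where
    neg : ∑ xs (λ x → - g x) ≡ - ∑ xs g
    neg = trans (∑-cong xs (λ x → sym (ℤₚ.-1*i≡-i (g x)))) (trans (∑-*ˡ xs ℤ.-1ℤ g) (ℤₚ.-1*i≡-i (∑ xs g)))

  ∑-const : (xs : List A) (c : ℤ) → ∑ xs (λ _ → c) ≡ + length xs * c
  ∑-const []       c = refl
  ∑-const (x ∷ xs) c = trans (+ˡ (c) (∑-const xs c)) (sym (ℤₚ.suc-* (+ length xs) c))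

  ∑-swap : (xs : List A) (ys : List B) (f : A → B → ℤ) →
           ∑ xs (λ x → ∑ ys (f x)) ≡ ∑ ys (λ y → ∑ xs (λ x → f x y))
  ∑-swap []       ys f = sym (∑-0 ys)
  ∑-swap (x ∷ xs) ys f =
    trans (+ˡ (∑ ys (f x)) (∑-swap xs ys f)) (sym (∑-+ ys (f x) _))

  ∑-product : (xs : List A) (ys : List B) (f : A → ℤ) (g : B → ℤ) →
              ∑ xs f * ∑ ys g ≡ ∑ xs (λ x → ∑ ys (λ y → f x * g y))
  ∑-product xs ys f g = trans (sym (∑-*ʳ xs _ f)) (∑-cong xs (λ x → sym (∑-*ˡ ys (f x) g)))

  ∑-mono : (xs : List A) {f g : A → ℤ} → (∀ x → f x ≤ᶻ g x) → ∑ xs f ≤ᶻ ∑ xs g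
  ∑-mono []       h = ℤₚ.≤-refl
  ∑-mono (x ∷ xs) h = ℤₚ.+-mono-≤ (h x) (∑-mono xs h)

  ∑-mono-All : {xs : List A} {f g : A → ℤ} → All (λ x → f x ≤ᶻ g x) xs → ∑ xs f ≤ᶻ ∑ xs g
  ∑-mono-All []       = ℤₚ.≤-refl
  ∑-mono-All (h ∷ hs) = ℤₚ.+-mono-≤ h (∑-mono-All hs)

  ∑-nonneg : (xs : List A) {f : A → ℤ} → (∀ x → 0ℤ ≤ᶻ f x) → 0ℤ ≤ᶻ ∑ xs f
  ∑-nonneg xs {f} h = subst (_≤ᶻ ∑ xs f) (∑-0 xs) (∑-mono xs h)

  abs : ℤ → ℤ
  abs i = + ∣ i ∣

  abs-+ : ∀ i j → abs (i + j) ≤ᶻ abs i + abs j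
  abs-+ i j = ℤ.+≤+ (ℤₚ.∣i+j∣≤∣i∣+∣j∣ i j)

  abs-* : ∀ i j → abs (i * j) ≡ abs i * abs j
  abs-* i j = trans (cong +_ (ℤₚ.abs-* i j)) (ℤₚ.pos-* ∣ i ∣ ∣ j ∣)

  abs-nonneg : ∀ {i} → 0ℤ ≤ᶻ i → abs i ≡ i
  abs-nonneg = ℤₚ.0≤i⇒+∣i∣≡i

  0≤abs : ∀ i → 0ℤ ≤ᶻ abs i
  0≤abs i = ℤ.+≤+ z≤n

  abs-neg : ∀ i → abs (- i) ≡ abs i
  abs-neg i = cong +_ (ℤₚ.∣-i∣≡∣i∣ i)

  ∑-abs : (xs : List A) (f : A → ℤ) → abs (∑ xs f) ≤ᶻ ∑ xs (λ x → abs (f x))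
  ∑-abs []       f = ℤₚ.≤-refl
  ∑-abs (x ∷ xs) f = ℤₚ.≤-trans (abs-+ (f x) _) (ℤₚ.+-monoʳ-≤ (abs (f x)) (∑-abs xs f))

  square-nonneg : ∀ i → 0ℤ ≤ᶻ i * i
  square-nonneg (+ n)      = subst (0ℤ ≤ᶻ_) (ℤₚ.pos-* n n) (ℤ.+≤+ z≤n)
  square-nonneg -[1+ n ]   = ℤ.+≤+ z≤n

  abs-square : ∀ i → abs i * abs i ≡ i * i
  abs-square i = trans (sym (abs-* i i)) (abs-nonneg (square-nonneg i))

  *-nonneg : ∀ {i j} → 0ℤ ≤ᶻ i → 0ℤ ≤ᶻ j → 0ℤ ≤ᶻ i * j
  *-nonneg {+ m} {+ n} _ _ = subst (0ℤ ≤ᶻ_) (ℤₚ.pos-* m n) (ℤ.+≤+ z≤n)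

  *-monoˡ : ∀ {c} → 0ℤ ≤ᶻ c → ∀ {i j} → i ≤ᶻ j → c * i ≤ᶻ c * j
  *-monoˡ {+ c} _ h = ℤₚ.*-monoˡ-≤-nonNeg (+ c) h

  *-monoʳ : ∀ {c} → 0ℤ ≤ᶻ c → ∀ {i j} → i ≤ᶻ j → i * c ≤ᶻ j * c
  *-monoʳ {+ c} _ h = ℤₚ.*-monoʳ-≤-nonNeg (+ c) h

  *-mono : ∀ {a b c d} → 0ℤ ≤ᶻ c → 0ℤ ≤ᶻ b → a ≤ᶻ b → c ≤ᶻ d → a * c ≤ᶻ b * d
  *-mono 0≤c 0≤b a≤b c≤d = ℤₚ.≤-trans (*-monoʳ 0≤c a≤b) (*-monoˡ 0≤b c≤d)

  -- Stands in for the Cauchy–Schwarz inequality.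
  2xy≤x²+y² : ∀ x y → + 2 * (x * y) ≤ᶻ x * x + y * y
  2xy≤x²+y² x y = ℤₚ.0≤i-j⇒j≤i (subst (0ℤ ≤ᶻ_) (identity x y) (square-nonneg (x - y)))
    where
    identity : ∀ x y → (x - y) * (x - y) ≡ x * x + y * y - + 2 * (x * y)
    identity = ℤ-solve-∀

  module _ {P : Set} where
    ⟦_⟧ : Dec P → ℤ
    ⟦ yes _ ⟧ = 1ℤ
    ⟦ no _ ⟧  = 0ℤ

    ⟦⟧-yes : (d : Dec P) → P → ⟦ d ⟧ ≡ 1ℤ
    ⟦⟧-yes (yes _) p = refl
    ⟦⟧-yes (no ¬p) p = contradiction p ¬p

    ⟦⟧-no : (d : Dec P) → ¬ P → ⟦ d ⟧ ≡ 0ℤ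
    ⟦⟧-no (yes p) ¬p = contradiction p ¬p
    ⟦⟧-no (no _)  ¬p = refl

    ⟦⟧-nonneg : (d : Dec P) → 0ℤ ≤ᶻ ⟦ d ⟧
    ⟦⟧-nonneg (yes _) = ℤ.+≤+ z≤n
    ⟦⟧-nonneg (no _)  = ℤ.+≤+ z≤n

    ⟦⟧≤1 : (d : Dec P) → ⟦ d ⟧ ≤ᶻ 1ℤ
    ⟦⟧≤1 (yes _) = ℤₚ.≤-refl
    ⟦⟧≤1 (no _)  = ℤ.+≤+ z≤n

    -- The comparison is only asked for where the indicator is 1. This is how facts about P become
    -- available inside a sum over all elements.
    ⟦⟧*-mono : (d : Dec P) {i j : ℤ} → (P → i ≤ᶻ j) → ⟦ d ⟧ * i ≤ᶻ ⟦ d ⟧ * j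
    ⟦⟧*-mono (yes p) h = *-monoˡ {1ℤ} (ℤ.+≤+ z≤n) (h p)
    ⟦⟧*-mono (no _) {i} {j} h = ℤₚ.≤-reflexive (trans (ℤₚ.*-zeroˡ i) (sym (ℤₚ.*-zeroˡ j)))

    ⟦⟧*-cong : (d : Dec P) {i j : ℤ} → (P → i ≡ j) → ⟦ d ⟧ * i ≡ ⟦ d ⟧ * j
    ⟦⟧*-cong (yes p) h = cong (1ℤ *_) (h p)
    ⟦⟧*-cong (no _) {i} {j} h = trans (ℤₚ.*-zeroˡ i) (sym (ℤₚ.*-zeroˡ j))

  ⟦⟧-mono : {P Q : Set} (d : Dec P) (e : Dec Q) → (P → Q) → ⟦ d ⟧ ≤ᶻ ⟦ e ⟧
  ⟦⟧-mono (yes p) e f = ℤₚ.≤-reflexive (sym (⟦⟧-yes e (f p)))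
  ⟦⟧-mono (no _)  e f = ⟦⟧-nonneg e

  ⟦⟧-cong : {P Q : Set} (d : Dec P) (e : Dec Q) → (P → Q) → (Q → P) → ⟦ d ⟧ ≡ ⟦ e ⟧
  ⟦⟧-cong d e f g = ℤₚ.≤-antisym (⟦⟧-mono d e f) (⟦⟧-mono e d g)

  ⟦⟧-× : {P Q : Set} (d : Dec P) (e : Dec Q) → ⟦ d ×-dec e ⟧ ≡ ⟦ d ⟧ * ⟦ e ⟧
  ⟦⟧-× (yes p) (yes q) = refl
  ⟦⟧-× (yes p) (no _)  = refl
  ⟦⟧-× (no _)  (yes q) = refl
  ⟦⟧-× (no _)  (no _)  = refl

  ⟦⟧-¬ : {P : Set} (d : Dec P) → ⟦ ¬? d ⟧ ≡ 1ℤ - ⟦ d ⟧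
  ⟦⟧-¬ (yes p) = refl
  ⟦⟧-¬ (no _)  = refl

  length-filter : {P : A → Set} (P? : ∀ x → Dec (P x)) (xs : List A) →
                  + length (filter P? xs) ≡ ∑ xs (λ x → ⟦ P? x ⟧)
  length-filter P? [] = refl
  length-filter P? (x ∷ xs) with P? x
  ... | yes _ = +ˡ (1ℤ) (length-filter P? xs)
  ... | no _  = trans (length-filter P? xs) (sym (ℤₚ.+-identityˡ _))

  ∑-filter : {P : A → Set} (P? : ∀ x → Dec (P x)) (xs : List A) (f : A → ℤ) →
             ∑ (filter P? xs) f ≡ ∑ xs (λ x → ⟦ P? x ⟧ * f x)
  ∑-filter P? [] f = refl
  ∑-filter P? (x ∷ xs) f with P? x
  ... | yes _ = cong₂ _+_ (sym (ℤₚ.*-identityˡ (f x))) (∑-filter P? xs f)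
  ... | no _  = trans (∑-filter P? xs f) (sym (trans (cong (λ z → z + ∑ xs (λ y → ⟦ P? y ⟧ * f y)) (ℤₚ.*-zeroˡ (f x))) (ℤₚ.+-identityˡ _)))

  -- A finite type, presented by a list in which every element occurs exactly once.
  record Enum (A : Set) : Set where
    infix 4 _≟_
    field
      _≟_  : (x y : A) → Dec (x ≡ y)
      list : List A
      once : ∀ a → ∑ list (λ x → ⟦ x ≟ a ⟧) ≡ 1ℤ

    sum : (A → ℤ) → ℤ
    sum = ∑ list

    size : ℤ
    size = sum (λ _ → 1ℤ)

    sum-pick : ∀ a (f : A → ℤ) → sum (λ x → ⟦ x ≟ a ⟧ * f x) ≡ f a
    sum-pick a f = trans (∑-cong list at) (trans (∑-*ʳ list (f a) _)
                     (trans (cong (_* f a) (once a)) (ℤₚ.*-identityˡ (f a))))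
      where
      at : ∀ x → ⟦ x ≟ a ⟧ * f x ≡ ⟦ x ≟ a ⟧ * f a
      at x = ⟦⟧*-cong (x ≟ a) (cong f)

    complete : ∀ a → a ∈ list
    complete a = go list (once a)
      where
      go : ∀ xs → ∑ xs (λ x → ⟦ x ≟ a ⟧) ≡ 1ℤ → a ∈ xs
      go [] ()
      go (x ∷ xs) h with x ≟ a
      ... | yes refl = here refl
      ... | no _     = there (go xs (trans (sym (ℤₚ.+-identityˡ _)) h))

    all? : {P : A → Set} → (∀ a → Dec (P a)) → Dec (∀ a → P a)
    all? P? = Dec.map′ (λ h a → All.lookup h (complete a)) (λ h → All.tabulate (λ {x} _ → h x)) (All.all? P? list)

    search : {P : A → Set} → (∀ a → Dec (P a)) → (∃ P) ⊎ (∀ a → ¬ P a)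
    search P? with Any.any? P? list
    ... | yes p = inj₁ (let (a , _ , pa) = find p in a , pa)
    ... | no ¬p = inj₂ (λ a pa → ¬p (lose (complete a) pa))

    any? : {P : A → Set} → (∀ a → Dec (P a)) → Dec (∃ P)
    any? P? with search P?
    ... | inj₁ p = yes p
    ... | inj₂ n = no (λ (a , pa) → n a pa)

    sum-*1 : ∀ c → sum (λ _ → c) ≡ size * c
    sum-*1 c = trans (∑-cong list (λ _ → sym (ℤₚ.*-identityˡ c))) (∑-*ʳ list c _)

  module _ {A B : Set} (𝔸 : Enum A) (𝔹 : Enum B) where
    private
      module 𝔸 = Enum 𝔸
      module 𝔹 = Enum 𝔹

    -- Both sides are the sum over pairs (a, b) of φ a, restricted to b = f a with P a; on pairs
    -- this condition is the same as a = g b with Q b.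
    ∑-bij : {P : A → Set} {Q : B → Set} (P? : ∀ a → Dec (P a)) (Q? : ∀ b → Dec (Q b))
            (f : A → B) (g : B → A) →
            (∀ a → P a → Q (f a) × g (f a) ≡ a) → (∀ b → Q b → P (g b) × f (g b) ≡ b) →
            (φ : A → ℤ) →
            𝔸.sum (λ a → ⟦ P? a ⟧ * φ a) ≡ 𝔹.sum (λ b → ⟦ Q? b ⟧ * φ (g b))
    ∑-bij P? Q? f g to from φ = begin
      𝔸.sum (λ a → ⟦ P? a ⟧ * φ a)
        ≡⟨ ∑-cong 𝔸.list (λ a → sym (𝔹.sum-pick (f a) (λ _ → ⟦ P? a ⟧ * φ a))) ⟩
      𝔸.sum (λ a → 𝔹.sum (λ b → ⟦ b 𝔹.≟ f a ⟧ * (⟦ P? a ⟧ * φ a)))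
        ≡⟨ ∑-swap 𝔸.list 𝔹.list _ ⟩
      𝔹.sum (λ b → 𝔸.sum (λ a → ⟦ b 𝔹.≟ f a ⟧ * (⟦ P? a ⟧ * φ a)))
        ≡⟨ ∑-cong 𝔹.list (λ b → ∑-cong 𝔸.list (λ a → move a b)) ⟩
      𝔹.sum (λ b → 𝔸.sum (λ a → ⟦ a 𝔸.≟ g b ⟧ * (⟦ Q? b ⟧ * φ a)))
        ≡⟨ ∑-cong 𝔹.list (λ b → 𝔸.sum-pick (g b) (λ a → ⟦ Q? b ⟧ * φ a)) ⟩
      𝔹.sum (λ b → ⟦ Q? b ⟧ * φ (g b)) ∎
      where
      open ≡-Reasoning
      move : ∀ a b → ⟦ b 𝔹.≟ f a ⟧ * (⟦ P? a ⟧ * φ a) ≡ ⟦ a 𝔸.≟ g b ⟧ * (⟦ Q? b ⟧ * φ a)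
      move a b = begin
        ⟦ b 𝔹.≟ f a ⟧ * (⟦ P? a ⟧ * φ a)  ≡⟨ ℤₚ.*-assoc ⟦ b 𝔹.≟ f a ⟧ _ _ ⟨
        ⟦ b 𝔹.≟ f a ⟧ * ⟦ P? a ⟧ * φ a    ≡⟨ cong (_* φ a) (⟦⟧-× (b 𝔹.≟ f a) (P? a)) ⟨
        ⟦ (b 𝔹.≟ f a) ×-dec P? a ⟧ * φ a  ≡⟨ cong (_* φ a) (⟦⟧-cong ((b 𝔹.≟ f a) ×-dec P? a) ((a 𝔸.≟ g b) ×-dec Q? b)
             (λ { (refl , p) → let (q , e) = to a p in sym e , q })
             (λ { (refl , q) → let (p , e) = from b q in sym e , p })) ⟩
        ⟦ (a 𝔸.≟ g b) ×-dec Q? b ⟧ * φ a  ≡⟨ cong (_* φ a) (⟦⟧-× (a 𝔸.≟ g b) (Q? b)) ⟩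
        ⟦ a 𝔸.≟ g b ⟧ * ⟦ Q? b ⟧ * φ a    ≡⟨ ℤₚ.*-assoc ⟦ a 𝔸.≟ g b ⟧ _ _ ⟩
        ⟦ a 𝔸.≟ g b ⟧ * (⟦ Q? b ⟧ * φ a)  ∎

    ∑-reindex : (f : A → B) (g : B → A) → (∀ a → g (f a) ≡ a) → (∀ b → f (g b) ≡ b) →
                (φ : A → ℤ) → 𝔸.sum φ ≡ 𝔹.sum (φ ∘ g)
    ∑-reindex f g gf fg φ = trans (∑-cong 𝔸.list (λ a → sym (ℤₚ.*-identityˡ (φ a))))
      (trans (∑-bij (λ _ → yes tt) (λ _ → yes tt) f g (λ a _ → tt , gf a) (λ b _ → tt , fg b) φ)
             (∑-cong 𝔹.list (λ b → ℤₚ.*-identityˡ (φ (g b)))))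

    ∑-fibre : (f : A → B) (φ : A → ℤ) →
              𝔸.sum φ ≡ 𝔹.sum (λ b → 𝔸.sum (λ a → ⟦ b 𝔹.≟ f a ⟧ * φ a))
    ∑-fibre f φ = trans (∑-cong 𝔸.list (λ a → sym (𝔹.sum-pick (f a) (λ _ → φ a)))) (∑-swap 𝔸.list 𝔹.list _)

    injective⇒fibre≤1 : (f : A → B) → (∀ a a′ → f a ≡ f a′ → a ≡ a′) →
                        ∀ b → 𝔸.sum (λ a → ⟦ b 𝔹.≟ f a ⟧) ≤ᶻ 1ℤ
    injective⇒fibre≤1 f inj b with 𝔸.search (λ a → b 𝔹.≟ f a)
    ... | inj₁ (a₀ , refl) = subst (𝔸.sum (λ a → ⟦ f a₀ 𝔹.≟ f a ⟧) ≤ᶻ_) (𝔸.once a₀)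
            (∑-mono 𝔸.list (λ a → ⟦⟧-mono (f a₀ 𝔹.≟ f a) (a 𝔸.≟ a₀) (λ e → sym (inj a₀ a e))))
    ... | inj₂ none = subst (_≤ᶻ 1ℤ) (sym (trans (∑-cong 𝔸.list (λ a → ⟦⟧-no (b 𝔹.≟ f a) (none a))) (∑-0 𝔸.list)))
            (ℤ.+≤+ z≤n)

    injective⇒size≤ : (f : A → B) → (∀ a a′ → f a ≡ f a′ → a ≡ a′) → 𝔸.size ≤ᶻ 𝔹.size
    injective⇒size≤ f inj = subst (_≤ᶻ 𝔹.size) (sym (∑-fibre f (λ _ → 1ℤ)))
      (∑-mono 𝔹.list (λ b → ℤₚ.≤-trans
        (ℤₚ.≤-reflexive (∑-cong 𝔸.list (λ a → ℤₚ.*-identityʳ ⟦ b 𝔹.≟ f a ⟧))) (injective⇒fibre≤1 f inj b)))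

    injective⇒surjective : 𝔸.size ≡ 𝔹.size → (f : A → B) → (∀ a a′ → f a ≡ f a′ → a ≡ a′) →
                           ∀ b → ∃ λ a → f a ≡ b
    injective⇒surjective same f inj b₀ with 𝔸.search (λ a → b₀ 𝔹.≟ f a)
    ... | inj₁ (a , e) = a , sym e
    ... | inj₂ none = ⊥-elim (ℤₚ.<-irrefl refl (ℤₚ.<-≤-trans strict (ℤₚ.≤-reflexive (sym same))))
      where
      -- Every fibre has at most one point and the one over b₀ is empty.
      short : 𝔸.size + 1ℤ ≤ᶻ 𝔹.size
      short = subst₂ _≤ᶻ_
        (trans (∑-+ 𝔹.list _ _) (cong₂ _+_
          (trans (∑-cong 𝔹.list (λ b → ∑-cong 𝔸.list (λ a → sym (ℤₚ.*-identityʳ ⟦ b 𝔹.≟ f a ⟧)))) (sym (∑-fibre f (λ _ → 1ℤ))))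
          (𝔹.once b₀)))
        refl
        (∑-mono 𝔹.list {λ b → 𝔸.sum (λ a → ⟦ b 𝔹.≟ f a ⟧) + ⟦ b 𝔹.≟ b₀ ⟧} {λ _ → 1ℤ} bound)
        where
        bound : ∀ b → 𝔸.sum (λ a → ⟦ b 𝔹.≟ f a ⟧) + ⟦ b 𝔹.≟ b₀ ⟧ ≤ᶻ 1ℤ
        bound b with b 𝔹.≟ b₀
        ... | yes refl = ℤₚ.≤-reflexive (cong (_+ 1ℤ)
                (trans (∑-cong 𝔸.list (λ a → ⟦⟧-no (b 𝔹.≟ f a) (none a))) (∑-0 𝔸.list)))
        ... | no _ = ℤₚ.≤-trans (ℤₚ.≤-reflexive (ℤₚ.+-identityʳ _)) (injective⇒fibre≤1 f inj b)
      strict : 𝔸.size ℤ.< 𝔹.size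
      strict = ℤₚ.<-≤-trans (subst (ℤ._< 𝔸.size + 1ℤ) (ℤₚ.+-identityʳ _) (ℤₚ.+-monoʳ-< 𝔸.size (ℤ.+<+ (s≤s z≤n)))) short

  module Vectors {A : Set} (𝔸 : Enum A) where
    private module 𝔸 = Enum 𝔸

    eq : ∀ {n} (x y : Vec A n) → Dec (x ≡ y)
    eq []       []       = yes refl
    eq (x ∷ xs) (y ∷ ys) = Dec.map′ (λ (p , r) → cong₂ _∷_ p r) Vecₚ.∷-injective ((x 𝔸.≟ y) ×-dec eq xs ys)

    lists : (n : ℕ) → List (Vec A n)
    lists zero    = [] ∷ []
    lists (suc n) = concatMap (λ x → map (x ∷_) (lists n)) 𝔸.list

    once′ : ∀ {n} (v : Vec A n) → ∑ (lists n) (λ x → ⟦ eq x v ⟧) ≡ 1ℤ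
    once′ [] = refl
    once′ {suc n} (a ∷ v) = begin
      ∑ (lists (suc n)) (λ x → ⟦ eq x (a ∷ v) ⟧)
        ≡⟨ ∑-concatMap _ 𝔸.list _ ⟩
      𝔸.sum (λ x → ∑ (map (x ∷_) (lists n)) (λ w → ⟦ eq w (a ∷ v) ⟧))
        ≡⟨ ∑-cong 𝔸.list (λ x → ∑-map (x ∷_) (lists n) _) ⟩
      𝔸.sum (λ x → ∑ (lists n) (λ w → ⟦ eq (x ∷ w) (a ∷ v) ⟧))
        ≡⟨ ∑-cong 𝔸.list (λ x → trans (∑-cong (lists n) (λ w → split x w)) (∑-*ˡ (lists n) ⟦ x 𝔸.≟ a ⟧ _)) ⟩
      𝔸.sum (λ x → ⟦ x 𝔸.≟ a ⟧ * ∑ (lists n) (λ w → ⟦ eq w v ⟧))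
        ≡⟨ 𝔸.sum-pick a (λ _ → ∑ (lists n) (λ w → ⟦ eq w v ⟧)) ⟩
      ∑ (lists n) (λ w → ⟦ eq w v ⟧)
        ≡⟨ once′ v ⟩
      1ℤ ∎
      where
      open ≡-Reasoning
      split : ∀ x w → ⟦ eq (x ∷ w) (a ∷ v) ⟧ ≡ ⟦ x 𝔸.≟ a ⟧ * ⟦ eq w v ⟧
      split x w = trans (⟦⟧-cong (eq (x ∷ w) (a ∷ v)) ((x 𝔸.≟ a) ×-dec eq w v) Vecₚ.∷-injective (λ (p , r) → cong₂ _∷_ p r))
                        (⟦⟧-× (x 𝔸.≟ a) (eq w v))

  Vec-Enum : {A : Set} → Enum A → (n : ℕ) → Enum (Vec A n)
  Vec-Enum 𝔸 n = record { _≟_ = eq ; list = lists n ; once = once′ }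
    where open Vectors 𝔸

  Vec-sum : {A : Set} (𝔸 : Enum A) (n : ℕ) (f : Vec A (suc n) → ℤ) →
            Enum.sum (Vec-Enum 𝔸 (suc n)) f ≡ Enum.sum 𝔸 (λ x → Enum.sum (Vec-Enum 𝔸 n) (λ v → f (x ∷ v)))
  Vec-sum 𝔸 n f = trans (∑-concatMap _ (Enum.list 𝔸) f) (∑-cong (Enum.list 𝔸) (λ x → ∑-map (x ∷_) (Vectors.lists 𝔸 n) f))

  Vec-size : {A : Set} (𝔸 : Enum A) (n : ℕ) → Enum.size (Vec-Enum 𝔸 n) ≡ (+ length (Enum.list 𝔸)) ℤ.^ n
  Vec-size 𝔸 zero    = refl
  Vec-size 𝔸 (suc n) = trans (Vec-sum 𝔸 n _) (trans (∑-const (Enum.list 𝔸) _) (cong (+ length (Enum.list 𝔸) *_) (Vec-size 𝔸 n)))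

-- A ring solver with integer coefficients for arbitrary commutative rings

module RingSolver {c ℓ} (R : CommutativeRing c ℓ) where
  open CommutativeRing R renaming (trans to ≈-trans; sym to ≈-sym; refl to ≈-refl)
  open RingProperties (CommutativeRing.ring R)
  open Multiples semiring using () renaming (_×_ to _×ⁿ_; ×-homo-+ to ×ⁿ-homo-+; ×1-homo-* to ×ⁿ-homo-*)
  open SetoidReasoning setoid

  private
    almostRing : AlmostCommutativeRing c ℓ
    almostRing = fromCommutativeRing R

    -- Integer coefficients as formal differences of naturals.
    reduce : ℕ × ℕ → ℕ × ℕ
    reduce (a , b) = a ∸ b , b ∸ a

    Coefficient : RawRing 0ℓ 0ℓ
    Coefficient = record
      { Carrier = ℕ × ℕ ; _≈_ = _≡_
      ; _+_ = λ (a , b) (c , d) → reduce (a ℕ.+ c , b ℕ.+ d)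
      ; _*_ = λ (a , b) (c , d) → reduce (a ℕ.* c ℕ.+ b ℕ.* d , a ℕ.* d ℕ.+ b ℕ.* c)
      ; -_  = λ (a , b) → b , a
      ; 0#  = 0 , 0
      ; 1#  = 1 , 0 }

    val : ℕ × ℕ → Carrier
    val (a , b) = a ×ⁿ 1# - b ×ⁿ 1#

    interchange : ∀ a b c d → (a + b) + (c + d) ≈ (a + c) + (b + d)
    interchange a b c d = begin
      (a + b) + (c + d)  ≈⟨ +-assoc a b _ ⟩
      a + (b + (c + d))  ≈⟨ +-congˡ (+-assoc b c d) ⟨
      a + (b + c + d)    ≈⟨ +-congˡ (+-congʳ (+-comm b c)) ⟩
      a + (c + b + d)    ≈⟨ +-congˡ (+-assoc c b d) ⟩
      a + (c + (b + d))  ≈⟨ +-assoc a c _ ⟨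
      (a + c) + (b + d)  ∎

    difference-+ : ∀ a b c d → (a + c) - (b + d) ≈ (a - b) + (c - d)
    difference-+ a b c d = ≈-trans (+-congˡ (≈-sym (-‿+-comm b d))) (interchange a c (- b) (- d))

    val-reduce : ∀ a b → val (reduce (a , b)) ≈ val (a , b)
    val-reduce zero    zero    = ≈-refl
    val-reduce zero    (suc b) = ≈-refl
    val-reduce (suc a) zero    = ≈-refl
    val-reduce (suc a) (suc b) = begin
      val (reduce (a , b))                     ≈⟨ val-reduce a b ⟩
      a ×ⁿ 1# - b ×ⁿ 1#                        ≈⟨ +-identityˡ _ ⟨
      0# + (a ×ⁿ 1# - b ×ⁿ 1#)                 ≈⟨ +-congʳ (-‿inverseʳ 1#) ⟨
      (1# - 1#) + (a ×ⁿ 1# - b ×ⁿ 1#)          ≈⟨ difference-+ _ _ _ _ ⟨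
      (1# + a ×ⁿ 1#) - (1# + b ×ⁿ 1#)          ∎

    val-+ : ∀ x y → val (RawRing._+_ Coefficient x y) ≈ val x + val y
    val-+ (a , b) (c , d) = ≈-trans (val-reduce (a ℕ.+ c) (b ℕ.+ d)) (≈-trans (+-cong (×ⁿ-homo-+ 1# a c) (-‿cong (×ⁿ-homo-+ 1# b d))) (difference-+ _ _ _ _))

    difference-* : ∀ a b c d → (a * c + b * d) - (a * d + b * c) ≈ (a - b) * (c - d)
    difference-* a b c d = begin
      (a * c + b * d) - (a * d + b * c)                 ≈⟨ +-congˡ (-‿cong (+-comm (a * d) (b * c))) ⟩
      (a * c + b * d) - (b * c + a * d)                 ≈⟨ difference-+ (a * c) (b * c) (b * d) (a * d) ⟩
      (a * c - b * c) + (b * d - a * d)                 ≈⟨ +-cong (+-congˡ (-‿distribˡ-* b c)) (+-comm (b * d) _) ⟩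
      (a * c + - b * c) + (- (a * d) + b * d)           ≈⟨ +-cong (≈-sym (distribʳ c a (- b))) (+-cong (-‿distribʳ-* a d) minusminus) ⟩
      (a - b) * c + (a * - d + - b * - d)               ≈⟨ +-congˡ (≈-sym (distribʳ (- d) a (- b))) ⟩
      (a - b) * c + (a - b) * - d                       ≈⟨ distribˡ (a - b) c (- d) ⟨
      (a - b) * (c - d)                                 ∎
      where
      minusminus : b * d ≈ - b * - d
      minusminus = ≈-sym (≈-trans (≈-sym (-‿distribˡ-* b (- d))) (≈-trans (-‿cong (≈-sym (-‿distribʳ-* b d))) (-‿involutive (b * d))))

    val-* : ∀ x y → val (RawRing._*_ Coefficient x y) ≈ val x * val y
    val-* (a , b) (c , d) = ≈-trans (val-reduce (a ℕ.* c ℕ.+ b ℕ.* d) _) (≈-trans (+-cong (expand a c b d) (-‿cong (expand a d b c))) (difference-* _ _ _ _))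
      where
      expand : ∀ a b c d → (a ℕ.* b ℕ.+ c ℕ.* d) ×ⁿ 1# ≈ a ×ⁿ 1# * b ×ⁿ 1# + c ×ⁿ 1# * d ×ⁿ 1#
      expand a b c d = ≈-trans (×ⁿ-homo-+ 1# (a ℕ.* b) (c ℕ.* d)) (+-cong (×ⁿ-homo-* a b) (×ⁿ-homo-* c d))

    val-neg : ∀ x → val (RawRing.-_ Coefficient x) ≈ - val x
    val-neg (a , b) = begin
      b ×ⁿ 1# - a ×ⁿ 1#          ≈⟨ +-comm _ _ ⟩
      - (a ×ⁿ 1#) + b ×ⁿ 1#      ≈⟨ +-congˡ (-‿involutive _) ⟨
      - (a ×ⁿ 1#) - - (b ×ⁿ 1#)  ≈⟨ -‿+-comm _ _ ⟩
      - (a ×ⁿ 1# - b ×ⁿ 1#)      ∎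

    morphism : Coefficient -Raw-AlmostCommutative⟶ almostRing
    morphism = record
      { ⟦_⟧ = val ; +-homo = val-+ ; *-homo = val-* ; -‿homo = val-neg
      ; 0-homo = -‿inverseʳ 0#
      ; 1-homo = ≈-trans (+-cong (+-identityʳ 1#) -0#≈0#) (+-identityʳ 1#) }

    -- Pairs denoting the same integer have the same value in every commutative ring. The converse
    -- depends on the characteristic, so a negative test yields no information.
    weakDec : ∀ x y → Maybe (val x ≈ val y)
    weakDec (a , b) (c , d) with a ℕ.+ d ℕ.≟ c ℕ.+ b
    ... | no _  = nothing
    ... | yes e = just (begin
      a ×ⁿ 1# - b ×ⁿ 1#                                ≈⟨ +-identityʳ _ ⟨
      a ×ⁿ 1# - b ×ⁿ 1# + 0#                           ≈⟨ +-congˡ (-‿inverseʳ (d ×ⁿ 1#)) ⟨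
      a ×ⁿ 1# - b ×ⁿ 1# + (d ×ⁿ 1# - d ×ⁿ 1#)          ≈⟨ difference-+ _ _ _ _ ⟨
      (a ×ⁿ 1# + d ×ⁿ 1#) - (b ×ⁿ 1# + d ×ⁿ 1#)        ≈⟨ +-cong same (-‿cong (+-comm _ _)) ⟩
      (c ×ⁿ 1# + b ×ⁿ 1#) - (d ×ⁿ 1# + b ×ⁿ 1#)        ≈⟨ difference-+ _ _ _ _ ⟩
      c ×ⁿ 1# - d ×ⁿ 1# + (b ×ⁿ 1# - b ×ⁿ 1#)          ≈⟨ +-congˡ (-‿inverseʳ (b ×ⁿ 1#)) ⟩
      c ×ⁿ 1# - d ×ⁿ 1# + 0#                           ≈⟨ +-identityʳ _ ⟩
      c ×ⁿ 1# - d ×ⁿ 1#                                ∎)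
      where
      same : a ×ⁿ 1# + d ×ⁿ 1# ≈ c ×ⁿ 1# + b ×ⁿ 1#
      same = ≈-trans (≈-sym (×ⁿ-homo-+ 1# a d)) (≈-trans (reflexive (cong (_×ⁿ 1#) e)) (×ⁿ-homo-+ 1# c b))

  open Solver Coefficient almostRing morphism weakDec public
    using (solve; _:+_; _:*_; :-_; _:-_; _:=_; con)

-- Arithmetic of the finite field

module FieldFacts (𝔽 : FiniteField) where
  open FiniteField 𝔽 public
  open Sums

  commutativeRing : CommutativeRing _ _
  commutativeRing = record { isCommutativeRing = isCommutativeRing }

  open CommutativeRing commutativeRing public
    using (_-_; +-congˡ; +-congʳ; *-congˡ; *-congʳ; +-assoc; +-comm; +-identityˡ; +-identityʳ; -‿inverseˡ; -‿inverseʳ; *-assoc; *-comm;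
           *-identityˡ; *-identityʳ; zeroˡ; zeroʳ; distribˡ; distribʳ)
  open RingProperties (CommutativeRing.ring commutativeRing) public
    using (-‿distribˡ-*; -‿distribʳ-*; -‿involutive; -‿injective)
    renaming (-0#≈0# to -0≡0)

  open RingSolver commutativeRing public

  inv : F → F
  inv x with x ≟ 0#
  ... | yes _   = 0#
  ... | no x≢0 = proj₁ (inverse x x≢0)

  *-inv : ∀ {x} → x ≢ 0# → x * inv x ≡ 1#
  *-inv {x} x≢0 with x ≟ 0#
  ... | yes x≡0 = contradiction x≡0 x≢0
  ... | no h    = proj₂ (inverse x h)

  *-cancelˡ-0 : ∀ {x y} → x ≢ 0# → x * y ≡ 0# → y ≡ 0#
  *-cancelˡ-0 {x} {y} x≢0 xy≡0 = begin
    y                ≡⟨ *-identityˡ y ⟨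
    1# * y           ≡⟨ cong (_* y) (*-inv x≢0) ⟨
    x * inv x * y    ≡⟨ solve 3 (λ a b c → a :* b :* c := b :* (a :* c)) refl x (inv x) y ⟩
    inv x * (x * y)  ≡⟨ cong (inv x *_) xy≡0 ⟩
    inv x * 0#       ≡⟨ zeroʳ (inv x) ⟩
    0#               ∎
    where open ≡-Reasoning

  x-y≡0⇒x≡y : ∀ {x y} → x - y ≡ 0# → x ≡ y
  x-y≡0⇒x≡y {x} {y} e = trans (solve 2 (λ x y → x := x :- y :+ y) refl x y) (trans (cong (_+ y) e) (+-identityˡ y))

  F-Enum : Enum F
  F-Enum = record { _≟_ = _≟_ ; list = elems ; once = λ a → once elems elems-unique (elems-complete a) }
    where
    none : ∀ {a} xs → All (a ≢_) xs → ∑ xs (λ x → ⟦ x ≟ a ⟧) ≡ 0ℤ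
    none []       []         = refl
    none {a} (x ∷ xs) (a≢x ∷ h) rewrite ⟦⟧-no (x ≟ a) (a≢x ∘ sym) = trans (ℤₚ.+-identityˡ _) (none xs h)
    once : ∀ {a} xs → Unique xs → a ∈ xs → ∑ xs (λ x → ⟦ x ≟ a ⟧) ≡ 1ℤ
    once {a} (x ∷ xs) (x∉ ∷ u) (here refl) rewrite ⟦⟧-yes (x ≟ x) refl = +ˡ 1ℤ (none xs x∉)
    once {a} (x ∷ xs) (x∉ ∷ u) (there a∈) rewrite ⟦⟧-no (x ≟ a) (All.lookup x∉ a∈) =
      trans (ℤₚ.+-identityˡ _) (once xs u a∈)

  2≤q : 2 ≤ q
  2≤q = go elems (elems-complete 0#) (elems-complete 1#)
    where
    go : ∀ xs → 0# ∈ xs → 1# ∈ xs → 2 ≤ length xs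
    go (x ∷ [])     (here p)   (here r)   = contradiction (trans p (sym r)) 0≢1
    go (x ∷ y ∷ xs) _          _          = s≤s (s≤s z≤n)

-- The ring of formal power series

module PowerSeries (𝔽 : FiniteField) where
  open FieldFacts 𝔽

  -- Polynomials are power series together with a separate degree bound. The ring axioms can then be
  -- proved without any bookkeeping of degrees.
  Series : Set
  Series = ℕ → F

  infix 4 _≈_
  _≈_ : Series → Series → Set
  f ≈ g = ∀ n → f n ≡ g n

  infixl 6 _⊕_
  infixl 7 _⊛_
  infixr 8 _∙_

  _⊕_ : Series → Series → Series
  (f ⊕ g) n = f n + g n

  ⊝_ : Series → Series
  (⊝ f) n = - f n

  -- Recursion on the index through f = f₀ + x · tail f.
  _⊛_ : Series → Series → Series
  (f ⊛ g) zero    = f 0 * g 0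
  (f ⊛ g) (suc n) = f 0 * g (suc n) + ((f ∘ suc) ⊛ g) n

  𝟘 : Series
  𝟘 _ = 0#

  𝟙 : Series
  𝟙 zero    = 1#
  𝟙 (suc _) = 0#

  _∙_ : F → Series → Series
  (c ∙ f) n = c * f n

  x·_ : Series → Series
  (x· f) zero    = 0#
  (x· f) (suc n) = f n

  ⊛-cong : ∀ {f f′ g g′} → f ≈ f′ → g ≈ g′ → f ⊛ g ≈ f′ ⊛ g′
  ⊛-cong p r zero    = cong₂ _*_ (p 0) (r 0)
  ⊛-cong p r (suc n) = cong₂ _+_ (cong₂ _*_ (p 0) (r (suc n))) (⊛-cong (p ∘ suc) r n)

  ⊛-zeroˡ : ∀ g → 𝟘 ⊛ g ≈ 𝟘
  ⊛-zeroˡ g zero    = zeroˡ (g 0)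
  ⊛-zeroˡ g (suc n) = trans (cong₂ _+_ (zeroˡ (g (suc n))) (⊛-zeroˡ g n)) (+-identityˡ 0#)

  ⊛-identityˡ : ∀ g → 𝟙 ⊛ g ≈ g
  ⊛-identityˡ g zero    = *-identityˡ (g 0)
  ⊛-identityˡ g (suc n) = trans (cong₂ _+_ (*-identityˡ (g (suc n))) (⊛-zeroˡ g n)) (+-identityʳ _)

  ⊛-distribʳ : ∀ h f g → (f ⊕ g) ⊛ h ≈ f ⊛ h ⊕ g ⊛ h
  ⊛-distribʳ h f g zero    = distribʳ (h 0) (f 0) (g 0)
  ⊛-distribʳ h f g (suc n) =
    trans (cong₂ _+_ (distribʳ (h (suc n)) (f 0) (g 0)) (⊛-distribʳ h (f ∘ suc) (g ∘ suc) n))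
          (solve 4 (λ a b c d → (a :+ b) :+ (c :+ d) := (a :+ c) :+ (b :+ d)) refl (f 0 * h (suc n)) _ _ _)

  ∙-⊛ : ∀ c f g → (c ∙ f) ⊛ g ≈ c ∙ (f ⊛ g)
  ∙-⊛ c f g zero    = *-assoc c (f 0) (g 0)
  ∙-⊛ c f g (suc n) = trans (cong₂ _+_ (*-assoc c (f 0) (g (suc n))) (∙-⊛ c (f ∘ suc) g n)) (sym (distribˡ c _ _))

  -- The defining recursion peels off the first coefficient of f; this one peels off the first
  -- coefficient of g. Comparing the two gives commutativity.
  ⊛-sucʳ : ∀ f g n → (f ⊛ g) (suc n) ≡ (f ⊛ (g ∘ suc)) n + f (suc n) * g 0
  ⊛-sucʳ f g zero    = refl
  ⊛-sucʳ f g (suc n) = trans (+-congˡ (⊛-sucʳ (f ∘ suc) g n)) (sym (+-assoc _ _ _))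

  ⊛-comm : ∀ f g → f ⊛ g ≈ g ⊛ f
  ⊛-comm f g zero    = *-comm (f 0) (g 0)
  ⊛-comm f g (suc n) = trans (⊛-sucʳ f g n) (trans (cong₂ _+_ (⊛-comm f (g ∘ suc) n) (*-comm (f (suc n)) (g 0))) (+-comm _ _))

  ⊛-assoc : ∀ f g h → (f ⊛ g) ⊛ h ≈ f ⊛ (g ⊛ h)
  ⊛-assoc f g h zero    = *-assoc (f 0) (g 0) (h 0)
  ⊛-assoc f g h (suc n) = begin
    f 0 * g 0 * h (suc n) + ((f 0 ∙ (g ∘ suc) ⊕ (f ∘ suc) ⊛ g) ⊛ h) n
      ≡⟨ +-congˡ (⊛-distribʳ h (f 0 ∙ (g ∘ suc)) ((f ∘ suc) ⊛ g) n) ⟩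
    f 0 * g 0 * h (suc n) + (((f 0 ∙ (g ∘ suc)) ⊛ h) n + (((f ∘ suc) ⊛ g) ⊛ h) n)
      ≡⟨ +-congˡ (cong₂ _+_ (∙-⊛ (f 0) (g ∘ suc) h n) (⊛-assoc (f ∘ suc) g h n)) ⟩
    f 0 * g 0 * h (suc n) + (f 0 * ((g ∘ suc) ⊛ h) n + ((f ∘ suc) ⊛ (g ⊛ h)) n)
      ≡⟨ solve 5 (λ a b c d e → a :* b :* c :+ (a :* d :+ e) := a :* (b :* c :+ d) :+ e) refl (f 0) (g 0) (h (suc n)) _ _ ⟩
    f 0 * (g 0 * h (suc n) + ((g ∘ suc) ⊛ h) n) + ((f ∘ suc) ⊛ (g ⊛ h)) n ∎
    where open ≡-Reasoning

  Series-commutativeRing : CommutativeRing _ _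
  Series-commutativeRing = record
    { Carrier = Series ; _≈_ = _≈_ ; _+_ = _⊕_ ; _*_ = _⊛_ ; -_ = ⊝_ ; 0# = 𝟘 ; 1# = 𝟙
    ; isCommutativeRing = record
      { isRing = record
        { +-isAbelianGroup = record
          { isGroup = record
            { isMonoid = record
              { isSemigroup = record
                { isMagma = record
                  { isEquivalence = record
                    { refl = λ _ → refl ; sym = λ p n → sym (p n) ; trans = λ p r n → trans (p n) (r n) }
                  ; ∙-cong = λ p r n → cong₂ _+_ (p n) (r n) }
                ; assoc = λ f g h n → +-assoc (f n) (g n) (h n) }
              ; identity = (λ f n → +-identityˡ (f n)) , (λ f n → +-identityʳ (f n)) }
            ; inverse = (λ f n → -‿inverseˡ (f n)) , (λ f n → -‿inverseʳ (f n))
            ; ⁻¹-cong = λ p n → cong -_ (p n) }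
          ; comm = λ f g n → +-comm (f n) (g n) }
        ; *-cong = λ {f} {f′} {g} {g′} → ⊛-cong {f} {f′} {g} {g′}
        ; *-assoc = ⊛-assoc
        ; *-identity = ⊛-identityˡ , (λ f n → trans (⊛-comm f 𝟙 n) (⊛-identityˡ f n))
        ; distrib = (λ f g h n → trans (⊛-comm f (g ⊕ h) n) (trans (⊛-distribʳ f g h n) (cong₂ _+_ (⊛-comm g f n) (⊛-comm h f n))))
                  , ⊛-distribʳ }
      ; *-comm = ⊛-comm } }


-- Matrices: similarity, invertibility, transvections, block triangular form

module MatrixFacts (𝔽 : FiniteField) where
  open FieldFacts 𝔽
  open Matrices 𝔽 public

  private variable
    n : ℕ

  Σᶠ-cong : {f g : Fin n → F} → (∀ i → f i ≡ g i) → Σᶠ f ≡ Σᶠ g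
  Σᶠ-cong {zero}  h = refl
  Σᶠ-cong {suc n} h = cong₂ _+_ (h zero) (Σᶠ-cong (h ∘ suc))

  Σᶠ-0 : Σᶠ {n} (λ _ → 0#) ≡ 0#
  Σᶠ-0 {zero}  = refl
  Σᶠ-0 {suc n} = trans (+-identityˡ _) (Σᶠ-0 {n})

  Σᶠ-+ : (f g : Fin n → F) → Σᶠ (λ i → f i + g i) ≡ Σᶠ f + Σᶠ g
  Σᶠ-+ {zero}  f g = sym (+-identityˡ 0#)
  Σᶠ-+ {suc n} f g = trans (+-congˡ (Σᶠ-+ (f ∘ suc) (g ∘ suc)))
    (solve 4 (λ a b c d → (a :+ b) :+ (c :+ d) := (a :+ c) :+ (b :+ d)) refl (f zero) (g zero) _ _)

  Σᶠ-*ˡ : (c : F) (f : Fin n → F) → Σᶠ (λ i → c * f i) ≡ c * Σᶠ f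
  Σᶠ-*ˡ {zero}  c f = sym (zeroʳ c)
  Σᶠ-*ˡ {suc n} c f = trans (+-congˡ (Σᶠ-*ˡ c (f ∘ suc))) (sym (distribˡ c (f zero) _))

  Σᶠ-*ʳ : (c : F) (f : Fin n → F) → Σᶠ (λ i → f i * c) ≡ Σᶠ f * c
  Σᶠ-*ʳ c f = trans (Σᶠ-cong (λ i → *-comm (f i) c)) (trans (Σᶠ-*ˡ c f) (*-comm c _))

  Σᶠ-swap : ∀ {m n} (f : Fin m → Fin n → F) → Σᶠ (λ i → Σᶠ (f i)) ≡ Σᶠ (λ j → Σᶠ (λ i → f i j))
  Σᶠ-swap {zero}  {n} f = sym (Σᶠ-0 {n})
  Σᶠ-swap {suc m} {n} f = trans (+-congˡ (Σᶠ-swap (f ∘ suc))) (sym (Σᶠ-+ (f zero) _))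

  Σᶠ-split : ∀ s {r} (f : Fin (s ℕ.+ r) → F) → Σᶠ f ≡ Σᶠ (λ i → f (i Fin.↑ˡ r)) + Σᶠ (λ i → f (s Fin.↑ʳ i))
  Σᶠ-split zero    f = sym (+-identityˡ _)
  Σᶠ-split (suc s) f = trans (+-congˡ (Σᶠ-split s (f ∘ suc))) (sym (+-assoc _ _ _))

  I-diag : (i : Fin n) → Iᴹ i i ≡ 1#
  I-diag i with i Finₚ.≟ i
  ... | yes _ = refl
  ... | no ¬p = contradiction refl ¬p

  I-off : {i j : Fin n} → i ≢ j → Iᴹ i j ≡ 0#
  I-off {i = i} {j} i≢j with i Finₚ.≟ j
  ... | yes p = contradiction p i≢j
  ... | no _  = refl

  I-sym : (i j : Fin n) → Iᴹ i j ≡ Iᴹ j i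
  I-sym i j with i Finₚ.≟ j
  ... | yes refl = sym (I-diag i)
  ... | no p     = sym (I-off (p ∘ sym))

  I-suc : (i j : Fin n) → Iᴹ (suc i) (suc j) ≡ Iᴹ i j
  I-suc i j with i Finₚ.≟ j
  ... | yes _ = refl
  ... | no _  = refl

  Σᶠ-Iˡ : (i : Fin n) (f : Fin n → F) → Σᶠ (λ l → Iᴹ i l * f l) ≡ f i
  Σᶠ-Iˡ {suc n} zero f = trans (cong₂ _+_ (trans (cong (_* f zero) (I-diag {suc n} zero)) (*-identityˡ _))
    (trans (Σᶠ-cong (λ l → trans (cong (_* f (suc l)) (I-off {i = zero} {suc l} (λ ()))) (zeroˡ _))) (Σᶠ-0 {n}))) (+-identityʳ _)
  Σᶠ-Iˡ (suc i) f = trans (cong₂ _+_ (trans (cong (_* f zero) (I-off {i = suc i} {zero} (λ ()))) (zeroˡ _))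
    (trans (Σᶠ-cong (λ l → cong (_* f (suc l)) (I-suc i l))) (Σᶠ-Iˡ i (f ∘ suc)))) (+-identityˡ _)

  Σᶠ-Iʳ : (j : Fin n) (f : Fin n → F) → Σᶠ (λ l → f l * Iᴹ l j) ≡ f j
  Σᶠ-Iʳ j f = trans (Σᶠ-cong (λ l → trans (*-comm (f l) _) (cong (_* f l) (I-sym l j)))) (Σᶠ-Iˡ j f)

  ≡ᴹ-sym : {A B : Mat n} → A ≡ᴹ B → B ≡ᴹ A
  ≡ᴹ-sym p i j = sym (p i j)

  ≡ᴹ-trans : {A B C : Mat n} → A ≡ᴹ B → B ≡ᴹ C → A ≡ᴹ C
  ≡ᴹ-trans p r i j = trans (p i j) (r i j)

  *ᴹ-cong : {A A′ B B′ : Mat n} → A ≡ᴹ A′ → B ≡ᴹ B′ → (A *ᴹ B) ≡ᴹ (A′ *ᴹ B′)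
  *ᴹ-cong p r i j = Σᶠ-cong (λ l → cong₂ _*_ (p i l) (r l j))

  *ᴹ-identityˡ : (A : Mat n) → (Iᴹ *ᴹ A) ≡ᴹ A
  *ᴹ-identityˡ A i j = Σᶠ-Iˡ i (λ l → A l j)

  *ᴹ-identityʳ : (A : Mat n) → (A *ᴹ Iᴹ) ≡ᴹ A
  *ᴹ-identityʳ A i j = Σᶠ-Iʳ j (A i)

  *ᴹ-assoc : (A B C : Mat n) → ((A *ᴹ B) *ᴹ C) ≡ᴹ (A *ᴹ (B *ᴹ C))
  *ᴹ-assoc A B C i j = begin
    Σᶠ (λ l → Σᶠ (λ t → A i t * B t l) * C l j)    ≡⟨ Σᶠ-cong (λ l → sym (Σᶠ-*ʳ (C l j) (λ t → A i t * B t l))) ⟩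
    Σᶠ (λ l → Σᶠ (λ t → A i t * B t l * C l j))    ≡⟨ Σᶠ-swap (λ l t → A i t * B t l * C l j) ⟩
    Σᶠ (λ t → Σᶠ (λ l → A i t * B t l * C l j))    ≡⟨ Σᶠ-cong (λ t → Σᶠ-cong (λ l → *-assoc (A i t) (B t l) (C l j))) ⟩
    Σᶠ (λ t → Σᶠ (λ l → A i t * (B t l * C l j)))  ≡⟨ Σᶠ-cong (λ t → Σᶠ-*ˡ (A i t) (λ l → B t l * C l j)) ⟩
    Σᶠ (λ t → A i t * Σᶠ (λ l → B t l * C l j))    ∎
    where open ≡-Reasoning

  ^ᴹ-cong : {A B : Mat n} → A ≡ᴹ B → ∀ k → (A ^ᴹ k) ≡ᴹ (B ^ᴹ k)
  ^ᴹ-cong p zero    i j = refl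
  ^ᴹ-cong p (suc k) = *ᴹ-cong p (^ᴹ-cong p k)

  Tr-cong : {A B : Mat n} → A ≡ᴹ B → Tr A ≡ Tr B
  Tr-cong p = Σᶠ-cong (λ i → p i i)

  Tr-comm : (A B : Mat n) → Tr (A *ᴹ B) ≡ Tr (B *ᴹ A)
  Tr-comm A B = trans (Σᶠ-swap (λ i l → A i l * B l i)) (Σᶠ-cong (λ l → Σᶠ-cong (λ i → *-comm (A i l) (B l i))))

  intertwine-^ : (E A B : Mat n) → (E *ᴹ A) ≡ᴹ (B *ᴹ E) → ∀ k → (E *ᴹ (A ^ᴹ k)) ≡ᴹ ((B ^ᴹ k) *ᴹ E)
  intertwine-^ E A B h zero    = ≡ᴹ-trans (*ᴹ-identityʳ E) (≡ᴹ-sym (*ᴹ-identityˡ E))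
  intertwine-^ E A B h (suc k) =
    ≡ᴹ-trans (≡ᴹ-sym (*ᴹ-assoc E A (A ^ᴹ k)))
    (≡ᴹ-trans (*ᴹ-cong h (λ _ _ → refl))
    (≡ᴹ-trans (*ᴹ-assoc B E (A ^ᴹ k))
    (≡ᴹ-trans (*ᴹ-cong {A = B} (λ _ _ → refl) (intertwine-^ E A B h k))
    (≡ᴹ-sym (*ᴹ-assoc B (B ^ᴹ k) E)))))

  Tr-similar : (E E′ A B : Mat n) → (E *ᴹ A) ≡ᴹ (B *ᴹ E) → (E′ *ᴹ E) ≡ᴹ Iᴹ → (E *ᴹ E′) ≡ᴹ Iᴹ →
               ∀ k → Tr (A ^ᴹ k) ≡ Tr (B ^ᴹ k)
  Tr-similar E E′ A B h l r k = begin
    Tr (A ^ᴹ k)                   ≡⟨ Tr-cong (*ᴹ-identityˡ (A ^ᴹ k)) ⟨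
    Tr (Iᴹ *ᴹ (A ^ᴹ k))           ≡⟨ Tr-cong (*ᴹ-cong l (λ _ _ → refl)) ⟨
    Tr ((E′ *ᴹ E) *ᴹ (A ^ᴹ k))    ≡⟨ Tr-cong (*ᴹ-assoc E′ E (A ^ᴹ k)) ⟩
    Tr (E′ *ᴹ (E *ᴹ (A ^ᴹ k)))    ≡⟨ Tr-cong (*ᴹ-cong {A = E′} (λ _ _ → refl) (intertwine-^ E A B h k)) ⟩
    Tr (E′ *ᴹ ((B ^ᴹ k) *ᴹ E))    ≡⟨ Tr-comm E′ ((B ^ᴹ k) *ᴹ E) ⟩
    Tr (((B ^ᴹ k) *ᴹ E) *ᴹ E′)    ≡⟨ Tr-cong (*ᴹ-assoc (B ^ᴹ k) E E′) ⟩
    Tr ((B ^ᴹ k) *ᴹ (E *ᴹ E′))    ≡⟨ Tr-cong (*ᴹ-cong {A = B ^ᴹ k} (λ _ _ → refl) r) ⟩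
    Tr ((B ^ᴹ k) *ᴹ Iᴹ)           ≡⟨ Tr-cong (*ᴹ-identityʳ (B ^ᴹ k)) ⟩
    Tr (B ^ᴹ k)                   ∎
    where open ≡-Reasoning

  -- Invertibility with an arbitrary inverse. In `Invertible` the inverse has to be a member of
  -- `allMat n`, which contains a given matrix only up to pointwise equality.
  Unit : Mat n → Set
  Unit {n} g = ∃ λ (h : Mat n) → (g *ᴹ h) ≡ᴹ Iᴹ × (h *ᴹ g) ≡ᴹ Iᴹ

  private
    ∈-allFuns : {A : Set} (R : A → A → Set) (xs : List A) → (∀ a → Any (R a) xs) →
                ∀ m (f : Fin m → A) → Any (λ g → ∀ i → R (f i) (g i)) (allFuns xs m)
    ∈-allFuns R xs c zero    f = here (λ ())
    ∈-allFuns R xs c (suc m) f = Anyₚ.concatMap⁺ _ (Any.map (λ {x} r →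
      Anyₚ.map⁺ (Any.map (λ h → λ { zero → r ; (suc i) → h i }) (∈-allFuns R xs c m (f ∘ suc)))) (c (f zero)))

  ∈-allMat : (h : Mat n) → Any (λ h′ → h ≡ᴹ h′) (allMat n)
  ∈-allMat {n} h = ∈-allFuns (λ u v → ∀ j → u j ≡ v j) (allFuns elems n) (∈-allFuns _≡_ elems elems-complete n) n h

  Unit⇒Invertible : {g : Mat n} → Unit g → Invertible g
  Unit⇒Invertible {g = g} (h , l , r) = Any.map (λ {h′} e →
    ≡ᴹ-trans (*ᴹ-cong {A = g} (λ _ _ → refl) (≡ᴹ-sym e)) l , ≡ᴹ-trans (*ᴹ-cong {B = g} (≡ᴹ-sym e) (λ _ _ → refl)) r) (∈-allMat h)

  Invertible⇒Unit : {g : Mat n} → Invertible g → Unit g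
  Invertible⇒Unit p = let (h , _ , e) = find p in h , e

  Unit-cong : {g g′ : Mat n} → g ≡ᴹ g′ → Unit g → Unit g′
  Unit-cong e (h , l , r) = h , ≡ᴹ-trans (*ᴹ-cong (≡ᴹ-sym e) (λ _ _ → refl)) l , ≡ᴹ-trans (*ᴹ-cong {A = h} (λ _ _ → refl) (≡ᴹ-sym e)) r

  *ᴹ-inverse : (g g′ h h′ : Mat n) → (g *ᴹ h) ≡ᴹ Iᴹ → (g′ *ᴹ h′) ≡ᴹ Iᴹ → ((g *ᴹ g′) *ᴹ (h′ *ᴹ h)) ≡ᴹ Iᴹ
  *ᴹ-inverse g g′ h h′ p p′ =
    ≡ᴹ-trans (*ᴹ-assoc g g′ (h′ *ᴹ h))
    (≡ᴹ-trans (*ᴹ-cong {A = g} (λ _ _ → refl) (≡ᴹ-trans (≡ᴹ-sym (*ᴹ-assoc g′ h′ h))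
      (≡ᴹ-trans (*ᴹ-cong p′ (λ _ _ → refl)) (*ᴹ-identityˡ h)))) p)

  Unit-* : {g g′ : Mat n} → Unit g → Unit g′ → Unit (g *ᴹ g′)
  Unit-* {g = g} {g′} (h , l , r) (h′ , l′ , r′) = h′ *ᴹ h , *ᴹ-inverse g g′ h h′ l l′ , *ᴹ-inverse h′ h g′ g r′ r

  cancelˡ : (a b g : Mat n) → (a *ᴹ b) ≡ᴹ Iᴹ → (a *ᴹ (b *ᴹ g)) ≡ᴹ g
  cancelˡ a b g e = ≡ᴹ-trans (≡ᴹ-sym (*ᴹ-assoc a b g)) (≡ᴹ-trans (*ᴹ-cong e (λ _ _ → refl)) (*ᴹ-identityˡ g))

  cancelʳ : (a b g : Mat n) → (a *ᴹ b) ≡ᴹ Iᴹ → ((g *ᴹ a) *ᴹ b) ≡ᴹ g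
  cancelʳ a b g e = ≡ᴹ-trans (*ᴹ-assoc g a b) (≡ᴹ-trans (*ᴹ-cong {A = g} (λ _ _ → refl) e) (*ᴹ-identityʳ g))

  -- The rank-one perturbation I + v eₗᵀ.
  transvection : Fin n → (Fin n → F) → Mat n
  transvection l v i j = Iᴹ i j + v i * Iᴹ l j

  transvection-*ˡ : ∀ l v (g : Mat n) i j → (transvection l v *ᴹ g) i j ≡ g i j + v i * g l j
  transvection-*ˡ l v g i j = begin
    Σᶠ (λ t → (Iᴹ i t + v i * Iᴹ l t) * g t j)
      ≡⟨ Σᶠ-cong (λ t → solve 4 (λ a b c d → (a :+ b :* c) :* d := a :* d :+ b :* (c :* d)) refl (Iᴹ i t) (v i) (Iᴹ l t) (g t j)) ⟩
    Σᶠ (λ t → Iᴹ i t * g t j + v i * (Iᴹ l t * g t j))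
      ≡⟨ Σᶠ-+ (λ t → Iᴹ i t * g t j) (λ t → v i * (Iᴹ l t * g t j)) ⟩
    Σᶠ (λ t → Iᴹ i t * g t j) + Σᶠ (λ t → v i * (Iᴹ l t * g t j))
      ≡⟨ cong₂ _+_ (Σᶠ-Iˡ i (λ t → g t j)) (trans (Σᶠ-*ˡ (v i) (λ t → Iᴹ l t * g t j)) (cong (v i *_) (Σᶠ-Iˡ l (λ t → g t j)))) ⟩
    g i j + v i * g l j ∎
    where open ≡-Reasoning

  transvection-*ʳ : ∀ l v (g : Mat n) i j → (g *ᴹ transvection l v) i j ≡ g i j + Σᶠ (λ t → g i t * v t) * Iᴹ l j
  transvection-*ʳ l v g i j = begin
    Σᶠ (λ t → g i t * (Iᴹ t j + v t * Iᴹ l j))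
      ≡⟨ Σᶠ-cong (λ t → solve 4 (λ a b c d → a :* (b :+ c :* d) := a :* b :+ a :* c :* d) refl (g i t) (Iᴹ t j) (v t) (Iᴹ l j)) ⟩
    Σᶠ (λ t → g i t * Iᴹ t j + g i t * v t * Iᴹ l j)
      ≡⟨ Σᶠ-+ (λ t → g i t * Iᴹ t j) (λ t → g i t * v t * Iᴹ l j) ⟩
    Σᶠ (λ t → g i t * Iᴹ t j) + Σᶠ (λ t → g i t * v t * Iᴹ l j)
      ≡⟨ cong₂ _+_ (Σᶠ-Iʳ j (g i)) (Σᶠ-*ʳ (Iᴹ l j) (λ t → g i t * v t)) ⟩
    g i j + Σᶠ (λ t → g i t * v t) * Iᴹ l j ∎
    where open ≡-Reasoning

  -- The Sherman-Morrison formula: the inverse of I + v eₗᵀ is I - v eₗᵀ / (1 + vₗ), provided that 1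
  -- + vₗ ≠ 0.
  transvection⁻ : Fin n → (Fin n → F) → Fin n → F
  transvection⁻ l v i = - (v i * inv (1# + v l))

  transvection-inverse : ∀ (l : Fin n) v → 1# + v l ≢ 0# →
    (transvection l v *ᴹ transvection l (transvection⁻ l v)) ≡ᴹ Iᴹ ×
    (transvection l (transvection⁻ l v) *ᴹ transvection l v) ≡ᴹ Iᴹ
  transvection-inverse l v ne = left , right
    where
    open ≡-Reasoning
    w = inv (1# + v l)
    e : (1# + v l) * w ≡ 1#
    e = *-inv ne
    left : (transvection l v *ᴹ transvection l (transvection⁻ l v)) ≡ᴹ Iᴹ
    left i j = begin
      (transvection l v *ᴹ transvection l (transvection⁻ l v)) i j
        ≡⟨ transvection-*ˡ l v (transvection l (transvection⁻ l v)) i j ⟩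
      Iᴹ i j + - (v i * w) * Iᴹ l j + v i * (Iᴹ l j + - (v l * w) * Iᴹ l j)
        ≡⟨ solve 5 (λ a b u w c → a :+ :- (u :* w) :* b :+ u :* (b :+ :- (c :* w) :* b) := a :+ u :* b :- u :* b :* (w :+ c :* w)) refl (Iᴹ i j) (Iᴹ l j) (v i) w (v l) ⟩
      Iᴹ i j + v i * Iᴹ l j - v i * Iᴹ l j * (w + v l * w)
        ≡⟨ cong (λ z → Iᴹ i j + v i * Iᴹ l j - v i * Iᴹ l j * z) (trans (sym (trans (distribʳ w 1# (v l)) (cong (_+ v l * w) (*-identityˡ w)))) e) ⟩
      Iᴹ i j + v i * Iᴹ l j - v i * Iᴹ l j * 1#
        ≡⟨ cong (λ z → Iᴹ i j + v i * Iᴹ l j - z) (*-identityʳ _) ⟩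
      Iᴹ i j + v i * Iᴹ l j - v i * Iᴹ l j
        ≡⟨ solve 2 (λ a b → a :+ b :- b := a) refl (Iᴹ i j) _ ⟩
      Iᴹ i j ∎
    right : (transvection l (transvection⁻ l v) *ᴹ transvection l v) ≡ᴹ Iᴹ
    right i j = begin
      (transvection l (transvection⁻ l v) *ᴹ transvection l v) i j
        ≡⟨ transvection-*ˡ l (transvection⁻ l v) (transvection l v) i j ⟩
      Iᴹ i j + v i * Iᴹ l j + - (v i * w) * (Iᴹ l j + v l * Iᴹ l j)
        ≡⟨ solve 5 (λ a b u w c → a :+ u :* b :+ :- (u :* w) :* (b :+ c :* b) := a :+ u :* b :- u :* b :* (w :+ c :* w)) refl (Iᴹ i j) (Iᴹ l j) (v i) w (v l) ⟩
      Iᴹ i j + v i * Iᴹ l j - v i * Iᴹ l j * (w + v l * w)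
        ≡⟨ cong (λ z → Iᴹ i j + v i * Iᴹ l j - v i * Iᴹ l j * z) (trans (sym (trans (distribʳ w 1# (v l)) (cong (_+ v l * w) (*-identityˡ w)))) e) ⟩
      Iᴹ i j + v i * Iᴹ l j - v i * Iᴹ l j * 1#
        ≡⟨ cong (λ z → Iᴹ i j + v i * Iᴹ l j - z) (*-identityʳ _) ⟩
      Iᴹ i j + v i * Iᴹ l j - v i * Iᴹ l j
        ≡⟨ solve 2 (λ a b → a :+ b :- b := a) refl (Iᴹ i j) _ ⟩
      Iᴹ i j ∎

  module Blocks (s r : ℕ) where
    upperLeft : Mat (s ℕ.+ r) → Mat s
    upperLeft g i j = g (i Fin.↑ˡ r) (j Fin.↑ˡ r)

    lowerRight : Mat (s ℕ.+ r) → Mat r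
    lowerRight g i j = g (s Fin.↑ʳ i) (s Fin.↑ʳ j)

    BlockTriangular : Mat (s ℕ.+ r) → Set
    BlockTriangular g = ∀ i j → g (s Fin.↑ʳ i) (j Fin.↑ˡ r) ≡ 0#

    private
      vanish : ∀ {n} {f g : Fin n → F} → (∀ i → g i ≡ 0#) → Σᶠ (λ i → f i * g i) ≡ 0#
      vanish {n} {f} h = trans (Σᶠ-cong (λ i → trans (cong (f i *_) (h i)) (zeroʳ (f i)))) (Σᶠ-0 {n})

    ↑ˡ≢↑ʳ : (i : Fin s) (j : Fin r) → i Fin.↑ˡ r ≢ s Fin.↑ʳ j
    ↑ˡ≢↑ʳ i j e with trans (sym (Finₚ.splitAt-↑ˡ s i r)) (trans (cong (Fin.splitAt s) e) (Finₚ.splitAt-↑ʳ s r j))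
    ... | ()

    I-upperLeft : upperLeft Iᴹ ≡ᴹ Iᴹ
    I-upperLeft i j with i Finₚ.≟ j
    ... | yes refl = I-diag (i Fin.↑ˡ r)
    ... | no i≢j   = I-off (i≢j ∘ Finₚ.↑ˡ-injective r i j)

    I-lowerRight : lowerRight Iᴹ ≡ᴹ Iᴹ
    I-lowerRight i j with i Finₚ.≟ j
    ... | yes refl = I-diag (s Fin.↑ʳ i)
    ... | no i≢j   = I-off (i≢j ∘ Finₚ.↑ʳ-injective s i j)

    module _ (g h : Mat (s ℕ.+ r)) (tg : BlockTriangular g) (th : BlockTriangular h) where
      *-triangular : BlockTriangular (g *ᴹ h)
      *-triangular i j = trans (Σᶠ-split s _) (trans (cong₂ _+_
        (trans (Σᶠ-cong (λ l → *-comm (g (s Fin.↑ʳ i) (l Fin.↑ˡ r)) _)) (vanish (tg i)))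
        (vanish (λ l → th l j))) (+-identityˡ 0#))

      *-upperLeft : upperLeft (g *ᴹ h) ≡ᴹ (upperLeft g *ᴹ upperLeft h)
      *-upperLeft i j = trans (Σᶠ-split s _) (trans (+-congˡ (vanish (λ l → th l j))) (+-identityʳ _))

      *-lowerRight : lowerRight (g *ᴹ h) ≡ᴹ (lowerRight g *ᴹ lowerRight h)
      *-lowerRight i j = trans (Σᶠ-split s _) (trans (+-congʳ
        (trans (Σᶠ-cong (λ l → *-comm (g (s Fin.↑ʳ i) (l Fin.↑ˡ r)) _)) (vanish (tg i)))) (+-identityˡ _))

    module _ {g : Mat (s ℕ.+ r)} (tg : BlockTriangular g) where
      ^-blocks : ∀ k → BlockTriangular (g ^ᴹ k) × upperLeft (g ^ᴹ k) ≡ᴹ (upperLeft g ^ᴹ k) ×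
                       lowerRight (g ^ᴹ k) ≡ᴹ (lowerRight g ^ᴹ k)
      ^-blocks zero    = (λ i j → I-off (↑ˡ≢↑ʳ j i ∘ sym)) , I-upperLeft , I-lowerRight
      ^-blocks (suc k) =
        let (t , u , l) = ^-blocks k in
        *-triangular g (g ^ᴹ k) tg t ,
        ≡ᴹ-trans (*-upperLeft g (g ^ᴹ k) tg t) (*ᴹ-cong {A = upperLeft g} (λ _ _ → refl) u) ,
        ≡ᴹ-trans (*-lowerRight g (g ^ᴹ k) tg t) (*ᴹ-cong {A = lowerRight g} (λ _ _ → refl) l)

      Tr-^-blocks : ∀ k → Tr (g ^ᴹ k) ≡ Tr (upperLeft g ^ᴹ k) + Tr (lowerRight g ^ᴹ k)
      Tr-^-blocks k = let (_ , u , l) = ^-blocks k in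
        trans (Σᶠ-split s _) (cong₂ _+_ (Tr-cong u) (Tr-cong l))

-- Polynomials: degrees, division with remainder, congruence

module Polynomials (𝔽 : FiniteField) where
  open FieldFacts 𝔽 hiding (solve; _:+_; _:*_; :-_; _:-_; _:=_; con)
  open PowerSeries 𝔽 public
  open RingSolver Series-commutativeRing public

  ≈-refl : ∀ {f} → f ≈ f
  ≈-refl n = refl

  ≈-sym : ∀ {f g} → f ≈ g → g ≈ f
  ≈-sym p n = sym (p n)

  ≈-trans : ∀ {f g h} → f ≈ g → g ≈ h → f ≈ h
  ≈-trans p r n = trans (p n) (r n)

  ⊕-cong : ∀ {f f′ g g′} → f ≈ f′ → g ≈ g′ → f ⊕ g ≈ f′ ⊕ g′
  ⊕-cong p r n = cong₂ _+_ (p n) (r n)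

  ⊝-cong : ∀ {f g} → f ≈ g → ⊝ f ≈ ⊝ g
  ⊝-cong p n = cong -_ (p n)

  x·-cong : ∀ {f g} → f ≈ g → (x· f) ≈ (x· g)
  x·-cong p zero    = refl
  x·-cong p (suc n) = p n

  Deg< : ℕ → Series → Set
  Deg< m f = ∀ i → m ≤ i → f i ≡ 0#

  Bounded : Series → Set
  Bounded f = ∃ λ m → Deg< m f

  Deg<-weaken : ∀ {m n f} → m ≤ n → Deg< m f → Deg< n f
  Deg<-weaken m≤n d i n≤i = d i (ℕₚ.≤-trans m≤n n≤i)

  Deg<-⊕ : ∀ {m f g} → Deg< m f → Deg< m g → Deg< m (f ⊕ g)
  Deg<-⊕ p r i h = trans (cong₂ _+_ (p i h) (r i h)) (+-identityˡ 0#)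

  Deg<-⊝ : ∀ {m f} → Deg< m f → Deg< m (⊝ f)
  Deg<-⊝ p i h = trans (cong -_ (p i h)) -0≡0

  Deg<-𝟘 : ∀ {m} → Deg< m 𝟘
  Deg<-𝟘 i h = refl

  Deg<-𝟙 : ∀ {m} → Deg< (suc m) 𝟙
  Deg<-𝟙 (suc i) h = refl

  Deg<-0 : ∀ {f} → Deg< 0 f → f ≈ 𝟘
  Deg<-0 d i = d i z≤n

  Deg<-lower : ∀ {m f} → Deg< (suc m) f → f m ≡ 0# → Deg< m f
  Deg<-lower {m} d e i m≤i with m ℕ.≟ i
  ... | yes refl = e
  ... | no m≢i   = d i (ℕₚ.≤∧≢⇒< m≤i m≢i)

  ⊛-deg : ∀ m l {f g} → Deg< (suc m) f → Deg< (suc l) g →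
          Deg< (suc (m ℕ.+ l)) (f ⊛ g) × (f ⊛ g) (m ℕ.+ l) ≡ f m * g l
  ⊛-deg zero l {f} {g} df dg = (λ i h → trans (scalar i) (trans (cong (f 0 *_) (dg i h)) (zeroʳ (f 0)))) , scalar l
    where
    scalar : ∀ i → (f ⊛ g) i ≡ f 0 * g i
    scalar zero    = refl
    scalar (suc i) = trans (+-congˡ (trans (⊛-cong {g = g} {g} (λ j → df (suc j) (s≤s z≤n)) (λ _ → refl) i) (⊛-zeroˡ g i)))
                           (+-identityʳ _)
  ⊛-deg (suc m) l {f} {g} df dg = deg , top
    where
    df′ : Deg< (suc m) (f ∘ suc)
    df′ i h = df (suc i) (s≤s h)
    deg : Deg< (suc (suc (m ℕ.+ l))) (f ⊛ g)
    deg (suc i) (s≤s h) = trans (cong₂ _+_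
      (trans (cong (f 0 *_) (dg (suc i) (ℕₚ.≤-trans (s≤s (ℕₚ.m≤n+m l m)) (ℕₚ.m≤n⇒m≤1+n h)))) (zeroʳ (f 0)))
      (proj₁ (⊛-deg m l df′ dg) i h)) (+-identityˡ 0#)
    top : (f ⊛ g) (suc (m ℕ.+ l)) ≡ f (suc m) * g l
    top = trans (cong₂ _+_
      (trans (cong (f 0 *_) (dg (suc (m ℕ.+ l)) (s≤s (ℕₚ.m≤n+m l m)))) (zeroʳ (f 0)))
      (proj₂ (⊛-deg m l df′ dg))) (+-identityˡ _)

  Deg<-⊛ : ∀ m l {f g} → Deg< m f → Deg< l g → Deg< (m ℕ.+ l) (f ⊛ g)
  Deg<-⊛ m l {f} {g} df dg with m | l
  ... | zero  | l′ = λ i _ → trans (⊛-cong {g = g} {g} (Deg<-0 df) (λ _ → refl) i) (⊛-zeroˡ g i)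
  ... | suc m′ | zero = λ i _ → trans (⊛-comm f g i) (trans (⊛-cong {g = f} {f} (Deg<-0 dg) (λ _ → refl) i) (⊛-zeroˡ f i))
  ... | suc m′ | suc l′ = Deg<-weaken (s≤s (ℕₚ.+-monoʳ-≤ m′ (ℕₚ.n≤1+n l′))) (proj₁ (⊛-deg m′ l′ df dg))

  Bounded-⊕ : ∀ {f g} → Bounded f → Bounded g → Bounded (f ⊕ g)
  Bounded-⊕ (m , d) (n , e) = m ℕ.+ n , Deg<-⊕ (Deg<-weaken (ℕₚ.m≤m+n m n) d) (Deg<-weaken (ℕₚ.m≤n+m n m) e)

  Bounded-⊝ : ∀ {f} → Bounded f → Bounded (⊝ f)
  Bounded-⊝ (m , d) = m , Deg<-⊝ d

  Bounded-⊛ : ∀ {f g} → Bounded f → Bounded g → Bounded (f ⊛ g)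
  Bounded-⊛ (m , d) (n , e) = m ℕ.+ n , Deg<-⊛ m n d e

  Bounded-𝟙 : Bounded 𝟙
  Bounded-𝟙 = 1 , Deg<-𝟙

  Bounded-𝟘 : Bounded 𝟘
  Bounded-𝟘 = 0 , Deg<-𝟘

  plain : ∀ {m} → Vec F m → Series
  plain []      _       = 0#
  plain (a ∷ v) zero    = a
  plain (a ∷ v) (suc i) = plain v i

  -- Monic polynomials of degree m are encoded by their m lower coefficients.
  mon : ∀ {m} → Vec F m → Series
  mon []      zero    = 1#
  mon []      (suc _) = 0#
  mon (a ∷ v) zero    = a
  mon (a ∷ v) (suc i) = mon v i

  truncate : ∀ m → Series → Vec F m
  truncate zero    f = []
  truncate (suc m) f = f 0 ∷ truncate m (f ∘ suc)

  plain-deg : ∀ {m} (v : Vec F m) → Deg< m (plain v)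
  plain-deg []      i       h       = refl
  plain-deg (a ∷ v) (suc i) (s≤s h) = plain-deg v i h

  mon-deg : ∀ {m} (v : Vec F m) → Deg< (suc m) (mon v)
  mon-deg []      (suc i) h       = refl
  mon-deg (a ∷ v) (suc i) (s≤s h) = mon-deg v i h

  mon-top : ∀ {m} (v : Vec F m) → mon v m ≡ 1#
  mon-top []      = refl
  mon-top (a ∷ v) = mon-top v

  plain-bounded : ∀ {m} (v : Vec F m) → Bounded (plain v)
  plain-bounded {m} v = m , plain-deg v

  mon-bounded : ∀ {m} (v : Vec F m) → Bounded (mon v)
  mon-bounded {m} v = suc m , mon-deg v

  plain-truncate : ∀ m {f} → Deg< m f → plain (truncate m f) ≈ f
  plain-truncate zero    d i       = sym (d i z≤n)
  plain-truncate (suc m) d zero    = refl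
  plain-truncate (suc m) d (suc i) = plain-truncate m (λ j h → d (suc j) (s≤s h)) i

  mon-truncate : ∀ m {f} → Deg< (suc m) f → f m ≡ 1# → mon (truncate m f) ≈ f
  mon-truncate zero    d e zero    = sym e
  mon-truncate zero    d e (suc i) = sym (d (suc i) (s≤s z≤n))
  mon-truncate (suc m) d e zero    = refl
  mon-truncate (suc m) d e (suc i) = mon-truncate m (λ j h → d (suc j) (s≤s h)) e i

  plain-injective : ∀ {m} (v w : Vec F m) → plain v ≈ plain w → v ≡ w
  plain-injective []      []      h = refl
  plain-injective (a ∷ v) (b ∷ w) h = cong₂ _∷_ (h 0) (plain-injective v w (h ∘ suc))

  mon-injective : ∀ {m} (v w : Vec F m) → mon v ≈ mon w → v ≡ w
  mon-injective []      []      h = refl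
  mon-injective (a ∷ v) (b ∷ w) h = cong₂ _∷_ (h 0) (mon-injective v w (h ∘ suc))

  mono : F → ℕ → Series
  mono c zero    zero    = c
  mono c zero    (suc _) = 0#
  mono c (suc l) zero    = 0#
  mono c (suc l) (suc i) = mono c l i

  mono-deg : ∀ c l → Deg< (suc l) (mono c l)
  mono-deg c zero    (suc i) h       = refl
  mono-deg c (suc l) (suc i) (s≤s h) = mono-deg c l i h

  mono-top : ∀ c l → mono c l l ≡ c
  mono-top c zero    = refl
  mono-top c (suc l) = mono-top c l

  mono-⊛ : ∀ c l f → mono c (suc l) ⊛ f ≈ (x· (mono c l ⊛ f))
  mono-⊛ c l f zero    = zeroˡ (f 0)
  mono-⊛ c l f (suc n) = trans (+-congʳ (zeroˡ (f (suc n)))) (+-identityˡ _)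

  mono-0-⊛ : ∀ c f → mono c 0 ⊛ f ≈ c ∙ f
  mono-0-⊛ c f zero = refl
  mono-0-⊛ c f (suc n) = trans (+-congˡ (⊛-zeroˡ f n)) (+-identityʳ _)

  mon-plain : ∀ {m} (v : Vec F m) → mon v ≈ mono 1# m ⊕ plain v
  mon-plain []      zero    = sym (+-identityʳ 1#)
  mon-plain []      (suc i) = sym (+-identityʳ 0#)
  mon-plain (a ∷ v) zero    = sym (+-identityˡ a)
  mon-plain (a ∷ v) (suc i) = mon-plain v i

  infixl 7 _⊗_
  abstract
    _⊗_ : ∀ {m l} → Vec F m → Vec F l → Vec F (m ℕ.+ l)
    _⊗_ {m} {l} P Q = truncate (m ℕ.+ l) (mon P ⊛ mon Q)

    mon-⊗ : ∀ {m l} (P : Vec F m) (Q : Vec F l) → mon (P ⊗ Q) ≈ mon P ⊛ mon Q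
    mon-⊗ {m} {l} P Q = let (d , t) = ⊛-deg m l (mon-deg P) (mon-deg Q) in
      mon-truncate (m ℕ.+ l) d (trans t (trans (cong₂ _*_ (mon-top P) (mon-top Q)) (*-identityˡ 1#)))

  private
    subtract : ∀ d l {m} (P : Vec F m) → m ≡ d → ∀ {p} → Deg< (suc (d ℕ.+ l)) p →
               Deg< (d ℕ.+ l) (p ⊕ ⊝ (mon P ⊛ mono (p (d ℕ.+ l)) l))
    subtract d l P refl {p} h = Deg<-lower (Deg<-⊕ h (Deg<-⊝ (proj₁ deg)))
      (trans (cong (λ z → p (d ℕ.+ l) - z) (trans (proj₂ deg) (trans (cong₂ _*_ (mon-top P) (mono-top _ l)) (*-identityˡ _))))
             (-‿inverseʳ _))
      where deg = ⊛-deg d l (mon-deg P) (mono-deg (p (d ℕ.+ l)) l)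

  division : ∀ {d} (P : Vec F d) l {p} → Deg< (d ℕ.+ l) p →
             ∃ λ (w : Vec F l) → ∃ λ (r : Vec F d) → p ≈ mon P ⊛ plain w ⊕ plain r
  division {d} P zero {p} h = [] , truncate d p ,
    ≈-trans (≈-sym (plain-truncate d (subst (λ m → Deg< m p) (ℕₚ.+-identityʳ d) h)))
            (λ i → sym (trans (cong (_+ _) (trans (⊛-comm (mon P) 𝟘 i) (⊛-zeroˡ (mon P) i))) (+-identityˡ _)))
  division {d} P (suc l) {p} h =
    let h′            = subst (λ m → Deg< m p) (ℕₚ.+-suc d l) h
        c             = p (d ℕ.+ l)
        (w , r , e)   = division P l (subtract d l P refl h′)
        s             = plain w ⊕ mono c l
        ds            = Deg<-⊕ (Deg<-weaken (ℕₚ.n≤1+n l) (plain-deg w)) (mono-deg c l)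
        back          = plain-truncate (suc l) ds
    in truncate (suc l) s , r ,
       ≈-trans (solve 2 (λ p t → p := (p :- t) :+ t) ≈-refl p (mon P ⊛ mono c l))
      (≈-trans (⊕-cong e (≈-refl {mon P ⊛ mono c l}))
      (≈-trans (solve 4 (λ P w m r → P :* w :+ r :+ P :* m := P :* (w :+ m) :+ r) ≈-refl (mon P) (plain w) (mono c l) (plain r))
               (⊕-cong (⊛-cong (≈-refl {mon P}) (≈-sym back)) (≈-refl {plain r}))))

  -- Since P is monic, the leading coefficient of w reappears in the product at a degree ≥ d, where
  -- ρ vanishes. This is the uniqueness of quotient and remainder.
  ⊛-small⇒0 : ∀ {d} (P : Vec F d) {w ρ} → Bounded w → Deg< d ρ → mon P ⊛ w ≈ ρ → w ≈ 𝟘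
  ⊛-small⇒0 {d} P {w} {ρ} (l , dw) dρ e = go l dw
    where
    go : ∀ l → Deg< l w → w ≈ 𝟘
    go zero    dw = Deg<-0 dw
    go (suc l) dw = go l (Deg<-lower dw (begin
      w l                      ≡⟨ *-identityˡ (w l) ⟨
      1# * w l                 ≡⟨ cong (_* w l) (mon-top P) ⟨
      mon P d * w l            ≡⟨ proj₂ (⊛-deg d l (mon-deg P) dw) ⟨
      (mon P ⊛ w) (d ℕ.+ l)    ≡⟨ e (d ℕ.+ l) ⟩
      ρ (d ℕ.+ l)              ≡⟨ dρ (d ℕ.+ l) (ℕₚ.m≤m+n d l) ⟩
      0#                       ∎))
      where open ≡-Reasoning

  infix 4 _≋_[_]
  -- The quotient has to be a polynomial: if P has a nonzero constant term it is invertible as a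
  -- power series, and with unbounded quotients any two series would be congruent.
  record _≋_[_] {d} (p p′ : Series) (P : Vec F d) : Set where
    constructor congruent
    field
      quotient : Series
      bounded  : Bounded quotient
      equation : p ≈ mon P ⊛ quotient ⊕ p′

  module _ {d} {P : Vec F d} where
    ≈⇒≋ : ∀ {p p′} → p ≈ p′ → p ≋ p′ [ P ]
    ≈⇒≋ {p} {p′} e = congruent 𝟘 Bounded-𝟘 (≈-trans e (λ i → sym (trans (cong (_+ _) (trans (⊛-comm (mon P) 𝟘 i) (⊛-zeroˡ (mon P) i))) (+-identityˡ _))))

    ≋-sym : ∀ {p p′} → p ≋ p′ [ P ] → p′ ≋ p [ P ]
    ≋-sym {p} {p′} (congruent w b e) = congruent (⊝ w) (Bounded-⊝ b)
      (≈-trans (solve 3 (λ p P w → p := P :* :- w :+ (P :* w :+ p)) ≈-refl p′ (mon P) w)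
               (⊕-cong (≈-refl {mon P ⊛ ⊝ w}) (≈-sym e)))

    ≋-trans : ∀ {p p′ p″} → p ≋ p′ [ P ] → p′ ≋ p″ [ P ] → p ≋ p″ [ P ]
    ≋-trans {p} {p′} {p″} (congruent w b e) (congruent w′ b′ e′) = congruent (w ⊕ w′) (Bounded-⊕ b b′)
      (≈-trans e (≈-trans (⊕-cong (≈-refl {mon P ⊛ w}) e′)
        (solve 4 (λ P w w′ p → P :* w :+ (P :* w′ :+ p) := P :* (w :+ w′) :+ p) ≈-refl (mon P) w w′ p″)))

    ≋-⊕ : ∀ {p p′ r r′} → p ≋ p′ [ P ] → r ≋ r′ [ P ] → p ⊕ r ≋ p′ ⊕ r′ [ P ]
    ≋-⊕ {p} {p′} {r} {r′} (congruent w b e) (congruent w′ b′ e′) = congruent (w ⊕ w′) (Bounded-⊕ b b′)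
      (≈-trans (⊕-cong e e′)
        (solve 5 (λ P w w′ p r → (P :* w :+ p) :+ (P :* w′ :+ r) := P :* (w :+ w′) :+ (p :+ r)) ≈-refl (mon P) w w′ p′ r′))

    ≋-⊝ : ∀ {p p′} → p ≋ p′ [ P ] → ⊝ p ≋ ⊝ p′ [ P ]
    ≋-⊝ {p} {p′} (congruent w b e) = congruent (⊝ w) (Bounded-⊝ b)
      (≈-trans (⊝-cong e) (solve 3 (λ P w p → :- (P :* w :+ p) := P :* :- w :- p) ≈-refl (mon P) w p′))

    ≋-⊛ʳ : ∀ {p p′} r → Bounded r → p ≋ p′ [ P ] → p ⊛ r ≋ p′ ⊛ r [ P ]
    ≋-⊛ʳ {p} {p′} r br (congruent w b e) = congruent (w ⊛ r) (Bounded-⊛ b br)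
      (≈-trans (⊛-cong e (≈-refl {r}))
        (solve 4 (λ P w p r → (P :* w :+ p) :* r := P :* (w :* r) :+ p :* r) ≈-refl (mon P) w p′ r))

    ≋-⊛ˡ : ∀ {p p′} r → Bounded r → p ≋ p′ [ P ] → r ⊛ p ≋ r ⊛ p′ [ P ]
    ≋-⊛ˡ {p} {p′} r br h = ≋-trans (≈⇒≋ (⊛-comm r p)) (≋-trans (≋-⊛ʳ r br h) (≈⇒≋ (⊛-comm p′ r)))

    ≋-modulus : mon P ≋ 𝟘 [ P ]
    ≋-modulus = congruent 𝟙 Bounded-𝟙 
      (λ i → sym (trans (+-identityʳ _) (trans (⊛-comm (mon P) 𝟙 i) (⊛-identityˡ (mon P) i))))

    ≋⇒≡ : ∀ {v w : Vec F d} → plain v ≋ plain w [ P ] → v ≡ w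
    ≋⇒≡ {v} {w} (congruent u b e) = plain-injective v w
      (≈-trans e (λ i → trans (cong (_+ plain w i)
        (trans (⊛-cong (≈-refl {mon P}) zero-quotient i) (trans (⊛-comm (mon P) 𝟘 i) (⊛-zeroˡ (mon P) i)))) (+-identityˡ _)))
      where
      zero-quotient : u ≈ 𝟘
      zero-quotient = ⊛-small⇒0 P b (Deg<-⊕ (plain-deg v) (Deg<-⊝ (plain-deg w)))
        (≈-trans (solve 2 (λ a b → a := (a :+ b) :- b) ≈-refl (mon P ⊛ u) (plain w))
                 (⊕-cong (≈-sym e) (≈-refl {⊝ plain w})))

    remainder : ∀ p → Bounded p → ∃ λ (r : Vec F d) → p ≋ plain r [ P ]
    remainder p (n , h) = let (w , r , e) = division P n (Deg<-weaken (ℕₚ.m≤n+m n d) h) in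
      r , congruent (plain w) (plain-bounded w) e

-- Evaluation of polynomials in commutative F-algebras

record Algebra (𝔽 : FiniteField) : Set₁ where
  no-eta-equality
  open FiniteField 𝔽 using (F)
  private module 𝔽 = FiniteField 𝔽
  infixl 6 _+_
  infixl 7 _*_
  field
    K   : Set
    _+_ _*_ : K → K → K
    -_  : K → K
    0# 1# : K
    isCommutativeRing : IsCommutativeRing _≡_ _+_ _*_ -_ 0# 1#
    ⌊_⌋ : F → K
    ⌊⌋-+ : ∀ a b → ⌊ a 𝔽.+ b ⌋ ≡ ⌊ a ⌋ + ⌊ b ⌋
    ⌊⌋-* : ∀ a b → ⌊ a 𝔽.* b ⌋ ≡ ⌊ a ⌋ * ⌊ b ⌋
    ⌊⌋-1 : ⌊ 𝔽.1# ⌋ ≡ 1#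

  commutativeRing : CommutativeRing _ _
  commutativeRing = record { isCommutativeRing = isCommutativeRing }

module AlgebraFacts {𝔽 : FiniteField} (𝔎 : Algebra 𝔽) where
  private
    module 𝔽 = FieldFacts 𝔽
  open FiniteField 𝔽 using (F)
  open Algebra 𝔎 public
  open CommutativeRing commutativeRing public
    using (_-_; +-congˡ; +-congʳ; *-congˡ; *-congʳ; +-assoc; +-comm; +-identityˡ; +-identityʳ; -‿inverseˡ; -‿inverseʳ; *-assoc; *-comm;
           *-identityˡ; *-identityʳ; zeroˡ; zeroʳ; distribˡ; distribʳ)
  open RingProperties (CommutativeRing.ring commutativeRing) public
    using (-‿distribˡ-*; -‿distribʳ-*; -‿involutive)
    renaming (-0#≈0# to -0≡0)
  open RingSolver commutativeRing public
  open Polynomials 𝔽 hiding (solve; _:+_; _:*_; :-_; _:-_; _:=_; con)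

  x-y≡0⇒x≡y : ∀ {x y} → x - y ≡ 0# → x ≡ y
  x-y≡0⇒x≡y {x} {y} e = trans (solve 2 (λ x y → x := x :- y :+ y) refl x y) (trans (cong (_+ y) e) (+-identityˡ y))

  x+y≡0⇒y≡-x : ∀ {x y} → x + y ≡ 0# → y ≡ - x
  x+y≡0⇒y≡-x {x} {y} e = trans (solve 2 (λ x y → y := x :+ y :- x) refl x y) (trans (cong (_- x) e) (+-identityˡ (- x)))

  ⌊⌋-0 : ⌊ 𝔽.0# ⌋ ≡ 0#
  ⌊⌋-0 = trans (solve 1 (λ z → z := z :+ z :- z) refl z) (trans (cong (_- z) (sym twice)) (-‿inverseʳ z))
    where
    z = ⌊ 𝔽.0# ⌋
    twice : z ≡ z + z
    twice = trans (cong ⌊_⌋ (sym (𝔽.+-identityˡ 𝔽.0#))) (⌊⌋-+ 𝔽.0# 𝔽.0#)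

  infixr 8 _^_
  _^_ : K → ℕ → K
  x ^ zero  = 1#
  x ^ suc k = x * x ^ k

  *-^ : ∀ x y k → (x * y) ^ k ≡ x ^ k * y ^ k
  *-^ x y zero    = sym (*-identityˡ 1#)
  *-^ x y (suc k) = trans (cong (x * y *_) (*-^ x y k))
    (solve 4 (λ a b c d → a :* b :* (c :* d) := a :* c :* (b :* d)) refl x y (x ^ k) (y ^ k))

  ^-+ : ∀ x m n → x ^ (m ℕ.+ n) ≡ x ^ m * x ^ n
  ^-+ x zero    n = sym (*-identityˡ _)
  ^-+ x (suc m) n = trans (cong (x *_) (^-+ x m n)) (sym (*-assoc x _ _))

  1^ : ∀ k → 1# ^ k ≡ 1#
  1^ zero    = refl
  1^ (suc k) = trans (*-identityˡ _) (1^ k)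

  ^-* : ∀ x m n → x ^ (m ℕ.* n) ≡ (x ^ n) ^ m
  ^-* x zero    n = refl
  ^-* x (suc m) n = trans (^-+ x n (m ℕ.* n)) (cong (x ^ n *_) (^-* x m n))

  -- The value Σ_{i<n} fᵢ αⁱ, by Horner's scheme.
  evs : ℕ → Series → K → K
  evs zero    f α = 0#
  evs (suc n) f α = ⌊ f 0 ⌋ + α * evs n (f ∘ suc) α

  -- The bound says where the sum may stop; by `ev-≈` the value does not depend on it.
  ev : ∀ f → Bounded f → K → K
  ev f (m , _) α = evs m f α

  module _ (α : K) where
    evs-cong : ∀ n {f g} → f ≈ g → evs n f α ≡ evs n g α
    evs-cong zero    h = refl
    evs-cong (suc n) h = cong₂ _+_ (cong ⌊_⌋ (h 0)) (cong (α *_) (evs-cong n (h ∘ suc)))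

    evs-⊕ : ∀ n f g → evs n (f ⊕ g) α ≡ evs n f α + evs n g α
    evs-⊕ zero    f g = sym (+-identityˡ 0#)
    evs-⊕ (suc n) f g = trans (cong₂ _+_ (⌊⌋-+ (f 0) (g 0)) (cong (α *_) (evs-⊕ n (f ∘ suc) (g ∘ suc))))
      (solve 5 (λ a b x c d → a :+ b :+ x :* (c :+ d) := a :+ x :* c :+ (b :+ x :* d)) refl ⌊ f 0 ⌋ ⌊ g 0 ⌋ α (evs n (f ∘ suc) α) (evs n (g ∘ suc) α))

    evs-∙ : ∀ n c f → evs n (c ∙ f) α ≡ ⌊ c ⌋ * evs n f α
    evs-∙ zero    c f = sym (zeroʳ _)
    evs-∙ (suc n) c f = trans (cong₂ _+_ (⌊⌋-* c (f 0)) (cong (α *_) (evs-∙ n c (f ∘ suc))))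
      (solve 4 (λ c a x b → c :* a :+ x :* (c :* b) := c :* (a :+ x :* b)) refl ⌊ c ⌋ ⌊ f 0 ⌋ α (evs n (f ∘ suc) α))

    evs-0 : ∀ n {f} → f ≈ 𝟘 → evs n f α ≡ 0#
    evs-0 zero    h = refl
    evs-0 (suc n) h = trans (cong₂ _+_ (trans (cong ⌊_⌋ (h 0)) ⌊⌋-0) (trans (cong (α *_) (evs-0 n (h ∘ suc))) (zeroʳ α))) (+-identityˡ 0#)

    evs-stable : ∀ m k {f} → Deg< m f → evs (m ℕ.+ k) f α ≡ evs m f α
    evs-stable zero    k d = evs-0 k (Deg<-0 d)
    evs-stable (suc m) k d = +-congˡ (cong (α *_) (evs-stable m k (λ i h → d (suc i) (s≤s h))))

    evs-⊛ : ∀ m n {f g} → Deg< m f → Deg< n g → evs (m ℕ.+ n) (f ⊛ g) α ≡ evs m f α * evs n g α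
    evs-⊛ zero n {f} {g} df dg = trans (evs-0 n (λ i → trans (⊛-cong {g = g} {g} (Deg<-0 df) (λ _ → refl) i) (⊛-zeroˡ g i))) (sym (zeroˡ _))
    evs-⊛ (suc m) n {f} {g} df dg = begin
      evs (suc m ℕ.+ n) (f ⊛ g) α
        ≡⟨ evs-cong (suc m ℕ.+ n) split ⟩
      evs (suc m ℕ.+ n) (f 0 ∙ g ⊕ (x· ((f ∘ suc) ⊛ g))) α
        ≡⟨ evs-⊕ (suc m ℕ.+ n) (f 0 ∙ g) (x· ((f ∘ suc) ⊛ g)) ⟩
      evs (suc m ℕ.+ n) (f 0 ∙ g) α + (⌊ 𝔽.0# ⌋ + α * evs (m ℕ.+ n) ((f ∘ suc) ⊛ g) α)
        ≡⟨ cong₂ _+_ (trans (evs-∙ (suc m ℕ.+ n) (f 0) g) (cong (⌊ f 0 ⌋ *_)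
             (trans (cong (λ z → evs z g α) (ℕₚ.+-comm (suc m) n)) (evs-stable n (suc m) dg))))
             (cong₂ _+_ ⌊⌋-0 (cong (α *_) (evs-⊛ m n (λ i h → df (suc i) (s≤s h)) dg))) ⟩
      ⌊ f 0 ⌋ * evs n g α + (0# + α * (evs m (f ∘ suc) α * evs n g α))
        ≡⟨ cong (λ z → ⌊ f 0 ⌋ * evs n g α + z) (+-identityˡ _) ⟩
      ⌊ f 0 ⌋ * evs n g α + α * (evs m (f ∘ suc) α * evs n g α)
        ≡⟨ solve 4 (λ a g x b → a :* g :+ x :* (b :* g) := (a :+ x :* b) :* g) refl ⌊ f 0 ⌋ (evs n g α) α (evs m (f ∘ suc) α) ⟩
      (⌊ f 0 ⌋ + α * evs m (f ∘ suc) α) * evs n g α ∎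
      where
      open ≡-Reasoning
      split : f ⊛ g ≈ f 0 ∙ g ⊕ (x· ((f ∘ suc) ⊛ g))
      split zero    = sym (𝔽.+-identityʳ _)
      split (suc i) = refl

    ev-≈ : ∀ {f g} (b : Bounded f) (b′ : Bounded g) → f ≈ g → ev f b α ≡ ev g b′ α
    ev-≈ {f} {g} (m , d) (n , d′) h = trans (sym (evs-stable m n d)) (trans (evs-cong (m ℕ.+ n) h)
      (trans (cong (λ z → evs z g α) (ℕₚ.+-comm m n)) (evs-stable n m d′)))

    ev-⊕ : ∀ {f g} (b : Bounded f) (b′ : Bounded g) (c : Bounded (f ⊕ g)) → ev (f ⊕ g) c α ≡ ev f b α + ev g b′ α
    ev-⊕ {f} {g} b@(m , d) b′@(n , d′) c = trans (ev-≈ c (Bounded-⊕ b b′) ≈-refl) (trans (evs-⊕ (m ℕ.+ n) f g)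
      (cong₂ _+_ (evs-stable m n d) (trans (cong (λ z → evs z g α) (ℕₚ.+-comm m n)) (evs-stable n m d′))))

    ev-⊛ : ∀ {f g} (b : Bounded f) (b′ : Bounded g) (c : Bounded (f ⊛ g)) → ev (f ⊛ g) c α ≡ ev f b α * ev g b′ α
    ev-⊛ b@(m , d) b′@(n , d′) c = trans (ev-≈ c (Bounded-⊛ b b′) ≈-refl) (evs-⊛ m n d d′)

    ev-mono : ∀ c l (b : Bounded (mono c l)) → ev (mono c l) b α ≡ ⌊ c ⌋ * α ^ l
    ev-mono c l b = trans (ev-≈ b (suc l , mono-deg c l) ≈-refl) (go l)
      where
      go : ∀ l → evs (suc l) (mono c l) α ≡ ⌊ c ⌋ * α ^ l
      go zero    = trans (trans (+-congˡ (zeroʳ α)) (+-identityʳ _)) (sym (*-identityʳ _))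
      go (suc l) = trans (cong₂ _+_ ⌊⌋-0 (cong (α *_) (go l))) (trans (+-identityˡ _)
        (solve 3 (λ x c y → x :* (c :* y) := c :* (x :* y)) refl α ⌊ c ⌋ (α ^ l)))

    evp : ∀ {m} → Vec F m → K
    evp v = ev (plain v) (plain-bounded v) α

    evm : ∀ {m} → Vec F m → K
    evm v = ev (mon v) (mon-bounded v) α

    evm-plain : ∀ {m} (v : Vec F m) → evm v ≡ α ^ m + evp v
    evm-plain {m} v = trans (ev-≈ (mon-bounded v) b (mon-plain v)) (trans (ev-⊕ (suc m , mono-deg 𝔽.1# m) (plain-bounded v) b)
      (cong (_+ evp v) (trans (ev-mono 𝔽.1# m (suc m , mono-deg 𝔽.1# m)) (trans (cong (_* α ^ m) ⌊⌋-1) (*-identityˡ _)))))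
      where b = Bounded-⊕ (suc m , mono-deg 𝔽.1# m) (plain-bounded v)

    evm-⊗ : ∀ {m l} (P : Vec F m) (Q : Vec F l) → evm (P ⊗ Q) ≡ evm P * evm Q
    evm-⊗ P Q = trans (ev-≈ (mon-bounded (P ⊗ Q)) b (mon-⊗ P Q)) (ev-⊛ (mon-bounded P) (mon-bounded Q) b)
      where b = Bounded-⊛ (mon-bounded P) (mon-bounded Q)

    ev-≋ : ∀ {d} (P : Vec F d) → evm P ≡ 0# → ∀ {f g} (b : Bounded f) (b′ : Bounded g) → f ≋ g [ P ] → ev f b α ≡ ev g b′ α
    ev-≋ P root {f} {g} b b′ (congruent w bw e) = begin
      ev f b α                         ≡⟨ ev-≈ b b₂ e ⟩
      ev (mon P ⊛ w ⊕ g) b₂ α          ≡⟨ ev-⊕ b₁ b′ b₂ ⟩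
      ev (mon P ⊛ w) b₁ α + ev g b′ α  ≡⟨ cong (_+ ev g b′ α) (trans (ev-⊛ (mon-bounded P) bw b₁) (trans (cong (_* ev w bw α) root) (zeroˡ _))) ⟩
      0# + ev g b′ α                   ≡⟨ +-identityˡ _ ⟩
      ev g b′ α                        ∎
      where
      open ≡-Reasoning
      b₁ = Bounded-⊛ (mon-bounded P) bw
      b₂ = Bounded-⊕ b₁ b′

    -- A linear functional is determined by its values on the powers of α. The extra factor β
    -- absorbs one power of α at each step of Horner's scheme, which lets the induction go through.
    functional-ev : (ℓ : K → F) → (∀ x y → ℓ (x + y) ≡ ℓ x 𝔽.+ ℓ y) → (∀ c x → ℓ (⌊ c ⌋ * x) ≡ c 𝔽.* ℓ x) →
                    ∀ {m} (v : Vec F m) (β : K) →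
                    ℓ (β * evp v) ≡ Matrices.Σᶠ 𝔽 {m} (λ i → plain v (toℕ i) 𝔽.* ℓ (β * α ^ toℕ i))
    functional-ev ℓ ℓ-+ ℓ-c [] β = trans (cong ℓ (trans (zeroʳ β) (sym (trans (cong (_* 0#) ⌊⌋-0) (zeroʳ 0#))))) (trans (ℓ-c 𝔽.0# 0#) (𝔽.zeroˡ _))
    functional-ev ℓ ℓ-+ ℓ-c {suc m} (a ∷ v) β = begin
      ℓ (β * (⌊ a ⌋ + α * evp v))
        ≡⟨ cong ℓ (solve 4 (λ b a x y → b :* (a :+ x :* y) := a :* b :+ b :* x :* y) refl β ⌊ a ⌋ α (evp v)) ⟩
      ℓ (⌊ a ⌋ * β + β * α * evp v)
        ≡⟨ ℓ-+ _ _ ⟩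
      ℓ (⌊ a ⌋ * β) 𝔽.+ ℓ (β * α * evp v)
        ≡⟨ cong₂ 𝔽._+_ (trans (ℓ-c a β) (cong (λ z → a 𝔽.* ℓ z) (sym (*-identityʳ β)))) (functional-ev ℓ ℓ-+ ℓ-c v (β * α)) ⟩
      a 𝔽.* ℓ (β * 1#) 𝔽.+ Matrices.Σᶠ 𝔽 {m} (λ i → plain v (toℕ i) 𝔽.* ℓ (β * α * α ^ toℕ i))
        ≡⟨ 𝔽.+-congˡ (MatrixFacts.Σᶠ-cong 𝔽 {m} (λ i → cong (λ z → plain v (toℕ i) 𝔽.* ℓ z) (*-assoc β α (α ^ toℕ i)))) ⟩
      a 𝔽.* ℓ (β * 1#) 𝔽.+ Matrices.Σᶠ 𝔽 {m} (λ i → plain v (toℕ i) 𝔽.* ℓ (β * (α * α ^ toℕ i))) ∎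
      where open ≡-Reasoning

-- The quotient ring F[x]/(P)

module Quotient (𝔽 : FiniteField) {d : ℕ} (P : Vec (FiniteField.F 𝔽) d) where
  private
    module 𝔽 = FieldFacts 𝔽
  open FiniteField 𝔽 using (F)
  open Polynomials 𝔽

  abstract
    cl : ∀ p → Bounded p → Vec F d
    cl p b = proj₁ (remainder {P = P} p b)

    cl-≋ : ∀ p b → plain (cl p b) ≋ p [ P ]
    cl-≋ p b = ≋-sym (proj₂ (remainder {P = P} p b))

  cl-unique : ∀ v {p} b → plain v ≋ p [ P ] → v ≡ cl p b
  cl-unique v {p} b h = ≋⇒≡ {P = P} {v} {cl p b} (≋-trans h (≋-sym (cl-≋ p b)))

  plain-cong : ∀ {v w : Vec F d} → v ≡ w → plain v ≈ plain w
  plain-cong refl i = refl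

  cl-small : ∀ {p} b → Deg< d p → plain (cl p b) ≈ p
  cl-small {p} b h = ≈-trans (plain-cong (sym (cl-unique (truncate d p) b (≈⇒≋ (plain-truncate d h))))) (plain-truncate d h)

  private
    ≋-small : ∀ v {p} → Deg< d p → plain v ≋ p [ P ] → plain v ≈ p
    ≋-small v {p} h k = let b = d , h in ≈-trans (plain-cong (cl-unique v b k)) (cl-small b h)

    infixl 6 _+ᴷ_
    infixl 7 _*ᴷ_
    abstract
      _+ᴷ_ _*ᴷ_ : Vec F d → Vec F d → Vec F d
      a +ᴷ b = cl (plain a ⊕ plain b) (Bounded-⊕ (plain-bounded a) (plain-bounded b))
      a *ᴷ b = cl (plain a ⊛ plain b) (Bounded-⊛ (plain-bounded a) (plain-bounded b))

      -ᴷ_ : Vec F d → Vec F d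
      -ᴷ a = cl (⊝ plain a) (Bounded-⊝ (plain-bounded a))

      0ᴷ 1ᴷ : Vec F d
      0ᴷ = cl 𝟘 Bounded-𝟘
      1ᴷ = cl 𝟙 Bounded-𝟙

      lift : F → Vec F d
      lift c = cl (mono c 0) (1 , mono-deg c 0)

      lift-≋ : ∀ c → plain (lift c) ≋ mono c 0 [ P ]
      lift-≋ c = cl-≋ (mono c 0) (1 , mono-deg c 0)

      0-≋ : plain 0ᴷ ≋ 𝟘 [ P ]
      0-≋ = cl-≋ 𝟘 Bounded-𝟘

      1-≋ : plain 1ᴷ ≋ 𝟙 [ P ]
      1-≋ = cl-≋ 𝟙 Bounded-𝟙

      neg-≋ : ∀ a → plain (-ᴷ a) ≋ ⊝ plain a [ P ]
      neg-≋ a = cl-≋ (⊝ plain a) (Bounded-⊝ (plain-bounded a))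

      +-≋ : ∀ a b → plain (a +ᴷ b) ≋ plain a ⊕ plain b [ P ]
      +-≋ a b = cl-≋ (plain a ⊕ plain b) (Bounded-⊕ (plain-bounded a) (plain-bounded b))

      *-≋ : ∀ a b → plain (a *ᴷ b) ≋ plain a ⊛ plain b [ P ]
      *-≋ a b = cl-≋ (plain a ⊛ plain b) (Bounded-⊛ (plain-bounded a) (plain-bounded b))

    ≋-refl : ∀ p → p ≋ p [ P ]
    ≋-refl p = ≈⇒≋ (≈-refl {p})

    from : ∀ v w {p r} → plain v ≋ p [ P ] → plain w ≋ r [ P ] → p ≈ r → v ≡ w
    from v w h k e = ≋⇒≡ {P = P} {v} {w} (≋-trans h (≋-trans (≈⇒≋ e) (≋-sym k)))

    +ᴷ-assoc : ∀ a b c → a +ᴷ b +ᴷ c ≡ a +ᴷ (b +ᴷ c)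
    +ᴷ-assoc a b c = from _ _ (≋-trans (+-≋ (a +ᴷ b) c) (≋-⊕ (+-≋ a b) (≋-refl (plain c)))) (≋-trans (+-≋ a (b +ᴷ c)) (≋-⊕ (≋-refl (plain a)) (+-≋ b c)))
      (λ i → 𝔽.+-assoc (plain a i) (plain b i) (plain c i))

    *ᴷ-assoc : ∀ a b c → a *ᴷ b *ᴷ c ≡ a *ᴷ (b *ᴷ c)
    *ᴷ-assoc a b c = from _ _ (≋-trans (*-≋ (a *ᴷ b) c) (≋-⊛ʳ (plain c) (plain-bounded c) (*-≋ a b)))
      (≋-trans (*-≋ a (b *ᴷ c)) (≋-⊛ˡ (plain a) (plain-bounded a) (*-≋ b c))) (⊛-assoc (plain a) (plain b) (plain c))

    +ᴷ-comm : ∀ a b → a +ᴷ b ≡ b +ᴷ a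
    +ᴷ-comm a b = from _ _ (+-≋ a b) (+-≋ b a) (λ i → 𝔽.+-comm (plain a i) (plain b i))

    *ᴷ-comm : ∀ a b → a *ᴷ b ≡ b *ᴷ a
    *ᴷ-comm a b = from _ _ (*-≋ a b) (*-≋ b a) (⊛-comm (plain a) (plain b))

    +ᴷ-identityˡ : ∀ a → 0ᴷ +ᴷ a ≡ a
    +ᴷ-identityˡ a = from _ _ (≋-trans (+-≋ 0ᴷ a) (≋-⊕ 0-≋ (≋-refl (plain a)))) (≋-refl (plain a)) (λ i → 𝔽.+-identityˡ (plain a i))

    *ᴷ-identityˡ : ∀ a → 1ᴷ *ᴷ a ≡ a
    *ᴷ-identityˡ a = from _ _ (≋-trans (*-≋ 1ᴷ a) (≋-⊛ʳ (plain a) (plain-bounded a) 1-≋)) (≋-refl (plain a)) (⊛-identityˡ (plain a))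

    -ᴷ-inverseˡ : ∀ a → -ᴷ a +ᴷ a ≡ 0ᴷ
    -ᴷ-inverseˡ a = from _ _ (≋-trans (+-≋ (-ᴷ a) a) (≋-⊕ (neg-≋ a) (≋-refl (plain a)))) 0-≋ (λ i → 𝔽.-‿inverseˡ (plain a i))

    *ᴷ-distribʳ : ∀ c a b → (a +ᴷ b) *ᴷ c ≡ a *ᴷ c +ᴷ b *ᴷ c
    *ᴷ-distribʳ c a b = from _ _ (≋-trans (*-≋ (a +ᴷ b) c) (≋-⊛ʳ (plain c) (plain-bounded c) (+-≋ a b)))
      (≋-trans (+-≋ (a *ᴷ c) (b *ᴷ c)) (≋-⊕ (*-≋ a c) (*-≋ b c))) (⊛-distribʳ (plain c) (plain a) (plain b))

  algebra : Algebra 𝔽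
  algebra = record
    { K = Vec F d ; _+_ = _+ᴷ_ ; _*_ = _*ᴷ_ ; -_ = -ᴷ_ ; 0# = 0ᴷ ; 1# = 1ᴷ
    ; isCommutativeRing = record
      { isRing = record
        { +-isAbelianGroup = record
          { isGroup = record
            { isMonoid = record
              { isSemigroup = record
                { isMagma = record { isEquivalence = ≡-isEquivalence ; ∙-cong = cong₂ _+ᴷ_ }
                ; assoc = +ᴷ-assoc }
              ; identity = +ᴷ-identityˡ , (λ a → trans (+ᴷ-comm a 0ᴷ) (+ᴷ-identityˡ a)) }
            ; inverse = -ᴷ-inverseˡ , (λ a → trans (+ᴷ-comm a (-ᴷ a)) (-ᴷ-inverseˡ a))
            ; ⁻¹-cong = cong -ᴷ_ }
          ; comm = +ᴷ-comm }
        ; *-cong = cong₂ _*ᴷ_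
        ; *-assoc = *ᴷ-assoc
        ; *-identity = *ᴷ-identityˡ , (λ a → trans (*ᴷ-comm a 1ᴷ) (*ᴷ-identityˡ a))
        ; distrib = (λ c a b → trans (*ᴷ-comm c (a +ᴷ b)) (trans (*ᴷ-distribʳ c a b) (cong₂ _+ᴷ_ (*ᴷ-comm a c) (*ᴷ-comm b c))))
                  , *ᴷ-distribʳ }
      ; *-comm = *ᴷ-comm }
    ; ⌊_⌋ = lift
    ; ⌊⌋-+ = λ a b → from _ _ (lift-≋ (a 𝔽.+ b)) (≋-trans (+-≋ (lift a) (lift b)) (≋-⊕ (lift-≋ a) (lift-≋ b)))
        (λ { zero → refl ; (suc i) → sym (𝔽.+-identityˡ 𝔽.0#) })
    ; ⌊⌋-* = λ a b → from _ _ (lift-≋ (a 𝔽.* b)) (≋-trans (*-≋ (lift a) (lift b)) (≋-trans (≋-⊛ʳ (plain (lift b)) (plain-bounded (lift b)) (lift-≋ a)) (≋-⊛ˡ (mono a 0) (1 , mono-deg a 0) (lift-≋ b))))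
        (λ i → sym (trans (mono-0-⊛ a (mono b 0) i) (scale a b i)))
    ; ⌊⌋-1 = from _ _ (lift-≋ 𝔽.1#) 1-≋ (λ { zero → refl ; (suc i) → refl }) }
    where
    scale : ∀ a b i → (a ∙ mono b 0) i ≡ mono (a 𝔽.* b) 0 i
    scale a b zero    = refl
    scale a b (suc i) = 𝔽.zeroʳ a

  open AlgebraFacts algebra hiding (solve; _:+_; _:*_; :-_; _:-_; _:=_; con)

  X : K
  X = cl (mono 𝔽.1# 1) (2 , mono-deg 𝔽.1# 1)

  -- Evaluating at the class of x is reduction modulo P. Identities in the quotient can therefore be
  -- obtained by computing with polynomials.
  plain-ev : ∀ {p} (b : Bounded p) → plain (ev p b X) ≋ p [ P ]
  plain-ev (m , h) = go m h
    where
    go : ∀ m {p} → Deg< m p → plain (evs m p X) ≋ p [ P ]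
    go zero    h = ≋-trans 0-≋ (≈⇒≋ (≈-sym (Deg<-0 h)))
    go (suc m) {p} h = ≋-trans (+-≋ (lift (p 0)) (X *ᴷ evs m (p ∘ suc) X))
      (≋-trans (≋-⊕ (lift-≋ (p 0)) (≋-trans (*-≋ X (evs m (p ∘ suc) X)) (≋-trans (≋-⊛ʳ (plain (evs m (p ∘ suc) X)) (plain-bounded (evs m (p ∘ suc) X)) (cl-≋ (mono 𝔽.1# 1) (2 , mono-deg 𝔽.1# 1)))
         (≋-⊛ˡ (mono 𝔽.1# 1) (2 , mono-deg 𝔽.1# 1) (go m (λ i le → h (suc i) (s≤s le)))))))
        (≈⇒≋ eq))
      where
      eq : mono (p 0) 0 ⊕ mono 𝔽.1# 1 ⊛ (p ∘ suc) ≈ p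
      eq i = trans (cong (λ z → mono (p 0) 0 i 𝔽.+ z) (trans (mono-⊛ 𝔽.1# 0 (p ∘ suc) i) (x·-cong (mono-0-⊛ 𝔽.1# (p ∘ suc)) i))) (eq′ i)
        where
        eq′ : ∀ i → mono (p 0) 0 i 𝔽.+ (x· (𝔽.1# ∙ (p ∘ suc))) i ≡ p i
        eq′ zero    = 𝔽.+-identityʳ (p 0)
        eq′ (suc i) = trans (𝔽.+-identityˡ _) (𝔽.*-identityˡ (p (suc i)))

  evp-X : ∀ v → evp X v ≡ v
  evp-X v = ≋⇒≡ {P = P} {evp X v} {v} (plain-ev (plain-bounded v))

  evm-X : evm X P ≡ 0#
  evm-X = from (evm X P) 0# (plain-ev (mon-bounded P)) (≋-trans 0-≋ (≋-sym (≋-modulus {P = P}))) ≈-refl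

  ev-X-small : ∀ {p} (b : Bounded p) → Deg< d p → plain (ev p b X) ≈ p
  ev-X-small b h = ≈-trans (plain-cong (cl-unique (ev _ b X) b (plain-ev b))) (cl-small b h)

  plain-+ : ∀ a b → plain (a + b) ≈ plain a ⊕ plain b
  plain-+ a b = ≋-small (a + b) (Deg<-⊕ (plain-deg a) (plain-deg b)) (+-≋ a b)

  plain-neg : ∀ a → plain (- a) ≈ ⊝ plain a
  plain-neg a = ≋-small (- a) (Deg<-⊝ (plain-deg a)) (neg-≋ a)

  plain-0 : plain 0# ≈ 𝟘
  plain-0 = ≋-small 0# Deg<-𝟘 0-≋

  plain-⌊⌋* : ∀ c a → plain (⌊ c ⌋ * a) ≈ c ∙ plain a
  plain-⌊⌋* c a = ≈-trans (plain-cong (cl-unique (⌊ c ⌋ * a) b (≋-trans (*-≋ ⌊ c ⌋ a) (≋-trans (≋-⊛ʳ (plain a) (plain-bounded a) (lift-≋ c)) (≈⇒≋ (mono-0-⊛ c (plain a)))))))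
    (cl-small b small)
    where
    small : Deg< d (c ∙ plain a)
    small i h = trans (cong (c 𝔽.*_) (plain-deg a i h)) (𝔽.zeroʳ c)
    b : Bounded (c ∙ plain a)
    b = d , small

  X^-plain : ∀ {j} → j < d → plain (X ^ j) ≈ mono 𝔽.1# j
  X^-plain {j} j<d = ≈-trans (plain-cong (sym (trans (ev-mono X 𝔽.1# j b) (trans (cong (_* X ^ j) ⌊⌋-1) (*-identityˡ (X ^ j))))))
    (ev-X-small b (Deg<-weaken j<d (mono-deg 𝔽.1# j)))
    where b = suc j , mono-deg 𝔽.1# j

  X^d-plain : plain (X ^ d) ≈ ⊝ plain P
  X^d-plain = ≈-trans (plain-cong X^d) (plain-neg P)
    where
    X^d : X ^ d ≡ - P
    X^d = trans (x+y≡0⇒y≡-x {evp X P} {X ^ d} (trans (+-comm (evp X P) (X ^ d)) (trans (sym (evm-plain X P)) evm-X))) (cong -_ (evp-X P))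

-- The formal derivative

module Derivative (𝔽 : FiniteField) where
  open FieldFacts 𝔽 hiding (solve; _:+_; _:*_; :-_; _:-_; _:=_; con)
  open Polynomials 𝔽

  tail : Series → Series
  tail f = f ∘ suc

  -- The formal derivative, through (f₀ + x f̃)′ = f̃ + x f̃′.
  der : Series → Series
  der f zero    = f 1
  der f (suc n) = f (2 ℕ.+ n) + der (tail f) n

  der-tail : ∀ f → der f ≈ tail f ⊕ (x· der (tail f))
  der-tail f zero    = sym (+-identityʳ (f 1))
  der-tail f (suc n) = refl

  der-cong : ∀ {f g} → f ≈ g → der f ≈ der g
  der-cong h zero    = h 1
  der-cong h (suc n) = cong₂ _+_ (h (2 ℕ.+ n)) (der-cong (h ∘ suc) n)

  der-0 : ∀ {f} → Deg< 1 f → der f ≈ 𝟘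
  der-0 h zero    = h 1 (s≤s z≤n)
  der-0 h (suc n) = trans (cong₂ _+_ (h (2 ℕ.+ n) (s≤s z≤n)) (der-0 (λ i _ → h (suc i) (s≤s z≤n)) n)) (+-identityˡ 0#)

  Deg<-tail : ∀ {m f} → Deg< m f → Deg< m (tail f)
  Deg<-tail h i le = h (suc i) (ℕₚ.m≤n⇒m≤1+n le)

  der-deg : ∀ {m f} → Deg< (suc m) f → Deg< m (der f)
  der-deg h zero    le = h 1 (s≤s le)
  der-deg {m} h (suc n) le = trans (cong₂ _+_ (h (2 ℕ.+ n) (s≤s le)) (below m h le)) (+-identityˡ 0#)
    where
    below : ∀ m {f} → Deg< (suc m) f → m ≤ suc n → der (tail f) n ≡ 0#
    below zero    h le = der-0 (λ i _ → h (suc i) (s≤s z≤n)) n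
    below (suc m) h le = der-deg (λ i k → h (suc i) (s≤s k)) n (ℕₚ.≤-pred le)

  der-bounded : ∀ {f} → Bounded f → Bounded (der f)
  der-bounded (m , h) = m , der-deg (Deg<-weaken (ℕₚ.n≤1+n m) h)

  der-∙⊕x· : ∀ c g h → der (c ∙ g ⊕ (x· h)) ≈ c ∙ der g ⊕ (h ⊕ (x· der h))
  der-∙⊕x· c g h zero    = +-congˡ (sym (+-identityʳ (h 0)))
  der-∙⊕x· c g h (suc n) = trans (+-congˡ (linear c (tail g) h n))
    (RingSolver.solve commutativeRing 5 (λ c a b d e → (c F:* a F:+ b) F:+ (c F:* d F:+ e) F:= c F:* (a F:+ d) F:+ (b F:+ e)) refl c (g (2 ℕ.+ n)) (h (suc n)) (der (tail g) n) (der h n))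
    where
    open RingSolver commutativeRing using () renaming (_:+_ to _F:+_; _:*_ to _F:*_; _:=_ to _F:=_)
    linear : ∀ c f g → der (c ∙ f ⊕ g) ≈ c ∙ der f ⊕ der g
    linear c f g zero    = refl
    linear c f g (suc n) = trans (+-congˡ (linear c (tail f) (tail g) n))
      (RingSolver.solve commutativeRing 5 (λ c a b d e → (c F:* a F:+ b) F:+ (c F:* d F:+ e) F:= c F:* (a F:+ d) F:+ (b F:+ e)) refl c (f (2 ℕ.+ n)) (g (2 ℕ.+ n)) (der (tail f) n) (der (tail g) n))

  x·-⊛ : ∀ f g → (x· f) ⊛ g ≈ (x· (f ⊛ g))
  x·-⊛ f g zero    = zeroˡ (g 0)
  x·-⊛ f g (suc n) = trans (+-congʳ (zeroˡ (g (suc n)))) (+-identityˡ _)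

  ⊛-head : ∀ f g → f ⊛ g ≈ f 0 ∙ g ⊕ (x· (tail f ⊛ g))
  ⊛-head f g zero    = sym (+-identityʳ _)
  ⊛-head f g (suc n) = refl

  -- Induction on the coefficient index: writing f = f₀ + x f̃ on both sides reduces the claim to
  -- the one for f̃ and g, one degree lower.
  leibniz : ∀ f g → der (f ⊛ g) ≈ der f ⊛ g ⊕ f ⊛ der g
  leibniz f g n = go n f g
    where
    expand : ∀ f g → der f ⊛ g ⊕ f ⊛ der g ≈ f 0 ∙ der g ⊕ (tail f ⊛ g ⊕ (x· (der (tail f) ⊛ g ⊕ tail f ⊛ der g)))
    expand f g n = begin
      (der f ⊛ g) n + (f ⊛ der g) n
        ≡⟨ cong₂ _+_ (trans (⊛-cong {g = g} {g} (der-tail f) ≈-refl n)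
             (trans (⊛-distribʳ g (tail f) (x· der (tail f)) n) (+-congˡ (x·-⊛ (der (tail f)) g n)))) (⊛-head f (der g) n) ⟩
      ((tail f ⊛ g) n + (x· (der (tail f) ⊛ g)) n) + (f 0 * der g n + (x· (tail f ⊛ der g)) n)
        ≡⟨ RingSolver.solve commutativeRing 4 (λ a b c d → (a F:+ b) F:+ (c F:+ d) F:= c F:+ (a F:+ (b F:+ d))) refl ((tail f ⊛ g) n) ((x· (der (tail f) ⊛ g)) n) (f 0 * der g n) ((x· (tail f ⊛ der g)) n) ⟩
      f 0 * der g n + ((tail f ⊛ g) n + ((x· (der (tail f) ⊛ g)) n + (x· (tail f ⊛ der g)) n))
        ≡⟨ +-congˡ (+-congˡ (sym (shift n))) ⟩
      f 0 * der g n + ((tail f ⊛ g) n + (x· (der (tail f) ⊛ g ⊕ tail f ⊛ der g)) n) ∎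
      where
      open ≡-Reasoning
      open RingSolver commutativeRing using () renaming (_:+_ to _F:+_; _:*_ to _F:*_; _:=_ to _F:=_)
      shift : ∀ n → (x· (der (tail f) ⊛ g ⊕ tail f ⊛ der g)) n ≡ (x· (der (tail f) ⊛ g)) n + (x· (tail f ⊛ der g)) n
      shift zero    = sym (+-identityˡ 0#)
      shift (suc n) = refl
    go : ∀ n f g → der (f ⊛ g) n ≡ (der f ⊛ g) n + (f ⊛ der g) n
    go n f g = trans (trans (der-cong (⊛-head f g) n) (der-∙⊕x· (f 0) g (tail f ⊛ g) n))
      (trans (+-congˡ (+-congˡ (inner n))) (sym (expand f g n)))
      where
      inner : ∀ n → (x· der (tail f ⊛ g)) n ≡ (x· (der (tail f) ⊛ g ⊕ tail f ⊛ der g)) n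
      inner zero    = refl
      inner (suc n) = go n (tail f) g

  drop : ℕ → Series → Series
  drop zero    f = f
  drop (suc i) f = drop i (tail f)

  drop-deg : ∀ i {m f} → Deg< m f → Deg< m (drop i f)
  drop-deg zero    h = h
  drop-deg (suc i) h = drop-deg i (Deg<-tail h)

  drop-bounded : ∀ i {f} → Bounded f → Bounded (drop i f)
  drop-bounded i (m , h) = m , drop-deg i h

  drop-0 : ∀ i f → drop i f 0 ≡ f i
  drop-0 zero    f = refl
  drop-0 (suc i) f = drop-0 i (tail f)

  drop-tail : ∀ i f → tail (drop i f) ≈ drop (suc i) f
  drop-tail zero    f n = refl
  drop-tail (suc i) f n = drop-tail i (tail f) n

  drop-mon : ∀ {m} (v : Vec F m) → drop m (mon v) ≈ 𝟙
  drop-mon []      zero    = refl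
  drop-mon []      (suc n) = refl
  drop-mon (a ∷ v) n       = drop-mon v n

-- The trace on F[x]/(P) and Euler's formula

module QuotientTrace (𝔽 : FiniteField) {e : ℕ} (P : Vec (FiniteField.F 𝔽) (suc e)) where
  private
    module 𝔽 = FieldFacts 𝔽
  open FiniteField 𝔽 using (F)
  open Polynomials 𝔽 hiding (solve; _:+_; _:*_; :-_; _:-_; _:=_; con)
  open Derivative 𝔽
  open MatrixFacts 𝔽
  open Quotient 𝔽 P
  open AlgebraFacts algebra

  mulMat : K → Mat (suc e)
  mulMat a i j = plain (a * X ^ toℕ j) (toℕ i)

  tr : K → F
  tr a = Tr (mulMat a)

  functional-expand : (ℓ : K → F) → (∀ x y → ℓ (x + y) ≡ ℓ x 𝔽.+ ℓ y) → (∀ c x → ℓ (⌊ c ⌋ * x) ≡ c 𝔽.* ℓ x) →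
                      ∀ β v → ℓ (β * v) ≡ Σᶠ {suc e} (λ l → ℓ (β * X ^ toℕ l) 𝔽.* plain v (toℕ l))
  functional-expand ℓ ℓ-+ ℓ-c β v = trans (cong (λ w → ℓ (β * w)) (sym (evp-X v)))
    (trans (functional-ev X ℓ ℓ-+ ℓ-c v β) (Σᶠ-cong {suc e} (λ l → 𝔽.*-comm (plain v (toℕ l)) (ℓ (β * X ^ toℕ l)))))

  coordinate-+ : ∀ i x y → plain (x + y) i ≡ plain x i 𝔽.+ plain y i
  coordinate-+ i x y = plain-+ x y i

  coordinate-⌊⌋ : ∀ i c x → plain (⌊ c ⌋ * x) i ≡ c 𝔽.* plain x i
  coordinate-⌊⌋ i c x = plain-⌊⌋* c x i

  mulMat-apply : ∀ a v i → plain (a * v) i ≡ Σᶠ {suc e} (λ l → plain (a * X ^ toℕ l) i 𝔽.* plain v (toℕ l))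
  mulMat-apply a v i = functional-expand (λ y → plain y i) (coordinate-+ i) (coordinate-⌊⌋ i) a v

  mono-I : ∀ {n} (i j : Fin n) → mono 𝔽.1# (toℕ j) (toℕ i) ≡ Iᴹ i j
  mono-I zero    zero    = refl
  mono-I zero    (suc j) = refl
  mono-I (suc i) zero    = refl
  mono-I (suc i) (suc j) = trans (mono-I i j) (sym (I-suc i j))

  X^-I : ∀ (i j : Fin (suc e)) → plain (X ^ toℕ j) (toℕ i) ≡ Iᴹ i j
  X^-I i j = trans (X^-plain (Finₚ.toℕ<n j) (toℕ i)) (mono-I i j)

  mulMat-^ : ∀ a k → (mulMat a ^ᴹ k) ≡ᴹ mulMat (a ^ k)
  mulMat-^ a zero    i j = sym (trans (cong (λ z → plain z (toℕ i)) (*-identityˡ (X ^ toℕ j))) (X^-I i j))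
  mulMat-^ a (suc k) i j = trans (Σᶠ-cong {suc e} (λ l → cong (mulMat a i l 𝔽.*_) (mulMat-^ a k l j)))
    (sym (trans (cong (λ z → plain z (toℕ i)) (*-assoc a (a ^ k) (X ^ toℕ j))) (mulMat-apply a (a ^ k * X ^ toℕ j) (toℕ i))))

  -- Together with `mulMat-X-last` this identifies the matrix of multiplication by X as the
  -- companion matrix of P.
  mulMat-X-shift : ∀ i j → suc (toℕ j) < (suc e) → mulMat X i j ≡ mono 𝔽.1# (suc (toℕ j)) (toℕ i)
  mulMat-X-shift i j lt = X^-plain lt (toℕ i)

  mulMat-X-last : ∀ i j → suc (toℕ j) ≡ (suc e) → mulMat X i j ≡ 𝔽.- plain P (toℕ i)
  mulMat-X-last i j eq = trans (cong (λ k → plain (X ^ k) (toℕ i)) eq) (X^d-plain (toℕ i))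

  top : K → F
  top a = plain a e

  -- As y has degree at most e, the product x y is reduced by a single subtraction, of P times the
  -- top coefficient of y.
  X*-coordinate : ∀ y i → plain (X * y) (suc i) ≡ plain y i 𝔽.- plain y e 𝔽.* mon P (suc i)
  X*-coordinate y i = trans (cong (λ z → plain z (suc i)) (sym value)) (trans (ev-X-small bρ small (suc i)) (𝔽.+-congˡ (sym (𝔽.-‿distribˡ-* c (mon P (suc i))))))
    where
    c = plain y e
    xy = mono 𝔽.1# 1 ⊛ plain y
    cP = mono (𝔽.- c) 0 ⊛ mon P
    bxy : Bounded xy
    bxy = Bounded-⊛ {g = plain y} (2 , mono-deg 𝔽.1# 1) (plain-bounded y)
    bcP : Bounded cP
    bcP = Bounded-⊛ {g = mon P} (1 , mono-deg (𝔽.- c) 0) (mon-bounded P)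
    b₁ : Bounded (xy ⊕ cP)
    b₁ = Bounded-⊕ bxy bcP
    ρ : Series
    ρ = (x· plain y) ⊕ (𝔽.- c) ∙ mon P
    same : xy ⊕ cP ≈ ρ
    same = ⊕-cong (≈-trans (mono-⊛ 𝔽.1# 0 (plain y)) (x·-cong (≈-trans (mono-0-⊛ 𝔽.1# (plain y)) (λ i → 𝔽.*-identityˡ _))))
                  (mono-0-⊛ (𝔽.- c) (mon P))
    small : Deg< (suc e) ρ
    small = Deg<-lower (λ { (suc i) (s≤s le) → trans (cong₂ 𝔽._+_ (plain-deg y i le)
                (trans (cong ((𝔽.- c) 𝔽.*_) (mon-deg P (suc i) (s≤s le))) (𝔽.zeroʳ _))) (𝔽.+-identityˡ 𝔽.0#) })
              (trans (𝔽.+-congˡ (trans (cong ((𝔽.- c) 𝔽.*_) (mon-top P)) (𝔽.*-identityʳ _))) (𝔽.-‿inverseʳ c))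
    bρ : Bounded ρ
    bρ = (suc e) , small
    value : ev ρ bρ X ≡ X * y
    value = begin
      ev ρ bρ X                                         ≡⟨ ev-≈ X bρ b₁ (≈-sym same) ⟩
      ev (xy ⊕ cP) b₁ X                                 ≡⟨ ev-⊕ X bxy bcP b₁ ⟩
      ev xy bxy X + ev cP bcP X                         ≡⟨ cong₂ _+_ (ev-⊛ X {g = plain y} (2 , mono-deg 𝔽.1# 1) (plain-bounded y) bxy)
                                                              (ev-⊛ X {g = mon P} (1 , mono-deg (𝔽.- c) 0) (mon-bounded P) bcP) ⟩
      ev (mono 𝔽.1# 1) (2 , mono-deg 𝔽.1# 1) X * evp X y + ev (mono (𝔽.- c) 0) (1 , mono-deg (𝔽.- c) 0) X * evm X P
        ≡⟨ cong₂ _+_ (cong₂ _*_ (trans (ev-mono X 𝔽.1# 1 (2 , mono-deg 𝔽.1# 1)) (trans (cong (_* X ^ 1) ⌊⌋-1) (trans (*-identityˡ (X ^ 1)) (*-identityʳ X)))) (evp-X y))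
             (trans (cong (ev (mono (𝔽.- c) 0) (1 , mono-deg (𝔽.- c) 0) X *_) evm-X) (zeroʳ _)) ⟩
      X * y + 0#                                        ≡⟨ +-identityʳ (X * y) ⟩
      X * y                                             ∎
      where open ≡-Reasoning
  
  -- The polynomials (P - lower terms)/x^{i+1} form the basis dual to 1, x, …, x^e with respect to (a, b) ↦ top (a * b).
  coordinate-dual : ∀ j i → i ℕ.+ j ≡ e → ∀ y → plain y i ≡ top (ev (drop (suc i) (mon P)) (drop-bounded (suc i) (mon-bounded P)) X * y)
  coordinate-dual zero i eq y = subst (λ i → plain y i ≡ top (ev (drop (suc i) (mon P)) (drop-bounded (suc i) (mon-bounded P)) X * y))
    (sym (trans (sym (ℕₚ.+-identityʳ i)) eq))
    (cong top (sym (trans (cong (_* y) (trans (ev-≈ X (drop-bounded (suc e) (mon-bounded P)) (1 , mono-deg 𝔽.1# 0) last) (trans (ev-mono X 𝔽.1# 0 (1 , mono-deg 𝔽.1# 0)) (trans (*-identityʳ ⌊ 𝔽.1# ⌋) ⌊⌋-1)))) (*-identityˡ y))))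
    where
    last : drop (suc e) (mon P) ≈ mono 𝔽.1# 0
    last n = trans (drop-mon P n) (unit n)
      where
      unit : ∀ n → 𝟙 n ≡ mono 𝔽.1# 0 n
      unit zero    = refl
      unit (suc n) = refl
  coordinate-dual (suc j) i eq y = begin
    plain y i
      ≡⟨ 𝔽.solve 2 (λ a b → a 𝔽.:= b 𝔽.:+ (a 𝔽.:- b)) refl (plain y i) (top y 𝔽.* mon P (suc i)) ⟩
    top y 𝔽.* mon P (suc i) 𝔽.+ (plain y i 𝔽.- top y 𝔽.* mon P (suc i))
      ≡⟨ cong₂ 𝔽._+_ (𝔽.*-comm (top y) (mon P (suc i))) (sym (X*-coordinate y i)) ⟩
    mon P (suc i) 𝔽.* top y 𝔽.+ plain (X * y) (suc i)
      ≡⟨ cong₂ 𝔽._+_ (sym (coordinate-⌊⌋ e (mon P (suc i)) y)) (coordinate-dual j (suc i) (trans (sym (ℕₚ.+-suc i j)) eq) (X * y)) ⟩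
    top (⌊ mon P (suc i) ⌋ * y) 𝔽.+ top (E₂ * (X * y))
      ≡⟨ coordinate-+ e (⌊ mon P (suc i) ⌋ * y) (E₂ * (X * y)) ⟨
    top (⌊ mon P (suc i) ⌋ * y + E₂ * (X * y))
      ≡⟨ cong top (solve 4 (λ a y b x → a :* y :+ b :* (x :* y) := (a :+ x :* b) :* y) refl ⌊ mon P (suc i) ⌋ y E₂ X) ⟩
    top ((⌊ mon P (suc i) ⌋ + X * E₂) * y)
      ≡⟨ cong (λ z → top (z * y)) (sym head) ⟩
    top (E₁ * y) ∎
    where
    open ≡-Reasoning
    E₁ = ev (drop (suc i) (mon P)) (drop-bounded (suc i) (mon-bounded P)) X
    E₂ = ev (drop (2 ℕ.+ i) (mon P)) (drop-bounded (2 ℕ.+ i) (mon-bounded P)) X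
    b′ : Bounded (drop (suc i) (mon P))
    b′ = 3 ℕ.+ e , Deg<-weaken (ℕₚ.n≤1+n _) (drop-deg (suc i) (mon-deg P))
    head : E₁ ≡ ⌊ mon P (suc i) ⌋ + X * E₂
    head = trans (ev-≈ X (drop-bounded (suc i) (mon-bounded P)) b′ ≈-refl)
      (cong₂ (λ u v → ⌊ u ⌋ + X * v) (drop-0 (suc i) (mon P)) (evs-cong X (2 ℕ.+ e) (drop-tail (suc i) (mon P))))

  private
    -- The polynomials obtained from f by discarding the terms below x^{i+1} and dividing by
    -- x^{i+1}, multiplied by x^i, add up to f′: the term f_j x^j contributes f_j x^{j-1} once for
    -- each i < j.
    dual-sum : ∀ m {f} (h : Deg< (suc m) f) (b : Bounded f) (a : K) →
      Σᶠ {m} (λ i → top (ev (drop (suc (toℕ i)) f) (drop-bounded (suc (toℕ i)) b) X * (a * X ^ toℕ i))) ≡ top (ev (der f) (der-bounded b) X * a)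
    dual-sum zero {f} h b a = sym (trans (cong (λ z → top (z * a)) (evs-0 X (proj₁ b) (der-0 h))) (trans (cong top (zeroˡ a)) (plain-0 e)))
    dual-sum (suc m) {f} h b a = begin
      top (ev (tail f) bt X * (a * 1#)) 𝔽.+ Σᶠ {m} (λ i → top (ev (drop (suc (toℕ i)) (tail f)) (drop-bounded (suc (toℕ i)) bt) X * (a * (X * X ^ toℕ i))))
        ≡⟨ cong₂ 𝔽._+_ (cong (λ z → top (ev (tail f) bt X * z)) (*-identityʳ a)) (Σᶠ-cong {m} (λ i → cong (λ z → top (ev (drop (suc (toℕ i)) (tail f)) (drop-bounded (suc (toℕ i)) bt) X * z)) (sym (*-assoc a X (X ^ toℕ i))))) ⟩
      top (ev (tail f) bt X * a) 𝔽.+ Σᶠ {m} (λ i → top (ev (drop (suc (toℕ i)) (tail f)) (drop-bounded (suc (toℕ i)) bt) X * (a * X * X ^ toℕ i)))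
        ≡⟨ 𝔽.+-congˡ (dual-sum m (λ i le → h (suc i) (s≤s le)) bt (a * X)) ⟩
      top (ev (tail f) bt X * a) 𝔽.+ top (ev (der (tail f)) (der-bounded bt) X * (a * X))
        ≡⟨ coordinate-+ e (ev (tail f) bt X * a) (ev (der (tail f)) (der-bounded bt) X * (a * X)) ⟨
      top (ev (tail f) bt X * a + ev (der (tail f)) (der-bounded bt) X * (a * X))
        ≡⟨ cong top (solve 4 (λ t a u x → t :* a :+ u :* (a :* x) := (t :+ x :* u) :* a) refl (ev (tail f) bt X) a (ev (der (tail f)) (der-bounded bt) X) X) ⟩
      top ((ev (tail f) bt X + X * ev (der (tail f)) (der-bounded bt) X) * a)
        ≡⟨ cong (λ z → top (z * a)) (sym value) ⟩
      top (ev (der f) (der-bounded b) X * a) ∎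
      where
      open ≡-Reasoning
      bt : Bounded (tail f)
      bt = proj₁ b , Deg<-tail (proj₂ b)
      bx : Bounded (x· der (tail f))
      bx = suc (proj₁ b) , (λ { (suc i) (s≤s le) → proj₂ (der-bounded bt) i le })
      value : ev (der f) (der-bounded b) X ≡ ev (tail f) bt X + X * ev (der (tail f)) (der-bounded bt) X
      value = trans (ev-≈ X (der-bounded b) (Bounded-⊕ bt bx) (der-tail f))
        (trans (ev-⊕ X bt bx (Bounded-⊕ bt bx)) (cong (λ z → ev (tail f) bt X + z) (trans (cong (_+ X * ev (der (tail f)) (der-bounded bt) X) ⌊⌋-0) (+-identityˡ _))))

  δ : K
  δ = ev (der (mon P)) (der-bounded (mon-bounded P)) X

  -- Euler's formula. The diagonal entries are read off with the dual basis, and the sum in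
  -- `dual-sum` collapses to P′. It holds for every monic P, irreducible or not, and so serves for
  -- random polynomials as well as for field extensions.
  tr-formula : ∀ a → tr a ≡ top (δ * a)
  tr-formula a = trans (Σᶠ-cong {suc e} (λ i → coordinate-dual (e ∸ toℕ i) (toℕ i) (ℕₚ.m+[n∸m]≡n (ℕₚ.≤-pred (Finₚ.toℕ<n i))) (a * X ^ toℕ i)))
    (dual-sum (suc e) (mon-deg P) (mon-bounded P) a)

  tr-+ : ∀ a b → tr (a + b) ≡ tr a 𝔽.+ tr b
  tr-+ a b = trans (tr-formula (a + b)) (trans (cong top (distribˡ δ a b)) (trans (coordinate-+ e (δ * a) (δ * b)) (sym (cong₂ 𝔽._+_ (tr-formula a) (tr-formula b)))))

  tr-⌊⌋ : ∀ c a → tr (⌊ c ⌋ * a) ≡ c 𝔽.* tr a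
  tr-⌊⌋ c a = trans (tr-formula (⌊ c ⌋ * a)) (trans (cong top (solve 3 (λ u c a → u :* (c :* a) := c :* (u :* a)) refl δ ⌊ c ⌋ a)) (trans (coordinate-⌊⌋ e c (δ * a)) (cong (c 𝔽.*_) (sym (tr-formula a)))))

module RingIdentities {c ℓ} (R : CommutativeRing c ℓ) where
  open CommutativeRing R hiding (refl)
  open CommutativeRing R using () renaming (refl to ≈-refl)
  open RingSolver R

  expand-remainder : ∀ p w r q → (p * w + r) * q ≈ p * q * w + r * q
  expand-remainder = solve 4 (λ p w r q → (p :* w :+ r) :* q := p :* q :* w :+ r :* q) ≈-refl

  expand-leibniz : ∀ p p′ q q′ x → (p′ * q + p * q′) * x ≈ p′ * x * q + q′ * x * p
  expand-leibniz = solve 5 (λ p p′ q q′ x → (p′ :* q :+ p :* q′) :* x := p′ :* x :* q :+ q′ :* x :* p) ≈-refl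

  drop-multiple : ∀ g c r b → (g * c + r) * b - g * b * c ≈ r * b
  drop-multiple = solve 4 (λ g c r b → (g :* c :+ r) :* b :- g :* b :* c := r :* b) ≈-refl

  swap-product : ∀ a b c → a * (b * c) ≈ b * (a * c)
  swap-product = solve 3 (λ a b c → a :* (b :* c) := b :* (a :* c)) ≈-refl

-- Power sums of the roots as traces

module PowerSums (𝔽 : FiniteField) where
  private
    module 𝔽 = FieldFacts 𝔽
  open FiniteField 𝔽 using (F)
  open Polynomials 𝔽 hiding (solve; _:+_; _:*_; :-_; _:-_; _:=_; con)
  open Derivative 𝔽
  open MatrixFacts 𝔽 using (Tr-cong; Tr; _^ᴹ_)

  module A {d : ℕ} (P : Vec F d) where
    open Quotient 𝔽 P public
    open AlgebraFacts algebra public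

  module T {e : ℕ} (P : Vec F (suc e)) = QuotientTrace 𝔽 P

  -- Reducing s · Q modulo P · Q does not change the leading coordinate, since Q is monic.
  top-⊛ : ∀ {e l N} (P : Vec F (suc e)) (Q : Vec F l) (R : Vec F (suc N)) → e ℕ.+ l ≡ N → mon R ≈ mon P ⊛ mon Q →
          ∀ {s} (b : Bounded s) (b′ : Bounded (s ⊛ mon Q)) → plain (A.ev R (s ⊛ mon Q) b′ (A.X R)) N ≡ plain (A.ev P s b (A.X P)) e
  top-⊛ {e} {l} P Q R refl h {s} b b′ = begin
    plain (A.ev R (s ⊛ mon Q) b′ (A.X R)) (e ℕ.+ l)       ≡⟨ A.plain-cong R same (e ℕ.+ l) ⟩
    plain (A.ev R (plain r ⊛ mon Q) b″ (A.X R)) (e ℕ.+ l) ≡⟨ A.ev-X-small R b″ (proj₁ deg) (e ℕ.+ l) ⟩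
    (plain r ⊛ mon Q) (e ℕ.+ l)                           ≡⟨ proj₂ deg ⟩
    plain r e 𝔽.* mon Q l                                 ≡⟨ cong (plain r e 𝔽.*_) (mon-top Q) ⟩
    plain r e 𝔽.* 𝔽.1#                                    ≡⟨ 𝔽.*-identityʳ _ ⟩
    plain r e                                             ∎
    where
    open ≡-Reasoning
    r = A.ev P s b (A.X P)
    deg = ⊛-deg e l (plain-deg r) (mon-deg Q)
    b″ : Bounded (plain r ⊛ mon Q)
    b″ = suc (e ℕ.+ l) , proj₁ deg
    lift-≋ : s ≋ plain r [ P ] → s ⊛ mon Q ≋ plain r ⊛ mon Q [ R ]
    lift-≋ (congruent w bw eq) = congruent w bw (≈-trans (⊛-cong eq (≈-refl {mon Q}))
      (≈-trans (RingIdentities.expand-remainder Series-commutativeRing (mon P) w (plain r) (mon Q))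
               (⊕-cong (⊛-cong (≈-sym h) (≈-refl {w})) (≈-refl {plain r ⊛ mon Q}))))
    same : A.ev R (s ⊛ mon Q) b′ (A.X R) ≡ A.ev R (plain r ⊛ mon Q) b″ (A.X R)
    same = A.ev-≋ R (A.X R) R (A.evm-X R) b′ b″ (lift-≋ (≋-sym (A.plain-ev P b)))

  -- The k-th power sum of the roots, obtained without a splitting field as the trace of
  -- multiplication by xᵏ on F[x]/(P).
  τ : ℕ → ∀ {e} → Vec F (suc e) → F
  τ k P = T.tr P (A._^_ P (A.X P) k)

  τ-companion : ∀ k {e} (P : Vec F (suc e)) → Tr (T.mulMat P (A.X P) ^ᴹ k) ≡ τ k P
  τ-companion k P = Tr-cong (T.mulMat-^ P (A.X P) k)

  -- In this form the power sum is the residue of xᵏ P′/P, up to the sign at infinity: the top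
  -- coefficient of xᵏ P′ reduced modulo P.
  τ-residue : ∀ k {e} (P : Vec F (suc e)) {s} (b : Bounded s) → s ≈ der (mon P) ⊛ mono 𝔽.1# k → τ k P ≡ plain (A.ev P s b (A.X P)) e
  τ-residue k {e} P {s} b h = trans (T.tr-formula P (A._^_ P X k)) (A.plain-cong P (sym value) e)
    where
    X = A.X P
    b₁ : Bounded (mono 𝔽.1# k)
    b₁ = suc k , mono-deg 𝔽.1# k
    b₂ = Bounded-⊛ {g = mono 𝔽.1# k} (der-bounded (mon-bounded P)) b₁
    value : A.ev P s b X ≡ A._*_ P (T.δ P) (A._^_ P X k)
    value = trans (A.ev-≈ P X b b₂ h) (trans (A.ev-⊛ P X {g = mono 𝔽.1# k} (der-bounded (mon-bounded P)) b₁ b₂)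
      (cong (A._*_ P (T.δ P)) (trans (A.ev-mono P X 𝔽.1# k b₁) (trans (cong (λ z → A._*_ P z (A._^_ P X k)) (A.⌊⌋-1 P)) (A.*-identityˡ P (A._^_ P X k))))))

  leibniz-split : ∀ {p q r x} → r ≈ p ⊛ q → der p ⊛ x ⊛ q ⊕ der q ⊛ x ⊛ p ≈ der r ⊛ x
  leibniz-split {p} {q} {r} {x} h = ≈-sym (≈-trans {der r ⊛ x} {(der p ⊛ q ⊕ p ⊛ der q) ⊛ x}
    (⊛-cong {der r} {der p ⊛ q ⊕ p ⊛ der q} {x} {x} (≈-trans {der r} {der (p ⊛ q)} (der-cong {r} {p ⊛ q} h) (leibniz p q)) (≈-refl {x}))
    (RingIdentities.expand-leibniz Series-commutativeRing p (der p) q (der q) x))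

  ev-⊕-coordinate : ∀ {N} (R : Vec F (suc N)) s s′ (b : Bounded s) (b′ : Bounded s′) (c : Bounded (s ⊕ s′)) →
    plain (A.ev R (s ⊕ s′) c (A.X R)) N ≡ plain (A.ev R s b (A.X R)) N 𝔽.+ plain (A.ev R s′ b′ (A.X R)) N
  ev-⊕-coordinate {N} R s s′ b b′ c = trans (A.plain-cong R (A.ev-⊕ R (A.X R) b b′ c) N)
    (A.plain-+ R (A.ev R s b (A.X R)) (A.ev R s′ b′ (A.X R)) N)

  τ-sum : ∀ k {e l N} (P : Vec F (suc e)) (Q : Vec F (suc l)) (R : Vec F (suc N)) →
            ∀ s₁ s₂ s₁′ s₂′ (b₁ : Bounded s₁) (b₂ : Bounded s₂) (b₁′ : Bounded s₁′) (b₂′ : Bounded s₂′) (b₃ : Bounded (s₁′ ⊕ s₂′)) →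
            s₁ ≈ der (mon P) ⊛ mono 𝔽.1# k → s₂ ≈ der (mon Q) ⊛ mono 𝔽.1# k → s₁′ ⊕ s₂′ ≈ der (mon R) ⊛ mono 𝔽.1# k →
            plain (A.ev R s₁′ b₁′ (A.X R)) N ≡ plain (A.ev P s₁ b₁ (A.X P)) e →
            plain (A.ev R s₂′ b₂′ (A.X R)) N ≡ plain (A.ev Q s₂ b₂ (A.X Q)) l →
            τ k R ≡ τ k P 𝔽.+ τ k Q
  τ-sum k P Q R s₁ s₂ s₁′ s₂′ b₁ b₂ b₁′ b₂′ b₃ h₁ h₂ h₃ left right =
      trans (τ-residue k R b₃ h₃)
      (trans (ev-⊕-coordinate R s₁′ s₂′ b₁′ b₂′ b₃)
      (trans (cong₂ 𝔽._+_ left right) (sym (cong₂ 𝔽._+_ (τ-residue k P b₁ h₁) (τ-residue k Q b₂ h₂)))))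

  -- The logarithmic derivative is additive: xᵏ R′ = (xᵏ P′) Q + (xᵏ Q′) P, and by `top-⊛` the
  -- multiplication by the other factor does not change the top coefficient.
  τ-product : ∀ k {e l N} (P : Vec F (suc e)) (Q : Vec F (suc l)) (R : Vec F (suc N)) → e ℕ.+ suc l ≡ N →
              mon R ≈ mon P ⊛ mon Q → τ k R ≡ τ k P 𝔽.+ τ k Q
  τ-product k {e} {l} {N} P Q R e+l≡N h = τ-sum k P Q R s₁ s₂ (s₁ ⊛ mon Q) (s₂ ⊛ mon P) b₁ b₂ b₁′ b₂′ (Bounded-⊕ b₁′ b₂′)
    (≈-refl {s₁}) (≈-refl {s₂}) (leibniz-split {mon P} {mon Q} {mon R} {xᵏ} h)
    (top-⊛ P Q R e+l≡N h {s₁} b₁ b₁′)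
    (top-⊛ Q P R l+e≡N (≈-trans {mon R} {mon P ⊛ mon Q} {mon Q ⊛ mon P} h (⊛-comm (mon P) (mon Q))) {s₂} b₂ b₂′)
    where
    xᵏ s₁ s₂ : Series
    xᵏ = mono 𝔽.1# k
    s₁ = der (mon P) ⊛ xᵏ
    s₂ = der (mon Q) ⊛ xᵏ
    l+e≡N : l ℕ.+ suc e ≡ N
    l+e≡N = trans (ℕₚ.+-suc l e) (trans (cong suc (ℕₚ.+-comm l e)) (trans (sym (ℕₚ.+-suc e l)) e+l≡N))
    b₁ : Bounded s₁
    b₁ = Bounded-⊛ {g = xᵏ} (der-bounded (mon-bounded P)) (suc k , mono-deg 𝔽.1# k)
    b₂ : Bounded s₂
    b₂ = Bounded-⊛ {g = xᵏ} (der-bounded (mon-bounded Q)) (suc k , mono-deg 𝔽.1# k)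
    b₁′ : Bounded (s₁ ⊛ mon Q)
    b₁′ = Bounded-⊛ {g = mon Q} b₁ (mon-bounded Q)
    b₂′ : Bounded (s₂ ⊛ mon P)
    b₂′ = Bounded-⊛ {g = mon P} b₂ (mon-bounded P)

-- Sealed, because unfolding τ makes conversion checking explode.
module RootPowerSums (𝔽 : FiniteField) where
  open FieldFacts 𝔽 using (F; _+_)
  open Polynomials 𝔽 using (mon; _≈_; _⊛_)
  open MatrixFacts 𝔽 using (Tr; _^ᴹ_)

  abstract
    -- The k-th power sum of the roots of the monic polynomial P.
    τ : ℕ → ∀ {e} → Vec F (suc e) → F
    τ = PowerSums.τ 𝔽

    τ-sealed : ∀ k {e} (P : Vec F (suc e)) → τ k P ≡ PowerSums.τ 𝔽 k P
    τ-sealed k P = refl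

  τ-companion : ∀ k {e} (P : Vec F (suc e)) → Tr (QuotientTrace.mulMat 𝔽 P (Quotient.X 𝔽 P) ^ᴹ k) ≡ τ k P
  τ-companion k P = trans (PowerSums.τ-companion 𝔽 k P) (sym (τ-sealed k P))

  τ-product : ∀ k {e l N} (P : Vec F (suc e)) (Q : Vec F (suc l)) (R : Vec F (suc N)) → e ℕ.+ suc l ≡ N →
              mon R ≈ mon P ⊛ mon Q → τ k R ≡ τ k P + τ k Q
  τ-product k P Q R eq h = trans (τ-sealed k R) (trans (PowerSums.τ-product 𝔽 k P Q R eq h) (sym (cong₂ _+_ (τ-sealed k P) (τ-sealed k Q))))

-- Finite domains: inverses, number of roots, Fermat's theorem, roots of unity

module Domain {𝔽 : FiniteField} (𝔎 : Algebra 𝔽) (𝔼 : Sums.Enum (Algebra.K 𝔎))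
              (zeroDivisors : ∀ a b → Algebra._*_ 𝔎 a b ≡ Algebra.0# 𝔎 → a ≡ Algebra.0# 𝔎 ⊎ b ≡ Algebra.0# 𝔎)
              (1≢0 : Algebra.1# 𝔎 ≢ Algebra.0# 𝔎) where
  private
    module 𝔽 = FieldFacts 𝔽
    module E = Sums.Enum 𝔼
    module 𝔽E = Sums.Enum 𝔽.F-Enum
  open FiniteField 𝔽 using (F)
  open Sums hiding (abs)
  open AlgebraFacts 𝔎
  open import Data.Integer using () renaming (_+_ to _+ᶻ_; _*_ to _*ᶻ_; _-_ to _-ᶻ_; _≤_ to _≤ᶻ_; -_ to -ᶻ_)

  *-cancelˡ : ∀ {a b c} → a ≢ 0# → a * b ≡ a * c → b ≡ c
  *-cancelˡ {a} {b} {c} a≢0 h with zeroDivisors a (b - c) (trans (solve 3 (λ a b c → a :* (b :- c) := a :* b :- a :* c) refl a b c) (trans (cong (_- a * c) h) (-‿inverseʳ (a * c))))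
  ... | inj₁ a≡0 = contradiction a≡0 a≢0
  ... | inj₂ e   = x-y≡0⇒x≡y e

  *-≢0 : ∀ {a b} → a ≢ 0# → b ≢ 0# → a * b ≢ 0#
  *-≢0 {a} {b} a≢0 b≢0 e with zeroDivisors a b e
  ... | inj₁ p = a≢0 p
  ... | inj₂ p = b≢0 p

  *-zero-cancelˡ : ∀ {a b} → a ≢ 0# → a * b ≡ 0# → b ≡ 0#
  *-zero-cancelˡ {a} {b} a≢0 h with zeroDivisors a b h
  ... | inj₁ p = contradiction p a≢0
  ... | inj₂ p = p

  ^-≢0 : ∀ {a} k → a ≢ 0# → a ^ k ≢ 0#
  ^-≢0 zero    h = 1≢0
  ^-≢0 (suc k) h = *-≢0 h (^-≢0 k h)

  -- Multiplication by a is injective on a finite set, hence onto.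
  inverse : ∀ a → a ≢ 0# → ∃ λ b → a * b ≡ 1#
  inverse a a≢0 = injective⇒surjective 𝔼 𝔼 refl (a *_) (λ x y → *-cancelˡ a≢0) 1#

  -- Monic polynomials with coefficients in K itself, because splitting off a root β₀ leads out of
  -- F[x].
  evK : ∀ {m} → Vec K m → K → K
  evK []      β = 1#
  evK (c ∷ v) β = c + β * evK v β

  evm-evK : ∀ {m} (v : Vec F m) β → evm β v ≡ evK (Vec.map ⌊_⌋ v) β
  evm-evK []      β = trans (+-congˡ (zeroʳ β)) (trans (+-identityʳ ⌊ 𝔽.1# ⌋) ⌊⌋-1)
  evm-evK (a ∷ v) β = cong (λ z → ⌊ a ⌋ + β * z) (evm-evK v β)

  deflate : ∀ {m} (v : Vec K (suc m)) β₀ → ∃ λ (w : Vec K m) → ∀ β → evK v β - evK v β₀ ≡ (β - β₀) * evK w β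
  deflate (c ∷ []) β₀ = [] , (λ β → trans (cong₂ (λ x y → c + x - (c + y)) (*-identityʳ β) (*-identityʳ β₀))
    (trans (solve 3 (λ c b b₀ → c :+ b :- (c :+ b₀) := b :- b₀) refl c β β₀) (sym (*-identityʳ _))))
  deflate (c ∷ v@(_ ∷ _)) β₀ = let (w , h) = deflate v β₀ in
    evK v β₀ ∷ w , (λ β → trans
      (solve 5 (λ c b b₀ x y → c :+ b :* x :- (c :+ b₀ :* y) := (b :- b₀) :* y :+ b :* (x :- y)) refl c β β₀ (evK v β) (evK v β₀))
      (trans (cong (λ z → (β - β₀) * evK v β₀ + β * z) (h β))
        (solve 4 (λ d y b t → d :* y :+ b :* (d :* t) := d :* (y :+ b :* t)) refl (β - β₀) (evK v β₀) β (evK w β))))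

  roots≤degree : ∀ {m} (v : Vec K m) → E.sum (λ β → ⟦ evK v β E.≟ 0# ⟧) ≤ᶻ + m
  roots≤degree [] = ℤₚ.≤-reflexive (trans (∑-cong E.list (λ β → ⟦⟧-no (1# E.≟ 0#) 1≢0)) (∑-0 E.list))
  roots≤degree {suc m} v with E.search (λ β → evK v β E.≟ 0#)
  ... | inj₂ none = ℤₚ.≤-trans (ℤₚ.≤-reflexive (trans (∑-cong E.list (λ β → ⟦⟧-no (evK v β E.≟ 0#) (none β))) (∑-0 E.list))) (ℤ.+≤+ z≤n)
  ... | inj₁ (β₀ , e) = let (w , h) = deflate v β₀ in
    ℤₚ.≤-trans (∑-mono E.list {g = λ β → ⟦ β E.≟ β₀ ⟧ +ᶻ ⟦ evK w β E.≟ 0# ⟧} (λ β → split w h β))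
      (ℤₚ.≤-trans (ℤₚ.≤-reflexive (∑-+ E.list _ _)) (ℤₚ.+-mono-≤ (ℤₚ.≤-reflexive (E.once β₀)) (roots≤degree w)))
    where
    split : ∀ w → (∀ β → evK v β - evK v β₀ ≡ (β - β₀) * evK w β) → ∀ β →
            ⟦ evK v β E.≟ 0# ⟧ ≤ᶻ ⟦ β E.≟ β₀ ⟧ +ᶻ ⟦ evK w β E.≟ 0# ⟧
    split w h β with evK v β E.≟ 0#
    ... | no _ = ℤₚ.+-mono-≤ (⟦⟧-nonneg (β E.≟ β₀)) (⟦⟧-nonneg (evK w β E.≟ 0#))
    ... | yes z with zeroDivisors (β - β₀) (evK w β) (trans (sym (h β)) (trans (cong₂ _-_ z e) (-‿inverseʳ 0#)))
    ...   | inj₁ p = ℤₚ.≤-trans (ℤₚ.≤-reflexive (sym (⟦⟧-yes (β E.≟ β₀) (x-y≡0⇒x≡y p))))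
              (ℤₚ.≤-trans (ℤₚ.≤-reflexive (sym (ℤₚ.+-identityʳ _))) (ℤₚ.+-monoʳ-≤ ⟦ β E.≟ β₀ ⟧ (⟦⟧-nonneg (evK w β E.≟ 0#))))
    ...   | inj₂ p = ℤₚ.≤-trans (ℤₚ.≤-reflexive (sym (⟦⟧-yes (evK w β E.≟ 0#) p)))
              (ℤₚ.≤-trans (ℤₚ.≤-reflexive (sym (ℤₚ.+-identityˡ _))) (ℤₚ.+-monoˡ-≤ ⟦ evK w β E.≟ 0# ⟧ (⟦⟧-nonneg (β E.≟ β₀))))

  roots-evm≤degree : ∀ {m} (v : Vec F m) → E.sum (λ β → ⟦ evm β v E.≟ 0# ⟧) ≤ᶻ + m
  roots-evm≤degree v = ℤₚ.≤-trans (∑-mono E.list (λ β → ⟦⟧-mono (evm β v E.≟ 0#) (evK (Vec.map ⌊_⌋ v) β E.≟ 0#) (trans (sym (evm-evK v β)))))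
    (roots≤degree (Vec.map ⌊_⌋ v))

  nonzero? : ∀ a → Dec (a ≢ 0#)
  nonzero? a = ¬? (a E.≟ 0#)

  #units : ℤ
  #units = E.sum (λ a → ⟦ nonzero? a ⟧)

  #units+1 : #units +ᶻ 1ℤ ≡ E.size
  #units+1 = trans (cong (#units +ᶻ_) (sym (E.once 0#))) (trans (sym (∑-+ E.list _ _)) (∑-cong E.list (λ a →
    trans (cong (_+ᶻ ⟦ a E.≟ 0# ⟧) (⟦⟧-¬ (a E.≟ 0#))) (identity ⟦ a E.≟ 0# ⟧))))
    where
    identity : ∀ x → 1ℤ -ᶻ x +ᶻ x ≡ 1ℤ
    identity = ℤ-solve-∀

  sum-scale : ∀ γ → γ ≢ 0# → (φ : K → ℤ) → E.sum φ ≡ E.sum (λ a → φ (γ * a))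
  sum-scale γ γ≢0 φ = let (δ , e) = inverse γ γ≢0 in
    ∑-reindex 𝔼 𝔼 (δ *_) (γ *_) (λ a → cancel γ δ e a) (λ a → cancel δ γ (trans (*-comm δ γ) e) a) φ
    where
    cancel : ∀ γ δ → γ * δ ≡ 1# → ∀ a → γ * (δ * a) ≡ a
    cancel γ δ e a = trans (sym (*-assoc γ δ a)) (trans (cong (_* a) e) (*-identityˡ a))

  sum-shift : ∀ γ → (φ : K → ℤ) → E.sum φ ≡ E.sum (λ a → φ (a + γ))
  sum-shift γ φ = ∑-reindex 𝔼 𝔼 (λ a → a - γ) (λ a → a + γ)
    (λ a → sym (solve 2 (λ a g → a := a :- g :+ g) refl a γ)) (λ a → sym (solve 2 (λ a g → a := a :+ g :- g) refl a γ)) φ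

  module Fermat where
    prod : List K → K
    prod []       = 1#
    prod (x ∷ xs) = x * prod xs

    pick : K → K → K
    pick x y with x E.≟ y
    ... | yes _ = y
    ... | no _  = 1#

    count : K → List K → ℕ
    count y [] = 0
    count y (x ∷ xs) with x E.≟ y
    ... | yes _ = suc (count y xs)
    ... | no _  = count y xs

    count-∑ : ∀ y xs → + count y xs ≡ ∑ xs (λ x → ⟦ x E.≟ y ⟧)
    count-∑ y [] = refl
    count-∑ y (x ∷ xs) with x E.≟ y
    ... | yes _ = cong (1ℤ +ᶻ_) (count-∑ y xs)
    ... | no _  = trans (count-∑ y xs) (sym (ℤₚ.+-identityˡ _))

    power : List K → List K → K
    power xs []       = 1#
    power xs (y ∷ ys) = y ^ count y xs * power xs ys

    picks : K → List K → K
    picks x []       = 1#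
    picks x (y ∷ ys) = pick x y * picks x ys

    power-[] : ∀ ys → power [] ys ≡ 1#
    power-[] []       = refl
    power-[] (y ∷ ys) = trans (*-identityˡ _) (power-[] ys)

    count-∷ : ∀ x xs y → y ^ count y (x ∷ xs) ≡ pick x y * y ^ count y xs
    count-∷ x xs y with x E.≟ y
    ... | yes _ = refl
    ... | no _  = sym (*-identityˡ _)

    power-∷ : ∀ x xs ys → power (x ∷ xs) ys ≡ picks x ys * power xs ys
    power-∷ x xs []       = sym (*-identityˡ 1#)
    power-∷ x xs (y ∷ ys) = trans (cong₂ _*_ (count-∷ x xs y) (power-∷ x xs ys))
      (solve 4 (λ a b c d → a :* b :* (c :* d) := a :* c :* (b :* d)) refl (pick x y) (y ^ count y xs) (picks x ys) (power xs ys))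

    picks-count : ∀ x ys → picks x ys ≡ x ^ count x ys
    picks-count x [] = refl
    picks-count x (y ∷ ys) with x E.≟ y | y E.≟ x
    ... | yes refl | yes _ = cong (x *_) (picks-count x ys)
    ... | yes refl | no n  = contradiction refl n
    ... | no n | yes refl  = contradiction refl n
    ... | no _ | no _      = trans (*-identityˡ _) (picks-count x ys)

    prod-power : ∀ xs → prod xs ≡ power xs E.list
    prod-power []       = sym (power-[] E.list)
    prod-power (x ∷ xs) = sym (trans (power-∷ x xs E.list) (cong₂ _*_
      (trans (picks-count x E.list) (trans (cong (x ^_) (ℤₚ.+-injective (trans (count-∑ x E.list) (E.once x)))) (*-identityʳ x)))
      (sym (prod-power xs))))

    -- A product over a list is rewritten as the product of y to the multiplicity of y, over the
    -- enumeration of K. It then depends on the multiplicities alone, and no permutation has to be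
    -- exhibited.
    prod-perm : ∀ xs ys → (∀ a → ∑ xs (λ x → ⟦ x E.≟ a ⟧) ≡ ∑ ys (λ x → ⟦ x E.≟ a ⟧)) → prod xs ≡ prod ys
    prod-perm xs ys h = trans (prod-power xs) (trans (go E.list) (sym (prod-power ys)))
      where
      go : ∀ zs → power xs zs ≡ power ys zs
      go []       = refl
      go (z ∷ zs) = cong₂ _*_ (cong (z ^_) (ℤₚ.+-injective (trans (count-∑ z xs) (trans (h z) (sym (count-∑ z ys)))))) (go zs)

    units : List K
    units = filter nonzero? E.list

    prod-scale : ∀ γ xs → prod (map (γ *_) xs) ≡ γ ^ length xs * prod xs
    prod-scale γ []       = sym (*-identityˡ 1#)
    prod-scale γ (x ∷ xs) = trans (cong (γ * x *_) (prod-scale γ xs))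
      (solve 4 (λ g x a b → g :* x :* (a :* b) := g :* a :* (x :* b)) refl γ x (γ ^ length xs) (prod xs))

    prod-units≢0 : ∀ xs → prod (filter nonzero? xs) ≢ 0#
    prod-units≢0 [] = 1≢0
    prod-units≢0 (x ∷ xs) with x E.≟ 0#
    ... | yes _ = prod-units≢0 xs
    ... | no p  = *-≢0 p (prod-units≢0 xs)

    -- Multiplication by γ permutes the units, so their product Π satisfies γᴺ Π = Π, with N the
    -- number of units.
    γ^#units : ∀ γ → γ ≢ 0# → γ ^ length units ≡ 1#
    γ^#units γ γ≢0 = *-cancelˡ (prod-units≢0 E.list) (begin
      prod units * γ ^ length units    ≡⟨ *-comm (prod units) _ ⟩
      γ ^ length units * prod units    ≡⟨ prod-scale γ units ⟨
      prod (map (γ *_) units)          ≡⟨ prod-perm (map (γ *_) units) units same ⟩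
      prod units                       ≡⟨ *-identityʳ _ ⟨
      prod units * 1#                  ∎)
      where
      open ≡-Reasoning
      same : ∀ a → ∑ (map (γ *_) units) (λ x → ⟦ x E.≟ a ⟧) ≡ ∑ units (λ x → ⟦ x E.≟ a ⟧)
      same a = begin
        ∑ (map (γ *_) units) (λ x → ⟦ x E.≟ a ⟧)
          ≡⟨ ∑-map (γ *_) units _ ⟩
        ∑ units (λ x → ⟦ γ * x E.≟ a ⟧)
          ≡⟨ ∑-filter nonzero? E.list _ ⟩
        E.sum (λ x → ⟦ nonzero? x ⟧ *ᶻ ⟦ γ * x E.≟ a ⟧)
          ≡⟨ ∑-cong E.list (λ x → cong (_*ᶻ ⟦ γ * x E.≟ a ⟧) (⟦⟧-cong (nonzero? x) (nonzero? (γ * x)) (*-≢0 γ≢0) (λ h e → h (trans (cong (γ *_) e) (zeroʳ γ))))) ⟩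
        E.sum (λ x → ⟦ nonzero? (γ * x) ⟧ *ᶻ ⟦ γ * x E.≟ a ⟧)
          ≡⟨ sum-scale γ γ≢0 (λ x → ⟦ nonzero? x ⟧ *ᶻ ⟦ x E.≟ a ⟧) ⟨
        E.sum (λ x → ⟦ nonzero? x ⟧ *ᶻ ⟦ x E.≟ a ⟧)
          ≡⟨ ∑-filter nonzero? E.list _ ⟨
        ∑ units (λ x → ⟦ x E.≟ a ⟧) ∎

  fermat : ∀ {N} → + suc N ≡ E.size → ∀ {γ} → γ ≢ 0# → γ ^ N ≡ 1#
  fermat {N} h {γ} γ≢0 = trans (cong (γ ^_) (sym N≡)) (Fermat.γ^#units γ γ≢0)
    where
    N≡ : length Fermat.units ≡ N
    N≡ = ℕₚ.+-cancelʳ-≡ 1 _ _ (ℤₚ.+-injective (trans (ℤₚ.pos-+ (length Fermat.units) 1) (trans (cong (_+ᶻ 1ℤ) (length-filter nonzero? E.list)) (trans #units+1 (trans (sym h) (cong +_ (ℕₚ.+-comm 1 N)))))))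

  #roots-of-unity : ℕ → ℤ
  #roots-of-unity k = E.sum (λ γ → ⟦ nonzero? γ ⟧ *ᶻ ⟦ γ ^ k E.≟ 1# ⟧)

  -- By Fermat γᴺ = 1, and with γᵏ = 1 Bézout gives γᵍ = 1 for g = gcd k N. So every k-th root of
  -- unity is among the at most g roots of xᵍ - 1.
  #roots-of-unity≤gcd : ∀ {N} → + suc N ≡ E.size → ∀ k → gcd k N ≢ 0 → #roots-of-unity k ≤ᶻ + gcd k N
  #roots-of-unity≤gcd {N} h k g≢0 with gcd k N in eq
  ... | zero  = contradiction refl g≢0
  ... | suc g = ℤₚ.≤-trans (∑-mono E.list bound) (roots≤degree poly)
    where
    zeros : ∀ n → Vec K n
    zeros zero    = []
    zeros (suc n) = 0# ∷ zeros n
    evK-zeros : ∀ n β → evK (zeros n) β ≡ β ^ n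
    evK-zeros zero    β = refl
    evK-zeros (suc n) β = trans (+-identityˡ _) (cong (β *_) (evK-zeros n β))
    poly : Vec K (suc g)
    poly = (- 1#) ∷ zeros g
    identity : Bézout.Identity (suc g) k N
    identity = subst (λ z → Bézout.Identity z k N) eq (Bézout.identity (gcd-GCD k N))
    root : ∀ γ → γ ≢ 0# → γ ^ k ≡ 1# → γ ^ suc g ≡ 1#
    root γ γ≢0 γ^k = go identity
      where
      trivial : ∀ x m → γ ^ m ≡ 1# → γ ^ (x ℕ.* m) ≡ 1#
      trivial x m e = trans (^-* γ x m) (trans (cong (_^ x) e) (1^ x))
      reduce : ∀ a b x m → a ℕ.+ b ≡ x ℕ.* m → γ ^ b ≡ 1# → γ ^ m ≡ 1# → γ ^ a ≡ 1#
      reduce a b x m e eb em = trans (sym (*-identityʳ (γ ^ a))) (trans (cong (γ ^ a *_) (sym eb)) (trans (sym (^-+ γ a b)) (trans (cong (γ ^_) e) (trivial x m em))))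
      go : Bézout.Identity (suc g) k N → γ ^ suc g ≡ 1#
      go (Bézout.+- x y e) = reduce (suc g) (y ℕ.* N) x k e (trivial y N (fermat h γ≢0)) γ^k
      go (Bézout.-+ x y e) = reduce (suc g) (x ℕ.* k) y N e (trivial x k γ^k) (fermat h γ≢0)
    bound : ∀ γ → ⟦ nonzero? γ ⟧ *ᶻ ⟦ γ ^ k E.≟ 1# ⟧ ≤ᶻ ⟦ evK poly γ E.≟ 0# ⟧
    bound γ = ℤₚ.≤-trans (ℤₚ.≤-reflexive (sym (⟦⟧-× (nonzero? γ) (γ ^ k E.≟ 1#))))
      (⟦⟧-mono (nonzero? γ ×-dec (γ ^ k E.≟ 1#)) (evK poly γ E.≟ 0#) (λ (γ≢0 , e) →
        trans (cong (λ z → - 1# + γ * z) (evK-zeros g γ)) (trans (cong (λ z → - 1# + z) (root γ γ≢0 e)) (-‿inverseˡ 1#))))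

  -- A nonempty fibre of γ ↦ γᵏ on the units is a coset of the roots of unity.
  #fibre≤ : ∀ k c → E.sum (λ γ → ⟦ nonzero? γ ⟧ *ᶻ ⟦ γ ^ k E.≟ c ⟧) ≤ᶻ #roots-of-unity k
  #fibre≤ k c with E.search (λ γ → nonzero? γ ×-dec (γ ^ k E.≟ c))
  ... | inj₂ none = ℤₚ.≤-trans (ℤₚ.≤-reflexive (trans (∑-cong E.list (λ γ → trans (sym (⟦⟧-× (nonzero? γ) (γ ^ k E.≟ c))) (⟦⟧-no (nonzero? γ ×-dec (γ ^ k E.≟ c)) (none γ)))) (∑-0 E.list)))
      (∑-nonneg E.list (λ γ → *-nonneg (⟦⟧-nonneg (nonzero? γ)) (⟦⟧-nonneg (γ ^ k E.≟ 1#))))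
  ... | inj₁ (γ₀ , γ₀≢0 , refl) = ℤₚ.≤-trans (ℤₚ.≤-reflexive (sum-scale γ₀ γ₀≢0 _)) (∑-mono E.list (λ ζ →
      *-mono (⟦⟧-nonneg ((γ₀ * ζ) ^ k E.≟ γ₀ ^ k)) (⟦⟧-nonneg (nonzero? ζ))
        (⟦⟧-mono (nonzero? (γ₀ * ζ)) (nonzero? ζ) (λ h e → h (trans (cong (γ₀ *_) e) (zeroʳ γ₀))))
        (⟦⟧-mono ((γ₀ * ζ) ^ k E.≟ γ₀ ^ k) (ζ ^ k E.≟ 1#) (λ e → *-cancelˡ (^-≢0 k γ₀≢0) (trans (sym (*-^ γ₀ ζ k)) (trans e (sym (*-identityʳ _))))))))

-- The test function ψ

module Characteristic (𝔽 : FiniteField) where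
  open FieldFacts 𝔽
  open Sums
  open import Data.Integer using () renaming (_*_ to _*ᶻ_; _-_ to _-ᶻ_; _≤_ to _≤ᶻ_; -_ to -ᶻ_)
  private module E = Enum F-Enum

  Q : ℤ
  Q = + q

  0≤Q : 0ℤ ≤ᶻ Q
  0≤Q = ℤ.+≤+ z≤n

  1≤Q : 1ℤ ≤ᶻ Q
  1≤Q = ℤ.+≤+ (ℕₚ.≤-trans (s≤s z≤n) 2≤q)

  F-size : E.size ≡ Q
  F-size = trans (∑-const elems 1ℤ) (ℤₚ.*-identityʳ Q)

  -- q times the centred indicator function of b, so that every bound below is one on a sum with mean zero.
  ψ : F → F → ℤ
  ψ b t = Q *ᶻ ⟦ t E.≟ b ⟧ -ᶻ 1ℤ

  ψ-sum : ∀ b t → E.sum (λ s → ψ b (t + s)) ≡ 0ℤ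
  ψ-sum b t = begin
    E.sum (λ s → Q *ᶻ ⟦ t + s E.≟ b ⟧ -ᶻ 1ℤ)                  ≡⟨ ∑-- elems _ _ ⟩
    E.sum (λ s → Q *ᶻ ⟦ t + s E.≟ b ⟧) -ᶻ E.size              ≡⟨ cong₂ _-ᶻ_ (∑-*ˡ elems Q _) F-size ⟩
    Q *ᶻ E.sum (λ s → ⟦ t + s E.≟ b ⟧) -ᶻ Q                   ≡⟨ cong (λ z → Q *ᶻ z -ᶻ Q) (trans (∑-cong elems (λ s →
        ⟦⟧-cong (t + s E.≟ b) (s E.≟ b - t) (λ e → trans (solve 2 (λ t s → s := t :+ s :- t) refl t s) (cong (_- t) e))
          (λ e → trans (+-congˡ e) (solve 2 (λ t b → t :+ (b :- t) := b) refl t b)))) (E.once (b - t))) ⟩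
    Q *ᶻ 1ℤ -ᶻ Q                                              ≡⟨ cong (_-ᶻ Q) (ℤₚ.*-identityʳ Q) ⟩
    Q -ᶻ Q                                                    ≡⟨ ℤₚ.+-inverseʳ Q ⟩
    0ℤ                                                        ∎
    where open ≡-Reasoning

  abs-ψ : ∀ b t → abs (ψ b t) ≤ᶻ Q
  abs-ψ b t with t E.≟ b
  ... | yes _ = subst (_≤ᶻ Q) (sym (abs-nonneg (ℤₚ.i≤j⇒0≤j-i (subst (1ℤ ≤ᶻ_) (sym (ℤₚ.*-identityʳ Q)) 1≤Q))))
                  (subst (Q *ᶻ 1ℤ -ᶻ 1ℤ ≤ᶻ_) (ℤₚ.*-identityʳ Q) (ℤₚ.i-j≤i (Q *ᶻ 1ℤ) 1ℤ))
  ... | no _  = subst (_≤ᶻ Q) (cong (λ z → abs (z -ᶻ 1ℤ)) (sym (ℤₚ.*-zeroʳ Q))) 1≤Q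

  x≤abs : ∀ x → x ≤ᶻ abs x
  x≤abs (+ n)      = ℤₚ.≤-refl
  x≤abs -[1+ n ]   = ℤ.-≤+

  ψψ≤ : ∀ b t u → ψ b t *ᶻ ψ b u ≤ᶻ Q *ᶻ Q
  ψψ≤ b t u = ℤₚ.≤-trans (x≤abs _) (ℤₚ.≤-trans (ℤₚ.≤-reflexive (abs-* (ψ b t) (ψ b u)))
    (*-mono (0≤abs (ψ b u)) 0≤Q (abs-ψ b t) (abs-ψ b u)))

  -- A fixed summand of a trace is absorbed into the target value. This is why the later estimates
  -- are demanded for all targets b at once.
  ψ-shift : ∀ b s t → ψ b (s + t) ≡ ψ (b - t) s
  ψ-shift b s t = cong (λ z → Q *ᶻ z -ᶻ 1ℤ) (⟦⟧-cong (s + t E.≟ b) (s E.≟ b - t)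
    (λ e → trans (solve 2 (λ s t → s := s :+ t :- t) refl s t) (cong (_- t) e))
    (λ e → trans (cong (_+ t) e) (solve 2 (λ b t → b :- t :+ t := b) refl b t)))

-- The sum of ψ (Tr αᵏ) over the units of an extension

module TraceSums {𝔽 : FiniteField} (𝔎 : Algebra 𝔽) (𝔼 : Sums.Enum (Algebra.K 𝔎))
                 (zeroDivisors : ∀ a b → Algebra._*_ 𝔎 a b ≡ Algebra.0# 𝔎 → a ≡ Algebra.0# 𝔎 ⊎ b ≡ Algebra.0# 𝔎)
                 (1≢0 : Algebra.1# 𝔎 ≢ Algebra.0# 𝔎)
                 (tr : Algebra.K 𝔎 → FiniteField.F 𝔽)
                 (tr-+ : ∀ a b → tr (Algebra._+_ 𝔎 a b) ≡ FiniteField._+_ 𝔽 (tr a) (tr b))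
                 (tr-⌊⌋ : ∀ c a → tr (Algebra._*_ 𝔎 (Algebra.⌊_⌋ 𝔎 c) a) ≡ FiniteField._*_ 𝔽 c (tr a))
                 (c₁ : Algebra.K 𝔎) (tr-c₁ : tr c₁ ≡ FiniteField.1# 𝔽) where
  private
    module 𝔽 = FieldFacts 𝔽
    module E = Sums.Enum 𝔼
    module 𝔽E = Sums.Enum 𝔽.F-Enum
  open FiniteField 𝔽 using (F)
  open Sums
  open Characteristic 𝔽
  open AlgebraFacts 𝔎
  open Domain 𝔎 𝔼 zeroDivisors 1≢0
  open import Data.Integer using () renaming (_*_ to _*ᶻ_; _≤_ to _≤ᶻ_)

  tr-neg⌊⌋ : ∀ c a → tr (- (⌊ c ⌋ * a)) ≡ 𝔽.- (c 𝔽.* tr a)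
  tr-neg⌊⌋ c a = 𝔽.x-y≡0⇒x≡y (trans (𝔽.+-congˡ (𝔽.-‿involutive (c 𝔽.* tr a)))
    (trans (𝔽.+-congˡ (sym (tr-⌊⌋ c a))) (trans (sym (tr-+ _ _)) (trans (cong tr (-‿inverseˡ (⌊ c ⌋ * a))) tr-0))))
    where
    tr-0 : tr 0# ≡ 𝔽.0#
    tr-0 = trans (cong tr (sym (trans (cong (_* 0#) ⌊⌋-0) (zeroˡ 0#)))) (trans (tr-⌊⌋ 𝔽.0# 0#) (𝔽.zeroˡ (tr 0#)))

  tr-difference : ∀ c x a → tr (x - ⌊ c ⌋ * a) ≡ tr x 𝔽.- c 𝔽.* tr a
  tr-difference c x a = trans (tr-+ x _) (𝔽.+-congˡ (tr-neg⌊⌋ c a))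

  -- If y is not an F-multiple of z, then y ↦ tr (c y) can be moved without moving tr (c z).
  separate : ∀ y z → z ≢ 0# → (∀ t → y ≢ ⌊ t ⌋ * z) → ∃ λ c → tr (c * z) ≡ 𝔽.0# × tr (c * y) ≡ 𝔽.1#
  separate y z z≢0 indep = c₀ * z′ , first , second
    where
    z′ = proj₁ (inverse z z≢0)
    zz′ : z * z′ ≡ 1#
    zz′ = proj₂ (inverse z z≢0)
    w = y * z′
    -- With w = y/z and this t, subtracting (tr c) c₁ from c makes the trace of c₀ vanish and turns
    -- that of c₀ w into tr (c w) - t tr c = tr (c (w - t)). Taking c = c₁/(w - t) makes this tr c₁
    -- = 1.
    t = tr (c₁ * w)
    w-t≢0 : w - ⌊ t ⌋ ≢ 0#
    w-t≢0 e = indep t (trans (sym (*-identityʳ y)) (trans (cong (y *_) (sym (trans (*-comm z′ z) zz′))) (trans (sym (*-assoc y z′ z)) (cong (_* z) (x-y≡0⇒x≡y e)))))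
    u = proj₁ (inverse (w - ⌊ t ⌋) w-t≢0)
    c = c₁ * u
    c₀ = c - ⌊ tr c ⌋ * c₁
    tr-c₀ : tr c₀ ≡ 𝔽.0#
    tr-c₀ = trans (tr-difference (tr c) c c₁) (trans (cong (λ s → tr c 𝔽.- tr c 𝔽.* s) tr-c₁) (trans (cong (λ s → tr c 𝔽.- s) (𝔽.*-identityʳ (tr c))) (𝔽.-‿inverseʳ (tr c))))
    first : tr (c₀ * z′ * z) ≡ 𝔽.0#
    first = trans (cong tr (trans (*-assoc c₀ z′ z) (trans (cong (c₀ *_) (trans (*-comm z′ z) zz′)) (*-identityʳ c₀)))) tr-c₀
    c₁-again : c * (w - ⌊ t ⌋) ≡ c₁
    c₁-again = trans (*-assoc c₁ u (w - ⌊ t ⌋)) (trans (cong (c₁ *_) (trans (*-comm u (w - ⌊ t ⌋)) (proj₂ (inverse (w - ⌊ t ⌋) w-t≢0)))) (*-identityʳ c₁))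
    second : tr (c₀ * z′ * y) ≡ 𝔽.1#
    second = begin
      tr (c₀ * z′ * y)                            ≡⟨ cong tr (solve 5 (λ c s a z y → (c :- s :* a) :* z :* y := c :* (y :* z) :- s :* (a :* (y :* z))) refl c ⌊ tr c ⌋ c₁ z′ y) ⟩
      tr (c * w - ⌊ tr c ⌋ * (c₁ * w))            ≡⟨ tr-difference (tr c) (c * w) (c₁ * w) ⟩
      tr (c * w) 𝔽.- tr c 𝔽.* t                   ≡⟨ cong (λ s → tr (c * w) 𝔽.- s) (𝔽.*-comm (tr c) t) ⟩
      tr (c * w) 𝔽.- t 𝔽.* tr c                   ≡⟨ tr-difference t (c * w) c ⟨
      tr (c * w - ⌊ t ⌋ * c)                      ≡⟨ cong tr (solve 3 (λ c w t → c :* w :- t :* c := c :* (w :- t)) refl c w ⌊ t ⌋) ⟩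
      tr (c * (w - ⌊ t ⌋))                        ≡⟨ cong tr c₁-again ⟩
      tr c₁                                       ≡⟨ tr-c₁ ⟩
      𝔽.1#                                        ∎
      where open ≡-Reasoning

  correlation : F → K → K → ℤ
  correlation b y z = E.sum (λ c → ψ b (tr (c * y)) *ᶻ ψ b (tr (c * z)))

  -- Translate c by s c₀ with c₀ from `separate`: the trace of c z stays fixed while that of c y
  -- moves by s. Averaging over s in F gives zero, because ψ has mean zero.
  correlation-0 : ∀ b y z → z ≢ 0# → (∀ t → y ≢ ⌊ t ⌋ * z) → correlation b y z ≡ 0ℤ
  correlation-0 b y z z≢0 indep = zero-multiple (begin
    Q *ᶻ correlation b y z
      ≡⟨ trans (cong (_*ᶻ correlation b y z) (sym F-size)) (sym (𝔽E.sum-*1 (correlation b y z))) ⟩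
    𝔽E.sum (λ s → correlation b y z)
      ≡⟨ ∑-cong 𝔽.elems (λ s → sum-shift (⌊ s ⌋ * c₀) _) ⟩
    𝔽E.sum (λ s → E.sum (λ c → ψ b (tr ((c + ⌊ s ⌋ * c₀) * y)) *ᶻ ψ b (tr ((c + ⌊ s ⌋ * c₀) * z))))
      ≡⟨ ∑-cong 𝔽.elems (λ s → ∑-cong E.list (λ c → cong₂ (λ p r → ψ b p *ᶻ ψ b r) (move s c y 𝔽.1# (proj₂ sep) (𝔽.*-identityʳ s)) (trans (move s c z 𝔽.0# (proj₁ sep) (𝔽.zeroʳ s)) (𝔽.+-identityʳ _)))) ⟩
    𝔽E.sum (λ s → E.sum (λ c → ψ b (tr (c * y) 𝔽.+ s) *ᶻ ψ b (tr (c * z))))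
      ≡⟨ ∑-swap 𝔽.elems E.list _ ⟩
    E.sum (λ c → 𝔽E.sum (λ s → ψ b (tr (c * y) 𝔽.+ s) *ᶻ ψ b (tr (c * z))))
      ≡⟨ ∑-cong E.list (λ c → trans (∑-*ʳ 𝔽.elems (ψ b (tr (c * z))) _) (trans (cong (_*ᶻ ψ b (tr (c * z))) (ψ-sum b (tr (c * y)))) (ℤₚ.*-zeroˡ (ψ b (tr (c * z)))))) ⟩
    E.sum (λ c → 0ℤ)
      ≡⟨ ∑-0 E.list ⟩
    0ℤ ∎)
    where
    open ≡-Reasoning
    c₀ = proj₁ (separate y z z≢0 indep)
    sep = proj₂ (separate y z z≢0 indep)
    move : ∀ s c x {v} u → tr (c₀ * x) ≡ u → s 𝔽.* u ≡ v → tr ((c + ⌊ s ⌋ * c₀) * x) ≡ tr (c * x) 𝔽.+ v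
    move s c x u e e′ = trans (cong tr (solve 4 (λ c s k x → (c :+ s :* k) :* x := c :* x :+ s :* (k :* x)) refl c ⌊ s ⌋ c₀ x))
      (trans (tr-+ _ _) (𝔽.+-congˡ (trans (tr-⌊⌋ s (c₀ * x)) (trans (cong (s 𝔽.*_) e) e′))))
    zero-multiple : ∀ {x} → Q *ᶻ x ≡ 0ℤ → x ≡ 0ℤ
    zero-multiple {x} e with ℤₚ.i*j≡0⇒i≡0∨j≡0 Q e
    ... | inj₁ p = contradiction (ℤₚ.+-injective p) (λ q≡0 → ℕₚ.<⇒≢ (ℕₚ.≤-trans (s≤s z≤n) 𝔽.2≤q) (sym q≡0))
    ... | inj₂ p = p

  correlation≤ : ∀ b y z → z ≢ 0# → correlation b y z ≤ᶻ Q *ᶻ Q *ᶻ E.size *ᶻ 𝔽E.sum (λ t → ⟦ y E.≟ ⌊ t ⌋ * z ⟧)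
  correlation≤ b y z z≢0 with 𝔽E.search (λ t → y E.≟ ⌊ t ⌋ * z)
  ... | inj₂ none = ℤₚ.≤-reflexive (trans (correlation-0 b y z z≢0 none) (sym (trans (cong (Q *ᶻ Q *ᶻ E.size *ᶻ_)
          (trans (∑-cong 𝔽.elems (λ t → ⟦⟧-no (y E.≟ ⌊ t ⌋ * z) (none t))) (∑-0 𝔽.elems))) (ℤₚ.*-zeroʳ (Q *ᶻ Q *ᶻ E.size)))))
  ... | inj₁ (t₀ , e) = ℤₚ.≤-trans (∑-mono E.list (λ c → ψψ≤ b _ _)) (ℤₚ.≤-trans (ℤₚ.≤-reflexive (trans (E.sum-*1 (Q *ᶻ Q)) (trans (ℤₚ.*-comm E.size _) (sym (ℤₚ.*-identityʳ _)))))
          (*-monoˡ (*-nonneg (*-nonneg 0≤Q 0≤Q) (∑-nonneg E.list (λ _ → ℤ.+≤+ z≤n)))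
            (subst (_≤ᶻ 𝔽E.sum (λ t → ⟦ y E.≟ ⌊ t ⌋ * z ⟧)) (𝔽E.once t₀) (∑-mono 𝔽.elems (λ t → ⟦⟧-mono (t 𝔽E.≟ t₀) (y E.≟ ⌊ t ⌋ * z) (λ { refl → e }))))))

  module _ (k : ℕ) (b : F) where
    private
      D = #roots-of-unity k
      nz : K → ℤ
      nz a = ⟦ nonzero? a ⟧

    powerSum : K → ℤ
    powerSum c = E.sum (λ α → nz α *ᶻ ψ b (tr (c * α ^ k)))

    private
      0≤D : 0ℤ ≤ᶻ D
      0≤D = ∑-nonneg E.list (λ γ → *-nonneg (⟦⟧-nonneg (nonzero? γ)) (⟦⟧-nonneg (γ ^ k E.≟ 1#)))

    powerSum-invariant : ∀ γ → γ ≢ 0# → powerSum (γ ^ k) ≡ powerSum 1#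
    powerSum-invariant γ γ≢0 = sym (trans (sum-scale γ γ≢0 _) (∑-cong E.list (λ α → cong₂ (λ u v → u *ᶻ ψ b (tr v))
      (⟦⟧-cong (nonzero? (γ * α)) (nonzero? α) (λ h e → h (trans (cong (γ *_) e) (zeroʳ γ))) (*-≢0 γ≢0))
      (trans (*-identityˡ _) (*-^ γ α k)))))

    private
      square : K → ℤ
      square c = powerSum c *ᶻ powerSum c

    -- By the substitution α ↦ γα, `powerSum` takes its value at 1 also at every γᵏ, and each c
    -- equals γᵏ for at most D units γ. So the square at 1, counted once per unit, is at most D
    -- times the sum of the squares over all c.
    orbit-average : #units *ᶻ square 1# ≤ᶻ D *ᶻ E.sum square
    orbit-average = subst₂ _≤ᶻ_ lhs (∑-*ˡ E.list D square)
      (∑-mono E.list {λ c → E.sum (λ γ → nz γ *ᶻ ⟦ γ ^ k E.≟ c ⟧) *ᶻ square c} (λ c → *-monoʳ (square-nonneg (powerSum c)) (#fibre≤ k c)))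
      where
      open ≡-Reasoning
      lhs : E.sum (λ c → E.sum (λ γ → nz γ *ᶻ ⟦ γ ^ k E.≟ c ⟧) *ᶻ square c) ≡ #units *ᶻ square 1#
      lhs = begin
        E.sum (λ c → E.sum (λ γ → nz γ *ᶻ ⟦ γ ^ k E.≟ c ⟧) *ᶻ square c)
          ≡⟨ ∑-cong E.list (λ c → sym (∑-*ʳ E.list (square c) _)) ⟩
        E.sum (λ c → E.sum (λ γ → nz γ *ᶻ ⟦ γ ^ k E.≟ c ⟧ *ᶻ square c))
          ≡⟨ ∑-swap E.list E.list _ ⟩
        E.sum (λ γ → E.sum (λ c → nz γ *ᶻ ⟦ γ ^ k E.≟ c ⟧ *ᶻ square c))
          ≡⟨ ∑-cong E.list (λ γ → trans (∑-cong E.list (λ c → trans (cong (λ z → nz γ *ᶻ z *ᶻ square c) (⟦⟧-cong (γ ^ k E.≟ c) (c E.≟ γ ^ k) sym sym)) (ℤₚ.*-assoc (nz γ) ⟦ c E.≟ γ ^ k ⟧ (square c))))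
               (trans (∑-*ˡ E.list (nz γ) _) (cong (nz γ *ᶻ_) (E.sum-pick (γ ^ k) square)))) ⟩
        E.sum (λ γ → nz γ *ᶻ square (γ ^ k))
          ≡⟨ ∑-cong E.list (λ γ → ⟦⟧*-cong (nonzero? γ) (λ γ≢0 → cong (λ z → z *ᶻ z) (powerSum-invariant γ γ≢0))) ⟩
        E.sum (λ γ → nz γ *ᶻ square 1#)
          ≡⟨ ∑-*ʳ E.list (square 1#) nz ⟩
        #units *ᶻ square 1# ∎

    -- Expanding the squares leaves the correlations of αᵏ and βᵏ. These vanish unless αᵏ is one of
    -- the q multiples t βᵏ with t in F, and for given β and t there are at most D such α.
    second-moment : E.sum square ≤ᶻ #units *ᶻ (Q *ᶻ Q *ᶻ E.size *ᶻ (Q *ᶻ D))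
    second-moment = begin
      E.sum square
        ≡⟨ ∑-cong E.list (λ c → ∑-product E.list E.list _ _) ⟩
      E.sum (λ c → E.sum (λ α → E.sum (λ β → nz α *ᶻ ψ b (tr (c * α ^ k)) *ᶻ (nz β *ᶻ ψ b (tr (c * β ^ k))))))
        ≡⟨ trans (∑-swap E.list E.list _) (∑-cong E.list (λ α → ∑-swap E.list E.list _)) ⟩
      E.sum (λ α → E.sum (λ β → E.sum (λ c → nz α *ᶻ ψ b (tr (c * α ^ k)) *ᶻ (nz β *ᶻ ψ b (tr (c * β ^ k))))))
        ≡⟨ ∑-swap E.list E.list _ ⟩
      E.sum (λ β → E.sum (λ α → E.sum (λ c → nz α *ᶻ ψ b (tr (c * α ^ k)) *ᶻ (nz β *ᶻ ψ b (tr (c * β ^ k))))))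
        ≡⟨ ∑-cong E.list (λ β → ∑-cong E.list (λ α → trans (∑-cong E.list (λ c → regroup (nz α) (ψ b (tr (c * α ^ k))) (nz β) (ψ b (tr (c * β ^ k))))) (∑-*ˡ E.list (nz β *ᶻ nz α) _))) ⟩
      E.sum (λ β → E.sum (λ α → nz β *ᶻ nz α *ᶻ correlation b (α ^ k) (β ^ k)))
        ≤⟨ ∑-mono E.list (λ β → ∑-mono E.list (λ α → bound α β)) ⟩
      E.sum (λ β → E.sum (λ α → nz β *ᶻ nz α *ᶻ (Q *ᶻ Q *ᶻ E.size *ᶻ 𝔽E.sum (λ t → ⟦ α ^ k E.≟ ⌊ t ⌋ * β ^ k ⟧))))
        ≡⟨ ∑-cong E.list (λ β → rearrange β) ⟩
      E.sum (λ β → nz β *ᶻ (Q *ᶻ Q *ᶻ E.size *ᶻ 𝔽E.sum (λ t → E.sum (λ α → nz α *ᶻ ⟦ α ^ k E.≟ ⌊ t ⌋ * β ^ k ⟧))))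
        ≤⟨ ∑-mono E.list (λ β → *-monoˡ (⟦⟧-nonneg (nonzero? β)) (*-monoˡ 0≤QQs (∑-mono 𝔽.elems (λ t → #fibre≤ k (⌊ t ⌋ * β ^ k))))) ⟩
      E.sum (λ β → nz β *ᶻ (Q *ᶻ Q *ᶻ E.size *ᶻ 𝔽E.sum (λ t → D)))
        ≡⟨ trans (∑-*ʳ E.list _ nz) (cong (λ z → #units *ᶻ (Q *ᶻ Q *ᶻ E.size *ᶻ z)) (trans (𝔽E.sum-*1 D) (cong (_*ᶻ D) F-size))) ⟩
      #units *ᶻ (Q *ᶻ Q *ᶻ E.size *ᶻ (Q *ᶻ D)) ∎
      where
      open ℤₚ.≤-Reasoning
      0≤QQs : 0ℤ ≤ᶻ Q *ᶻ Q *ᶻ E.size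
      0≤QQs = *-nonneg (*-nonneg 0≤Q 0≤Q) (∑-nonneg E.list (λ _ → ℤ.+≤+ z≤n))
      regroup : ∀ a p c r → a *ᶻ p *ᶻ (c *ᶻ r) ≡ c *ᶻ a *ᶻ (p *ᶻ r)
      regroup = ℤ-solve-∀
      bound : ∀ α β → nz β *ᶻ nz α *ᶻ correlation b (α ^ k) (β ^ k) ≤ᶻ nz β *ᶻ nz α *ᶻ (Q *ᶻ Q *ᶻ E.size *ᶻ 𝔽E.sum (λ t → ⟦ α ^ k E.≟ ⌊ t ⌋ * β ^ k ⟧))
      bound α β = subst₂ _≤ᶻ_ (sym (ℤₚ.*-assoc (nz β) (nz α) _)) (sym (ℤₚ.*-assoc (nz β) (nz α) _))
        (⟦⟧*-mono (nonzero? β) (λ β≢0 → *-monoˡ (⟦⟧-nonneg (nonzero? α)) (correlation≤ b (α ^ k) (β ^ k) (^-≢0 k β≢0))))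
      shuffle : ∀ x y c s → x *ᶻ y *ᶻ (c *ᶻ s) ≡ x *ᶻ (c *ᶻ (y *ᶻ s))
      shuffle = ℤ-solve-∀
      rearrange : ∀ β → E.sum (λ α → nz β *ᶻ nz α *ᶻ (Q *ᶻ Q *ᶻ E.size *ᶻ 𝔽E.sum (λ t → ⟦ α ^ k E.≟ ⌊ t ⌋ * β ^ k ⟧))) ≡
                        nz β *ᶻ (Q *ᶻ Q *ᶻ E.size *ᶻ 𝔽E.sum (λ t → E.sum (λ α → nz α *ᶻ ⟦ α ^ k E.≟ ⌊ t ⌋ * β ^ k ⟧)))
      rearrange β = trans (∑-cong E.list (λ α → trans (shuffle (nz β) (nz α) (Q *ᶻ Q *ᶻ E.size) _) (cong (λ z → nz β *ᶻ (Q *ᶻ Q *ᶻ E.size *ᶻ z)) (sym (∑-*ˡ 𝔽.elems (nz α) _)))))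
        (trans (∑-*ˡ E.list (nz β) _) (cong (nz β *ᶻ_) (trans (∑-*ˡ E.list (Q *ᶻ Q *ᶻ E.size) _) (cong (Q *ᶻ Q *ᶻ E.size *ᶻ_) (∑-swap E.list 𝔽.elems _)))))

    -- The number of units cancels between the two preceding bounds. What remains is D² q³ |K|, that
    -- is |powerSum| ≤ D q^{(d+3)/2} for |K| = q^d.
    powerSum² : powerSum 1# *ᶻ powerSum 1# ≤ᶻ D *ᶻ (Q *ᶻ Q *ᶻ E.size *ᶻ (Q *ᶻ D))
    powerSum² = cancel 1≤#units (ℤₚ.≤-trans orbit-average (ℤₚ.≤-trans (*-monoˡ 0≤D second-moment) (ℤₚ.≤-reflexive (swap D #units _))))
      where
      swap : ∀ a b c → a *ᶻ (b *ᶻ c) ≡ b *ᶻ (a *ᶻ c)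
      swap = ℤ-solve-∀
      1≤#units : 1ℤ ≤ᶻ #units
      1≤#units = subst (_≤ᶻ #units) (E.once 1#) (∑-mono E.list (λ a → ⟦⟧-mono (a E.≟ 1#) (nonzero? a) (λ { refl → 1≢0 })))
      cancel : ∀ {u x y} → 1ℤ ≤ᶻ u → u *ᶻ x ≤ᶻ u *ᶻ y → x ≤ᶻ y
      cancel {+ suc n} {x} {y} _ h = ℤₚ.*-cancelˡ-≤-pos x y (+ suc n) h
      cancel {+ zero} (ℤ.+≤+ ())

-- Division and products of monic polynomials

module PolynomialDivision (𝔽 : FiniteField) where
  open FieldFacts 𝔽 hiding (solve; _:+_; _:*_; :-_; _:-_; _:=_; con)
  open Polynomials 𝔽

  normalise : ∀ {n} (w : Vec F n) → plain w ≈ 𝟘 ⊎ ∃ λ c → c ≢ 0# × ∃ λ j → j < n × ∃ λ (g : Vec F j) → plain w ≈ c ∙ mon g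
  normalise []      = inj₁ (λ _ → refl)
  normalise (a ∷ w) with normalise w
  ... | inj₂ (c , c≢0 , j , j<n , g , e) = inj₂ (c , c≢0 , suc j , s≤s j<n , (a * inv c) ∷ g , eq)
    where
    eq : plain (a ∷ w) ≈ c ∙ mon ((a * inv c) ∷ g)
    eq zero    = trans (sym (*-identityʳ a)) (trans (cong (a *_) (sym (*-inv c≢0))) (trans (sym (*-assoc a c (inv c))) (trans (cong (_* inv c) (*-comm a c)) (*-assoc c a (inv c)))))
    eq (suc i) = e i
  ... | inj₁ e with a ≟ 0#
  ...   | yes a≡0 = inj₁ (λ { zero → a≡0 ; (suc i) → e i })
  ...   | no a≢0  = inj₂ (a , a≢0 , 0 , s≤s z≤n , [] , (λ { zero → sym (*-identityʳ a) ; (suc i) → trans (e i) (sym (zeroʳ a)) }))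

  monic-division : ∀ {d l} (R : Vec F d) (f : Vec F (d ℕ.+ l)) →
                   ∃ λ (Q : Vec F l) → ∃ λ (r : Vec F d) → mon f ≈ mon R ⊛ mon Q ⊕ plain r
  monic-division {d} {l} R f =
    -- Removing R xˡ first cancels the leading term; the quotient of the rest has degree below l, so
    -- adding xˡ to it gives a monic quotient.
    let p           = mon f ⊕ ⊝ (mon R ⊛ mono 1# l)
        (w , r , e) = division R l {p} small
    in w , r , ≈-trans {mon f} {p ⊕ mon R ⊛ mono 1# l} (solve 2 (λ f t → f := (f :- t) :+ t) ≈-refl (mon f) (mon R ⊛ mono 1# l))
       (≈-trans {p ⊕ mon R ⊛ mono 1# l} {(mon R ⊛ plain w ⊕ plain r) ⊕ mon R ⊛ mono 1# l} (⊕-cong e (≈-refl {mon R ⊛ mono 1# l}))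
       (≈-trans {(mon R ⊛ plain w ⊕ plain r) ⊕ mon R ⊛ mono 1# l} {mon R ⊛ (mono 1# l ⊕ plain w) ⊕ plain r}
         (solve 4 (λ R w r x → (R :* w :+ r) :+ R :* x := R :* (x :+ w) :+ r) ≈-refl (mon R) (plain w) (plain r) (mono 1# l))
         (⊕-cong {mon R ⊛ (mono 1# l ⊕ plain w)} {mon R ⊛ mon w} {plain r} {plain r} (⊛-cong {mon R} {mon R} (≈-refl {mon R}) (≈-sym (mon-plain w))) (≈-refl {plain r}))))
    where
    deg = ⊛-deg d l {mon R} {mono 1# l} (mon-deg R) (mono-deg 1# l)
    small : Deg< (d ℕ.+ l) (mon f ⊕ ⊝ (mon R ⊛ mono 1# l))
    small = Deg<-lower (Deg<-⊕ (mon-deg f) (Deg<-⊝ (proj₁ deg)))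
      (trans (cong₂ _-_ (mon-top f) (trans (proj₂ deg) (trans (cong₂ _*_ (mon-top R) (mono-top 1# l)) (*-identityˡ 1#)))) (-‿inverseʳ 1#))

  ⊛-cancelˡ : ∀ {d} (R : Vec F d) {p r} → Bounded p → Bounded r → mon R ⊛ p ≈ mon R ⊛ r → p ≈ r
  ⊛-cancelˡ R {p} {r} bp br h i = x-y≡0⇒x≡y (⊛-small⇒0 R {p ⊕ ⊝ r} {𝟘} (Bounded-⊕ bp (Bounded-⊝ br)) Deg<-𝟘
    (≈-trans {mon R ⊛ (p ⊕ ⊝ r)} {mon R ⊛ p ⊕ ⊝ (mon R ⊛ r)} (solve 3 (λ R p r → R :* (p :- r) := R :* p :- R :* r) ≈-refl (mon R) p r)
      (λ j → trans (cong (_- (mon R ⊛ r) j) (h j)) (-‿inverseʳ _))) i)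

  -- The degree is an index of the type, so a product that has to be compared with a polynomial of
  -- degree m carries a proof that the degrees add up to m.
  product : ∀ {d l m} → d ℕ.+ l ≡ m → Vec F d → Vec F l → Vec F m
  product refl R Q = R ⊗ Q

  mon-product : ∀ {d l m} (eq : d ℕ.+ l ≡ m) (R : Vec F d) (Q : Vec F l) → mon (product eq R Q) ≈ mon R ⊛ mon Q
  mon-product refl R Q = mon-⊗ R Q

  evm-product : (𝔎 : Algebra 𝔽) → ∀ α {d l m} (eq : d ℕ.+ l ≡ m) (R : Vec F d) (Q : Vec F l) →
                AlgebraFacts.evm 𝔎 α (product eq R Q) ≡ Algebra._*_ 𝔎 (AlgebraFacts.evm 𝔎 α R) (AlgebraFacts.evm 𝔎 α Q)
  evm-product 𝔎 α refl R Q = AlgebraFacts.evm-⊗ 𝔎 α R Q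

  product-injective : ∀ {d l m} (eq : d ℕ.+ l ≡ m) (R : Vec F d) (Q Q′ : Vec F l) → product eq R Q ≡ product eq R Q′ → Q ≡ Q′
  product-injective eq R Q Q′ h = mon-injective Q Q′ (⊛-cancelˡ R (mon-bounded Q) (mon-bounded Q′)
    (λ i → trans (sym (mon-product eq R Q i)) (trans (cong (λ v → mon v i) h) (mon-product eq R Q′ i))))

  zeros : ∀ n → Vec F n
  zeros zero    = []
  zeros (suc n) = 0# ∷ zeros n

  plain-zeros : ∀ n → plain (zeros n) ≈ 𝟘
  plain-zeros zero    i       = refl
  plain-zeros (suc n) zero    = refl
  plain-zeros (suc n) (suc i) = plain-zeros n i

  spow : Series → ℕ → Series
  spow t zero    = 𝟙
  spow t (suc n) = t ⊛ spow t n

  spow-bounded : ∀ {t} → Bounded t → ∀ n → Bounded (spow t n)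
  spow-bounded b zero    = Bounded-𝟙
  spow-bounded {t} b (suc n) = Bounded-⊛ {t} {spow t n} b (spow-bounded b n)

-- Generators of an extension and their minimal polynomials

module Generators {𝔽 : FiniteField} (𝔎 : Algebra 𝔽) (𝔼 : Sums.Enum (Algebra.K 𝔎))
                  (zeroDivisors : ∀ a b → Algebra._*_ 𝔎 a b ≡ Algebra.0# 𝔎 → a ≡ Algebra.0# 𝔎 ⊎ b ≡ Algebra.0# 𝔎)
                  (1≢0 : Algebra.1# 𝔎 ≢ Algebra.0# 𝔎)
                  {e : ℕ} (K-size : Sums.Enum.size 𝔼 ≡ (+ FiniteField.q 𝔽) ℤ.^ suc e) where
  private
    module 𝔽 = FieldFacts 𝔽
    module 𝔽E = Sums.Enum 𝔽.F-Enum
    module E = Sums.Enum 𝔼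
  open FiniteField 𝔽 using (F; q)
  open Sums
  open Characteristic 𝔽
  open Polynomials 𝔽 hiding (solve; _:+_; _:*_; :-_; _:-_; _:=_; con)
  open PolynomialDivision 𝔽
  open AlgebraFacts 𝔎
  open Domain 𝔎 𝔼 zeroDivisors 1≢0
  open import Data.Integer using () renaming (_*_ to _*ᶻ_; _≤_ to _≤ᶻ_; _<_ to _<ᶻ_)

  Vecs : (m : ℕ) → Enum (Vec F m)
  Vecs = Vec-Enum 𝔽.F-Enum

  Vecs-size : ∀ m → Enum.size (Vecs m) ≡ Q ℤ.^ m
  Vecs-size m = Vec-size 𝔽.F-Enum m

  ⌊⌋≢0 : ∀ {c} → c ≢ 𝔽.0# → ⌊ c ⌋ ≢ 0#
  ⌊⌋≢0 {c} c≢0 h = 1≢0 (trans (sym ⌊⌋-1) (trans (cong ⌊_⌋ (sym (𝔽.*-inv c≢0))) (trans (⌊⌋-* c (𝔽.inv c)) (trans (cong (_* ⌊ 𝔽.inv c ⌋) h) (zeroˡ _)))))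

  ev-scale : ∀ α {p} c (b : Bounded p) {r} (b′ : Bounded r) → r ≈ c ∙ p → ev r b′ α ≡ ⌊ c ⌋ * ev p b α
  ev-scale α {p} c (m , h) b′ e = trans (ev-≈ α b′ (m , Deg<-∙) e) (evs-∙ α m c p)
    where
    Deg<-∙ : Deg< m (c ∙ p)
    Deg<-∙ i le = trans (cong (c 𝔽.*_) (h i le)) (𝔽.zeroʳ c)

  ev-spow : ∀ α {t} (b : Bounded t) n → ev (spow t n) (spow-bounded b n) α ≡ ev t b α ^ n
  ev-spow α b zero    = trans (+-congˡ (zeroʳ α)) (trans (+-identityʳ _) ⌊⌋-1)
  ev-spow α {t} b (suc n) = trans (ev-⊛ α {t} {spow t n} b (spow-bounded b n) (spow-bounded b (suc n))) (cong (ev t b α *_) (ev-spow α b n))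

  scaledRoot : ∀ α {n j} (w : Vec F n) (g : Vec F j) c → c ≢ 𝔽.0# → plain w ≈ c ∙ mon g → evp α w ≡ 0# → evm α g ≡ 0#
  scaledRoot α w g c c≢0 h z = *-zero-cancelˡ {⌊ c ⌋} {evm α g} (⌊⌋≢0 c≢0) (trans (sym (ev-scale α c (mon-bounded g) (plain-bounded w) h)) z)

  monicRoot : ∀ α {n} (w : Vec F n) → ¬ plain w ≈ 𝟘 → evp α w ≡ 0# → ∃ λ j → j < n × ∃ λ (g : Vec F j) → evm α g ≡ 0#
  monicRoot α {n} w w≢0 z = go (normalise w)
    where
    go : (plain w ≈ 𝟘 ⊎ ∃ λ c → c ≢ 𝔽.0# × ∃ λ j → j < n × ∃ λ (g : Vec F j) → plain w ≈ c ∙ mon g) → ∃ λ j → j < n × ∃ λ (g : Vec F j) → evm α g ≡ 0#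
    go (inj₁ h) = ⊥-elim (w≢0 h)
    go (inj₂ (c , c≢0 , j , j<n , g , h)) = j , j<n , g , scaledRoot α w g c c≢0 h z

  private
    difference : ∀ {n} → Vec F n → Vec F n → Vec F n
    difference {n} v w = truncate n (plain v ⊕ ⊝ plain w)

    plain-difference : ∀ {n} (v w : Vec F n) → plain (difference v w) ≈ plain v ⊕ ⊝ plain w
    plain-difference {n} v w = plain-truncate n (Deg<-⊕ (plain-deg v) (Deg<-⊝ (plain-deg w)))

    difference-0 : ∀ {n} (v w : Vec F n) → plain (difference v w) ≈ 𝟘 → v ≡ w
    difference-0 v w h = plain-injective v w (λ i → 𝔽.x-y≡0⇒x≡y (trans (sym (plain-difference v w i)) (h i)))

    evp-difference : ∀ α {n} (v w : Vec F n) → evp α (difference v w) ≡ evp α v - evp α w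
    evp-difference α {n} v w = trans (evs-cong α n (plain-difference v w)) (trans (evs-⊕ α n (plain v) (⊝ plain w)) (cong (λ z → evp α v + z) neg))
      where
      neg : evs n (⊝ plain w) α ≡ - evp α w
      neg = x+y≡0⇒y≡-x (trans (sym (evs-⊕ α n (plain w) (⊝ plain w))) (evs-0 α n (λ i → 𝔽.-‿inverseʳ (plain w i))))

  -- Linear independence of 1, α, ..., α^e over F. As K has q^{e+1} elements, it follows by counting
  -- that these powers span K.
  Generator : K → Set
  Generator α = ∀ (v : Vec F (suc e)) → evp α v ≡ 0# → v ≡ zeros (suc e)

  generator? : ∀ α → Dec (Generator α)
  generator? α = Enum.all? (Vecs (suc e)) (λ v → (evp α v E.≟ 0#) →-dec (Enum._≟_ (Vecs (suc e)) v (zeros (suc e))))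

  module _ {α : K} (gen : Generator α) where
    evp-injective : ∀ (v w : Vec F (suc e)) → evp α v ≡ evp α w → v ≡ w
    evp-injective v w h = difference-0 v w (λ i → trans (cong (λ u → plain u i) (gen (difference v w) (trans (evp-difference α v w) (trans (cong (_- evp α w) h) (-‿inverseʳ (evp α w)))))) (plain-zeros (suc e) i))

    evp-surjective : ∀ y → ∃ λ (v : Vec F (suc e)) → evp α v ≡ y
    evp-surjective = injective⇒surjective (Vecs (suc e)) 𝔼 (trans (Vecs-size (suc e)) (sym K-size)) (evp α) evp-injective

    minimal : ∀ {p} (b : Bounded p) → Deg< (suc e) p → ev p b α ≡ 0# → p ≈ 𝟘
    minimal {p} b h z i = trans (sym (plain-truncate (suc e) h i)) (trans (cong (λ u → plain u i) (gen (truncate (suc e) p) (trans (ev-≈ α (plain-bounded (truncate (suc e) p)) b (plain-truncate (suc e) h)) z))) (plain-zeros (suc e) i))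

    evm≢0 : ∀ {m} (v : Vec F m) → m < (suc e) → evm α v ≢ 0#
    evm≢0 {m} v m<d z = 𝔽.0≢1 (sym (trans (sym (mon-top v)) (minimal (mon-bounded v) (Deg<-weaken m<d (mon-deg v)) z m)))

    abstract
      minPoly : Vec F (suc e)
      minPoly = proj₁ (evp-surjective (- (α ^ (suc e))))

      evm-minPoly : evm α minPoly ≡ 0#
      evm-minPoly = trans (evm-plain α minPoly) (trans (+-congˡ (proj₂ (evp-surjective (- (α ^ (suc e)))))) (-‿inverseʳ (α ^ (suc e))))

  -- If no nonzero polynomial of degree ≤ h vanishes at α and β is not a polynomial in α, then the q^{2(h+1)} elements
  -- u(α) + β v(α) with deg u, deg v ≤ h are distinct.
  module Tower (α : K) {h N : ℕ} (2h≥e : e ≤ h ℕ.+ h) (size : + suc (suc N) ≡ E.size)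
               (free : ∀ (w : Vec F (suc h)) → evp α w ≡ 0# → plain w ≈ 𝟘)
               (β : K) (β∉ : ∀ {p} (b : Bounded p) → ev p b α ≢ β) where
    private
      Φ : Vec F (suc h ℕ.+ suc h) → K
      Φ x = evp α (Vec.take (suc h) x) + β * evp α (Vec.drop (suc h) x)

      halves-injective : ∀ u v u′ v′ → evp α u + β * evp α v ≡ evp α u′ + β * evp α v′ → u ≡ u′ × v ≡ v′
      halves-injective u v u′ v′ eq with evp α (difference v v′) E.≟ 0#
      ... | yes z = difference-0 u u′ (free (difference u u′) (trans (evp-difference α u u′) u-u′)) , v≡v′
        where
        v≡v′ : v ≡ v′
        v≡v′ = difference-0 v v′ (free (difference v v′) z)
        u-u′ : evp α u - evp α u′ ≡ 0#
        u-u′ = trans (solve 3 (λ a b c → a :- b := (a :+ c) :- (b :+ c)) refl (evp α u) (evp α u′) (β * evp α v))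
          (trans (cong₂ _-_ eq (cong (λ z → evp α u′ + β * evp α z) v≡v′)) (-‿inverseʳ _))
      ... | no y≢0 = ⊥-elim (β∉ b value)
        where
        s = difference u′ u
        t = difference v v′
        y = evp α t
        -- Here β = s(α)/t(α). The field has N + 1 nonzero elements, so the inverse of y = t(α) is
        -- y^N, and β would be a polynomial in α.
        p = plain s ⊛ spow (plain t) N
        b : Bounded p
        b = Bounded-⊛ {plain s} {spow (plain t) N} (plain-bounded s) (spow-bounded (plain-bounded t) N)
        βy : evp α s ≡ β * y
        βy = trans (evp-difference α u′ u) (trans
          (solve 5 (λ a b c v v′ → a :- b := (a :+ c :* v′) :- (b :+ c :* v) :+ c :* (v :- v′)) refl (evp α u′) (evp α u) β (evp α v) (evp α v′))
          (trans (cong₂ _+_ (trans (cong (_- (evp α u + β * evp α v)) (sym eq)) (-‿inverseʳ _)) (cong (β *_) (sym (evp-difference α v v′)))) (+-identityˡ _)))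
        value : ev p b α ≡ β
        value = trans (ev-⊛ α {plain s} {spow (plain t) N} (plain-bounded s) (spow-bounded (plain-bounded t) N) b)
          (trans (cong₂ _*_ βy (ev-spow α (plain-bounded t) N)) (trans (*-assoc β y (y ^ N)) (trans (cong (β *_) (fermat {suc N} size y≢0)) (*-identityʳ β))))

      Φ-injective : ∀ x y → Φ x ≡ Φ y → x ≡ y
      Φ-injective x y eq = let (p , r) = halves-injective (Vec.take (suc h) x) (Vec.drop (suc h) x) (Vec.take (suc h) y) (Vec.drop (suc h) y) eq in
        trans (sym (Vecₚ.take++drop≡id (suc h) x)) (trans (cong₂ Vec._++_ p r) (Vecₚ.take++drop≡id (suc h) y))

    impossible : ⊥
    impossible = ℤₚ.<-irrefl refl (ℤₚ.<-≤-trans big (ℤₚ.≤-trans (ℤₚ.≤-reflexive (sym (Vecs-size (suc h ℕ.+ suc h)))) (injective⇒size≤ (Vecs (suc h ℕ.+ suc h)) 𝔼 Φ Φ-injective)))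
      where
      big : E.size <ᶻ Q ℤ.^ (suc h ℕ.+ suc h)
      big = subst₂ _<ᶻ_ (trans (Q^ (suc e)) (sym K-size)) (Q^ (suc h ℕ.+ suc h)) (ℤ.+<+ (ℕₚ.^-monoʳ-< q (𝔽.2≤q) (s≤s (ℕₚ.≤-trans (s≤s 2h≥e) (ℕₚ.≤-reflexive (sym (ℕₚ.+-suc h h)))))))
        where
        Q^ : ∀ n → + (q ℕ.^ n) ≡ Q ℤ.^ n
        Q^ zero    = refl
        Q^ (suc n) = trans (ℤₚ.pos-* q (q ℕ.^ n)) (cong (Q *ᶻ_) (Q^ n))

  -- A non-generator has degree at most half that of K, since F[α] is a proper subfield; the
  -- counting in `Tower` replaces multiplicativity of degrees. A polynomial of smaller degree
  -- vanishing at α is padded by a power of x to degree exactly h.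
  nonGenerator-root : ∀ {h N} → e ≤ h ℕ.+ h → + suc (suc N) ≡ E.size → ∀ α → ¬ Generator α → ∃ λ (g : Vec F h) → evm α g ≡ 0#
  nonGenerator-root {h} {N} 2h≥e size α ¬gen with Enum.search (Vecs h) (λ g → evm α g E.≟ 0#)
  ... | inj₁ found = found
  ... | inj₂ none  = ⊥-elim (¬gen generator)
    where
    free : ∀ (w : Vec F (suc h)) → evp α w ≡ 0# → plain w ≈ 𝟘
    free w z with normalise w
    ... | inj₁ e = e
    ... | inj₂ (c , c≢0 , j , s≤s j≤h , g , e) = ⊥-elim (none (product (ℕₚ.m∸n+n≡m j≤h) (zeros (h ∸ j)) g)
            (trans (evm-product 𝔎 α (ℕₚ.m∸n+n≡m j≤h) (zeros (h ∸ j)) g) (trans (cong (evm α (zeros (h ∸ j)) *_) (scaledRoot α w g c c≢0 e z)) (zeroʳ _))))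
    generator : Generator α
    generator v z with Enum._≟_ (Vecs (suc e)) v (zeros (suc e))
    ... | yes v≡0 = v≡0
    ... | no v≢0 = ⊥-elim (Tower.impossible α 2h≥e size free β (λ {p} b hit → β∉ (proj₁ (attained b)) (trans (proj₂ (attained b)) hit)))
      where
      killed : ∃ λ r → r < suc e × ∃ λ (g : Vec F r) → evm α g ≡ 0#
      killed = monicRoot α v (λ h → v≢0 (plain-injective v (zeros (suc e)) (λ i → trans (h i) (sym (plain-zeros (suc e) i))))) z
      attained : ∀ {p} (b : Bounded p) → ∃ λ (w : Vec F (suc e)) → evp α w ≡ ev p b α
      attained {p} b with killed
      ... | r , r<d , g , root = let (s , cong-s) = remainder {P = g} p b
                                     w = truncate (suc e) (plain s)
                                 in w , trans (ev-≈ α (plain-bounded w) (plain-bounded s) (plain-truncate (suc e) (Deg<-weaken (ℕₚ.<⇒≤ r<d) (plain-deg s))))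
                                              (sym (ev-≋ α g root b (plain-bounded s) cong-s))
      -- A surjective evaluation would have an injective section, which is then onto and hits both v and 0.
      missed : ∃ λ β → ∀ w → evp α w ≢ β
      missed with E.search (λ β → Dec.¬? (Enum.any? (Vecs (suc e)) (λ w → evp α w E.≟ β)))
      ... | inj₁ (β , n) = β , (λ w h → n (w , h))
      ... | inj₂ all = ⊥-elim (v≢0 (trans (sym (proj₂ (onto v))) (trans (cong section same) (proj₂ (onto (zeros (suc e)))))))
        where
        hit : ∀ β → ∃ λ w → evp α w ≡ β
        hit β = Dec.decidable-stable (Enum.any? (Vecs (suc e)) (λ w → evp α w E.≟ β)) (all β)
        section : K → Vec F (suc e)
        section β = proj₁ (hit β)
        onto : ∀ w → ∃ λ β → section β ≡ w
        onto = injective⇒surjective 𝔼 (Vecs (suc e)) (trans K-size (sym (Vecs-size (suc e)))) section (λ β β′ h → trans (sym (proj₂ (hit β))) (trans (cong (evp α) h) (proj₂ (hit β′))))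
        value : ∀ w → evp α w ≡ proj₁ (onto w)
        value w = trans (cong (evp α) (sym (proj₂ (onto w)))) (proj₂ (hit (proj₁ (onto w))))
        same : proj₁ (onto v) ≡ proj₁ (onto (zeros (suc e)))
        same = trans (sym (value v)) (trans (trans z (sym (evs-0 α (suc e) (plain-zeros (suc e))))) (value (zeros (suc e))))
      β = proj₁ missed
      β∉ = proj₂ missed

  -- Every non-generator is a root of one of the q^h monic polynomials of degree h, and each of
  -- these has at most h roots.
  nonGenerators≤ : ∀ {h N} → e ≤ h ℕ.+ h → + suc (suc N) ≡ E.size → E.sum (λ α → ⟦ Dec.¬? (generator? α) ⟧) ≤ᶻ Q ℤ.^ h *ᶻ + h
  nonGenerators≤ {h} 2h≥e size = ℤₚ.≤-trans (∑-mono E.list {g = λ α → Enum.sum (Vecs h) (λ g → ⟦ evm α g E.≟ 0# ⟧)} bound)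
    (ℤₚ.≤-trans (ℤₚ.≤-reflexive (∑-swap E.list (Enum.list (Vecs h)) _))
    (ℤₚ.≤-trans (∑-mono (Enum.list (Vecs h)) (λ g → roots-evm≤degree g))
      (ℤₚ.≤-reflexive (trans (Enum.sum-*1 (Vecs h) (+ h)) (cong (_*ᶻ + h) (Vecs-size h))))))
    where
    bound : ∀ α → ⟦ Dec.¬? (generator? α) ⟧ ≤ᶻ Enum.sum (Vecs h) (λ g → ⟦ evm α g E.≟ 0# ⟧)
    bound α with generator? α
    ... | yes _ = ∑-nonneg (Enum.list (Vecs h)) (λ g → ⟦⟧-nonneg (evm α g E.≟ 0#))
    ... | no ¬gen = let (g₀ , root) = nonGenerator-root 2h≥e size α ¬gen in
      subst (_≤ᶻ Enum.sum (Vecs h) (λ g → ⟦ evm α g E.≟ 0# ⟧)) (Enum.once (Vecs h) g₀)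
        (∑-mono (Enum.list (Vecs h)) (λ g → ⟦⟧-mono (Enum._≟_ (Vecs h) g g₀) (evm α g E.≟ 0#) (λ { refl → root })))

  -- The monic multiples of the minimal polynomial R of α, indexed by the cofactor.
  module MinPolyMultiples {α : K} (gen : Generator α) (R : Vec F (suc e)) (rootR : evm α R ≡ 0#) {l : ℕ} where
    private
      cofactor : ∀ {m} → suc e ℕ.+ l ≡ m → Vec F m → Vec F l
      cofactor refl f = proj₁ (monic-division R f)

      exact : ∀ (f : Vec F (suc e ℕ.+ l)) (C : Vec F l) (r : Vec F (suc e)) → mon f ≈ mon R ⊛ mon C ⊕ plain r → evm α f ≡ 0# → R ⊗ C ≡ f
      exact f C r h root = mon-injective (R ⊗ C) f (λ i → trans (mon-⊗ R C i) (sym (trans (h i) (trans (cong (λ z → (mon R ⊛ mon C) i 𝔽.+ z) (r≈0 i)) (𝔽.+-identityʳ _)))))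
        where
        r≈0 : plain r ≈ 𝟘
        r≈0 = minimal gen (plain-bounded r) (plain-deg r) (trans (sym (ev-≋ α R rootR (mon-bounded f) (plain-bounded r) (congruent (mon C) (mon-bounded C) h))) root)

      cofactor-product : ∀ {m} (eq : suc e ℕ.+ l ≡ m) (f : Vec F m) → evm α f ≡ 0# → product eq R (cofactor eq f) ≡ f
      cofactor-product refl f root = exact f (proj₁ (monic-division R f)) (proj₁ (proj₂ (monic-division R f))) (proj₂ (proj₂ (monic-division R f))) root

    evm-multiple : ∀ {m} (eq : suc e ℕ.+ l ≡ m) C → evm α (product eq R C) ≡ 0#
    evm-multiple eq C = trans (evm-product 𝔎 α eq R C) (trans (cong (_* evm α C) rootR) (zeroˡ _))

    sum-multiples : ∀ {m} (eq : suc e ℕ.+ l ≡ m) (φ : Vec F m → ℤ) →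
                    Enum.sum (Vecs m) (λ f → ⟦ evm α f E.≟ 0# ⟧ *ᶻ φ f) ≡ Enum.sum (Vecs l) (λ C → φ (product eq R C))
    sum-multiples {m} eq φ = trans (∑-bij (Vecs m) (Vecs l) (λ f → evm α f E.≟ 0#) (λ _ → yes tt) (cofactor eq) (product eq R)
        (λ f root → tt , cofactor-product eq f root)
        (λ C _ → evm-multiple eq C , product-injective eq R (cofactor eq (product eq R C)) C (cofactor-product eq (product eq R C) (evm-multiple eq C))) φ)
      (∑-cong (Enum.list (Vecs l)) (λ C → ℤₚ.*-identityˡ (φ (product eq R C))))

    count-multiples : ∀ {m} → suc e ℕ.+ l ≡ m → Enum.sum (Vecs m) (λ f → ⟦ evm α f E.≟ 0# ⟧) ≡ Q ℤ.^ l
    count-multiples {m} eq = trans (∑-cong (Enum.list (Vecs m)) (λ f → sym (ℤₚ.*-identityʳ ⟦ evm α f E.≟ 0# ⟧))) (trans (sum-multiples eq (λ _ → 1ℤ)) (Vecs-size l))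

-- The field F[x]/(P) for irreducible P

module Extension (𝔽 : FiniteField) {e : ℕ} (P : Vec (FiniteField.F 𝔽) (suc e)) where
  private
    module 𝔽 = FieldFacts 𝔽
    module 𝔽E = Sums.Enum 𝔽.F-Enum
  open FiniteField 𝔽 using (F)
  open Sums
  open Characteristic 𝔽
  open Polynomials 𝔽 hiding (solve; _:+_; _:*_; :-_; _:-_; _:=_; con)
  open MatrixFacts 𝔽 using (Tr-similar; Mat; _*ᴹ_; _≡ᴹ_; Iᴹ; Σᶠ; Σᶠ-cong)
  open Quotient 𝔽 P public
  open AlgebraFacts algebra public
  open QuotientTrace 𝔽 P public using (tr; tr-+; tr-⌊⌋; tr-formula; δ; top; mulMat; mulMat-^; mulMat-apply; functional-expand; X^-I; coordinate-+; coordinate-⌊⌋)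

  Vecs : (m : ℕ) → Enum (Vec F m)
  Vecs = Vec-Enum 𝔽.F-Enum

  K-Enum : Enum K
  K-Enum = Vecs (suc e)

  module E = Enum K-Enum

  Vecs-size : ∀ m → Enum.size (Vecs m) ≡ Q ℤ.^ m
  Vecs-size m = Vec-size 𝔽.F-Enum m

  Prime : Set
  Prime = ∀ a b → a * b ≡ 0# → a ≡ 0# ⊎ b ≡ 0#

  prime? : Dec Prime
  prime? = E.all? (λ a → E.all? (λ b → (a * b E.≟ 0#) →-dec ((a E.≟ 0#) ⊎-dec (b E.≟ 0#))))

  1≢0 : 1# ≢ 0#
  1≢0 h = 𝔽.0≢1 (sym (trans (sym (X^-plain {0} (s≤s z≤n) 0)) (trans (plain-cong h 0) (plain-0 0))))

  evp-+ : ∀ α v w → evp α (v + w) ≡ evp α v + evp α w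
  evp-+ α v w = trans (ev-≈ α (plain-bounded (v + w)) b (plain-+ v w)) (ev-⊕ α (plain-bounded v) (plain-bounded w) b)
    where b = Bounded-⊕ (plain-bounded v) (plain-bounded w)

  evp-⌊⌋ : ∀ α c v → evp α (⌊ c ⌋ * v) ≡ ⌊ c ⌋ * evp α v
  evp-⌊⌋ α c v = trans (evs-cong α (suc e) (plain-⌊⌋* c v)) (evs-∙ α (suc e) c (plain v))

  module _ (prime : Prime) {α : K} (gen : Generators.Generator algebra K-Enum prime 1≢0 {e} (Vecs-size (suc e)) α) where
    open Generators algebra K-Enum prime 1≢0 {e} (Vecs-size (suc e)) using (evp-injective; evp-surjective)
    -- Evaluation at α identifies F[x]/(R) with K, where R is the minimal polynomial of α, and hence the two traces.
    τ-root : ∀ k (R : Vec F (suc e)) → evm α R ≡ 0# → PowerSums.τ 𝔽 k R ≡ tr (α ^ k)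
    τ-root k R root = trans (sym (PowerSums.τ-companion 𝔽 k R)) (trans
      (Tr-similar M M′ (T.mulMat A.X) (mulMat α) intertwine left right k)
      (MatrixFacts.Tr-cong 𝔽 (mulMat-^ α k)))
      where
      module A = PowerSums.A 𝔽 R
      module T = PowerSums.T 𝔽 R
      θ : Vec F (suc e) → K
      θ = evp α
      θ⁻ : K → Vec F (suc e)
      θ⁻ y = proj₁ (evp-surjective gen y)
      θθ⁻ : ∀ y → θ (θ⁻ y) ≡ y
      θθ⁻ y = proj₂ (evp-surjective gen y)
      θ⁻θ : ∀ v → θ⁻ (θ v) ≡ v
      θ⁻θ v = evp-injective gen (θ⁻ (θ v)) v (θθ⁻ (θ v))
      θ-X^ : ∀ j → θ (A.X A.^ j) ≡ α ^ j
      θ-X^ j = trans (ev-≋ α R root (plain-bounded (A.X A.^ j)) b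
          (subst (λ v → plain v ≋ mono 𝔽.1# j [ R ]) (trans (A.ev-mono A.X 𝔽.1# j b) (trans (cong (λ z → z A.* A.X A.^ j) A.⌊⌋-1) (A.*-identityˡ (A.X A.^ j)))) (A.plain-ev b)))
        (trans (ev-mono α 𝔽.1# j b) (trans (cong (_* α ^ j) ⌊⌋-1) (*-identityˡ (α ^ j))))
        where
        b : Bounded (mono 𝔽.1# j)
        b = suc j , mono-deg 𝔽.1# j
      M M′ : Mat (suc e)
      M i j = plain (α ^ toℕ j) (toℕ i)
      M′ i j = plain (θ⁻ (X ^ toℕ j)) (toℕ i)
      apply : ∀ v i → Σᶠ {suc e} (λ l → plain (α ^ toℕ l) i 𝔽.* plain v (toℕ l)) ≡ plain (θ v) i
      apply v i = sym (trans (cong (λ z → plain z i) (sym (*-identityˡ (θ v)))) (trans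
        (functional-ev α (λ y → plain y i) (coordinate-+ i) (coordinate-⌊⌋ i) v 1#)
        (Σᶠ-cong {suc e} (λ l → trans (𝔽.*-comm (plain v (toℕ l)) _) (cong (λ z → plain z i 𝔽.* plain v (toℕ l)) (*-identityˡ (α ^ toℕ l)))))))
      θ⁻-+ : ∀ x y i → plain (θ⁻ (x + y)) i ≡ plain (θ⁻ x) i 𝔽.+ plain (θ⁻ y) i
      θ⁻-+ x y i = trans (plain-cong (evp-injective gen (θ⁻ (x + y)) (θ⁻ x + θ⁻ y) (trans (θθ⁻ (x + y)) (sym (trans (evp-+ α (θ⁻ x) (θ⁻ y)) (cong₂ _+_ (θθ⁻ x) (θθ⁻ y)))))) i) (plain-+ (θ⁻ x) (θ⁻ y) i)
      θ⁻-⌊⌋ : ∀ c x i → plain (θ⁻ (⌊ c ⌋ * x)) i ≡ c 𝔽.* plain (θ⁻ x) i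
      θ⁻-⌊⌋ c x i = trans (plain-cong (evp-injective gen (θ⁻ (⌊ c ⌋ * x)) (⌊ c ⌋ * θ⁻ x) (trans (θθ⁻ (⌊ c ⌋ * x)) (sym (trans (evp-⌊⌋ α c (θ⁻ x)) (cong (⌊ c ⌋ *_) (θθ⁻ x)))))) i) (plain-⌊⌋* c (θ⁻ x) i)
      apply⁻ : ∀ y i → Σᶠ {suc e} (λ l → plain (θ⁻ (X ^ toℕ l)) i 𝔽.* plain y (toℕ l)) ≡ plain (θ⁻ y) i
      apply⁻ y i = sym (trans (cong (λ z → plain (θ⁻ z) i) (sym (*-identityˡ y))) (trans
        (functional-expand (λ x → plain (θ⁻ x) i) (λ x x′ → θ⁻-+ x x′ i) (λ c x → θ⁻-⌊⌋ c x i) 1# y)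
        (Σᶠ-cong {suc e} (λ l → cong (λ z → plain (θ⁻ z) i 𝔽.* plain y (toℕ l)) (*-identityˡ (X ^ toℕ l))))))
      intertwine : (M *ᴹ T.mulMat A.X) ≡ᴹ (mulMat α *ᴹ M)
      intertwine i j = trans (apply (A.X A.* A.X A.^ toℕ j) (toℕ i)) (trans (plain-cong (θ-X^ (suc (toℕ j))) (toℕ i)) (mulMat-apply α (α ^ toℕ j) (toℕ i)))
      left : (M′ *ᴹ M) ≡ᴹ Iᴹ
      left i j = trans (apply⁻ (α ^ toℕ j) (toℕ i)) (trans (plain-cong (trans (cong θ⁻ (sym (θ-X^ (toℕ j)))) (θ⁻θ (A.X A.^ toℕ j))) (toℕ i)) (T.X^-I i j))
      right : (M *ᴹ M′) ≡ᴹ Iᴹ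
      right i j = trans (apply (θ⁻ (X ^ toℕ j)) (toℕ i)) (trans (plain-cong (θθ⁻ (X ^ toℕ j)) (toℕ i)) (X^-I i j))

-- The interface to the field with q^{e+1} elements, which hides the polynomial that presents it.
-- `c₁` witnesses that the trace is onto, and `τ-root` turns the power sum of a minimal polynomial
-- into a trace.
record FieldExtension (𝔽 : FiniteField) : Set₁ where
  no-eta-equality
  field
    e : ℕ
    𝔎 : Algebra 𝔽
    𝔼 : Sums.Enum (Algebra.K 𝔎)
    zeroDivisors : ∀ a b → Algebra._*_ 𝔎 a b ≡ Algebra.0# 𝔎 → a ≡ Algebra.0# 𝔎 ⊎ b ≡ Algebra.0# 𝔎
    1≢0 : Algebra.1# 𝔎 ≢ Algebra.0# 𝔎
    K-size : Sums.Enum.size 𝔼 ≡ (+ FiniteField.q 𝔽) ℤ.^ suc e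
    tr : Algebra.K 𝔎 → FiniteField.F 𝔽
    tr-+ : ∀ a b → tr (Algebra._+_ 𝔎 a b) ≡ FiniteField._+_ 𝔽 (tr a) (tr b)
    tr-⌊⌋ : ∀ c a → tr (Algebra._*_ 𝔎 (Algebra.⌊_⌋ 𝔎 c) a) ≡ FiniteField._*_ 𝔽 c (tr a)
    c₁ : Algebra.K 𝔎
    tr-c₁ : tr c₁ ≡ FiniteField.1# 𝔽
    τ-root : ∀ {α} → Generators.Generator 𝔎 𝔼 zeroDivisors 1≢0 {e} K-size α → ∀ k (R : Vec (FiniteField.F 𝔽) (suc e)) →
             AlgebraFacts.evm 𝔎 α R ≡ Algebra.0# 𝔎 → RootPowerSums.τ 𝔽 k R ≡ tr (AlgebraFacts._^_ 𝔎 α k)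

module _ (𝔽 : FiniteField) {e : ℕ} (P : Vec (FiniteField.F 𝔽) (suc e)) where
  open Extension 𝔽 P
  open Polynomials 𝔽 using (mono-top; mon; mon-deg; mon-bounded)
  open Derivative 𝔽 using (der; der-deg; der-bounded)

  -- Since P′ ≠ 0 has degree below that of P, its class δ is invertible. By Euler's formula the
  -- trace of δ⁻¹ X^e is the top coefficient of X^e, namely 1.
  fieldExtension : (prime : Prime) → (∃ λ i → der (mon P) i ≢ FiniteField.0# 𝔽) → ∃ λ (L : FieldExtension 𝔽) → FieldExtension.e L ≡ e
  fieldExtension prime (i , der≢0) = record
    { e = e ; 𝔎 = algebra ; 𝔼 = K-Enum ; zeroDivisors = prime ; 1≢0 = 1≢0 ; K-size = Vecs-size (suc e)
    ; tr = tr ; tr-+ = tr-+ ; tr-⌊⌋ = tr-⌊⌋ ; c₁ = δ⁻ * X ^ e ; tr-c₁ = value ; τ-root = λ gen k R root → trans (RootPowerSums.τ-sealed 𝔽 k R) (τ-root prime gen k R root) } , refl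
    where
    δ≢0 : δ ≢ 0#
    δ≢0 δ≡0 = der≢0 (trans (sym (ev-X-small (der-bounded (mon-bounded P)) (der-deg (mon-deg P)) i)) (trans (plain-cong δ≡0 i) (plain-0 i)))
    δ⁻ : K
    δ⁻ = proj₁ (Domain.inverse algebra K-Enum prime 1≢0 δ δ≢0)
    value : tr (δ⁻ * X ^ e) ≡ FiniteField.1# 𝔽
    value = trans (tr-formula (δ⁻ * X ^ e)) (trans (plain-cong (trans (sym (*-assoc δ δ⁻ (X ^ e)))
      (trans (cong (_* X ^ e) (proj₂ (Domain.inverse algebra K-Enum prime 1≢0 δ δ≢0))) (*-identityˡ (X ^ e)))) e)
      (trans (X^-plain (ℕₚ.n<1+n e) e) (mono-top (FiniteField.1# 𝔽) e)))

-- Prime polynomials and factorisation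

module PrimePolynomials (𝔽 : FiniteField) where
  open FieldFacts 𝔽 hiding (solve; _:+_; _:*_; :-_; _:-_; _:=_; con)
  open Polynomials 𝔽
  open PolynomialDivision 𝔽
  open Sums using (Enum; Vec-Enum)

  private
    Vecs : (m : ℕ) → Enum (Vec F m)
    Vecs = Vec-Enum F-Enum

  -- Primality instead of irreducibility: it says that the quotient ring has no zero divisors, and
  -- it is Euclid's lemma outright. The passage from irreducibility is `¬prime⇒reducible`.
  Prime : ∀ {e} → Vec F (suc e) → Set
  Prime P = ∀ p r → Bounded p → Bounded r → p ⊛ r ≋ 𝟘 [ P ] → p ≋ 𝟘 [ P ] ⊎ r ≋ 𝟘 [ P ]

  private
    module Ext {e} (P : Vec F (suc e)) where
      open Extension 𝔽 P using (X; ev; evp-X; evm-X; plain-ev; plain-cong; plain-0; ev-≋; ev-⊛) renaming (0# to 0ᴷ; _*_ to _*ᴷ_)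

      zero⇒≋ : ∀ {p} (b : Bounded p) → ev p b X ≡ 0ᴷ → p ≋ 𝟘 [ P ]
      zero⇒≋ {p} b h = ≋-trans (≋-sym (plain-ev b)) (≈⇒≋ (λ i → trans (plain-cong h i) (plain-0 i)))

      ≋⇒zero : ∀ {p} (b : Bounded p) → p ≋ 𝟘 [ P ] → ev p b X ≡ 0ᴷ
      ≋⇒zero {p} b h = trans (ev-≋ X P evm-X b Bounded-𝟘 h) refl

      to : Extension.Prime 𝔽 P → Prime P
      to prime p r bp br h = split (prime (ev p bp X) (ev r br X) (trans (sym (ev-⊛ X {p} {r} bp br b)) (≋⇒zero b h)))
        where
        b : Bounded (p ⊛ r)
        b = Bounded-⊛ {p} {r} bp br
        split : ev p bp X ≡ 0ᴷ ⊎ ev r br X ≡ 0ᴷ → p ≋ 𝟘 [ P ] ⊎ r ≋ 𝟘 [ P ]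
        split (inj₁ z) = inj₁ (zero⇒≋ bp z)
        split (inj₂ z) = inj₂ (zero⇒≋ br z)

      from : Prime P → Extension.Prime 𝔽 P
      from prime a b h = split (prime (plain a) (plain b) (plain-bounded a) (plain-bounded b) (zero⇒≋ bb (trans (ev-⊛ X {plain a} {plain b} (plain-bounded a) (plain-bounded b) bb) (trans (cong₂ _*ᴷ_ (evp-X a) (evp-X b)) h))))
        where
        bb : Bounded (plain a ⊛ plain b)
        bb = Bounded-⊛ {plain a} {plain b} (plain-bounded a) (plain-bounded b)
        zeroV : ∀ v → plain v ≋ 𝟘 [ P ] → v ≡ 0ᴷ
        zeroV v k = ≋⇒≡ {P = P} {v} {0ᴷ} (≋-trans k (≈⇒≋ (λ i → sym (plain-0 i))))
        split : plain a ≋ 𝟘 [ P ] ⊎ plain b ≋ 𝟘 [ P ] → a ≡ 0ᴷ ⊎ b ≡ 0ᴷ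
        split (inj₁ z) = inj₁ (zeroV a z)
        split (inj₂ z) = inj₂ (zeroV b z)

  prime? : ∀ {e} (P : Vec F (suc e)) → Dec (Prime P)
  prime? P = Dec.map′ (Ext.to P) (Ext.from P) (Extension.prime? 𝔽 P)

  Prime⇒domain : ∀ {e} (P : Vec F (suc e)) → Prime P → Extension.Prime 𝔽 P
  Prime⇒domain = Ext.from

  small≋0⇒≈0 : ∀ {d} (P : Vec F d) {p} → Deg< d p → p ≋ 𝟘 [ P ] → p ≈ 𝟘
  small≋0⇒≈0 {d} P {p} h (congruent w bw eq) i = trans (eq i) (trans (+-identityʳ _) (trans (⊛-cong {mon P} {mon P} (≈-refl {mon P}) w≈0 i) (trans (⊛-comm (mon P) 𝟘 i) (⊛-zeroˡ (mon P) i))))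
    where
    w≈0 : w ≈ 𝟘
    w≈0 = ⊛-small⇒0 P bw h (λ i → trans (sym (+-identityʳ _)) (sym (eq i)))

  mon≋̸0 : ∀ {d m} (P : Vec F d) (A : Vec F m) → m < d → ¬ mon A ≋ 𝟘 [ P ]
  mon≋̸0 {m = m} P A m<d h = 0≢1 (trans (sym (small≋0⇒≈0 P (Deg<-weaken m<d (mon-deg A)) h m)) (mon-top A))

  infix 4 _∣ᵖ_
  record _∣ᵖ_ {d m} (P : Vec F d) (f : Vec F m) : Set where
    constructor divides
    field
      {codegree} : ℕ
      degrees    : d ℕ.+ codegree ≡ m
      cofactor   : Vec F codegree
      factors    : f ≡ product degrees P cofactor

  ∣⇒≋ : ∀ {d m} {P : Vec F d} {f : Vec F m} → P ∣ᵖ f → mon f ≋ 𝟘 [ P ]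
  ∣⇒≋ {P = P} (divides degrees Q refl) = congruent (mon Q) (mon-bounded Q) (λ i → trans (mon-product degrees P Q i) (sym (+-identityʳ _)))

  exact-division : ∀ {d l} (P : Vec F d) (f : Vec F (d ℕ.+ l)) → mon f ≋ 𝟘 [ P ] → f ≡ P ⊗ proj₁ (monic-division P f)
  exact-division P f h = mon-injective f (P ⊗ C) (λ i → trans (eq i) (trans (cong (λ z → (mon P ⊛ mon C) i + z) (r≈0 i)) (trans (+-identityʳ _) (sym (mon-⊗ P C i)))))
    where
    C = proj₁ (monic-division P f)
    r = proj₁ (proj₂ (monic-division P f))
    eq = proj₂ (proj₂ (monic-division P f))
    r≈0 : plain r ≈ 𝟘
    r≈0 = small≋0⇒≈0 P (plain-deg r) (≋-trans (≋-sym (congruent (mon C) (mon-bounded C) eq)) h)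

  ≋⇒∣ : ∀ {d m} {P : Vec F d} {f : Vec F m} → mon f ≋ 𝟘 [ P ] → P ∣ᵖ f
  ≋⇒∣ {d} {m} {P} {f} h = go (d ℕ.≤? m)
    where
    build : ∀ {m l} (eq : d ℕ.+ l ≡ m) (f : Vec F m) → mon f ≋ 𝟘 [ P ] → P ∣ᵖ f
    build refl f h = divides refl _ (exact-division P f h)
    go : Dec (d ≤ m) → P ∣ᵖ f
    go (yes d≤m) = build (ℕₚ.m+[n∸m]≡n d≤m) f h
    go (no d≰m)  = ⊥-elim (mon≋̸0 P f (ℕₚ.≰⇒> d≰m) h)

  _∣ᵖ?_ : ∀ {d m} (P : Vec F d) (f : Vec F m) → Dec (P ∣ᵖ f)
  _∣ᵖ?_ {d} {m} P f with d ℕ.≤? m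
  ... | no d≰m = no (λ { (divides {l} eq Q _) → d≰m (ℕₚ.≤-trans (ℕₚ.m≤m+n d l) (ℕₚ.≤-reflexive eq)) })
  ... | yes d≤m = Dec.map′ (λ (Q , h) → divides (ℕₚ.m+[n∸m]≡n d≤m) Q h) back (Enum.any? (Vecs (m ∸ d)) (λ Q → Enum._≟_ (Vecs m) f (product (ℕₚ.m+[n∸m]≡n d≤m) P Q)))
    where
    align : ∀ {l l′} (eq : d ℕ.+ l ≡ m) (eq′ : d ℕ.+ l′ ≡ m) (Q : Vec F l) → f ≡ product eq P Q → ∃ λ (Q′ : Vec F l′) → f ≡ product eq′ P Q′
    align {l} {l′} eq eq′ Q h with ℕₚ.+-cancelˡ-≡ d l l′ (trans eq (sym eq′))
    ... | refl with ℕₚ.≡-irrelevant eq eq′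
    ...   | refl = Q , h
    back : P ∣ᵖ f → ∃ λ Q → f ≡ product (ℕₚ.m+[n∸m]≡n d≤m) P Q
    back (divides eq Q h) = align eq (ℕₚ.m+[n∸m]≡n d≤m) Q h

  euclid : ∀ {e a b m} {P : Vec F (suc e)} → Prime P → (eq : a ℕ.+ b ≡ m) (A : Vec F a) (B : Vec F b) → P ∣ᵖ product eq A B → P ∣ᵖ A ⊎ P ∣ᵖ B
  euclid {P = P} prime eq A B h = split (prime (mon A) (mon B) (mon-bounded A) (mon-bounded B) (≋-trans (≈⇒≋ (≈-sym (mon-product eq A B))) (∣⇒≋ h)))
    where
    split : mon A ≋ 𝟘 [ P ] ⊎ mon B ≋ 𝟘 [ P ] → P ∣ᵖ A ⊎ P ∣ᵖ B
    split (inj₁ z) = inj₁ (≋⇒∣ z)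
    split (inj₂ z) = inj₂ (≋⇒∣ z)

  -- Equality of polynomials whose degrees agree only up to a proof.
  record _≅_ {d d′} (P : Vec F d) (P′ : Vec F d′) : Set where
    constructor same
    field
      degree-≡ : d ≡ d′
      vec-≡    : subst (Vec F) degree-≡ P ≡ P′
  private
    product-[] : ∀ {d m} (eq : d ℕ.+ 0 ≡ m) (P : Vec F d) → P ≅ product eq P []
    product-[] {d} eq P = go (trans (sym (ℕₚ.+-identityʳ d)) eq) (product eq P []) (λ i → trans (mon-product eq P [] i) (trans (⊛-comm (mon P) (mon []) i) (trans (⊛-cong {g = mon P} {mon P} one (≈-refl {mon P}) i) (⊛-identityˡ (mon P) i))))
      where
      one : mon [] ≈ 𝟙
      one zero    = refl
      one (suc i) = refl
      go : ∀ {m} → d ≡ m → (f : Vec F m) → mon f ≈ mon P → P ≅ f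
      go refl f h = same refl (mon-injective P f (≈-sym h))

  -- If the cofactor is not constant, both factors have smaller degree than P, so P divides neither
  -- of them although it divides their product.
  prime-∣-prime : ∀ {e e′} {P : Vec F (suc e)} {P′ : Vec F (suc e′)} → Prime P → P′ ∣ᵖ P → P′ ≅ P
  prime-∣-prime {P = P} {P′} prime (divides {zero} eq [] refl) = product-[] eq P′
  prime-∣-prime {e} {e′} {P} {P′} prime (divides {suc l} eq Q h) = ⊥-elim (split (prime (mon P′) (mon Q) (mon-bounded P′) (mon-bounded Q)
      (≋-trans (≈⇒≋ (λ i → trans (sym (mon-product eq P′ Q i)) (cong (λ f → mon f i) (sym h)))) (≋-modulus {P = P}))))
    where
    split : mon P′ ≋ 𝟘 [ P ] ⊎ mon Q ≋ 𝟘 [ P ] → ⊥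
    split (inj₁ z) = mon≋̸0 P P′ (ℕₚ.≤-trans (ℕₚ.m<m+n (suc e′) (s≤s z≤n)) (ℕₚ.≤-reflexive eq)) z
    split (inj₂ z) = mon≋̸0 P Q (ℕₚ.≤-trans (ℕₚ.m<n+m (suc l) (s≤s z≤n)) (ℕₚ.≤-reflexive eq)) z

  record Reducible {e} (P : Vec F (suc e)) : Set where
    constructor reducible
    field
      {deg₁ deg₂} : ℕ
      degrees     : suc deg₁ ℕ.+ suc deg₂ ≡ suc e
      factor₁     : Vec F (suc deg₁)
      factor₂     : Vec F (suc deg₂)
      factors     : P ≡ product degrees factor₁ factor₂

  private
    -- Euclid's algorithm: a zero divisor modulo P of least degree divides P.
    factor : ∀ {e} (P : Vec F (suc e)) (b : Vec F (suc e)) → ¬ plain b ≈ 𝟘 → ∀ fuel {n} (w : Vec F n) → n ≤ fuel → n ≤ suc e →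
             ¬ plain w ≈ 𝟘 → plain w ⊛ plain b ≋ 𝟘 [ P ] → Reducible P
    factor P b b≢0 zero {zero} [] n≤ n≤e w≢0 h = ⊥-elim (w≢0 (λ _ → refl))
    factor {e} P b b≢0 (suc fuel) {n} w n≤ n≤e w≢0 h = go (normalise w)
      where
      unscale : ∀ {j} c → c ≢ 0# → (g : Vec F j) → plain w ≈ c ∙ mon g → mon g ⊛ plain b ≋ 𝟘 [ P ]
      unscale c c≢0 g eq = ≋-trans (≈⇒≋ (λ i → sym (scaled i)))
          (≋-trans (≋-⊛ˡ (mono (inv c) 0) (1 , mono-deg (inv c) 0) h) (≈⇒≋ (λ i → trans (⊛-comm (mono (inv c) 0) 𝟘 i) (⊛-zeroˡ (mono (inv c) 0) i))))
        where
        scaled : ∀ i → (mono (inv c) 0 ⊛ (plain w ⊛ plain b)) i ≡ (mon g ⊛ plain b) i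
        scaled i = begin
          (mono (inv c) 0 ⊛ (plain w ⊛ plain b)) i  ≡⟨ mono-0-⊛ (inv c) (plain w ⊛ plain b) i ⟩
          inv c * (plain w ⊛ plain b) i             ≡⟨ cong (inv c *_) (trans (⊛-cong {g = plain b} {plain b} eq (≈-refl {plain b}) i) (∙-⊛ c (mon g) (plain b) i)) ⟩
          inv c * (c * (mon g ⊛ plain b) i)         ≡⟨ *-assoc (inv c) c _ ⟨
          inv c * c * (mon g ⊛ plain b) i           ≡⟨ cong (_* (mon g ⊛ plain b) i) (trans (*-comm (inv c) c) (*-inv c≢0)) ⟩
          1# * (mon g ⊛ plain b) i                  ≡⟨ *-identityˡ _ ⟩
          (mon g ⊛ plain b) i                       ∎
          where open ≡-Reasoning
      constant : (g : Vec F 0) → mon g ⊛ plain b ≋ 𝟘 [ P ] → ⊥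
      constant [] k = b≢0 (small≋0⇒≈0 P (plain-deg b) (≋-trans (≈⇒≋ (λ i → sym (trans (⊛-cong {g = plain b} {plain b} one (≈-refl {plain b}) i) (⊛-identityˡ (plain b) i)))) k))
        where
        one : mon [] ≈ 𝟙
        one zero    = refl
        one (suc i) = refl
      divide : ∀ {j l} → suc j ≤ fuel → suc j ≤ suc e → (eq : suc j ℕ.+ suc l ≡ suc e) (g : Vec F (suc j)) → mon g ⊛ plain b ≋ 𝟘 [ P ] → Reducible P
      divide {j} {l} j≤ j≤e eq g k = decide (search r)
        where
        P′ : Vec F (suc j ℕ.+ suc l)
        P′ = subst (Vec F) (sym eq) P
        mon-P′ : mon P′ ≈ mon P
        mon-P′ i = transport (sym eq) P i
          where
          transport : ∀ {a b} (q : a ≡ b) (v : Vec F a) → ∀ i → mon (subst (Vec F) q v) i ≡ mon v i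
          transport refl v i = refl
        C = proj₁ (monic-division g P′)
        r = proj₁ (proj₂ (monic-division g P′))
        division-eq : mon P ≈ mon g ⊛ mon C ⊕ plain r
        division-eq i = trans (sym (mon-P′ i)) (proj₂ (proj₂ (monic-division g P′)) i)
        search : (v : Vec F (suc j)) → Dec (v ≡ zeros (suc j))
        search v = Enum._≟_ (Vecs (suc j)) v (zeros (suc j))
        -- As r = P - g C, the product r b vanishes modulo P because g b does. Either r = 0 and g
        -- divides P, or r is a zero divisor of smaller degree.
        rb : plain r ⊛ plain b ≋ 𝟘 [ P ]
        rb = ≋-trans (≈⇒≋ expand) (≋-trans (≋-⊕ {P = P} {mon P ⊛ plain b} {𝟘 ⊛ plain b} (≋-⊛ʳ (plain b) (plain-bounded b) (≋-modulus {P = P}))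
            (≋-⊝ {P = P} (≋-⊛ʳ (mon C) (mon-bounded C) k)))
            (≈⇒≋ (λ i → trans (cong₂ (λ x y → x - y) (⊛-zeroˡ (plain b) i) (⊛-zeroˡ (mon C) i)) (-‿inverseʳ 0#))))
          where
          expand : plain r ⊛ plain b ≈ mon P ⊛ plain b ⊕ ⊝ (mon g ⊛ plain b ⊛ mon C)
          expand i = trans (sym (identity i)) (cong (λ z → z - (mon g ⊛ plain b ⊛ mon C) i) (⊛-cong {mon g ⊛ mon C ⊕ plain r} {mon P} {plain b} {plain b} (≈-sym division-eq) (≈-refl {plain b}) i))
            where
            identity : (mon g ⊛ mon C ⊕ plain r) ⊛ plain b ⊕ ⊝ (mon g ⊛ plain b ⊛ mon C) ≈ plain r ⊛ plain b
            identity = RingIdentities.drop-multiple Series-commutativeRing (mon g) (mon C) (plain r) (plain b)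
        decide : Dec (r ≡ zeros (suc j)) → Reducible P
        decide (yes r≡0) = finish eq C (λ i → trans (division-eq i) (trans (cong (λ z → (mon g ⊛ mon C) i + z) (trans (cong (λ v → plain v i) r≡0) (plain-zeros (suc j) i))) (+-identityʳ _)))
          where
          finish : (eq : suc j ℕ.+ suc l ≡ suc e) (C : Vec F (suc l)) → mon P ≈ mon g ⊛ mon C → Reducible P
          finish eq C h = reducible eq g C (mon-injective P (product eq g C) (λ i → trans (h i) (sym (mon-product eq g C i))))
        decide (no r≢0) = factor P b b≢0 fuel r j≤ j≤e (λ z → r≢0 (plain-injective r (zeros (suc j)) (λ i → trans (z i) (sym (plain-zeros (suc j) i))))) rb
      go : (plain w ≈ 𝟘 ⊎ ∃ λ c → c ≢ 0# × ∃ λ j → j < n × ∃ λ (g : Vec F j) → plain w ≈ c ∙ mon g) → Reducible P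
      go (inj₁ z) = ⊥-elim (w≢0 z)
      go (inj₂ (c , c≢0 , zero , j<n , g , eq)) = ⊥-elim (constant g (unscale c c≢0 g eq))
      go (inj₂ (c , c≢0 , suc j , j<n , g , eq)) = divide (ℕₚ.≤-pred (ℕₚ.≤-trans j<n n≤)) (ℕₚ.<⇒≤ (ℕₚ.≤-trans j<n n≤e)) (split (ℕₚ.≤-trans j<n n≤e)) g (unscale c c≢0 g eq)
        where
        split : suc j < suc e → suc j ℕ.+ suc (e ∸ suc j) ≡ suc e
        split (s≤s j<e) = trans (ℕₚ.+-suc (suc j) (e ∸ suc j)) (cong suc (ℕₚ.m+[n∸m]≡n j<e))

  ¬prime⇒reducible : ∀ {e} (P : Vec F (suc e)) → ¬ Prime P → Reducible P
  ¬prime⇒reducible {e} P ¬prime = go (Enum.search (Vecs (suc e)) (λ a → Enum.any? (Vecs (suc e)) (λ b → bad? a b)))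
    where
    z = zeros (suc e)
    Bad : Vec F (suc e) → Vec F (suc e) → Set
    Bad a b = Extension._*_ 𝔽 P a b ≡ Extension.0# 𝔽 P × a ≢ Extension.0# 𝔽 P × b ≢ Extension.0# 𝔽 P
    bad? : ∀ a b → Dec (Bad a b)
    bad? a b = Enum._≟_ (Vecs (suc e)) _ _ ×-dec (¬? (Enum._≟_ (Vecs (suc e)) _ _) ×-dec ¬? (Enum._≟_ (Vecs (suc e)) _ _))
    zero-vec : ∀ v → plain v ≈ 𝟘 → v ≡ Extension.0# 𝔽 P
    zero-vec v h = plain-injective v _ (λ i → trans (h i) (sym (Extension.plain-0 𝔽 P i)))
    go : (∃ λ a → ∃ λ b → Bad a b) ⊎ (∀ a → ¬ ∃ λ b → Bad a b) → Reducible P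
    go (inj₁ (a , b , h , a≢0 , b≢0)) = factor P b (b≢0 ∘ zero-vec b) (suc e) a ℕₚ.≤-refl ℕₚ.≤-refl (a≢0 ∘ zero-vec a)
      (Ext.zero⇒≋ P bb (trans (Extension.ev-⊛ 𝔽 P (Extension.X 𝔽 P) {plain a} {plain b} (plain-bounded a) (plain-bounded b) bb)
        (trans (cong₂ (Extension._*_ 𝔽 P) (Extension.evp-X 𝔽 P a) (Extension.evp-X 𝔽 P b)) h)))
      where
      bb : Bounded (plain a ⊛ plain b)
      bb = Bounded-⊛ {plain a} {plain b} (plain-bounded a) (plain-bounded b)
    go (inj₂ none) = ⊥-elim (¬prime (Ext.to P (λ a b h → decide a b h (Enum._≟_ (Vecs (suc e)) a _) (Enum._≟_ (Vecs (suc e)) b _))))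
      where
      decide : ∀ a b → Extension._*_ 𝔽 P a b ≡ Extension.0# 𝔽 P → Dec (a ≡ Extension.0# 𝔽 P) → Dec (b ≡ Extension.0# 𝔽 P) → a ≡ Extension.0# 𝔽 P ⊎ b ≡ Extension.0# 𝔽 P
      decide a b h (yes p) _ = inj₁ p
      decide a b h (no _) (yes p) = inj₂ p
      decide a b h (no p) (no r) = ⊥-elim (none a (b , h , p , r))

  record PrimeFactor {m} (f : Vec F m) : Set where
    constructor primeFactor
    field
      {deg}    : ℕ
      factor₀  : Vec F (suc deg)
      isPrime  : Prime factor₀
      divisible : factor₀ ∣ᵖ f

  private
    ∣-product : ∀ {d a b m} {P : Vec F d} (eq : a ℕ.+ b ≡ m) (A : Vec F a) (B : Vec F b) → P ∣ᵖ A → P ∣ᵖ product eq A B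
    ∣-product {P = P} eq A B h = ≋⇒∣ (≋-trans (≈⇒≋ (mon-product eq A B)) (≋-trans (≋-⊛ʳ (mon B) (mon-bounded B) (∣⇒≋ h)) (≈⇒≋ (⊛-zeroˡ (mon B)))))

  exists-primeFactor : ∀ {e} (f : Vec F (suc e)) → PrimeFactor f
  exists-primeFactor {e} f = go (suc e) f ℕₚ.≤-refl
    where
    go : ∀ fuel {e} (f : Vec F (suc e)) → suc e ≤ fuel → PrimeFactor f
    go (suc fuel) {e} f le = decide (prime? f)
      where
      pass : ∀ {j l} (eq : suc j ℕ.+ suc l ≡ suc e) (A : Vec F (suc j)) (B : Vec F (suc l)) → f ≡ product eq A B → PrimeFactor A → PrimeFactor f
      pass eq A B h (primeFactor P prime P∣A) = primeFactor P prime (subst (P ∣ᵖ_) (sym h) (∣-product eq A B P∣A))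
      decide : Dec (Prime f) → PrimeFactor f
      decide (yes prime) = primeFactor f prime (≋⇒∣ (≋-modulus {P = f}))
      decide (no ¬prime) with ¬prime⇒reducible f ¬prime
      ... | reducible {j} {l} eq A B h = pass eq A B h (go fuel A (ℕₚ.≤-pred (ℕₚ.≤-trans (ℕₚ.≤-trans (ℕₚ.m<m+n (suc j) (s≤s z≤n)) (ℕₚ.≤-reflexive eq)) le)))

-- Gauss's count of prime polynomials

module PrimeCount (𝔽 : FiniteField) where
  open FieldFacts 𝔽 using (F; F-Enum)
  open Polynomials 𝔽 hiding (solve; _:+_; _:*_; :-_; _:-_; _:=_; con)
  open PolynomialDivision 𝔽
  open PrimePolynomials 𝔽
  open Characteristic 𝔽 using (Q; 0≤Q; 1≤Q)
  open Sums
  open import Data.Integer using (_+_; _*_; _-_; -_) renaming (_≤_ to _≤ᶻ_)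
  open import Data.Nat.Divisibility using () renaming (divides to ℕ-divides)

  Vecs : (m : ℕ) → Enum (Vec F m)
  Vecs = Vec-Enum F-Enum

  Vecs-size : ∀ m → Enum.size (Vecs m) ≡ Q ℤ.^ m
  Vecs-size m = Vec-size F-Enum m

  step : ∀ {e m} {P : Vec F (suc e)} {f : Vec F m} → (∀ {l} → Vec F l → ℤ) → Dec (P ∣ᵖ f) → ℤ
  step φ (yes (divides _ C _)) = 1ℤ + φ C
  step φ (no _)                = 0ℤ

  -- The multiplicity of P in f, counting at most t factors.
  val : ℕ → ∀ {e} → Vec F (suc e) → ∀ {m} → Vec F m → ℤ
  val zero    P f = 0ℤ
  val (suc t) P f = step (val t P) (P ∣ᵖ? f)

  private
    step-product : ∀ {e l m} (φ : ∀ {l} → Vec F l → ℤ) (P : Vec F (suc e)) (eq : suc e ℕ.+ l ≡ m) (C : Vec F l) (d : Dec (P ∣ᵖ product eq P C)) → step φ d ≡ 1ℤ + φ C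
    step-product φ P eq C (no n) = contradiction (divides eq C refl) n
    step-product {e} {l} φ P eq C (yes (divides {l′} eq′ C′ h)) with ℕₚ.+-cancelˡ-≡ (suc e) l l′ (trans eq (sym eq′))
    ... | refl with ℕₚ.≡-irrelevant eq eq′
    ...   | refl = cong (λ D → 1ℤ + φ D) (sym (product-injective eq P C C′ h))

  val-product : ∀ t {e l m} (P : Vec F (suc e)) (eq : suc e ℕ.+ l ≡ m) (C : Vec F l) → val (suc t) P (product eq P C) ≡ 1ℤ + val t P C
  val-product t P eq C = step-product (val t P) P eq C (P ∣ᵖ? product eq P C)

  private
    step-no : ∀ {e m} {P : Vec F (suc e)} {f : Vec F m} (φ : ∀ {l} → Vec F l → ℤ) → ¬ P ∣ᵖ f → (d : Dec (P ∣ᵖ f)) → step φ d ≡ 0ℤ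
    step-no φ n (yes y) = contradiction y n
    step-no φ n (no _)  = refl

  val-no : ∀ t {e m} (P : Vec F (suc e)) (f : Vec F m) → ¬ P ∣ᵖ f → val t P f ≡ 0ℤ
  val-no zero    P f n = refl
  val-no (suc t) P f n = step-no (val t P) n (P ∣ᵖ? f)

  ∤[] : ∀ {e} (P : Vec F (suc e)) (f : Vec F 0) → ¬ P ∣ᵖ f
  ∤[] P f (divides () C h)

  ∣⇒codegree< : ∀ {e l m} → suc e ℕ.+ l ≡ m → l < m
  ∣⇒codegree< {e} {l} refl = s≤s (ℕₚ.m≤n+m l e)

  val-fuel : ∀ t t′ {e m} (P : Vec F (suc e)) (f : Vec F m) → m ≤ t → m ≤ t′ → val t P f ≡ val t′ P f
  val-fuel zero t′ P [] z≤n z≤n = sym (val-no t′ P [] (∤[] P []))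
  val-fuel (suc t) zero P [] le z≤n = val-no (suc t) P [] (∤[] P [])
  val-fuel (suc t) (suc t′) {e} {m} P f le le′ = go (P ∣ᵖ? f)
    where
    go : (d : Dec (P ∣ᵖ f)) → step (val t P) d ≡ step (val t′ P) d
    go (no _) = refl
    go (yes (divides eq C h)) = +ˡ 1ℤ (val-fuel t t′ P C (ℕₚ.≤-pred (ℕₚ.≤-trans (∣⇒codegree< {e} eq) le)) (ℕₚ.≤-pred (ℕₚ.≤-trans (∣⇒codegree< {e} eq) le′)))

  v : ∀ {e} → Vec F (suc e) → ∀ {m} → Vec F m → ℤ
  v P {m} f = val m P f

  v-product : ∀ {e l m} (P : Vec F (suc e)) (eq : suc e ℕ.+ l ≡ m) (C : Vec F l) → v P (product eq P C) ≡ 1ℤ + v P C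
  v-product {e} {l} P refl C = trans (val-product (e ℕ.+ l) P refl C) (+ˡ 1ℤ (val-fuel (e ℕ.+ l) l P C (ℕₚ.m≤n+m l e) ℕₚ.≤-refl))

  private
    product-swap : ∀ {a b c l m} (eq₁ : a ℕ.+ l ≡ m) (eq₂ : b ℕ.+ c ≡ l) (eq₃ : b ℕ.+ (a ℕ.+ c) ≡ m) (A : Vec F a) (B : Vec F b) (C : Vec F c) →
                   product eq₁ A (product eq₂ B C) ≡ product eq₃ B (product refl A C)
    product-swap eq₁ eq₂ eq₃ A B C = mon-injective _ _ (λ i → trans (mon-product eq₁ A (product eq₂ B C) i) (trans
      (⊛-cong {mon A} {mon A} (≈-refl {mon A}) (mon-product eq₂ B C) i) (trans (RingIdentities.swap-product Series-commutativeRing (mon A) (mon B) (mon C) i)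
      (sym (trans (mon-product eq₃ B (product refl A C) i) (⊛-cong {mon B} {mon B} (≈-refl {mon B}) (mon-product refl A C) i))))))

  -- By Euclid's lemma a factor P′ of P C must divide C, since it cannot divide the different prime
  -- P. It is moved to the front and removed, one at a time.
  v-coprime : ∀ {e e′ l m} {P : Vec F (suc e)} {P′ : Vec F (suc e′)} → Prime P → Prime P′ → ¬ P′ ≅ P → (eq : suc e ℕ.+ l ≡ m) (C : Vec F l) →
              v P′ (product eq P C) ≡ v P′ C
  v-coprime {e} {e′} {P = P} {P′} pP pP′ ne = λ eq C → go _ eq C ℕₚ.≤-refl
    where
    go : ∀ t {l m} (eq : suc e ℕ.+ l ≡ m) (C : Vec F l) → l ≤ t → v P′ (product eq P C) ≡ v P′ C
    case : ∀ t {l m} (eq : suc e ℕ.+ l ≡ m) (C : Vec F l) → l ≤ t → Dec (P′ ∣ᵖ C) → v P′ (product eq P C) ≡ v P′ C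
    go t eq C le = case t eq C le (P′ ∣ᵖ? C)
    case t {l} {m} eq C le (no n) = trans (val-no m P′ (product eq P C) bad) (sym (val-no l P′ C n))
      where
      bad : ¬ P′ ∣ᵖ product eq P C
      bad h = split (euclid pP′ eq P C h)
        where
        split : P′ ∣ᵖ P ⊎ P′ ∣ᵖ C → ⊥
        split (inj₁ k) = ne (prime-∣-prime pP k)
        split (inj₂ k) = n k
    case zero {zero} eq C le (yes k) = ⊥-elim (∤[] P′ C k)
    case (suc t) {l} {m} eq C le (yes (divides {c} eq′ D refl)) = begin
      v P′ (product eq P (product eq′ P′ D))        ≡⟨ cong (v P′) (product-swap eq eq′ eq″ P P′ D) ⟩
      v P′ (product eq″ P′ (product refl P D))      ≡⟨ v-product P′ eq″ (product refl P D) ⟩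
      1ℤ + v P′ (product refl P D)                  ≡⟨ +ˡ 1ℤ (go t refl D (ℕₚ.≤-pred (ℕₚ.≤-trans (∣⇒codegree< {e′} eq′) le))) ⟩
      1ℤ + v P′ D                                   ≡⟨ v-product P′ eq′ D ⟨
      v P′ (product eq′ P′ D)                       ∎
      where
      open ≡-Reasoning
      eq″ : suc e′ ℕ.+ (suc e ℕ.+ c) ≡ m
      eq″ = trans (sym (ℕₚ.+-assoc (suc e′) (suc e) c)) (trans (cong (ℕ._+ c) (ℕₚ.+-comm (suc e′) (suc e))) (trans (ℕₚ.+-assoc (suc e) (suc e′) c) (trans (cong (suc e ℕ.+_) eq′) eq)))

  range-pick : ∀ {N e₀} → e₀ < N → (g : ℕ → ℤ) → ∑ (downFrom N) (λ e → ⟦ e ℕ.≟ e₀ ⟧ * g e) ≡ g e₀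
  range-pick {suc N} {e₀} (s≤s e₀≤N) g = case (N ℕ.≟ e₀)
    where
    absent : ∀ N → N ≤ e₀ → ∑ (downFrom N) (λ e → ⟦ e ℕ.≟ e₀ ⟧ * g e) ≡ 0ℤ
    absent zero    le = refl
    absent (suc N) le = trans (cong₂ _+_ (trans (cong (_* g N) (⟦⟧-no (N ℕ.≟ e₀) (ℕₚ.<⇒≢ le))) (ℤₚ.*-zeroˡ (g N))) (absent N (ℕₚ.<⇒≤ le))) refl
    case : Dec (N ≡ e₀) → ∑ (downFrom (suc N)) (λ e → ⟦ e ℕ.≟ e₀ ⟧ * g e) ≡ g e₀
    case (yes refl) = trans (cong₂ _+_ (trans (cong (_* g N) (⟦⟧-yes (N ℕ.≟ N) refl)) (ℤₚ.*-identityˡ (g N))) (absent N ℕₚ.≤-refl)) (ℤₚ.+-identityʳ (g N))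
    case (no n) = trans (cong₂ _+_ (trans (cong (_* g N) (⟦⟧-no (N ℕ.≟ e₀) n)) (ℤₚ.*-zeroˡ (g N))) (range-pick (ℕₚ.≤∧≢⇒< e₀≤N (n ∘ sym)) g)) (ℤₚ.+-identityˡ (g e₀))

  inner : ∀ e {m} → Vec F m → ℤ
  inner e f = Enum.sum (Vecs (suc e)) (λ P → ⟦ prime? P ⟧ * v P f)

  -- The sum of deg P · v_P(f) over the primes P of degree at most N, the logarithmic form of the
  -- prime factorisation of f.
  W : ℕ → ∀ {m} → Vec F m → ℤ
  W N f = ∑ (downFrom N) (λ e → + suc e * inner e f)

  inner-product : ∀ e {e₀ l m} (P₀ : Vec F (suc e₀)) → Prime P₀ → (eq : suc e₀ ℕ.+ l ≡ m) (C : Vec F l) →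
                  inner e (product eq P₀ C) ≡ inner e C + ⟦ e ℕ.≟ e₀ ⟧ * 1ℤ
  inner-product e {e₀} P₀ pP₀ eq C = case (e ℕ.≟ e₀)
    where
    open ≡-Reasoning
    case : (d : Dec (e ≡ e₀)) → inner e (product eq P₀ C) ≡ inner e C + ⟦ d ⟧ * 1ℤ
    case (no n) = trans (∑-cong (Enum.list (Vecs (suc e))) (λ P → ⟦⟧*-cong (prime? P) (λ pP → v-coprime pP₀ pP (λ { (same refl _) → n refl }) eq C)))
                        (sym (ℤₚ.+-identityʳ (inner e C)))
    case (yes refl) = begin
      inner e (product eq P₀ C)
        ≡⟨ ∑-cong (Enum.list (Vecs (suc e))) (λ P → trans (⟦⟧*-cong (prime? P) (λ pP → extra P pP (Enum._≟_ (Vecs (suc e)) P P₀))) (ℤₚ.*-distribˡ-+ ⟦ prime? P ⟧ (v P C) _)) ⟩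
      Enum.sum (Vecs (suc e)) (λ P → ⟦ prime? P ⟧ * v P C + ⟦ prime? P ⟧ * ⟦ Enum._≟_ (Vecs (suc e)) P P₀ ⟧)
        ≡⟨ ∑-+ (Enum.list (Vecs (suc e))) _ _ ⟩
      inner e C + Enum.sum (Vecs (suc e)) (λ P → ⟦ prime? P ⟧ * ⟦ Enum._≟_ (Vecs (suc e)) P P₀ ⟧)
        ≡⟨ cong (λ z → inner e C + z) (trans (∑-cong (Enum.list (Vecs (suc e))) (λ P → ℤₚ.*-comm ⟦ prime? P ⟧ _)) (trans (Enum.sum-pick (Vecs (suc e)) P₀ (λ P → ⟦ prime? P ⟧)) (⟦⟧-yes (prime? P₀) pP₀))) ⟩
      inner e C + 1ℤ ∎
      where
      extra : ∀ P → Prime P → (d : Dec (P ≡ P₀)) → v P (product eq P₀ C) ≡ v P C + ⟦ d ⟧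
      extra P pP (yes refl) = trans (v-product P eq C) (ℤₚ.+-comm 1ℤ (v P C))
      extra P pP (no n) = trans (v-coprime pP₀ pP (λ { (same refl k) → n k }) eq C) (sym (ℤₚ.+-identityʳ (v P C)))

  W-product : ∀ N {e₀ l m} (P₀ : Vec F (suc e₀)) → Prime P₀ → e₀ < N → (eq : suc e₀ ℕ.+ l ≡ m) (C : Vec F l) → W N (product eq P₀ C) ≡ W N C + + suc e₀
  W-product N {e₀} P₀ pP₀ e₀<N eq C = trans (∑-cong (downFrom N) (λ e → trans (cong (+ suc e *_) (inner-product e P₀ pP₀ eq C)) (distribute (+ suc e) (inner e C) ⟦ e ℕ.≟ e₀ ⟧)))
    (trans (∑-+ (downFrom N) _ _) (cong (λ z → W N C + z) (range-pick e₀<N (λ e → + suc e))))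
    where
    distribute : ∀ s i d → s * (i + d * 1ℤ) ≡ s * i + d * s
    distribute = ℤ-solve-∀

  -- Splitting off one prime factor lowers both sides by its degree. This identity is the only form
  -- in which unique factorisation enters.
  W-degree : ∀ N {m} (f : Vec F m) → m ≤ N → W N f ≡ + m
  W-degree N {m} f le = go m f ℕₚ.≤-refl le
    where
    go : ∀ t {m} (f : Vec F m) → m ≤ t → m ≤ N → W N f ≡ + m
    go t {zero} f _ _ = trans (∑-cong (downFrom N) (λ e → trans (cong (+ suc e *_) (trans (∑-cong (Enum.list (Vecs (suc e))) (λ P → ℤₚ.*-zeroʳ ⟦ prime? P ⟧)) (∑-0 (Enum.list (Vecs (suc e)))))) (ℤₚ.*-zeroʳ (+ suc e)))) (∑-0 (downFrom N))
    go (suc t) {suc e} f le leN = use (exists-primeFactor f)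
      where
      use : PrimeFactor f → W N f ≡ + suc e
      use (primeFactor {e₀} P₀ pP₀ (divides {l} eq C refl)) =
        trans (W-product N P₀ pP₀ (ℕₚ.≤-trans (ℕₚ.≤-trans (ℕₚ.m≤m+n (suc e₀) l) (ℕₚ.≤-reflexive eq)) leN) eq C)
        (trans (cong (_+ + suc e₀) (go t C (ℕₚ.≤-pred (ℕₚ.≤-trans (∣⇒codegree< {e₀} eq) le)) (ℕₚ.≤-trans (ℕₚ.<⇒≤ (∣⇒codegree< {e₀} eq)) leN)))
               (cong +_ (trans (ℕₚ.+-comm l (suc e₀)) eq)))

  V : ∀ {e} → Vec F (suc e) → ℕ → ℤ
  V P m = Enum.sum (Vecs m) (v P)

  V-small : ∀ {e} (P : Vec F (suc e)) m → m < suc e → V P m ≡ 0ℤ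
  V-small {e} P m lt = trans (∑-cong (Enum.list (Vecs m)) (λ f → val-no m P f (λ { (divides {l} eq _ _) → ℕₚ.<⇒≱ lt (ℕₚ.≤-trans (ℕₚ.m≤m+n (suc e) l) (ℕₚ.≤-reflexive eq)) }))) (∑-0 (Enum.list (Vecs m)))

  sum-divisible : ∀ {e} (P : Vec F (suc e)) l (φ : Vec F (suc e ℕ.+ l) → ℤ) →
                  Enum.sum (Vecs (suc e ℕ.+ l)) (λ f → ⟦ P ∣ᵖ? f ⟧ * φ f) ≡ Enum.sum (Vecs l) (λ C → φ (P ⊗ C))
  sum-divisible {e} P l φ = trans (∑-bij (Vecs (suc e ℕ.+ l)) (Vecs l) (P ∣ᵖ?_) (λ _ → yes tt) (λ f → proj₁ (monic-division P f)) (P ⊗_)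
      (λ f h → tt , sym (exact-division P f (∣⇒≋ h)))
      (λ C _ → divides refl C refl , product-injective refl P (proj₁ (monic-division P (P ⊗ C))) C (sym (exact-division P (P ⊗ C) (∣⇒≋ (divides refl C refl))))) φ)
    (∑-cong (Enum.list (Vecs l)) (λ C → ℤₚ.*-identityˡ (φ (P ⊗ C))))

  V-step : ∀ {e} (P : Vec F (suc e)) l → V P (suc e ℕ.+ l) ≡ Q ℤ.^ l + V P l
  V-step {e} P l = trans (∑-cong (Enum.list (Vecs (suc e ℕ.+ l))) (λ f → only f (P ∣ᵖ? f))) (trans (sum-divisible P l (v P))
    (trans (∑-cong (Enum.list (Vecs l)) (λ C → v-product P refl C)) (trans (∑-+ (Enum.list (Vecs l)) _ _) (cong (_+ V P l) (Vecs-size l)))))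
    where
    only : ∀ f (d : Dec (P ∣ᵖ f)) → v P f ≡ ⟦ d ⟧ * v P f
    only f (yes _) = sym (ℤₚ.*-identityˡ (v P f))
    only f (no n)  = trans (val-no (suc e ℕ.+ l) P f n) (sym (ℤₚ.*-zeroˡ (v P f)))

  -- With d = deg P, the polynomials of degree m divisible by P^j number q^{m-jd}, so V P m is the
  -- sum of q^{m-jd} over j ≥ 1 with jd ≤ m. Passing to m + 1 multiplies every term by q and adds a
  -- new term 1 exactly when d divides m + 1.
  V-recursion : ∀ {e} (P : Vec F (suc e)) m → V P (suc m) ≡ Q * V P m + ⟦ suc e ∣? suc m ⟧
  V-recursion {e} P m = go m m ℕₚ.≤-refl
    where
    go : ∀ t m → m ≤ t → V P (suc m) ≡ Q * V P m + ⟦ suc e ∣? suc m ⟧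
    go t m le with ℕₚ.<-cmp (suc m) (suc e)
    ... | tri< lt _ _ = trans (V-small P (suc m) lt) (sym (cong₂ _+_ (trans (cong (Q *_) (V-small P m (ℕₚ.<-trans (ℕₚ.n<1+n m) lt))) (ℤₚ.*-zeroʳ Q)) (⟦⟧-no (suc e ∣? suc m) (λ d → ℕₚ.<⇒≱ lt (∣⇒≤ d)))))
    ... | tri≈ _ refl _ = trans (trans (cong (V P) (sym (ℕₚ.+-identityʳ (suc e)))) (trans (V-step P 0) (+ˡ 1ℤ (trans (V-small P 0 (s≤s z≤n)) refl))))
            (sym (cong₂ _+_ (trans (cong (Q *_) (V-small P e (ℕₚ.n<1+n e))) (ℤₚ.*-zeroʳ Q)) (⟦⟧-yes (suc e ∣? suc e) ∣-refl)))
    go zero m z≤n | tri> _ _ (s≤s ())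
    go (suc t) m le | tri> _ _ (s≤s e<m) = above (m ∸ suc e) (ℕₚ.m+[n∸m]≡n e<m) le
      where
      above : ∀ l {m} → suc e ℕ.+ l ≡ m → m ≤ suc t → V P (suc m) ≡ Q * V P m + ⟦ suc e ∣? suc m ⟧
      above l refl le = begin
        V P (suc (suc e ℕ.+ l))                          ≡⟨ cong (V P) (sym (ℕₚ.+-suc (suc e) l)) ⟩
        V P (suc e ℕ.+ suc l)                            ≡⟨ V-step P (suc l) ⟩
        Q ℤ.^ suc l + V P (suc l)                        ≡⟨ +ˡ (Q ℤ.^ suc l) (go t l (ℕₚ.≤-pred (ℕₚ.≤-trans (s≤s (ℕₚ.m≤n+m l e)) le))) ⟩
        Q * Q ℤ.^ l + (Q * V P l + ⟦ suc e ∣? suc l ⟧)   ≡⟨ factorise Q (Q ℤ.^ l) (V P l) _ ⟩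
        Q * (Q ℤ.^ l + V P l) + ⟦ suc e ∣? suc l ⟧       ≡⟨ cong₂ (λ x y → Q * x + y) (sym (V-step P l)) (⟦⟧-cong (suc e ∣? suc l) (suc e ∣? suc (suc e ℕ.+ l)) up down) ⟩
        Q * V P (suc e ℕ.+ l) + ⟦ suc e ∣? suc (suc e ℕ.+ l) ⟧ ∎
        where
        open ≡-Reasoning
        factorise : ∀ q a b c → q * a + (q * b + c) ≡ q * (a + b) + c
        factorise = ℤ-solve-∀
        up : suc e ∣ suc l → suc e ∣ suc (suc e ℕ.+ l)
        up h = subst (suc e ∣_) (ℕₚ.+-suc (suc e) l) (∣m∣n⇒∣m+n ∣-refl h)
        down : suc e ∣ suc (suc e ℕ.+ l) → suc e ∣ suc l
        down h = ∣m+n∣m⇒∣n (subst (suc e ∣_) (sym (ℕₚ.+-suc (suc e) l)) h) ∣-refl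

  #primes : ℕ → ℤ
  #primes e = Enum.sum (Vecs (suc e)) (λ P → ⟦ prime? P ⟧)

  private
    total : ℕ → ℕ → ℤ
    total N m = ∑ (downFrom N) (λ e → + suc e * Enum.sum (Vecs (suc e)) (λ P → ⟦ prime? P ⟧ * V P m))

    total-W : ∀ N m → total N m ≡ Enum.sum (Vecs m) (W N)
    total-W N m = trans (∑-cong (downFrom N) (λ e → trans (cong (+ suc e *_) (trans (∑-cong (Enum.list (Vecs (suc e))) (λ P → sym (∑-*ˡ (Enum.list (Vecs m)) ⟦ prime? P ⟧ (v P)))) (∑-swap (Enum.list (Vecs (suc e))) (Enum.list (Vecs m)) _))) (sym (∑-*ˡ (Enum.list (Vecs m)) (+ suc e) (inner e)))))
      (∑-swap (downFrom N) (Enum.list (Vecs m)) _)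

    total-value : ∀ N m → m ≤ N → total N m ≡ Q ℤ.^ m * + m
    total-value N m le = trans (total-W N m) (trans (∑-cong (Enum.list (Vecs m)) (λ f → W-degree N f le)) (trans (Enum.sum-*1 (Vecs m) (+ m)) (cong (_* + m) (Vecs-size m))))

    total-recursion : ∀ N m → total N (suc m) ≡ Q * total N m + ∑ (downFrom N) (λ e → + suc e * (#primes e * ⟦ suc e ∣? suc m ⟧))
    total-recursion N m = trans (∑-cong (downFrom N) (λ e → trans (cong (+ suc e *_) (each e)) (distribute (+ suc e) Q _ _)))
      (trans (∑-+ (downFrom N) _ _) (cong (_+ ∑ (downFrom N) (λ e → + suc e * (#primes e * ⟦ suc e ∣? suc m ⟧))) (∑-*ˡ (downFrom N) Q _)))
      where
      distribute : ∀ s q a b → s * (q * a + b) ≡ q * (s * a) + s * b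
      distribute = ℤ-solve-∀
      expand : ∀ p q x y → p * (q * x + y) ≡ q * (p * x) + p * y
      expand = ℤ-solve-∀
      each : ∀ e → Enum.sum (Vecs (suc e)) (λ P → ⟦ prime? P ⟧ * V P (suc m)) ≡ Q * Enum.sum (Vecs (suc e)) (λ P → ⟦ prime? P ⟧ * V P m) + #primes e * ⟦ suc e ∣? suc m ⟧
      each e = trans (∑-cong L (λ P → trans (cong (⟦ prime? P ⟧ *_) (V-recursion P m)) (expand ⟦ prime? P ⟧ Q (V P m) _)))
        (trans (∑-+ L _ _) (cong₂ _+_ (∑-*ˡ L Q _) (∑-*ʳ L ⟦ suc e ∣? suc m ⟧ _)))
        where L = Enum.list (Vecs (suc e))

  -- Gauss: comparing Σ_f deg f in degrees m + 1 and m isolates the primes whose degree divides m + 1.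
  prime-sum : ∀ N m → suc m ≤ N → ∑ (downFrom N) (λ e → + suc e * (#primes e * ⟦ suc e ∣? suc m ⟧)) ≡ Q ℤ.^ suc m
  prime-sum N m le = begin
    S₀                                                   ≡⟨ isolate S₀ (Q * total N m) ⟩
    (Q * total N m + S₀) - Q * total N m                  ≡⟨ cong₂ (λ x y → x - Q * y) (sym (total-recursion N m)) (total-value N m (ℕₚ.≤-trans (ℕₚ.n≤1+n m) le)) ⟩
    total N (suc m) - Q * (Q ℤ.^ m * + m)                ≡⟨ cong (_- Q * (Q ℤ.^ m * + m)) (total-value N (suc m) le) ⟩
    Q * Q ℤ.^ m * (1ℤ + + m) - Q * (Q ℤ.^ m * + m)       ≡⟨ compute Q (Q ℤ.^ m) (+ m) ⟩
    Q * Q ℤ.^ m                                          ∎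
    where
    open ≡-Reasoning
    S₀ = ∑ (downFrom N) (λ e → + suc e * (#primes e * ⟦ suc e ∣? suc m ⟧))
    isolate : ∀ s a → s ≡ (a + s) - a
    isolate = ℤ-solve-∀
    compute : ∀ q a m → q * a * (1ℤ + m) - q * (a * m) ≡ q * a
    compute = ℤ-solve-∀

  #primes-nonneg : ∀ e → 0ℤ ≤ᶻ #primes e
  #primes-nonneg e = ∑-nonneg (Enum.list (Vecs (suc e))) (λ P → ⟦⟧-nonneg (prime? P))

  private
    term-nonneg : ∀ m e → 0ℤ ≤ᶻ + suc e * (#primes e * ⟦ suc e ∣? suc m ⟧)
    term-nonneg m e = *-nonneg {+ suc e} (ℤ.+≤+ z≤n) (*-nonneg (#primes-nonneg e) (⟦⟧-nonneg (suc e ∣? suc m)))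

    +-nonnegʳ : ∀ {a b} → 0ℤ ≤ᶻ b → a ≤ᶻ a + b
    +-nonnegʳ {a} h = ℤₚ.≤-trans (ℤₚ.≤-reflexive (sym (ℤₚ.+-identityʳ a))) (ℤₚ.+-monoʳ-≤ a h)

  #primes≤ : ∀ e → + suc e * #primes e ≤ᶻ Q ℤ.^ suc e
  #primes≤ e = ℤₚ.≤-trans (ℤₚ.≤-reflexive (cong (+ suc e *_) (sym (trans (cong (#primes e *_) (⟦⟧-yes (suc e ∣? suc e) ∣-refl)) (ℤₚ.*-identityʳ (#primes e))))))
    (ℤₚ.≤-trans (+-nonnegʳ (∑-nonneg (downFrom e) (term-nonneg e))) (ℤₚ.≤-reflexive (prime-sum (suc e) e ℕₚ.≤-refl)))

  -- In `prime-sum` a proper divisor of m + 1 is at most h, so by `#primes≤` its term is at most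
  -- q^h, and there are at most m such terms.
  #primes≥ : ∀ m h → m ≤ h ℕ.+ h → Q ℤ.^ suc m ≤ᶻ + suc m * #primes m + + m * Q ℤ.^ h
  #primes≥ m h le = ℤₚ.≤-trans (ℤₚ.≤-reflexive (sym (prime-sum (suc m) m ℕₚ.≤-refl))) (ℤₚ.+-mono-≤
      (ℤₚ.≤-reflexive (cong (+ suc m *_) (trans (cong (#primes m *_) (⟦⟧-yes (suc m ∣? suc m) ∣-refl)) (ℤₚ.*-identityʳ (#primes m)))))
      (lower m ℕₚ.≤-refl))
    where
    0≤Q^ : ∀ n → 0ℤ ≤ᶻ Q ℤ.^ n
    0≤Q^ zero    = ℤ.+≤+ z≤n
    0≤Q^ (suc n) = *-nonneg 0≤Q (0≤Q^ n)
    Q^-mono : ∀ {a b} → a ≤ b → Q ℤ.^ a ≤ᶻ Q ℤ.^ b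
    Q^-mono {zero}  {zero}  z≤n     = ℤₚ.≤-refl
    Q^-mono {zero}  {suc b} z≤n     = ℤₚ.≤-trans (Q^-mono {zero} {b} z≤n) (ℤₚ.≤-trans (ℤₚ.≤-reflexive (sym (ℤₚ.*-identityˡ _))) (*-monoʳ (0≤Q^ b) 1≤Q))
    Q^-mono {suc a} {suc b} (s≤s h) = *-monoˡ 0≤Q (Q^-mono h)
    half : ∀ e → e < m → suc e ∣ suc m → suc e ≤ h
    half e e<m (ℕ-divides zero ())
    half e e<m (ℕ-divides (suc zero) eq) = ⊥-elim (ℕₚ.<⇒≢ e<m (sym (ℕₚ.suc-injective (trans eq (ℕₚ.+-identityʳ (suc e))))))
    half e e<m (ℕ-divides (suc (suc k)) eq) = ℕₚ.≮⇒≥ (λ h<e → ℕₚ.<⇒≱ (ℕₚ.≤-trans (s≤s (s≤s le)) (ℕₚ.≤-trans (ℕₚ.≤-reflexive (cong suc (sym (ℕₚ.+-suc h h)))) (ℕₚ.+-mono-≤ h<e h<e)))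
          (ℕₚ.≤-trans (ℕₚ.m≤m+n (suc e ℕ.+ suc e) (k ℕ.* suc e)) (ℕₚ.≤-reflexive (trans (ℕₚ.+-assoc (suc e) (suc e) _) (sym eq)))))
    one : ∀ e → e < m → (d : Dec (suc e ∣ suc m)) → + suc e * (#primes e * ⟦ d ⟧) ≤ᶻ Q ℤ.^ h
    one e e<m (no _)  = ℤₚ.≤-trans (ℤₚ.≤-reflexive (trans (cong (+ suc e *_) (ℤₚ.*-zeroʳ (#primes e))) (ℤₚ.*-zeroʳ (+ suc e)))) (0≤Q^ h)
    one e e<m (yes d) = ℤₚ.≤-trans (ℤₚ.≤-reflexive (cong (+ suc e *_) (ℤₚ.*-identityʳ (#primes e)))) (ℤₚ.≤-trans (#primes≤ e) (Q^-mono (half e e<m d)))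
    lower : ∀ N → N ≤ m → ∑ (downFrom N) (λ e → + suc e * (#primes e * ⟦ suc e ∣? suc m ⟧)) ≤ᶻ + N * Q ℤ.^ h
    lower zero    le = ℤₚ.≤-reflexive (sym (ℤₚ.*-zeroˡ (Q ℤ.^ h)))
    lower (suc N) le = ℤₚ.≤-trans (ℤₚ.+-mono-≤ (one N le (suc N ∣? suc m)) (lower N (ℕₚ.<⇒≤ le))) (ℤₚ.≤-reflexive (sym (ℤₚ.suc-* (+ N) (Q ℤ.^ h))))

-- Prime polynomials with nonzero derivative and existence of extensions

module SeparablePrime (𝔽 : FiniteField) where
  private
    module 𝔽 = FieldFacts 𝔽
  open FiniteField 𝔽 using (F)
  open Polynomials 𝔽 hiding (solve; _:+_; _:*_; :-_; _:-_; _:=_; con)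
  open Derivative 𝔽
  open PrimePolynomials 𝔽
  open PrimeCount 𝔽
  open Characteristic 𝔽
  open Sums
  open import Data.Integer using (_+_; _*_) renaming (_≤_ to _≤ᶻ_; _<_ to _<ᶻ_)
  private module E = Enum 𝔽.F-Enum

  times : ℕ → F → F
  times zero    a = 𝔽.0#
  times (suc n) a = a 𝔽.+ times n a

  times-* : ∀ n a → times n a ≡ times n 𝔽.1# 𝔽.* a
  times-* zero    a = sym (𝔽.zeroˡ a)
  times-* (suc n) a = trans (cong₂ 𝔽._+_ (sym (𝔽.*-identityˡ a)) (times-* n a)) (sym (𝔽.distribʳ a 𝔽.1# (times n 𝔽.1#)))

  der-times : ∀ f n → der f n ≡ times (suc n) (f (suc n))
  der-times f zero    = sym (𝔽.+-identityʳ (f 1))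
  der-times f (suc n) = 𝔽.+-congˡ (der-times (tail f) n)

  -- The coefficients of v, placed in degrees j, j+1, …, have vanishing derivative.
  Degenerate : ∀ {L} → ℕ → Vec F L → Set
  Degenerate j []      = ⊤
  Degenerate j (a ∷ v) = times j a ≡ 𝔽.0# × Degenerate (suc j) v

  degenerate? : ∀ {L} j (v : Vec F L) → Dec (Degenerate j v)
  degenerate? j []      = yes tt
  degenerate? j (a ∷ v) = (times j a E.≟ 𝔽.0#) ×-dec degenerate? (suc j) v

  #degenerate : ℕ → ℕ → ℤ
  #degenerate j L = Enum.sum (Vecs L) (λ v → ⟦ degenerate? j v ⟧)

  private
    A : ℕ → ℤ
    A j = E.sum (λ a → ⟦ times j a E.≟ 𝔽.0# ⟧)

    A≤Q : ∀ j → A j ≤ᶻ Q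
    A≤Q j = ℤₚ.≤-trans (∑-mono 𝔽.elems (λ a → ⟦⟧≤1 (times j a E.≟ 𝔽.0#))) (ℤₚ.≤-reflexive F-size)

    0≤A : ∀ j → 0ℤ ≤ᶻ A j
    0≤A j = ∑-nonneg 𝔽.elems (λ a → ⟦⟧-nonneg (times j a E.≟ 𝔽.0#))

    A≤1 : ∀ j → times j 𝔽.1# ≢ 𝔽.0# → A j ≤ᶻ 1ℤ
    A≤1 j ne = ℤₚ.≤-trans (∑-mono 𝔽.elems (λ a → ⟦⟧-mono (times j a E.≟ 𝔽.0#) (a E.≟ 𝔽.0#) (λ h → 𝔽.*-cancelˡ-0 ne (trans (sym (times-* j a)) h)))) (ℤₚ.≤-reflexive (E.once 𝔽.0#))

    -- The integers j and j + 1 cannot both vanish in F. So of two consecutive coefficients of a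
    -- polynomial with zero derivative one must be 0, and only about half of the coefficients are
    -- free.
    AA≤Q : ∀ j → A j * A (suc j) ≤ᶻ Q
    AA≤Q j with times j 𝔽.1# E.≟ 𝔽.0#
    ... | no ne = ℤₚ.≤-trans (*-mono (0≤A (suc j)) (ℤ.+≤+ z≤n) (A≤1 j ne) (A≤Q (suc j))) (ℤₚ.≤-reflexive (ℤₚ.*-identityˡ Q))
    ... | yes e = ℤₚ.≤-trans (*-mono (0≤A (suc j)) 0≤Q (A≤Q j) (A≤1 (suc j) (λ h → 𝔽.0≢1 (sym (trans (sym (𝔽.+-identityʳ 𝔽.1#)) (trans (𝔽.+-congˡ (sym e)) h)))))) (ℤₚ.≤-reflexive (ℤₚ.*-identityʳ Q))

    cons : ∀ j L → #degenerate j (suc L) ≡ A j * #degenerate (suc j) L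
    cons j L = trans (Vec-sum 𝔽.F-Enum L _) (trans (∑-cong 𝔽.elems (λ a → trans (∑-cong (Enum.list (Vecs L)) (λ v → ⟦⟧-× (times j a E.≟ 𝔽.0#) (degenerate? (suc j) v))) (∑-*ˡ (Enum.list (Vecs L)) ⟦ times j a E.≟ 𝔽.0# ⟧ _)))
      (∑-*ʳ 𝔽.elems (#degenerate (suc j) L) _))

  #degenerate-nonneg : ∀ j L → 0ℤ ≤ᶻ #degenerate j L
  #degenerate-nonneg j L = ∑-nonneg (Enum.list (Vecs L)) (λ v → ⟦⟧-nonneg (degenerate? j v))

  0≤Q^ : ∀ n → 0ℤ ≤ᶻ Q ℤ.^ n
  0≤Q^ zero    = ℤ.+≤+ z≤n
  0≤Q^ (suc n) = *-nonneg 0≤Q (0≤Q^ n)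

  1≤Q^ : ∀ n → 1ℤ ≤ᶻ Q ℤ.^ n
  1≤Q^ zero    = ℤₚ.≤-refl
  1≤Q^ (suc n) = *-mono {1ℤ} {Q} {1ℤ} (ℤ.+≤+ z≤n) 0≤Q 1≤Q (1≤Q^ n)

  #degenerate≤ : ∀ j n L → L ≤ n ℕ.+ n → #degenerate j L ≤ᶻ Q ℤ.^ n
  #degenerate≤ j n zero le = 1≤Q^ n
  #degenerate≤ j (suc n) (suc zero) le = ℤₚ.≤-trans (ℤₚ.≤-reflexive (trans (cons j 0) (ℤₚ.*-identityʳ (A j)))) (ℤₚ.≤-trans (A≤Q j) (ℤₚ.≤-trans (ℤₚ.≤-reflexive (sym (ℤₚ.*-identityʳ Q))) (*-monoˡ 0≤Q (1≤Q^ n))))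
  #degenerate≤ j (suc n) (suc (suc L)) (s≤s le) = ℤₚ.≤-trans (ℤₚ.≤-reflexive (trans (cons j (suc L)) (trans (cong (A j *_) (cons (suc j) L)) (sym (ℤₚ.*-assoc (A j) (A (suc j)) _)))))
    (*-mono (#degenerate-nonneg (suc (suc j)) L) 0≤Q (AA≤Q j) (#degenerate≤ (suc (suc j)) n L (ℕₚ.≤-pred (ℕₚ.≤-trans le (ℕₚ.≤-reflexive (ℕₚ.+-suc n n))))))

  inseparable⇒degenerate : ∀ {m} (P : Vec F (suc m)) → (∀ (i : Fin (suc m)) → der (mon P) (toℕ i) ≡ 𝔽.0#) → Degenerate 0 P
  inseparable⇒degenerate {m} P h = go P 0 (λ { zero _ → refl ; (suc n) (s≤s lt) → trans (sym (der-times (mon P) n)) (trans (cong (der (mon P)) (sym (Finₚ.toℕ-fromℕ< (ℕₚ.m≤n⇒m≤1+n lt)))) (h (Fin.fromℕ< (ℕₚ.m≤n⇒m≤1+n lt)))) })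
    where
    go : ∀ {L} (v : Vec F L) j → (∀ i → i < L → times (j ℕ.+ i) (mon v i) ≡ 𝔽.0#) → Degenerate j v
    go []      j h = tt
    go (a ∷ v) j h = trans (cong (λ n → times n a) (sym (ℕₚ.+-identityʳ j))) (h 0 (s≤s z≤n)) , go v (suc j) (λ i lt → trans (cong (λ n → times n (mon v i)) (sym (ℕₚ.+-suc j i))) (h (suc i) (s≤s lt)))

  -- Counting replaces the perfectness of finite fields: there are at least (q^{m+1} - m q^h)/(m +
  -- 1) primes of degree m + 1, but at most q^{h+1} polynomials with zero derivative.
  exists-separablePrime : ∀ m h → m ≤ h ℕ.+ h → + suc m * Q ℤ.^ suc h + + m * Q ℤ.^ h <ᶻ Q ℤ.^ suc m →
                          ∃ λ (P : Vec F (suc m)) → Prime P × ∃ λ i → der (mon P) i ≢ 𝔽.0#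
  exists-separablePrime m h le big = go (Enum.search (Vecs (suc m)) (λ P → prime? P ×-dec ¬? (degenerate? 0 P)))
    where
    coefficient : ∀ P → ¬ Degenerate 0 P → (d : Dec (∀ (i : Fin (suc m)) → der (mon P) (toℕ i) ≡ 𝔽.0#)) → ∃ λ i → der (mon P) i ≢ 𝔽.0#
    coefficient P n (yes all) = ⊥-elim (n (inseparable⇒degenerate P all))
    coefficient P n (no ¬all) = let (i , ne , _) = Finₚ.¬∀⟶∃¬-smallest (suc m) _ (λ i → der (mon P) (toℕ i) E.≟ 𝔽.0#) ¬all in toℕ i , ne
    go : (∃ λ P → Prime P × ¬ Degenerate 0 P) ⊎ (∀ P → ¬ (Prime P × ¬ Degenerate 0 P)) → _
    go (inj₁ (P , prime , n)) = P , prime , coefficient P n (Finₚ.all? (λ i → der (mon P) (toℕ i) E.≟ 𝔽.0#))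
    go (inj₂ none) = ⊥-elim (ℤₚ.<-irrefl refl (ℤₚ.≤-<-trans (ℤₚ.≤-trans (#primes≥ m h le) (ℤₚ.+-monoˡ-≤ (+ m * Q ℤ.^ h) (*-monoˡ {+ suc m} (ℤ.+≤+ z≤n) few))) big))
      where
      few : #primes m ≤ᶻ Q ℤ.^ suc h
      few = ℤₚ.≤-trans (∑-mono (Enum.list (Vecs (suc m))) (λ P → ⟦⟧-mono (prime? P) (degenerate? 0 P) (λ p → Dec.decidable-stable (degenerate? 0 P) (λ n → none P (p , n)))))
        (#degenerate≤ 0 (suc h) (suc m) (ℕₚ.≤-trans (s≤s le) (s≤s (ℕₚ.+-monoʳ-≤ h (ℕₚ.n≤1+n h)))))

  exists-extension : ∀ m h → m ≤ h ℕ.+ h → + suc m * Q ℤ.^ suc h + + m * Q ℤ.^ h <ᶻ Q ℤ.^ suc m →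
                     ∃ λ (L : FieldExtension 𝔽) → FieldExtension.e L ≡ m
  exists-extension m h le big = build (exists-separablePrime m h le big)
    where
    build : (∃ λ (P : Vec F (suc m)) → Prime P × ∃ λ i → der (mon P) i ≢ 𝔽.0#) → ∃ λ (L : FieldExtension 𝔽) → FieldExtension.e L ≡ m
    build (P , prime , sep) = fieldExtension 𝔽 P (Prime⇒domain P prime) sep

module Weights (𝔽 : FiniteField) where
  private
    module 𝔽 = FieldFacts 𝔽
  open FiniteField 𝔽 using (F)
  open Polynomials 𝔽 using (mon)
  open RootPowerSums 𝔽
  open Characteristic 𝔽
  open Sums
  open import Data.Integer using () renaming (_*_ to _*ᶻ_; _≤_ to _≤ᶻ_)

  -- The factor f(0) ≠ 0 singles out the polynomials whose companion matrices are invertible, the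
  -- only ones that close a block of an element of GL_n.
  weight : ℕ → F → ∀ {m} → Vec F (suc m) → ℤ
  weight k b f = ⟦ ¬? (mon f 0 𝔽.≟ 𝔽.0#) ⟧ *ᶻ ψ b (τ k f)

  abs-weight : ∀ k b {m} (f : Vec F (suc m)) → abs (weight k b f) ≤ᶻ Q
  abs-weight k b f = ℤₚ.≤-trans (ℤₚ.≤-reflexive (trans (abs-* ⟦ nz ⟧ (ψ b (τ k f))) (cong (_*ᶻ abs (ψ b (τ k f))) (abs-nonneg (⟦⟧-nonneg nz)))))
    (ℤₚ.≤-trans (*-mono (0≤abs (ψ b (τ k f))) (ℤ.+≤+ z≤n) (⟦⟧≤1 nz) (abs-ψ b (τ k f))) (ℤₚ.≤-reflexive (ℤₚ.*-identityˡ Q)))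
    where nz = ¬? (mon f 0 𝔽.≟ 𝔽.0#)

-- Moments of the number of generating roots in one extension

module Moments {𝔽 : FiniteField} (𝕃 : FieldExtension 𝔽) where
  private
    module 𝔽 = FieldFacts 𝔽
  open FiniteField 𝔽 using (F)
  open FieldExtension 𝕃 public
  open AlgebraFacts 𝔎 public
  open Domain 𝔎 𝔼 zeroDivisors 1≢0 public
  open Generators 𝔎 𝔼 zeroDivisors 1≢0 {e} K-size public
  open TraceSums 𝔎 𝔼 zeroDivisors 1≢0 tr tr-+ tr-⌊⌋ c₁ tr-c₁ public
  open Polynomials 𝔽 using (mon)
  open PolynomialDivision 𝔽 using (product; mon-product)
  open RootPowerSums 𝔽
  open Characteristic 𝔽
  open Weights 𝔽
  open Sums
  open import Data.Integer using () renaming (_+_ to _+ᶻ_; _*_ to _*ᶻ_; _-_ to _-ᶻ_; _≤_ to _≤ᶻ_; -_ to -ᶻ_)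
  module E = Enum 𝔼

  #generators : ℤ
  #generators = E.sum (λ α → ⟦ generator? α ⟧)

  #generators≤ : #generators ≤ᶻ Q ℤ.^ suc e
  #generators≤ = ℤₚ.≤-trans (∑-mono E.list (λ α → ⟦⟧≤1 (generator? α))) (ℤₚ.≤-reflexive K-size)

  #roots : ∀ {m} → Vec F m → ℤ
  #roots f = E.sum (λ α → ⟦ generator? α ⟧ *ᶻ ⟦ evm α f E.≟ 0# ⟧)

  sum-#roots : ∀ {l m} → suc e ℕ.+ l ≡ m → (φ : Vec F m → ℤ) →
               Enum.sum (Vecs m) (λ f → φ f *ᶻ #roots f) ≡ E.sum (λ α → ⟦ generator? α ⟧ *ᶻ Enum.sum (Vecs m) (λ f → ⟦ evm α f E.≟ 0# ⟧ *ᶻ φ f))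
  sum-#roots {l} {m} eq φ = trans (∑-cong (Enum.list (Vecs m)) (λ f → sym (∑-*ˡ E.list (φ f) _))) (trans (∑-swap (Enum.list (Vecs m)) E.list _)
    (∑-cong E.list (λ α → trans (∑-cong (Enum.list (Vecs m)) (λ f → rearrange (φ f) ⟦ generator? α ⟧ ⟦ evm α f E.≟ 0# ⟧)) (∑-*ˡ (Enum.list (Vecs m)) ⟦ generator? α ⟧ _))))
    where
    rearrange : ∀ a g r → a *ᶻ (g *ᶻ r) ≡ g *ᶻ (r *ᶻ a)
    rearrange = ℤ-solve-∀

  -- The polynomials of degree m vanishing at a generator α are the q^l multiples of its minimal
  -- polynomial.
  first-moment : ∀ {l m} → suc e ℕ.+ l ≡ m → Enum.sum (Vecs m) #roots ≡ #generators *ᶻ Q ℤ.^ l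
  first-moment {l} {m} eq = trans (∑-cong (Enum.list (Vecs m)) (λ f → sym (ℤₚ.*-identityˡ (#roots f)))) (trans (sum-#roots eq (λ _ → 1ℤ))
    (trans (∑-cong E.list (λ α → ⟦⟧*-cong (generator? α) (λ gen → trans (∑-cong (Enum.list (Vecs m)) (λ f → ℤₚ.*-identityʳ ⟦ evm α f E.≟ 0# ⟧))
      (MinPolyMultiples.count-multiples gen (minPoly gen) (evm-minPoly gen) eq)))) (∑-*ʳ E.list (Q ℤ.^ l) _)))

  -- In the trivial extension, e = 0, the element 0 is a generator too; a generator of degree at
  -- least 2 cannot be a root of x.
  generator≢0 : 1 ≤ e → ∀ {α} → Generator α → α ≢ 0#
  generator≢0 1≤e {α} gen α≡0 = evm≢0 gen (𝔽.0# ∷ []) (s≤s 1≤e) (trans (cong₂ _+_ ⌊⌋-0 (trans (cong (_* evm α []) α≡0) (zeroˡ _))) (+-identityˡ 0#))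

  minPoly-0≢0 : 1 ≤ e → ∀ {α} (gen : Generator α) (R : Vec F (suc e)) → evm α R ≡ 0# → mon R 0 ≢ 𝔽.0#
  minPoly-0≢0 1≤e {α} gen (r ∷ R) root r≡0 = *-≢0 (generator≢0 1≤e gen) (evm≢0 gen R (ℕₚ.n<1+n e))
    (trans (sym (+-identityˡ _)) (trans (cong (_+ α * evm α R) (sym (trans (cong ⌊_⌋ r≡0) ⌊⌋-0))) root))

  generatorSum : ℕ → F → ℤ
  generatorSum k b = E.sum (λ α → ⟦ generator? α ⟧ *ᶻ ψ b (tr (α ^ k)))

  -- A polynomial with root α is R C with R the minimal polynomial of α. Its constant term vanishes
  -- exactly when that of C does, and its power sum is Tr αᵏ + τ_k(C). For fixed C the sum over α is
  -- thus a `generatorSum` with the target shifted by τ_k(C).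
  weighted-moment : 1 ≤ e → ∀ {l m} → suc e ℕ.+ suc l ≡ suc m → ∀ k b {B} → (∀ b′ → abs (generatorSum k b′) ≤ᶻ B) →
                    abs (Enum.sum (Vecs (suc m)) (λ f → weight k b f *ᶻ #roots f)) ≤ᶻ Q ℤ.^ suc l *ᶻ B
  weighted-moment 1≤e {l} {m} eq k b {B} bound = ℤₚ.≤-trans (ℤₚ.≤-reflexive (cong abs total)) (ℤₚ.≤-trans (∑-abs (Enum.list (Vecs (suc l))) _)
    (ℤₚ.≤-trans (∑-mono (Enum.list (Vecs (suc l))) each) (ℤₚ.≤-reflexive (trans (Enum.sum-*1 (Vecs (suc l)) B) (cong (_*ᶻ B) (Vecs-size (suc l)))))))
    where
    open ≡-Reasoning
    nz : Vec F (suc l) → ℤ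
    nz C = ⟦ ¬? (mon C 0 𝔽.≟ 𝔽.0#) ⟧
    multiple : ∀ {α} (gen : Generator α) C → weight k b (product eq (minPoly gen) C) ≡ nz C *ᶻ ψ (b 𝔽.- τ k C) (tr (α ^ k))
    multiple {α} gen C = cong₂ _*ᶻ_
      (⟦⟧-cong (¬? (mon (product eq R C) 0 𝔽.≟ 𝔽.0#)) (¬? (mon C 0 𝔽.≟ 𝔽.0#))
        (λ h c → h (trans (mon-product eq R C 0) (trans (cong (mon R 0 𝔽.*_) c) (𝔽.zeroʳ _))))
        (λ h c → h (𝔽.*-cancelˡ-0 (minPoly-0≢0 1≤e gen R (evm-minPoly gen)) (trans (sym (mon-product eq R C 0)) c))))
      (trans (cong (ψ b) (trans (τ-product k R C (product eq R C) (ℕₚ.suc-injective eq) (mon-product eq R C)) (cong (𝔽._+ τ k C) (τ-root gen k R (evm-minPoly gen))))) (ψ-shift b (tr (α ^ k)) (τ k C)))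
      where R = minPoly gen
    total : Enum.sum (Vecs (suc m)) (λ f → weight k b f *ᶻ #roots f) ≡ Enum.sum (Vecs (suc l)) (λ C → nz C *ᶻ generatorSum k (b 𝔽.- τ k C))
    total = begin
      Enum.sum (Vecs (suc m)) (λ f → weight k b f *ᶻ #roots f)
        ≡⟨ sum-#roots eq (weight k b) ⟩
      E.sum (λ α → ⟦ generator? α ⟧ *ᶻ Enum.sum (Vecs (suc m)) (λ f → ⟦ evm α f E.≟ 0# ⟧ *ᶻ weight k b f))
        ≡⟨ ∑-cong E.list (λ α → ⟦⟧*-cong (generator? α) (λ gen → trans (MinPolyMultiples.sum-multiples gen (minPoly gen) (evm-minPoly gen) eq (weight k b)) (∑-cong (Enum.list (Vecs (suc l))) (multiple gen)))) ⟩
      E.sum (λ α → ⟦ generator? α ⟧ *ᶻ Enum.sum (Vecs (suc l)) (λ C → nz C *ᶻ ψ (b 𝔽.- τ k C) (tr (α ^ k))))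
        ≡⟨ ∑-cong E.list (λ α → sym (∑-*ˡ (Enum.list (Vecs (suc l))) ⟦ generator? α ⟧ _)) ⟩
      E.sum (λ α → Enum.sum (Vecs (suc l)) (λ C → ⟦ generator? α ⟧ *ᶻ (nz C *ᶻ ψ (b 𝔽.- τ k C) (tr (α ^ k)))))
        ≡⟨ ∑-swap E.list (Enum.list (Vecs (suc l))) _ ⟩
      Enum.sum (Vecs (suc l)) (λ C → E.sum (λ α → ⟦ generator? α ⟧ *ᶻ (nz C *ᶻ ψ (b 𝔽.- τ k C) (tr (α ^ k)))))
        ≡⟨ ∑-cong (Enum.list (Vecs (suc l))) (λ C → trans (∑-cong E.list (λ α → swap ⟦ generator? α ⟧ (nz C) _)) (∑-*ˡ E.list (nz C) _)) ⟩
      Enum.sum (Vecs (suc l)) (λ C → nz C *ᶻ generatorSum k (b 𝔽.- τ k C)) ∎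
      where
      swap : ∀ a b c → a *ᶻ (b *ᶻ c) ≡ b *ᶻ (a *ᶻ c)
      swap = ℤ-solve-∀
    each : ∀ C → abs (nz C *ᶻ generatorSum k (b 𝔽.- τ k C)) ≤ᶻ B
    each C = ℤₚ.≤-trans (ℤₚ.≤-reflexive (abs-* (nz C) _)) (ℤₚ.≤-trans (*-mono (0≤abs (generatorSum k (b 𝔽.- τ k C))) (ℤ.+≤+ z≤n)
        (ℤₚ.≤-trans (ℤₚ.≤-reflexive (abs-nonneg (⟦⟧-nonneg (¬? (mon C 0 𝔽.≟ 𝔽.0#))))) (⟦⟧≤1 (¬? (mon C 0 𝔽.≟ 𝔽.0#)))) (bound (b 𝔽.- τ k C)))
      (ℤₚ.≤-reflexive (ℤₚ.*-identityˡ B)))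

  #nonGenerators : ℤ
  #nonGenerators = E.sum (λ α → ⟦ ¬? (generator? α) ⟧)

  #generators-complement : #generators ≡ Q ℤ.^ suc e -ᶻ #nonGenerators
  #generators-complement = sym (trans (cong₂ _-ᶻ_ (sym K-size) refl) (trans (sym (∑-- E.list _ _)) (∑-cong E.list (λ α → trans (cong (λ z → 1ℤ -ᶻ z) (⟦⟧-¬ (generator? α))) (identity ⟦ generator? α ⟧)))))
    where
    identity : ∀ x → 1ℤ -ᶻ (1ℤ -ᶻ x) ≡ x
    identity = ℤ-solve-∀

  -- The sum over all units differs from the sum over generators by terms of non-generators only,
  -- each at most q in absolute value.
  generatorSum≤ : 1 ≤ e → ∀ k b → abs (generatorSum k b) ≤ᶻ abs (powerSum k b 1#) +ᶻ Q *ᶻ #nonGenerators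
  generatorSum≤ 1≤e k b = ℤₚ.≤-trans (ℤₚ.≤-reflexive (cong abs split)) (ℤₚ.≤-trans (abs-+ (powerSum k b 1#) (-ᶻ rest))
    (ℤₚ.+-monoʳ-≤ (abs (powerSum k b 1#)) (ℤₚ.≤-trans (ℤₚ.≤-reflexive (abs-neg rest)) rest≤)))
    where
    rest : ℤ
    rest = E.sum (λ α → ⟦ ¬? (generator? α) ⟧ *ᶻ (⟦ nonzero? α ⟧ *ᶻ ψ b (tr (1# * α ^ k))))
    split : generatorSum k b ≡ powerSum k b 1# -ᶻ rest
    split = trans (∑-cong E.list (λ α → each α (generator? α))) (∑-- E.list _ _)
      where
      each : ∀ α (d : Dec (Generator α)) → ⟦ d ⟧ *ᶻ ψ b (tr (α ^ k)) ≡ ⟦ nonzero? α ⟧ *ᶻ ψ b (tr (1# * α ^ k)) -ᶻ ⟦ ¬? d ⟧ *ᶻ (⟦ nonzero? α ⟧ *ᶻ ψ b (tr (1# * α ^ k)))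
      each α (yes gen) = trans (cong₂ _*ᶻ_ (sym (⟦⟧-yes (nonzero? α) (generator≢0 1≤e gen))) (cong (λ z → ψ b (tr z)) (sym (*-identityˡ (α ^ k))))) (minus0 _)
        where
        minus0 : ∀ x → x ≡ x -ᶻ 0ℤ *ᶻ x
        minus0 = ℤ-solve-∀
      each α (no _) = cancel (ψ b (tr (α ^ k))) (⟦ nonzero? α ⟧ *ᶻ ψ b (tr (1# * α ^ k)))
        where
        cancel : ∀ y x → 0ℤ *ᶻ y ≡ x -ᶻ 1ℤ *ᶻ x
        cancel = ℤ-solve-∀
    rest≤ : abs rest ≤ᶻ Q *ᶻ #nonGenerators
    rest≤ = ℤₚ.≤-trans (∑-abs E.list _) (ℤₚ.≤-trans (∑-mono E.list (λ α → bound α)) (ℤₚ.≤-reflexive (∑-*ˡ E.list Q _)))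
      where
      bound : ∀ α → abs (⟦ ¬? (generator? α) ⟧ *ᶻ (⟦ nonzero? α ⟧ *ᶻ ψ b (tr (1# * α ^ k)))) ≤ᶻ Q *ᶻ ⟦ ¬? (generator? α) ⟧
      bound α = ℤₚ.≤-trans (ℤₚ.≤-reflexive (trans (abs-* ⟦ ¬? (generator? α) ⟧ _) (cong₂ _*ᶻ_ (abs-nonneg (⟦⟧-nonneg (¬? (generator? α)))) (trans (abs-* ⟦ nonzero? α ⟧ _) (cong (_*ᶻ abs (ψ b (tr (1# * α ^ k)))) (abs-nonneg (⟦⟧-nonneg (nonzero? α))))))))
        (ℤₚ.≤-trans (*-monoˡ (⟦⟧-nonneg (¬? (generator? α))) (ℤₚ.≤-trans (*-mono (0≤abs (ψ b (tr (1# * α ^ k)))) (ℤ.+≤+ z≤n) (⟦⟧≤1 (nonzero? α)) (abs-ψ b (tr (1# * α ^ k)))) (ℤₚ.≤-reflexive (ℤₚ.*-identityˡ Q))))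
          (ℤₚ.≤-reflexive (ℤₚ.*-comm ⟦ ¬? (generator? α) ⟧ Q)))

-- Mixed second moments for two extensions

module CrossMoments {𝔽 : FiniteField} where
  private
    module 𝔽 = FieldFacts 𝔽
  open FiniteField 𝔽 using (F)
  open PolynomialDivision 𝔽 using (product; evm-product)
  open Characteristic 𝔽
  open Sums
  open import Data.Integer using (_+_; _*_) renaming (_≤_ to _≤ᶻ_)
  open PrimeCount 𝔽 using (Vecs; Vecs-size)
  open SeparablePrime 𝔽 using (0≤Q^)

  private
    e : FieldExtension 𝔽 → ℕ
    e = FieldExtension.e

    module Pair (𝕃 𝕃′ : FieldExtension 𝔽) (e≤e′ : e 𝕃 ≤ e 𝕃′) {l l′ m : ℕ} (eq : suc (e 𝕃) ℕ.+ l ≡ m) (eq′ : suc (e 𝕃′) ℕ.+ l′ ≡ l) where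
      private
        module A = Moments 𝕃
        module B = Moments 𝕃′

      common : A.K → B.K → ℤ
      common α β = Enum.sum (Vecs m) (λ f → ⟦ A.evm α f A.E.≟ A.0# ⟧ * ⟦ B.evm β f B.E.≟ B.0# ⟧)

      -- If f = R C with R the minimal polynomial of α, then β is a root of C, which leaves q^{l′}
      -- choices, or a root of R, in which case all q^l cofactors count.
      common≤ : ∀ {α β} (gen : A.Generator α) → B.Generator β →
                common α β ≤ᶻ Q ℤ.^ l′ + ⟦ B.evm β (A.minPoly gen) B.E.≟ B.0# ⟧ * Q ℤ.^ l
      common≤ {α} {β} gen gen′ = ℤₚ.≤-trans (ℤₚ.≤-reflexive (A.MinPolyMultiples.sum-multiples gen R (A.evm-minPoly gen) eq (λ f → ⟦ B.evm β f B.E.≟ B.0# ⟧))) (decide (B.evm β R B.E.≟ B.0#))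
        where
        R = A.minPoly gen
        value : ∀ C → B.evm β (product eq R C) ≡ B.evm β R B.* B.evm β C
        value C = evm-product B.𝔎 β eq R C
        decide : (d : Dec (B.evm β R ≡ B.0#)) → Enum.sum (Vecs l) (λ C → ⟦ B.evm β (product eq R C) B.E.≟ B.0# ⟧) ≤ᶻ Q ℤ.^ l′ + ⟦ d ⟧ * Q ℤ.^ l
        decide (yes _) = ℤₚ.≤-trans (∑-mono (Enum.list (Vecs l)) (λ C → ⟦⟧≤1 (B.evm β (product eq R C) B.E.≟ B.0#))) (ℤₚ.≤-trans (ℤₚ.≤-reflexive (trans (Vecs-size l) (trans (sym (ℤₚ.*-identityˡ (Q ℤ.^ l))) (sym (ℤₚ.+-identityˡ _))))) (ℤₚ.+-monoˡ-≤ (1ℤ * Q ℤ.^ l) (0≤Q^ l′)))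
        decide (no ne) = ℤₚ.≤-trans (∑-mono (Enum.list (Vecs l)) (λ C → ⟦⟧-mono (B.evm β (product eq R C) B.E.≟ B.0#) (B.evm β C B.E.≟ B.0#) (λ h → B.*-zero-cancelˡ ne (trans (sym (value C)) h))))
          (ℤₚ.≤-reflexive (trans (B.MinPolyMultiples.count-multiples gen′ (B.minPoly gen′) (B.evm-minPoly gen′) eq′) (sym (trans (cong (λ z → Q ℤ.^ l′ + z) (ℤₚ.*-zeroˡ (Q ℤ.^ l))) (ℤₚ.+-identityʳ _)))))

      roots≤ : (R : Vec F (suc (e 𝕃))) → B.E.sum (λ β → ⟦ B.generator? β ⟧ * ⟦ B.evm β R B.E.≟ B.0# ⟧) ≤ᶻ ⟦ e 𝕃 ℕ.≟ e 𝕃′ ⟧ * + suc (e 𝕃)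
      roots≤ R = decide (e 𝕃 ℕ.≟ e 𝕃′)
        where
        decide : (d : Dec (e 𝕃 ≡ e 𝕃′)) → B.E.sum (λ β → ⟦ B.generator? β ⟧ * ⟦ B.evm β R B.E.≟ B.0# ⟧) ≤ᶻ ⟦ d ⟧ * + suc (e 𝕃)
        decide (yes _) = ℤₚ.≤-trans (∑-mono B.E.list (λ β → ℤₚ.≤-trans (*-monoʳ (⟦⟧-nonneg (B.evm β R B.E.≟ B.0#)) (⟦⟧≤1 (B.generator? β))) (ℤₚ.≤-reflexive (ℤₚ.*-identityˡ _)))) (ℤₚ.≤-trans (B.roots-evm≤degree R) (ℤₚ.≤-reflexive (sym (ℤₚ.*-identityˡ (+ suc (e 𝕃))))))
        decide (no ne) = ℤₚ.≤-reflexive (trans (∑-cong B.E.list (λ β → trans (⟦⟧*-cong (B.generator? β) (λ gen′ → ⟦⟧-no (B.evm β R B.E.≟ B.0#) (B.evm≢0 gen′ R (s≤s (ℕₚ.≤∧≢⇒< e≤e′ ne))))) (ℤₚ.*-zeroʳ ⟦ B.generator? β ⟧))) (trans (∑-0 B.E.list) (sym (ℤₚ.*-zeroˡ (+ suc (e 𝕃))))))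

      row≤ : ∀ {α} → A.Generator α → B.E.sum (λ β → ⟦ B.generator? β ⟧ * common α β) ≤ᶻ Q ℤ.^ suc (e 𝕃′) * Q ℤ.^ l′ + ⟦ e 𝕃 ℕ.≟ e 𝕃′ ⟧ * + suc (e 𝕃) * Q ℤ.^ l
      row≤ {α} gen = ℤₚ.≤-trans (∑-mono B.E.list (λ β → ⟦⟧*-mono (B.generator? β) (λ gen′ → common≤ gen gen′)))
        (ℤₚ.≤-trans (ℤₚ.≤-reflexive (trans (∑-cong B.E.list (λ β → distribute ⟦ B.generator? β ⟧ (Q ℤ.^ l′) ⟦ B.evm β (A.minPoly gen) B.E.≟ B.0# ⟧ (Q ℤ.^ l))) (trans (∑-+ B.E.list _ _) (cong₂ _+_ (∑-*ʳ B.E.list (Q ℤ.^ l′) _) (∑-*ʳ B.E.list (Q ℤ.^ l) _)))))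
          (ℤₚ.+-mono-≤ (*-monoʳ (0≤Q^ l′) B.#generators≤) (*-monoʳ (0≤Q^ l) (roots≤ (A.minPoly gen)))))
        where
        distribute : ∀ g a r b → g * (a + r * b) ≡ g * a + g * r * b
        distribute = ℤ-solve-∀

      sum≤ : Enum.sum (Vecs m) (λ f → A.#roots f * B.#roots f) ≤ᶻ Q ℤ.^ m * (1ℤ + ⟦ e 𝕃 ℕ.≟ e 𝕃′ ⟧ * + suc (e 𝕃))
      sum≤ = begin
        Enum.sum (Vecs m) (λ f → A.#roots f * B.#roots f)
          ≡⟨ ∑-cong (Enum.list (Vecs m)) (λ f → ℤₚ.*-comm (A.#roots f) (B.#roots f)) ⟩
        Enum.sum (Vecs m) (λ f → B.#roots f * A.#roots f)
          ≡⟨ A.sum-#roots eq B.#roots ⟩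
        A.E.sum (λ α → ⟦ A.generator? α ⟧ * Enum.sum (Vecs m) (λ f → ⟦ A.evm α f A.E.≟ A.0# ⟧ * B.#roots f))
          ≡⟨ ∑-cong A.E.list (λ α → cong (⟦ A.generator? α ⟧ *_) (trans (B.sum-#roots {m ∸ suc (e 𝕃′)} split (λ f → ⟦ A.evm α f A.E.≟ A.0# ⟧)) (∑-cong B.E.list (λ β → cong (⟦ B.generator? β ⟧ *_) (∑-cong (Enum.list (Vecs m)) (λ f → ℤₚ.*-comm ⟦ B.evm β f B.E.≟ B.0# ⟧ _)))))) ⟩
        A.E.sum (λ α → ⟦ A.generator? α ⟧ * B.E.sum (λ β → ⟦ B.generator? β ⟧ * common α β))
          ≤⟨ ∑-mono A.E.list (λ α → ⟦⟧*-mono (A.generator? α) row≤) ⟩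
        A.E.sum (λ α → ⟦ A.generator? α ⟧ * bound)
          ≡⟨ ∑-*ʳ A.E.list bound _ ⟩
        A.#generators * bound
          ≤⟨ *-monoʳ 0≤bound A.#generators≤ ⟩
        Q ℤ.^ suc (e 𝕃) * bound
          ≡⟨ final ⟩
        Q ℤ.^ m * (1ℤ + ⟦ e 𝕃 ℕ.≟ e 𝕃′ ⟧ * + suc (e 𝕃)) ∎
        where
        open ℤₚ.≤-Reasoning
        bound : ℤ
        bound = Q ℤ.^ suc (e 𝕃′) * Q ℤ.^ l′ + ⟦ e 𝕃 ℕ.≟ e 𝕃′ ⟧ * + suc (e 𝕃) * Q ℤ.^ l
        0≤bound : 0ℤ ≤ᶻ bound
        0≤bound = ℤₚ.+-mono-≤ (*-nonneg (0≤Q^ (suc (e 𝕃′))) (0≤Q^ l′)) (*-nonneg (*-nonneg (⟦⟧-nonneg (e 𝕃 ℕ.≟ e 𝕃′)) (ℤ.+≤+ z≤n)) (0≤Q^ l))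
        split : suc (e 𝕃′) ℕ.+ (m ∸ suc (e 𝕃′)) ≡ m
        split = ℕₚ.m+[n∸m]≡n (ℕₚ.≤-trans (ℕₚ.≤-trans (ℕₚ.m≤m+n (suc (e 𝕃′)) l′) (ℕₚ.≤-reflexive eq′)) (ℕₚ.≤-trans (ℕₚ.m≤n+m l (suc (e 𝕃))) (ℕₚ.≤-reflexive eq)))
        power : ∀ a b {c} → a ℕ.+ b ≡ c → Q ℤ.^ a * Q ℤ.^ b ≡ Q ℤ.^ c
        power a b refl = sym (ℤₚ.^-distribˡ-+-* Q a b)
        final : Q ℤ.^ suc (e 𝕃) * bound ≡ Q ℤ.^ m * (1ℤ + ⟦ e 𝕃 ℕ.≟ e 𝕃′ ⟧ * + suc (e 𝕃))
        final = trans (cong (λ z → Q ℤ.^ suc (e 𝕃) * (z + ⟦ e 𝕃 ℕ.≟ e 𝕃′ ⟧ * + suc (e 𝕃) * Q ℤ.^ l)) (power (suc (e 𝕃′)) l′ eq′))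
          (trans (collect (Q ℤ.^ suc (e 𝕃)) (Q ℤ.^ l) (⟦ e 𝕃 ℕ.≟ e 𝕃′ ⟧ * + suc (e 𝕃))) (cong (_* (1ℤ + ⟦ e 𝕃 ℕ.≟ e 𝕃′ ⟧ * + suc (e 𝕃))) (power (suc (e 𝕃)) l eq)))
          where
          collect : ∀ a x c → a * (x + c * x) ≡ a * x * (1ℤ + c)
          collect = ℤ-solve-∀

  -- Roots in extensions of different degree are uncorrelated up to the stated bound; in equal
  -- degree the conjugates of a root add the degree. The extensions are ordered by degree, because a
  -- minimal polynomial of smaller degree has no generator of the larger field as a root.
  cross-moment : ∀ (𝕃 𝕃′ : FieldExtension 𝔽) {m} → suc (e 𝕃) ℕ.+ suc (e 𝕃′) ≤ m →
                 Enum.sum (Vecs m) (λ f → Moments.#roots 𝕃 f * Moments.#roots 𝕃′ f) ≤ᶻ Q ℤ.^ m * (1ℤ + ⟦ e 𝕃 ℕ.≟ e 𝕃′ ⟧ * + suc (e 𝕃))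
  cross-moment 𝕃 𝕃′ {m} le = decide (ℕₚ.≤-total (e 𝕃) (e 𝕃′))
    where
    split : ∀ a b → a ℕ.+ b ≤ m → a ℕ.+ (b ℕ.+ (m ∸ (a ℕ.+ b))) ≡ m
    split a b le = trans (sym (ℕₚ.+-assoc a b _)) (ℕₚ.m+[n∸m]≡n le)
    decide : e 𝕃 ≤ e 𝕃′ ⊎ e 𝕃′ ≤ e 𝕃 → Enum.sum (Vecs m) (λ f → Moments.#roots 𝕃 f * Moments.#roots 𝕃′ f) ≤ᶻ Q ℤ.^ m * (1ℤ + ⟦ e 𝕃 ℕ.≟ e 𝕃′ ⟧ * + suc (e 𝕃))
    decide (inj₁ h) = Pair.sum≤ 𝕃 𝕃′ h (split (suc (e 𝕃)) (suc (e 𝕃′)) le) refl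
    decide (inj₂ h) = ℤₚ.≤-trans (ℤₚ.≤-reflexive (∑-cong (Enum.list (Vecs m)) (λ f → ℤₚ.*-comm (Moments.#roots 𝕃 f) (Moments.#roots 𝕃′ f))))
      (ℤₚ.≤-trans (Pair.sum≤ 𝕃′ 𝕃 h (split (suc (e 𝕃′)) (suc (e 𝕃)) (subst (_≤ m) (ℕₚ.+-comm (suc (e 𝕃)) (suc (e 𝕃′))) le)) refl)
        (ℤₚ.≤-reflexive (cong (λ z → Q ℤ.^ m * (1ℤ + z)) (flip (e 𝕃 ℕ.≟ e 𝕃′) (e 𝕃′ ℕ.≟ e 𝕃)))))
      where
      flip : (d : Dec (e 𝕃 ≡ e 𝕃′)) (d′ : Dec (e 𝕃′ ≡ e 𝕃)) → ⟦ d′ ⟧ * + suc (e 𝕃′) ≡ ⟦ d ⟧ * + suc (e 𝕃)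
      flip (yes p) (yes _) = cong (λ n → 1ℤ * + suc n) (sym p)
      flip (yes p) (no n)  = contradiction (sym p) n
      flip (no n) (yes p)  = contradiction (sym p) n
      flip (no _) (no _)   = refl

-- Equidistribution of τ_k by the second moment method

module PolynomialLaw {𝔽 : FiniteField} (m k : ℕ) (b : FiniteField.F 𝔽)
                     (𝕃s : List (FieldExtension 𝔽)) (c : ℕ → ℤ) (c₀ s : ℤ) where
  open FiniteField 𝔽 using (F; q)
  open Characteristic 𝔽
  open Weights 𝔽
  open Sums
  open import Data.Integer using (_+_; _*_; _-_; -_) renaming (_≤_ to _≤ᶻ_)
  open PrimeCount 𝔽 using (Vecs; Vecs-size)
  open SeparablePrime 𝔽 using (0≤Q^)
  open CrossMoments {𝔽}

  private
    e : FieldExtension 𝔽 → ℕ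
    e = FieldExtension.e

    N : ℤ
    N = Q ℤ.^ suc m

  -- `degree≤` leaves room for two minimal polynomials in a polynomial of degree m + 1;
  -- `c-normalised` makes the coefficient c₀/d; `few` and `B-small` ask for relative errors 1/s², so
  -- that errors 1/s remain after taking a square root.
  record Suitable (𝕃 : FieldExtension 𝔽) : Set where
    field
      1≤e          : 1 ≤ e 𝕃
      degree≤      : suc (e 𝕃) ℕ.+ suc (e 𝕃) ≤ suc m
      0≤c          : 0ℤ ≤ᶻ c (e 𝕃)
      c-normalised : c (e 𝕃) * + suc (e 𝕃) ≡ c₀
      few          : s * s * Moments.#nonGenerators 𝕃 ≤ᶻ Q ℤ.^ suc (e 𝕃)
      B            : ℤ
      generatorSum : ∀ b′ → abs (Moments.generatorSum 𝕃 k b′) ≤ᶻ B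
      B-small      : s * s * B ≤ᶻ Q ℤ.^ suc (e 𝕃)

  private
    w : FieldExtension 𝔽 → ℤ
    w 𝕃 = c (e 𝕃)

  μ : ℤ
  μ = ∑ 𝕃s w

  W : Vec F (suc m) → ℤ
  W f = ∑ 𝕃s (λ 𝕃 → w 𝕃 * Moments.#roots 𝕃 f)

  private
    L : List (Vec F (suc m))
    L = Enum.list (Vecs (suc m))

    power : ∀ x y {z} → x ℕ.+ y ≡ z → Q ℤ.^ x * Q ℤ.^ y ≡ Q ℤ.^ z
    power x y refl = sym (ℤₚ.^-distribˡ-+-* Q x y)

  module _ (suitable : All Suitable 𝕃s)
           -- A weighted way of saying that no degree occurs twice in the list.
           (distinct : All (λ 𝕃 → ∑ 𝕃s (λ 𝕃′ → ⟦ e 𝕃 ℕ.≟ e 𝕃′ ⟧ * w 𝕃′) ≤ᶻ w 𝕃) 𝕃s)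
           (1≤s : 1ℤ ≤ᶻ s) (0≤c₀ : 0ℤ ≤ᶻ c₀) (1≤μ : 1ℤ ≤ᶻ μ) (large : s * s * c₀ ≤ᶻ μ) where
    private
      0≤s : 0ℤ ≤ᶻ s
      0≤s = ℤₚ.≤-trans (ℤ.+≤+ z≤n) 1≤s
      t = s * s
      0≤t : 0ℤ ≤ᶻ t
      0≤t = *-nonneg 0≤s 0≤s
      0≤μ : 0ℤ ≤ᶻ μ
      0≤μ = ℤₚ.≤-trans (ℤ.+≤+ z≤n) 1≤μ
      s≤t : s ≤ᶻ t
      s≤t = ℤₚ.≤-trans (ℤₚ.≤-reflexive (sym (ℤₚ.*-identityʳ s))) (*-monoˡ 0≤s 1≤s)

      codegree : ∀ {𝕃} → Suitable 𝕃 → ∃ λ l → suc (e 𝕃) ℕ.+ suc l ≡ suc m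
      codegree {𝕃} S = m ∸ suc (e 𝕃) , trans (ℕₚ.+-suc (suc (e 𝕃)) (m ∸ suc (e 𝕃))) (cong suc (ℕₚ.m+[n∸m]≡n (ℕₚ.≤-pred (ℕₚ.≤-trans (ℕₚ.≤-trans (s≤s (s≤s (ℕₚ.m≤n+m (e 𝕃) (e 𝕃)))) (ℕₚ.≤-reflexive (cong suc (sym (ℕₚ.+-suc (e 𝕃) (e 𝕃)))))) (Suitable.degree≤ S)))))

    -- The mean of W falls short of μ only through the non-generators, which `few` limits to the
    -- fraction 1/t of each field.
    first : t * (μ * N - ∑ L W) ≤ᶻ μ * N
    first = ℤₚ.≤-trans (ℤₚ.≤-reflexive (cong (t *_) expand)) (ℤₚ.≤-trans (ℤₚ.≤-reflexive (sym (∑-*ˡ 𝕃s t _)))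
        (ℤₚ.≤-trans (∑-mono-All (All.map each suitable)) (ℤₚ.≤-reflexive (∑-*ʳ 𝕃s N w))))
      where
      ΣW : ∑ L W ≡ ∑ 𝕃s (λ 𝕃 → w 𝕃 * ∑ L (Moments.#roots 𝕃))
      ΣW = trans (∑-swap L 𝕃s _) (∑-cong 𝕃s (λ 𝕃 → ∑-*ˡ L (w 𝕃) _))
      expand : μ * N - ∑ L W ≡ ∑ 𝕃s (λ 𝕃 → w 𝕃 * (N - ∑ L (Moments.#roots 𝕃)))
      expand = trans (cong₂ _-_ (sym (∑-*ʳ 𝕃s N w)) ΣW) (trans (sym (∑-- 𝕃s _ _)) (∑-cong 𝕃s (λ 𝕃 → factorise (w 𝕃) N _)))
        where
        factorise : ∀ a b c → a * b - a * c ≡ a * (b - c)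
        factorise = ℤ-solve-∀
      each : ∀ {𝕃} → Suitable 𝕃 → t * (w 𝕃 * (N - ∑ L (Moments.#roots 𝕃))) ≤ᶻ w 𝕃 * N
      each {𝕃} S = ℤₚ.≤-trans (ℤₚ.≤-reflexive (trans (cong (λ z → t * (w 𝕃 * z)) missing) (rearrange t (w 𝕃) _ (Q ℤ.^ suc l))))
          (*-monoˡ (Suitable.0≤c S) (ℤₚ.≤-trans (*-monoʳ (0≤Q^ (suc l)) (Suitable.few S)) (ℤₚ.≤-reflexive (power (suc (e 𝕃)) (suc l) eq))))
        where
        l = proj₁ (codegree S)
        eq = proj₂ (codegree S)
        missing : N - ∑ L (Moments.#roots 𝕃) ≡ Moments.#nonGenerators 𝕃 * Q ℤ.^ suc l
        missing = trans (cong₂ _-_ (sym (power (suc (e 𝕃)) (suc l) eq)) (trans (Moments.first-moment 𝕃 eq) (cong (_* Q ℤ.^ suc l) (Moments.#generators-complement 𝕃))))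
          (simplify (Q ℤ.^ suc (e 𝕃)) (Q ℤ.^ suc l) _)
          where
          simplify : ∀ a x n → a * x - (a - n) * x ≡ n * x
          simplify = ℤ-solve-∀
        rearrange : ∀ t w n x → t * (w * (n * x)) ≡ w * (t * n * x)
        rearrange = ℤ-solve-∀

    -- The pairs of extensions give μ² as if independent. Equal degrees add c_d · d · c_d = c₀ c_d,
    -- and these terms sum to c₀ μ.
    second : ∑ L (λ f → W f * W f) ≤ᶻ N * (μ * μ + c₀ * μ)
    second = begin
      ∑ L (λ f → W f * W f)
        ≡⟨ ∑-cong L (λ f → ∑-product 𝕃s 𝕃s _ _) ⟩
      ∑ L (λ f → ∑ 𝕃s (λ 𝕃 → ∑ 𝕃s (λ 𝕃′ → w 𝕃 * Moments.#roots 𝕃 f * (w 𝕃′ * Moments.#roots 𝕃′ f))))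
        ≡⟨ trans (∑-swap L 𝕃s _) (∑-cong 𝕃s (λ 𝕃 → ∑-swap L 𝕃s _)) ⟩
      ∑ 𝕃s (λ 𝕃 → ∑ 𝕃s (λ 𝕃′ → ∑ L (λ f → w 𝕃 * Moments.#roots 𝕃 f * (w 𝕃′ * Moments.#roots 𝕃′ f))))
        ≡⟨ ∑-cong 𝕃s (λ 𝕃 → ∑-cong 𝕃s (λ 𝕃′ → trans (∑-cong L (λ f → regroup (w 𝕃) (Moments.#roots 𝕃 f) (w 𝕃′) (Moments.#roots 𝕃′ f))) (∑-*ˡ L (w 𝕃 * w 𝕃′) _))) ⟩
      ∑ 𝕃s (λ 𝕃 → ∑ 𝕃s (λ 𝕃′ → w 𝕃 * w 𝕃′ * ∑ L (λ f → Moments.#roots 𝕃 f * Moments.#roots 𝕃′ f)))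
        ≤⟨ ∑-mono-All (All.map (λ S → ∑-mono-All (All.map (λ S′ → pair S S′) suitable)) suitable) ⟩
      ∑ 𝕃s (λ 𝕃 → ∑ 𝕃s (λ 𝕃′ → w 𝕃 * w 𝕃′ * (N * (1ℤ + ⟦ e 𝕃 ℕ.≟ e 𝕃′ ⟧ * + suc (e 𝕃)))))
        ≡⟨ ∑-cong 𝕃s (λ 𝕃 → trans (∑-cong 𝕃s (λ 𝕃′ → spread (w 𝕃) (w 𝕃′) N ⟦ e 𝕃 ℕ.≟ e 𝕃′ ⟧ (+ suc (e 𝕃)))) (trans (∑-+ 𝕃s _ _) (cong₂ _+_ (∑-*ˡ 𝕃s (N * w 𝕃) w) (∑-*ˡ 𝕃s (N * (w 𝕃 * + suc (e 𝕃))) _)))) ⟩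
      ∑ 𝕃s (λ 𝕃 → N * w 𝕃 * μ + N * (w 𝕃 * + suc (e 𝕃)) * ∑ 𝕃s (λ 𝕃′ → ⟦ e 𝕃 ℕ.≟ e 𝕃′ ⟧ * w 𝕃′))
        ≤⟨ ∑-mono-All (All.zipWith (λ (S , D) → diagonal S D) (suitable , distinct)) ⟩
      ∑ 𝕃s (λ 𝕃 → w 𝕃 * (N * μ + N * c₀))
        ≡⟨ trans (∑-*ʳ 𝕃s (N * μ + N * c₀) w) (collect μ N c₀) ⟩
      N * (μ * μ + c₀ * μ) ∎
      where
      open ℤₚ.≤-Reasoning
      regroup : ∀ a x b y → a * x * (b * y) ≡ a * b * (x * y)
      regroup = ℤ-solve-∀
      spread : ∀ a b n i d → a * b * (n * (1ℤ + i * d)) ≡ n * a * b + n * (a * d) * (i * b)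
      spread = ℤ-solve-∀
      collect : ∀ m n c → m * (n * m + n * c) ≡ n * (m * m + c * m)
      collect = ℤ-solve-∀
      pair : ∀ {𝕃 𝕃′} → Suitable 𝕃 → Suitable 𝕃′ → w 𝕃 * w 𝕃′ * ∑ L (λ f → Moments.#roots 𝕃 f * Moments.#roots 𝕃′ f) ≤ᶻ w 𝕃 * w 𝕃′ * (N * (1ℤ + ⟦ e 𝕃 ℕ.≟ e 𝕃′ ⟧ * + suc (e 𝕃)))
      pair {𝕃} {𝕃′} S S′ = *-monoˡ (*-nonneg (Suitable.0≤c S) (Suitable.0≤c S′)) (cross-moment 𝕃 𝕃′ (halves (suc (e 𝕃)) (suc (e 𝕃′)) (Suitable.degree≤ S) (Suitable.degree≤ S′)))
        where
        halves : ∀ x y {n} → x ℕ.+ x ≤ n → y ℕ.+ y ≤ n → x ℕ.+ y ≤ n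
        halves x y p r with ℕₚ.≤-total x y
        ... | inj₁ h = ℕₚ.≤-trans (ℕₚ.+-monoˡ-≤ y h) r
        ... | inj₂ h = ℕₚ.≤-trans (ℕₚ.+-monoʳ-≤ x h) p
      diagonal : ∀ {𝕃} → Suitable 𝕃 → ∑ 𝕃s (λ 𝕃′ → ⟦ e 𝕃 ℕ.≟ e 𝕃′ ⟧ * w 𝕃′) ≤ᶻ w 𝕃 →
                 N * w 𝕃 * μ + N * (w 𝕃 * + suc (e 𝕃)) * ∑ 𝕃s (λ 𝕃′ → ⟦ e 𝕃 ℕ.≟ e 𝕃′ ⟧ * w 𝕃′) ≤ᶻ w 𝕃 * (N * μ + N * c₀)
      diagonal {𝕃} S D = ℤₚ.≤-trans (ℤₚ.+-monoʳ-≤ (N * w 𝕃 * μ) (ℤₚ.≤-trans (ℤₚ.≤-reflexive (cong (λ z → N * z * ∑ 𝕃s (λ 𝕃′ → ⟦ e 𝕃 ℕ.≟ e 𝕃′ ⟧ * w 𝕃′)) (Suitable.c-normalised S)))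
          (*-monoˡ (*-nonneg (0≤Q^ (suc m)) 0≤c₀) D))) (ℤₚ.≤-reflexive (finish N (w 𝕃) μ c₀))
        where
        finish : ∀ n a m c → n * a * m + n * c * a ≡ a * (n * m + n * c)
        finish = ℤ-solve-∀

    -- Of the 3, one part comes from the excess c₀ μ of the second moment, at most μ²/t by `large`,
    -- and two parts from the deficit of the mean, which enters through the middle term -2 μ W.
    variance : t * ∑ L (λ f → (W f - μ) * (W f - μ)) ≤ᶻ + 3 * (μ * μ * N)
    variance = begin
      t * ∑ L (λ f → (W f - μ) * (W f - μ))
        ≡⟨ cong (t *_) expand ⟩
      t * (∑ L (λ f → W f * W f) - + 2 * μ * ∑ L W + N * (μ * μ))
        ≡⟨ regroup t (∑ L (λ f → W f * W f)) μ (∑ L W) N ⟩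
      t * ∑ L (λ f → W f * W f) + (+ 2 * μ * (t * (μ * N - ∑ L W)) - t * (N * (μ * μ)))
        ≤⟨ ℤₚ.+-mono-≤ (*-monoˡ 0≤t second) (ℤₚ.+-monoˡ-≤ (- (t * (N * (μ * μ)))) (*-monoˡ (*-nonneg {+ 2} (ℤ.+≤+ z≤n) 0≤μ) first)) ⟩
      t * (N * (μ * μ + c₀ * μ)) + (+ 2 * μ * (μ * N) - t * (N * (μ * μ)))
        ≡⟨ cancel t N μ c₀ ⟩
      t * c₀ * (μ * N) + + 2 * μ * (μ * N)
        ≤⟨ ℤₚ.+-monoˡ-≤ (+ 2 * μ * (μ * N)) (*-monoʳ (*-nonneg 0≤μ (0≤Q^ (suc m))) large) ⟩
      μ * (μ * N) + + 2 * μ * (μ * N)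
        ≡⟨ add μ N ⟩
      + 3 * (μ * μ * N) ∎
      where
      open ℤₚ.≤-Reasoning
      square : ∀ x y → (x - y) * (x - y) ≡ x * x - + 2 * y * x + y * y
      square = ℤ-solve-∀
      regroup : ∀ t a m w n → t * (a - + 2 * m * w + n * (m * m)) ≡ t * a + (+ 2 * m * (t * (m * n - w)) - t * (n * (m * m)))
      regroup = ℤ-solve-∀
      cancel : ∀ t n m c → t * (n * (m * m + c * m)) + (+ 2 * m * (m * n) - t * (n * (m * m))) ≡ t * c * (m * n) + + 2 * m * (m * n)
      cancel = ℤ-solve-∀
      add : ∀ m n → m * (m * n) + + 2 * m * (m * n) ≡ + 3 * (m * m * n)
      add = ℤ-solve-∀
      expand : ∑ L (λ f → (W f - μ) * (W f - μ)) ≡ ∑ L (λ f → W f * W f) - + 2 * μ * ∑ L W + N * (μ * μ)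
      expand = trans (∑-cong L (λ f → square (W f) μ)) (trans (∑-+ L _ _) (cong₂ _+_ (trans (∑-- L _ _) (cong (λ z → ∑ L (λ f → W f * W f) - z) (∑-*ˡ L (+ 2 * μ) W)))
        (trans (Enum.sum-*1 (Vecs (suc m)) (μ * μ)) (cong (_* (μ * μ)) (Vecs-size (suc m))))))

    private
      cancel-μ : ∀ {x y} → μ * x ≤ᶻ μ * y → x ≤ᶻ y
      cancel-μ {x} {y} = go 1≤μ
        where
        go : ∀ {u} → 1ℤ ≤ᶻ u → u * x ≤ᶻ u * y → x ≤ᶻ y
        go {+ suc n} _ h = ℤₚ.*-cancelˡ-≤-pos x y (+ suc n) h
        go {+ zero} (ℤ.+≤+ ())

    -- From the variance by 2 s|W - μ| μ ≤ s²(W - μ)² + μ², summed over f: the right side totals at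
    -- most 3 + 1 = 4 times μ² N.
    deviation : s * ∑ L (λ f → abs (W f - μ)) ≤ᶻ + 2 * (μ * N)
    deviation = halve (cancel-μ (begin
      μ * (+ 2 * (s * ∑ L (λ f → abs (W f - μ))))
        ≡⟨ trans (shuffle μ s _) (sym (∑-*ˡ L (+ 2 * (s * μ)) _)) ⟩
      ∑ L (λ f → + 2 * (s * μ) * abs (W f - μ))
        ≤⟨ ∑-mono L (λ f → each f) ⟩
      ∑ L (λ f → t * ((W f - μ) * (W f - μ)) + μ * μ)
        ≡⟨ trans (∑-+ L _ _) (cong₂ _+_ (∑-*ˡ L t _) (trans (Enum.sum-*1 (Vecs (suc m)) (μ * μ)) (cong (_* (μ * μ)) (Vecs-size (suc m))))) ⟩
      t * ∑ L (λ f → (W f - μ) * (W f - μ)) + N * (μ * μ)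
        ≤⟨ ℤₚ.+-monoˡ-≤ (N * (μ * μ)) variance ⟩
      + 3 * (μ * μ * N) + N * (μ * μ)
        ≡⟨ four μ N ⟩
      μ * (+ 2 * (+ 2 * (μ * N))) ∎))
      where
      open ℤₚ.≤-Reasoning
      shuffle : ∀ m s x → m * (+ 2 * (s * x)) ≡ + 2 * (s * m) * x
      shuffle = ℤ-solve-∀
      four : ∀ m n → + 3 * (m * m * n) + n * (m * m) ≡ m * (+ 2 * (+ 2 * (m * n)))
      four = ℤ-solve-∀
      halve : ∀ {x y} → + 2 * x ≤ᶻ + 2 * y → x ≤ᶻ y
      halve {x} {y} h = ℤₚ.*-cancelˡ-≤-pos x y (+ 2) h
      each : ∀ f → + 2 * (s * μ) * abs (W f - μ) ≤ᶻ t * ((W f - μ) * (W f - μ)) + μ * μ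
      each f = ℤₚ.≤-trans (ℤₚ.≤-reflexive (arrange s μ (abs (W f - μ)))) (ℤₚ.≤-trans (2xy≤x²+y² (s * abs (W f - μ)) μ)
        (ℤₚ.≤-reflexive (cong (_+ μ * μ) (trans (expand s (abs (W f - μ))) (cong (t *_) (abs-square (W f - μ)))))))
        where
        arrange : ∀ s m x → + 2 * (s * m) * x ≡ + 2 * (s * x * m)
        arrange = ℤ-solve-∀
        expand : ∀ s x → s * x * (s * x) ≡ s * s * (x * x)
        expand = ℤ-solve-∀

    private
      y : Vec F (suc m) → ℤ
      y = weight k b

    weighted : t * abs (∑ L (λ f → y f * W f)) ≤ᶻ μ * N
    weighted = begin
      t * abs (∑ L (λ f → y f * W f))
        ≡⟨ cong (λ z → t * abs z) expand ⟩
      t * abs (∑ 𝕃s (λ 𝕃 → w 𝕃 * ∑ L (λ f → y f * Moments.#roots 𝕃 f)))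
        ≤⟨ *-monoˡ 0≤t (∑-abs 𝕃s _) ⟩
      t * ∑ 𝕃s (λ 𝕃 → abs (w 𝕃 * ∑ L (λ f → y f * Moments.#roots 𝕃 f)))
        ≡⟨ ∑-*ˡ 𝕃s t _ ⟨
      ∑ 𝕃s (λ 𝕃 → t * abs (w 𝕃 * ∑ L (λ f → y f * Moments.#roots 𝕃 f)))
        ≤⟨ ∑-mono-All (All.map each suitable) ⟩
      ∑ 𝕃s (λ 𝕃 → w 𝕃 * N)
        ≡⟨ ∑-*ʳ 𝕃s N w ⟩
      μ * N ∎
      where
      open ℤₚ.≤-Reasoning
      swap : ∀ a b c → a * (b * c) ≡ b * (a * c)
      swap = ℤ-solve-∀
      expand : ∑ L (λ f → y f * W f) ≡ ∑ 𝕃s (λ 𝕃 → w 𝕃 * ∑ L (λ f → y f * Moments.#roots 𝕃 f))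
      expand = trans (∑-cong L (λ f → sym (∑-*ˡ 𝕃s (y f) _))) (trans (∑-swap L 𝕃s _) (∑-cong 𝕃s (λ 𝕃 → trans (∑-cong L (λ f → swap (y f) (w 𝕃) (Moments.#roots 𝕃 f))) (∑-*ˡ L (w 𝕃) _))))
      each : ∀ {𝕃} → Suitable 𝕃 → t * abs (w 𝕃 * ∑ L (λ f → y f * Moments.#roots 𝕃 f)) ≤ᶻ w 𝕃 * N
      each {𝕃} S = ℤₚ.≤-trans (ℤₚ.≤-reflexive (trans (cong (t *_) (trans (abs-* (w 𝕃) _) (cong (_* abs (∑ L (λ f → y f * Moments.#roots 𝕃 f))) (abs-nonneg (Suitable.0≤c S))))) (swap t (w 𝕃) _)))
        (*-monoˡ (Suitable.0≤c S) (ℤₚ.≤-trans (*-monoˡ 0≤t (Moments.weighted-moment 𝕃 (Suitable.1≤e S) eq k b (Suitable.generatorSum S)))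
          (ℤₚ.≤-trans (ℤₚ.≤-reflexive (swap′ t (Q ℤ.^ suc l) (Suitable.B S))) (ℤₚ.≤-trans (*-monoʳ (0≤Q^ (suc l)) (Suitable.B-small S)) (ℤₚ.≤-reflexive (power (suc (e 𝕃)) (suc l) eq))))))
        where
        l = proj₁ (codegree S)
        eq = proj₂ (codegree S)
        swap′ : ∀ t x b → t * (x * b) ≡ t * b * x
        swap′ = ℤ-solve-∀

    -- Write μ y = y W - y (W - μ). The first sum is small by the equidistribution of traces in each
    -- extension, the second by concentration of W together with |y| ≤ q.
    law : s * abs (∑ L y) ≤ᶻ (+ 2 * Q + 1ℤ) * N
    law = cancel-μ (begin
      μ * (s * abs (∑ L y))
        ≡⟨ trans (swap μ s _) (cong (s *_) (trans (cong (_* abs (∑ L y)) (sym (abs-nonneg 0≤μ))) (sym (abs-* μ _)))) ⟩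
      s * abs (μ * ∑ L y)
        ≡⟨ cong (λ z → s * abs z) split ⟩
      s * abs (∑ L (λ f → y f * W f) + - ∑ L (λ f → y f * (W f - μ)))
        ≤⟨ *-monoˡ 0≤s (ℤₚ.≤-trans (abs-+ (∑ L (λ f → y f * W f)) (- ∑ L (λ f → y f * (W f - μ)))) (ℤₚ.+-monoʳ-≤ (abs (∑ L (λ f → y f * W f))) (ℤₚ.≤-trans (ℤₚ.≤-reflexive (abs-neg (∑ L (λ f → y f * (W f - μ))))) remainder≤))) ⟩
      s * (abs (∑ L (λ f → y f * W f)) + Q * ∑ L (λ f → abs (W f - μ)))
        ≡⟨ distribute s _ Q _ ⟩
      s * abs (∑ L (λ f → y f * W f)) + Q * (s * ∑ L (λ f → abs (W f - μ)))
        ≤⟨ ℤₚ.+-mono-≤ (ℤₚ.≤-trans (*-monoʳ (0≤abs (∑ L (λ f → y f * W f))) s≤t) weighted) (*-monoˡ 0≤Q deviation) ⟩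
      μ * N + Q * (+ 2 * (μ * N))
        ≡⟨ collect μ N Q ⟩
      μ * ((+ 2 * Q + 1ℤ) * N) ∎)
      where
      open ℤₚ.≤-Reasoning
      swap : ∀ a b c → a * (b * c) ≡ b * (a * c)
      swap = ℤ-solve-∀
      distribute : ∀ s a q d → s * (a + q * d) ≡ s * a + q * (s * d)
      distribute = ℤ-solve-∀
      collect : ∀ m n q → m * n + q * (+ 2 * (m * n)) ≡ m * ((+ 2 * q + 1ℤ) * n)
      collect = ℤ-solve-∀
      pointwise : ∀ m y w → m * y ≡ y * w - y * (w - m)
      pointwise = ℤ-solve-∀
      split : μ * ∑ L y ≡ ∑ L (λ f → y f * W f) - ∑ L (λ f → y f * (W f - μ))
      split = trans (sym (∑-*ˡ L μ y)) (trans (∑-cong L (λ f → pointwise μ (y f) (W f))) (∑-- L _ _))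
      remainder≤ : abs (∑ L (λ f → y f * (W f - μ))) ≤ᶻ Q * ∑ L (λ f → abs (W f - μ))
      remainder≤ = ℤₚ.≤-trans (∑-abs L _) (ℤₚ.≤-trans (∑-mono L (λ f → ℤₚ.≤-trans (ℤₚ.≤-reflexive (abs-* (y f) (W f - μ))) (*-monoʳ (0≤abs (W f - μ)) (abs-weight k b f)))) (ℤₚ.≤-reflexive (∑-*ˡ L Q _)))

-- Column-by-column reduction of a matrix to companion form

module GLRecursion (𝔽 : FiniteField) where
  private
    module 𝔽 = FieldFacts 𝔽
    module 𝔽E = Sums.Enum 𝔽.F-Enum
  open FieldFacts 𝔽 using (F; 0#; 1#; _+_; _*_; -_; _-_; inv)
  open MatrixFacts 𝔽
  open Polynomials 𝔽 using (plain; mono)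
  open PrimeCount 𝔽 using (Vecs)
  open Sums
  open import Data.Integer using () renaming (_+_ to _+ᶻ_; _*_ to _*ᶻ_)

  -- Tables instead of functions: propositional equality of tables is decidable, so sums over them
  -- can be reindexed by bijections.
  𝕄 : ℕ → Set
  𝕄 n = Vec (Vec F n) n

  𝕄s : ∀ n → Enum (𝕄 n)
  𝕄s n = Vec-Enum (Vecs n) n

  toMat : ∀ {n} → 𝕄 n → Mat n
  toMat g i j = Vec.lookup (Vec.lookup g i) j

  fromMat : ∀ {n} → Mat n → 𝕄 n
  fromMat A = Vec.tabulate (λ i → Vec.tabulate (A i))

  toMat-fromMat : ∀ {n} (A : Mat n) → toMat (fromMat A) ≡ᴹ A
  toMat-fromMat A i j = trans (cong (λ r → Vec.lookup r j) (Vecₚ.lookup∘tabulate (λ i → Vec.tabulate (A i)) i)) (Vecₚ.lookup∘tabulate (A i) j)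

  fromMat-≡ : ∀ {n} (A : Mat n) (g : 𝕄 n) → A ≡ᴹ toMat g → fromMat A ≡ g
  fromMat-≡ A g h = trans (Vecₚ.tabulate-cong (λ i → trans (Vecₚ.tabulate-cong (h i)) (Vecₚ.tabulate∘lookup (Vec.lookup g i)))) (Vecₚ.tabulate∘lookup g)

  module _ {A B : Set} (R : A → A → Set) (R-refl : ∀ a → R a a) (h : B → A) where
    ∑-allFuns : (xs : List A) (𝔹 : Enum B) → (∀ (φ : A → ℤ) → (∀ a a′ → R a a′ → φ a ≡ φ a′) → ∑ xs φ ≡ Enum.sum 𝔹 (φ ∘ h)) →
                ∀ m (φ : (Fin m → A) → ℤ) → (∀ f f′ → (∀ i → R (f i) (f′ i)) → φ f ≡ φ f′) →
                ∑ (allFuns xs m) φ ≡ Enum.sum (Vec-Enum 𝔹 m) (λ v → φ (λ i → h (Vec.lookup v i)))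
    ∑-allFuns xs 𝔹 base zero φ resp = cong (_+ᶻ 0ℤ) (resp _ _ (λ ()))
    ∑-allFuns xs 𝔹 base (suc m) φ resp = trans (∑-concatMap _ xs φ) (trans (∑-cong xs (λ x → trans (∑-map _ (allFuns xs m) φ)
        (∑-allFuns xs 𝔹 base m _ (λ f f′ r → resp _ _ (λ { zero → R-refl x ; (suc i) → r i })))))
      (trans (base _ (λ a a′ r → ∑-cong (Enum.list (Vec-Enum 𝔹 m)) (λ v → resp _ _ (λ { zero → r ; (suc i) → R-refl _ }))))
      (trans (∑-cong (Enum.list 𝔹) (λ y → ∑-cong (Enum.list (Vec-Enum 𝔹 m)) (λ v → resp _ _ (λ { zero → R-refl _ ; (suc i) → R-refl _ })))) (sym (Vec-sum 𝔹 m _)))))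

  -- A listed function agrees with the lookup in a table only pointwise, hence the demand that φ
  -- respect pointwise equality.
  ∑-allMat : ∀ n (φ : Mat n → ℤ) → (∀ A B → A ≡ᴹ B → φ A ≡ φ B) → ∑ (allMat n) φ ≡ Enum.sum (𝕄s n) (φ ∘ toMat)
  ∑-allMat n φ resp = ∑-allFuns (λ u v → ∀ j → u j ≡ v j) (λ _ _ → refl) Vec.lookup (allFuns 𝔽.elems n) (Vecs n)
    (λ ψ r → ∑-allFuns _≡_ (λ _ → refl) id 𝔽.elems 𝔽.F-Enum (λ χ _ → refl) n ψ r) n φ resp

  -- The recursion is run for class functions in general, so that the trace sum and the number of
  -- matrices satisfy it with the same coefficients `#generic` and can be compared step by step.
  record ClassFunction (n : ℕ) : Set where
    field
      φ       : Mat n → ℤ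
      similar : ∀ (E E′ A B : Mat n) → (E *ᴹ A) ≡ᴹ (B *ᴹ E) → (E′ *ᴹ E) ≡ᴹ Iᴹ → (E *ᴹ E′) ≡ᴹ Iᴹ → φ A ≡ φ B

    φ-cong : ∀ A B → A ≡ᴹ B → φ A ≡ φ B
    φ-cong A B h = similar Iᴹ Iᴹ A B (≡ᴹ-trans (*ᴹ-identityˡ A) (≡ᴹ-trans h (≡ᴹ-sym (*ᴹ-identityʳ B)))) (*ᴹ-identityˡ Iᴹ) (*ᴹ-identityˡ Iᴹ)

  -- The columns before p are those of a companion matrix.
  Shift : ∀ {n} → Fin n → Mat n → Set
  Shift p A = ∀ i j → toℕ j < toℕ p → A i j ≡ mono 1# (suc (toℕ j)) (toℕ i)

  Column : ∀ {n} → Fin n → Vec F n → Mat n → Set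
  Column p c A = ∀ i → A i p ≡ plain c (toℕ i)

  shift? : ∀ {n} (p : Fin n) A → Dec (Shift p A)
  shift? p A = Finₚ.all? (λ i → Finₚ.all? (λ j → (suc (toℕ j) ℕ.≤? toℕ p) →-dec (A i j 𝔽E.≟ mono 1# (suc (toℕ j)) (toℕ i))))

  column? : ∀ {n} (p : Fin n) c A → Dec (Column p c A)
  column? p c A = Finₚ.all? (λ i → A i p 𝔽E.≟ plain c (toℕ i))

  State : ∀ {n} → Fin n → Vec F n → Mat n → Set
  State p c A = Invertible A × Shift p A × Column p c A

  state? : ∀ {n} (p : Fin n) c A → Dec (State p c A)
  state? p c A = invertible? A ×-dec (shift? p A ×-dec column? p c A)

  plain-lookup : ∀ {n} (c : Vec F n) (i : Fin n) → plain c (toℕ i) ≡ Vec.lookup c i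
  plain-lookup (a ∷ c) zero    = refl
  plain-lookup (a ∷ c) (suc i) = plain-lookup c i

  plain-tabulate : ∀ {n} (f : Fin n → F) i → plain (Vec.tabulate f) (toℕ i) ≡ f i
  plain-tabulate f i = trans (plain-lookup (Vec.tabulate f) i) (Vecₚ.lookup∘tabulate f i)

  mono-< : ∀ a {j i} → j ≢ i → mono a j i ≡ 0#
  mono-< a {zero}  {zero}  h = contradiction refl h
  mono-< a {zero}  {suc i} h = refl
  mono-< a {suc j} {zero}  h = refl
  mono-< a {suc j} {suc i} h = mono-< a (h ∘ cong suc)

  State-cong : ∀ {n} {p : Fin n} {c A B} → A ≡ᴹ B → State p c A → State p c B
  State-cong h (u , s , k) = Unit⇒Invertible (Unit-cong h (Invertible⇒Unit u)) , (λ i j lt → trans (sym (h i j)) (s i j lt)) , (λ i → trans (sym (h i _)) (k i))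

  plain-≡ : ∀ {m} (c d : Vec F m) → (∀ (i : Fin m) → plain c (toℕ i) ≡ plain d (toℕ i)) → c ≡ d
  plain-≡ []      []      h = refl
  plain-≡ (a ∷ c) (b ∷ d) h = cong₂ _∷_ (h zero) (plain-≡ c d (h ∘ suc))

  -- The column stays in the span of the first p + 1 basis vectors, so the cyclic subspace generated
  -- so far is invariant and the companion block closes.
  Low : ∀ {n} → Fin n → Vec F n → Set
  Low {n} p c = ∀ (i : Fin n) → toℕ p < toℕ i → plain c (toℕ i) ≡ 0#

  low? : ∀ {n} (p : Fin n) c → Dec (Low p c)
  low? p c = Finₚ.all? (λ i → (suc (toℕ p) ℕ.≤? toℕ i) →-dec (plain c (toℕ i) 𝔽E.≟ 0#))

  transvection⁻-undo : ∀ {n} l (v : Fin n → F) → 1# + v l ≢ 0# → ∀ (x y : Fin n → F) → (∀ i → y i ≡ x i + v i * x l) →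
                       ∀ i → x i ≡ y i + transvection⁻ l v i * y l
  transvection⁻-undo l v ne x y h i = sym (trans (cong₂ (λ a b → a + transvection⁻ l v i * b) (h i) (h l)) (begin
    x i + v i * x l + - (v i * w) * (x l + v l * x l)   ≡⟨ 𝔽.solve 5 (λ ci vi cl w vl → ci 𝔽.:+ vi 𝔽.:* cl 𝔽.:+ 𝔽.:- (vi 𝔽.:* w) 𝔽.:* (cl 𝔽.:+ vl 𝔽.:* cl) 𝔽.:= ci 𝔽.:+ vi 𝔽.:* cl 𝔽.:- vi 𝔽.:* cl 𝔽.:* (w 𝔽.:+ vl 𝔽.:* w)) refl (x i) (v i) (x l) w (v l) ⟩
    x i + v i * x l - v i * x l * (w + v l * w)         ≡⟨ cong (λ z → x i + v i * x l - v i * x l * z) (trans (sym (trans (𝔽.distribʳ w 1# (v l)) (cong (_+ v l * w) (𝔽.*-identityˡ w)))) (𝔽.*-inv ne)) ⟩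
    x i + v i * x l - v i * x l * 1#                    ≡⟨ cong (λ z → x i + v i * x l - z) (𝔽.*-identityʳ _) ⟩
    x i + v i * x l - v i * x l                         ≡⟨ 𝔽.solve 2 (λ a b → a 𝔽.:+ b 𝔽.:- b 𝔽.:= a) refl (x i) (v i * x l) ⟩
    x i                                                 ∎))
    where
    open ≡-Reasoning
    w = inv (1# + v l)

  module _ {n : ℕ} (Φ : ClassFunction n) where
    open ClassFunction Φ

    count : Fin n → Vec F n → ℤ
    count p c = Enum.sum (𝕄s n) (λ g → ⟦ state? p c (toMat g) ⟧ *ᶻ φ (toMat g))

    -- The bijection is A ↦ U A V with U and V independent. Conjugations are the case V = U⁻¹; when
    -- only matrices are counted, a one-sided multiplication serves as well.
    count-transport : ∀ p c c′ (U U′ V V′ : Mat n) → (U *ᴹ U′) ≡ᴹ Iᴹ → (U′ *ᴹ U) ≡ᴹ Iᴹ → (V *ᴹ V′) ≡ᴹ Iᴹ → (V′ *ᴹ V) ≡ᴹ Iᴹ →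
      (∀ A → State p c A → State p c′ (U *ᴹ (A *ᴹ V))) → (∀ A → State p c′ A → State p c (U′ *ᴹ (A *ᴹ V′))) →
      (∀ A → φ A ≡ φ (U′ *ᴹ (A *ᴹ V′))) → count p c ≡ count p c′
    count-transport p c c′ U U′ V V′ UU′ U′U VV′ V′V to from inv = trans
      (∑-bij (𝕄s n) (𝕄s n) (λ g → state? p c (toMat g)) (λ g → state? p c′ (toMat g)) fwd bwd
        (λ g s → State-cong {c = c′} (≡ᴹ-sym (toMat-fromMat _)) (to (toMat g) s) , roundtrip U′ U V V′ U′U VV′ g)
        (λ g s → State-cong {c = c} (≡ᴹ-sym (toMat-fromMat _)) (from (toMat g) s) , roundtrip U U′ V′ V UU′ V′V g) (λ g → φ (toMat g)))
      (∑-cong (Enum.list (𝕄s n)) (λ g → cong (⟦ state? p c′ (toMat g) ⟧ *ᶻ_) (trans (φ-cong _ _ (toMat-fromMat _)) (sym (inv (toMat g))))))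
      where
      fwd bwd : 𝕄 n → 𝕄 n
      fwd g = fromMat (U *ᴹ (toMat g *ᴹ V))
      bwd g = fromMat (U′ *ᴹ (toMat g *ᴹ V′))
      roundtrip : ∀ (X Y Z W : Mat n) → (X *ᴹ Y) ≡ᴹ Iᴹ → (Z *ᴹ W) ≡ᴹ Iᴹ → ∀ g → fromMat (X *ᴹ (toMat (fromMat (Y *ᴹ (toMat g *ᴹ Z))) *ᴹ W)) ≡ g
      roundtrip X Y Z W XY ZW g = fromMat-≡ _ g
        (≡ᴹ-trans (*ᴹ-cong {A = X} (λ _ _ → refl) (*ᴹ-cong {B = W} (toMat-fromMat (Y *ᴹ (toMat g *ᴹ Z))) (λ _ _ → refl)))
        (≡ᴹ-trans (*ᴹ-cong {A = X} (λ _ _ → refl) (*ᴹ-assoc Y (toMat g *ᴹ Z) W))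
        (≡ᴹ-trans (cancelˡ X Y ((toMat g *ᴹ Z) *ᴹ W) XY) (cancelʳ Z W (toMat g) ZW))))

    total : Fin n → ℤ
    total p = Enum.sum (𝕄s n) (λ g → ⟦ invertible? (toMat g) ×-dec shift? p (toMat g) ⟧ *ᶻ φ (toMat g))

    column : Fin n → 𝕄 n → Vec F n
    column p g = Vec.tabulate (λ i → toMat g i p)

    total-fibre : ∀ p → total p ≡ Enum.sum (Vecs n) (count p)
    total-fibre p = trans (∑-fibre (𝕄s n) (Vecs n) (column p) _) (∑-cong (Enum.list (Vecs n)) (λ c → ∑-cong (Enum.list (𝕄s n)) (λ g → combine c g)))
      where
      combine : ∀ c g → ⟦ Enum._≟_ (Vecs n) c (column p g) ⟧ *ᶻ (⟦ invertible? (toMat g) ×-dec shift? p (toMat g) ⟧ *ᶻ φ (toMat g)) ≡ ⟦ state? p c (toMat g) ⟧ *ᶻ φ (toMat g)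
      combine c g = trans (sym (ℤₚ.*-assoc ⟦ eq ⟧ ⟦ is ⟧ (φ (toMat g)))) (cong (_*ᶻ φ (toMat g)) (trans (sym (⟦⟧-× eq is)) (⟦⟧-cong (eq ×-dec is) (state? p c (toMat g))
          (λ { (refl , u , s) → u , s , (λ i → sym (plain-tabulate (λ i → toMat g i p) i)) })
          (λ (u , s , k) → plain-≡ c (column p g) (λ i → sym (trans (plain-tabulate (λ i → toMat g i p) i) (k i))) , u , s))))
        where
        eq = Enum._≟_ (Vecs n) c (column p g)
        is = invertible? (toMat g) ×-dec shift? p (toMat g)

    -- Conjugation by I + v eₗᵀ with l > p moves the column c to c + c_l v.
    count-conjugate : ∀ p l → toℕ p < toℕ l → ∀ (v : Fin n → F) → 1# + v l ≢ 0# → ∀ c c′ →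
      (∀ i → plain c′ (toℕ i) ≡ plain c (toℕ i) + v i * plain c (toℕ l)) → count p c ≡ count p c′
    count-conjugate p l p<l v ne c c′ h = count-transport p c c′ T T⁻ T⁻ T (proj₁ inverses) (proj₂ inverses) (proj₂ inverses) (proj₁ inverses)
        (λ A s → move v v⁻ inverses c c′ h A s) (λ A s → move v⁻ v (proj₂ inverses , proj₁ inverses) c′ c h⁻ A s)
        (λ A → similar T⁻ T A (T⁻ *ᴹ (A *ᴹ T)) (intertwine A) (proj₁ inverses) (proj₂ inverses))
      where
      v⁻ = transvection⁻ l v
      T = transvection l v
      T⁻ = transvection l v⁻
      inverses = transvection-inverse l v ne
      intertwine : ∀ A → (T⁻ *ᴹ A) ≡ᴹ ((T⁻ *ᴹ (A *ᴹ T)) *ᴹ T⁻)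
      intertwine A = ≡ᴹ-sym (≡ᴹ-trans (*ᴹ-assoc T⁻ (A *ᴹ T) T⁻) (*ᴹ-cong {A = T⁻} (λ _ _ → refl) (cancelʳ T T⁻ A (proj₁ inverses))))
      h⁻ : ∀ i → plain c (toℕ i) ≡ plain c′ (toℕ i) + v⁻ i * plain c′ (toℕ l)
      h⁻ = transvection⁻-undo l v ne (λ i → plain c (toℕ i)) (λ i → plain c′ (toℕ i)) h
      entry : ∀ u u′ (A : Mat n) i j → j ≢ l → (transvection l u *ᴹ (A *ᴹ transvection l u′)) i j ≡ A i j + u i * A l j
      entry u u′ A i j j≢l = trans (transvection-*ˡ l u (A *ᴹ transvection l u′) i j) (cong₂ (λ x y → x + u i * y) (right i) (right l))
        where
        right : ∀ i → (A *ᴹ transvection l u′) i j ≡ A i j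
        right i = trans (transvection-*ʳ l u′ A i j) (trans (cong (λ z → A i j + Σᶠ (λ t → A i t * u′ t) * z) (I-off (j≢l ∘ sym))) (trans (𝔽.+-congˡ (𝔽.zeroʳ _)) (𝔽.+-identityʳ _)))
      move : ∀ u u′ → (transvection l u *ᴹ transvection l u′) ≡ᴹ Iᴹ × (transvection l u′ *ᴹ transvection l u) ≡ᴹ Iᴹ → ∀ c c′ →
             (∀ i → plain c′ (toℕ i) ≡ plain c (toℕ i) + u i * plain c (toℕ l)) → ∀ A → State p c A → State p c′ (transvection l u *ᴹ (A *ᴹ transvection l u′))
      move u u′ (uu′ , u′u) c c′ h A (unit , s , k) =
        Unit⇒Invertible (Unit-* (transvection l u′ , uu′ , u′u) (Unit-* (Invertible⇒Unit unit) (transvection l u , u′u , uu′))) ,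
        (λ i j lt → trans (entry u u′ A i j (λ e → ℕₚ.<⇒≢ (ℕₚ.<-trans lt p<l) (cong toℕ e)))
          (trans (cong₂ (λ x y → x + u i * y) (s i j lt) (trans (s l j lt) (mono-< 1# (λ e → ℕₚ.<⇒≢ (ℕₚ.≤-<-trans lt p<l) e)))) (trans (𝔽.+-congˡ (𝔽.zeroʳ (u i))) (𝔽.+-identityʳ _)))) ,
        (λ i → trans (entry u u′ A i p (λ e → ℕₚ.<⇒≢ p<l (cong toℕ e))) (trans (cong₂ (λ x y → x + u i * y) (k i) (k l)) (sym (h i))))

    basis : Fin n → Vec F n
    basis p = Vec.tabulate (λ i → mono 1# (toℕ p) (toℕ i))

    plain-basis : ∀ p (i : Fin n) → plain (basis p) (toℕ i) ≡ mono 1# (toℕ p) (toℕ i)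
    plain-basis p i = plain-tabulate (λ i → mono 1# (toℕ p) (toℕ i)) i

    total-next : ∀ p p′ → toℕ p′ ≡ suc (toℕ p) → total p′ ≡ count p (basis p′)
    total-next p p′ p′≡ = ∑-cong (Enum.list (𝕄s n)) (λ g → cong (_*ᶻ φ (toMat g)) (⟦⟧-cong (invertible? (toMat g) ×-dec shift? p′ (toMat g)) (state? p (basis p′) (toMat g))
        (λ (u , s) → u , (λ i j lt → s i j (ℕₚ.≤-trans (ℕₚ.m≤n⇒m≤1+n lt) (ℕₚ.≤-reflexive (sym p′≡)))) ,
          (λ i → trans (s i p (ℕₚ.≤-reflexive (sym p′≡))) (trans (cong (λ m → mono 1# m (toℕ i)) (sym p′≡)) (sym (plain-basis p′ i)))))
        (λ (u , s , k) → u , (λ i j lt → extend (toMat g) s k i j (ℕₚ.m≤n⇒m<n∨m≡n (ℕₚ.≤-pred (ℕₚ.≤-trans lt (ℕₚ.≤-reflexive p′≡))))))))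
      where
      extend : ∀ A → Shift p A → Column p (basis p′) A → ∀ i j → toℕ j < toℕ p ⊎ toℕ j ≡ toℕ p → A i j ≡ mono 1# (suc (toℕ j)) (toℕ i)
      extend A s k i j (inj₁ lt) = s i j lt
      extend A s k i j (inj₂ e) with Finₚ.toℕ-injective e
      ... | refl = trans (k i) (trans (plain-basis p′ i) (cong (λ m → mono 1# m (toℕ i)) p′≡))

    -- The transvection with v = c - e_{p′} sends e_{p′} to c, and it is invertible because 1 +
    -- v_{p′} is the entry of c at p′.
    count-pivot : ∀ p p′ → toℕ p′ ≡ suc (toℕ p) → ∀ c → plain c (toℕ p′) ≢ 0# → count p (basis p′) ≡ count p c
    count-pivot p p′ p′≡ c ne = count-conjugate p p′ (ℕₚ.≤-reflexive (sym p′≡)) v (λ e → ne (trans (sym (add p′ (trans (plain-basis p′ p′) (Polynomials.mono-top 𝔽 1# (toℕ p′))))) e)) (basis p′) c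
        (λ i → trans (𝔽.solve 2 (λ x y → x 𝔽.:= y 𝔽.:+ (x 𝔽.:- y)) refl (plain c (toℕ i)) (plain (basis p′) (toℕ i)))
          (𝔽.+-congˡ (trans (sym (𝔽.*-identityʳ (v i))) (cong (v i *_) (sym (trans (plain-basis p′ p′) (Polynomials.mono-top 𝔽 1# (toℕ p′))))))))
      where
      v : Fin n → F
      v i = plain c (toℕ i) - plain (basis p′) (toℕ i)
      add : ∀ i → plain (basis p′) (toℕ i) ≡ 1# → 1# + v i ≡ plain c (toℕ i)
      add i e = trans (cong (λ z → 1# + (plain c (toℕ i) - z)) e) (𝔽.solve 2 (λ o x → o 𝔽.:+ (x 𝔽.:- o) 𝔽.:= x) refl 1# (plain c (toℕ i)))

    -- If the entry at p′ is zero, a conjugation first adds to it some nonzero entry further down;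
    -- then the column can be made e_{p′}, which is the condition for one more companion column. So
    -- all columns that extend the block count equally.
    count-generic : ∀ p p′ → toℕ p′ ≡ suc (toℕ p) → ∀ c → ¬ Low p c → count p c ≡ total p′
    count-generic p p′ p′≡ c ¬low = trans (decide (plain c (toℕ p′) 𝔽E.≟ 0#)) (sym (total-next p p′ p′≡))
      where
      nonzero : ∃ λ l → toℕ p < toℕ l × plain c (toℕ l) ≢ 0#
      nonzero = let (l , nl , _) = Finₚ.¬∀⟶∃¬-smallest n (λ i → toℕ p < toℕ i → plain c (toℕ i) ≡ 0#) (λ i → (suc (toℕ p) ℕ.≤? toℕ i) →-dec (plain c (toℕ i) 𝔽E.≟ 0#)) ¬low in
        l , Dec.decidable-stable (suc (toℕ p) ℕ.≤? toℕ l) (λ nlt → nl (λ lt → contradiction lt nlt)) , (λ e → nl (λ _ → e))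
      decide : Dec (plain c (toℕ p′) ≡ 0#) → count p c ≡ count p (basis p′)
      decide (no ne) = sym (count-pivot p p′ p′≡ c ne)
      decide (yes z) = trans (count-conjugate p l p<l v (λ e → 𝔽.0≢1 (sym (trans (sym (trans (𝔽.+-congˡ vl) (𝔽.+-identityʳ 1#))) e))) c c′ (λ i → plain-tabulate (λ i → plain c (toℕ i) + v i * plain c (toℕ l)) i))
          (sym (count-pivot p p′ p′≡ c′ (λ e → cl≢0 (trans (sym pivot) e))))
        where
        l = proj₁ nonzero
        p<l = proj₁ (proj₂ nonzero)
        cl≢0 = proj₂ (proj₂ nonzero)
        v : Fin n → F
        v i = mono 1# (toℕ p′) (toℕ i)
        l≢p′ : toℕ p′ ≢ toℕ l
        l≢p′ e = cl≢0 (trans (cong (plain c) (sym e)) z)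
        vl : v l ≡ 0#
        vl = mono-< 1# l≢p′
        c′ : Vec F n
        c′ = Vec.tabulate (λ i → plain c (toℕ i) + v i * plain c (toℕ l))
        pivot : plain c′ (toℕ p′) ≡ plain c (toℕ l)
        pivot = trans (plain-tabulate (λ i → plain c (toℕ i) + v i * plain c (toℕ l)) p′) (trans (cong₂ (λ x y → x + y * plain c (toℕ l)) z (Polynomials.mono-top 𝔽 1# (toℕ p′))) (trans (𝔽.+-identityˡ _) (𝔽.*-identityˡ _)))

    junk : Fin n → ℤ
    junk p = Enum.sum (Vecs n) (λ c → ⟦ low? p c ⟧ *ᶻ count p c)

    #generic : Fin n → ℤ
    #generic p = Enum.sum (Vecs n) (λ c → ⟦ ¬? (low? p c) ⟧)

    total-step : ∀ p p′ → toℕ p′ ≡ suc (toℕ p) → total p ≡ junk p +ᶻ #generic p *ᶻ total p′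
    total-step p p′ p′≡ = trans (total-fibre p) (trans (∑-cong (Enum.list (Vecs n)) (λ c → each c (low? p c))) (trans (∑-+ (Enum.list (Vecs n)) _ _) (cong (junk p +ᶻ_) (∑-*ʳ (Enum.list (Vecs n)) (total p′) _))))
      where
      each : ∀ c (d : Dec (Low p c)) → count p c ≡ ⟦ d ⟧ *ᶻ count p c +ᶻ ⟦ ¬? d ⟧ *ᶻ total p′
      each c (yes _) = sym (trans (cong₂ _+ᶻ_ (ℤₚ.*-identityˡ (count p c)) (ℤₚ.*-zeroˡ (total p′))) (ℤₚ.+-identityʳ _))
      each c (no ¬low) = trans (count-generic p p′ p′≡ c ¬low) (sym (trans (cong₂ _+ᶻ_ (ℤₚ.*-zeroˡ (count p c)) (ℤₚ.*-identityˡ (total p′))) (ℤₚ.+-identityˡ _)))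

    total-last : ∀ p → suc (toℕ p) ≡ n → total p ≡ junk p
    total-last p last = trans (total-fibre p) (∑-cong (Enum.list (Vecs n)) (λ c → sym (trans (cong (_*ᶻ count p c) (⟦⟧-yes (low? p c) (λ i lt → ⊥-elim (ℕₚ.<⇒≱ (ℕₚ.≤-trans (Finₚ.toℕ<n i) (ℕₚ.≤-reflexive (sym last))) lt)))) (ℤₚ.*-identityˡ (count p c)))))

-- Columns that close a companion block of size e + 1

module Junk (𝔽 : FiniteField) (e r : ℕ) where
  private
    module 𝔽 = FieldFacts 𝔽
    module 𝔽E = Sums.Enum 𝔽.F-Enum
  open FieldFacts 𝔽 using (F; 0#; 1#; _+_; _*_; -_; _-_; inv; 0≢1)
  open MatrixFacts 𝔽
  open Blocks (suc e) r
  open Polynomials 𝔽 using (plain; mono; plain-deg; _≈_)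
  open PolynomialDivision 𝔽 using (zeros; plain-zeros)
  open PrimeCount 𝔽 using (Vecs)
  open GLRecursion 𝔽
  open Sums
  open import Data.Integer using () renaming (_*_ to _*ᶻ_)

  p : Fin (suc e ℕ.+ r)
  p = Fin.fromℕ e Fin.↑ˡ r

  toℕ-p : toℕ p ≡ e
  toℕ-p = trans (Finₚ.toℕ-↑ˡ (Fin.fromℕ e) r) (Finₚ.toℕ-fromℕ e)

  ext : Vec F (suc e) → Vec F (suc e ℕ.+ r)
  ext u = u Vec.++ zeros r

  plain-++ʳ : ∀ {a b} (u : Vec F a) (w : Vec F b) i → plain (u Vec.++ w) (a ℕ.+ i) ≡ plain w i
  plain-++ʳ []      w i = refl
  plain-++ʳ (x ∷ u) w i = plain-++ʳ u w i

  plain-++zeros : ∀ {a} (u : Vec F a) → plain (u Vec.++ zeros r) ≈ plain u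
  plain-++zeros []      i       = plain-zeros r i
  plain-++zeros (x ∷ u) zero    = refl
  plain-++zeros (x ∷ u) (suc i) = plain-++zeros u i

  sum-++ : ∀ a b (φ : Vec F (a ℕ.+ b) → ℤ) → Enum.sum (Vecs (a ℕ.+ b)) φ ≡ Enum.sum (Vecs a) (λ u → Enum.sum (Vecs b) (λ w → φ (u Vec.++ w)))
  sum-++ zero    b φ = sym (ℤₚ.+-identityʳ _)
  sum-++ (suc a) b φ = trans (Vec-sum 𝔽.F-Enum (a ℕ.+ b) φ) (trans (∑-cong 𝔽.elems (λ x → sum-++ a b (λ v → φ (x ∷ v)))) (sym (Vec-sum 𝔽.F-Enum a _)))

  low⇒zeros : ∀ u w → Low p (u Vec.++ w) → w ≡ zeros r
  low⇒zeros u w low = plain-≡ w (zeros r) (λ i → trans (sym (plain-++ʳ u w (toℕ i))) (trans (cong (plain (u Vec.++ w)) (sym (Finₚ.toℕ-↑ʳ (suc e) i)))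
    (trans (low (suc e Fin.↑ʳ i) (ℕₚ.≤-trans (s≤s (ℕₚ.≤-reflexive toℕ-p)) (ℕₚ.≤-trans (ℕₚ.m≤m+n (suc e) (toℕ i)) (ℕₚ.≤-reflexive (sym (Finₚ.toℕ-↑ʳ (suc e) i)))))) (sym (plain-zeros r (toℕ i))))))

  ext-low : ∀ u → Low p (ext u)
  ext-low u i lt = trans (plain-++zeros u (toℕ i)) (plain-deg u (toℕ i) (ℕₚ.≤-trans (s≤s (ℕₚ.≤-reflexive (sym toℕ-p))) lt))

  junk-sum : ∀ (Φ : ClassFunction (suc e ℕ.+ r)) → junk Φ p ≡ Enum.sum (Vecs (suc e)) (λ u → count Φ p (ext u))
  junk-sum Φ = trans (sum-++ (suc e) r _) (∑-cong (Enum.list (Vecs (suc e))) (λ u → trans (∑-cong (Enum.list (Vecs r)) (λ w → cong (_*ᶻ count Φ p (u Vec.++ w))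
      (⟦⟧-cong (low? p (u Vec.++ w)) (Enum._≟_ (Vecs r) w (zeros r)) (low⇒zeros u w) (λ { refl → ext-low u }))))
    (Enum.sum-pick (Vecs r) (zeros r) (λ w → count Φ p (u Vec.++ w)))))

  repl : Mat (suc e ℕ.+ r) → Vec F (suc e) → Mat (suc e ℕ.+ r)
  repl A u i j with j Finₚ.≟ p
  ... | yes _ = plain u (toℕ i)
  ... | no _  = A i j

  repl-p : ∀ A u i → repl A u i p ≡ plain u (toℕ i)
  repl-p A u i with p Finₚ.≟ p
  ... | yes _ = refl
  ... | no ne = contradiction refl ne

  repl-other : ∀ A u i j → j ≢ p → repl A u i j ≡ A i j
  repl-other A u i j ne with j Finₚ.≟ p
  ... | yes e = contradiction e ne
  ... | no _  = refl

  repl-cong : ∀ {A B} u → (∀ i j → j ≢ p → A i j ≡ B i j) → repl A u ≡ᴹ repl B u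
  repl-cong u h i j with j Finₚ.≟ p
  ... | yes _ = refl
  ... | no ne = h i j ne

  repl-id : ∀ A u → Column p (ext u) A → repl A u ≡ᴹ A
  repl-id A u k i j with j Finₚ.≟ p
  ... | yes refl = trans (sym (plain-++zeros u (toℕ i))) (sym (k i))
  ... | no _     = refl

  repl-shift : ∀ {A} u → Shift p A → Shift p (repl A u)
  repl-shift {A} u s i j lt = trans (repl-other A u i j (λ eq → ℕₚ.<⇒≢ lt (cong toℕ eq))) (s i j lt)

  repl-column : ∀ A u → Column p (ext u) (repl A u)
  repl-column A u i = trans (repl-p A u i) (sym (plain-++zeros u (toℕ i)))

  private
    shift-sum : ∀ {N} (w : Fin (suc N) → F) i → Σᶠ {suc N} (λ t → mono 1# (suc (toℕ t)) (toℕ (suc i)) * w t) ≡ w (Fin.inject₁ i)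
    shift-sum {N} w i = trans (Σᶠ-cong {suc N} (λ t → cong (_* w t) (unit (Fin.inject₁ i) t (Finₚ.toℕ-inject₁ i)))) (Σᶠ-Iˡ (Fin.inject₁ i) w)
      where
      unit : ∀ (i′ t : Fin (suc N)) → toℕ i′ ≡ toℕ i → mono 1# (toℕ t) (toℕ i) ≡ Iᴹ i′ t
      unit i′ t eq = trans (cong (mono 1# (toℕ t)) (sym eq)) (mono-I i′ t)
        where
        mono-I : ∀ {n} (i j : Fin n) → mono 1# (toℕ j) (toℕ i) ≡ Iᴹ i j
        mono-I zero    zero    = refl
        mono-I zero    (suc j) = refl
        mono-I (suc i) zero    = refl
        mono-I (suc i) (suc j) = trans (mono-I i j) (sym (I-suc i j))

  -- A column operation turns the last companion column u into any u′ with u′₀ = (1 + c) u₀.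
  module ColumnOperation (A : Mat (suc e ℕ.+ r)) (s : Shift p A) (u u′ : Vec F (suc e)) (k : Column p (ext u) A)
                         (c : F) (h₀ : plain u′ 0 ≡ plain u 0 * (1# + c)) where
    v′ : Fin (suc e ℕ.+ r) → F
    v′ t = plain u′ (suc (toℕ t)) - (1# + c) * plain u (suc (toℕ t))

    v : Fin (suc e ℕ.+ r) → F
    v t = v′ t + c * Iᴹ p t

    v′-high : ∀ t → e ≤ toℕ t → v′ t ≡ 0#
    v′-high t le = trans (cong₂ (λ x y → x - (1# + c) * y) (plain-deg u′ (suc (toℕ t)) (s≤s le)) (plain-deg u (suc (toℕ t)) (s≤s le)))
      (trans (cong (λ z → 0# - z) (𝔽.zeroʳ (1# + c))) (𝔽.-‿inverseʳ 0#))

    v-p : v p ≡ c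
    v-p = trans (cong₂ _+_ (v′-high p (ℕₚ.≤-reflexive (sym toℕ-p))) (trans (cong (c *_) (I-diag p)) (𝔽.*-identityʳ c))) (𝔽.+-identityˡ c)

    private
      term : ∀ i t → A i t * v′ t ≡ mono 1# (suc (toℕ t)) (toℕ i) * v′ t
      term i t = decide (suc (toℕ t) ℕ.≤? toℕ p)
        where
        decide : Dec (toℕ t < toℕ p) → A i t * v′ t ≡ mono 1# (suc (toℕ t)) (toℕ i) * v′ t
        decide (yes lt) = cong (_* v′ t) (s i t lt)
        decide (no ge)  = trans (trans (cong (A i t *_) z) (𝔽.zeroʳ _)) (sym (trans (cong (mono 1# (suc (toℕ t)) (toℕ i) *_) z) (𝔽.zeroʳ _)))
          where
          z : v′ t ≡ 0#
          z = v′-high t (ℕₚ.≤-trans (ℕₚ.≤-reflexive (sym toℕ-p)) (ℕₚ.≮⇒≥ ge))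

      A-p : ∀ i → A i p ≡ plain u (toℕ i)
      A-p i = trans (k i) (plain-++zeros u (toℕ i))

      sum-v : ∀ i → Σᶠ (λ t → A i t * v t) ≡ Σᶠ (λ t → mono 1# (suc (toℕ t)) (toℕ i) * v′ t) + c * plain u (toℕ i)
      sum-v i = trans (Σᶠ-cong (λ t → 𝔽.solve 4 (λ a v c d → a 𝔽.:* (v 𝔽.:+ c 𝔽.:* d) 𝔽.:= a 𝔽.:* v 𝔽.:+ c 𝔽.:* (d 𝔽.:* a)) refl (A i t) (v′ t) c (Iᴹ p t)))
        (trans (Σᶠ-+ (λ t → A i t * v′ t) (λ t → c * (Iᴹ p t * A i t))) (cong₂ _+_ (Σᶠ-cong (term i)) (trans (Σᶠ-*ˡ c (λ t → Iᴹ p t * A i t)) (cong (c *_) (trans (Σᶠ-Iˡ p (A i)) (A-p i))))))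

      new-column : ∀ i → A i p + Σᶠ (λ t → A i t * v t) ≡ plain u′ (toℕ i)
      new-column i = trans (cong₂ _+_ (A-p i) (sum-v i)) (finish i)
        where
        finish : ∀ (i : Fin (suc (e ℕ.+ r))) → plain u (toℕ i) + (Σᶠ {suc (e ℕ.+ r)} (λ t → mono 1# (suc (toℕ t)) (toℕ i) * v′ t) + c * plain u (toℕ i)) ≡ plain u′ (toℕ i)
        finish zero = trans (cong (λ z → plain u 0 + (z + c * plain u 0)) (trans (Σᶠ-cong {suc (e ℕ.+ r)} (λ t → 𝔽.zeroˡ (v′ t))) (Σᶠ-0 {suc (e ℕ.+ r)})))
          (trans (trans (𝔽.+-congˡ (𝔽.+-identityˡ _)) (trans (cong₂ _+_ (sym (𝔽.*-identityʳ (plain u 0))) (𝔽.*-comm c (plain u 0))) (sym (𝔽.distribˡ (plain u 0) 1# c)))) (sym h₀))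
        finish (suc i) = trans (cong (λ z → plain u (suc (toℕ i)) + (z + c * plain u (suc (toℕ i)))) (trans (shift-sum v′ i) (cong (λ m → plain u′ (suc m) - (1# + c) * plain u (suc m)) (Finₚ.toℕ-inject₁ i))))
          (trans (cong (λ z → plain u (suc (toℕ i)) + (plain u′ (suc (toℕ i)) - z + c * plain u (suc (toℕ i)))) (trans (𝔽.distribʳ (plain u (suc (toℕ i))) 1# c) (cong (_+ c * plain u (suc (toℕ i))) (𝔽.*-identityˡ _))))
            (𝔽.solve 3 (λ x y z → x 𝔽.:+ (y 𝔽.:- (x 𝔽.:+ z) 𝔽.:+ z) 𝔽.:= y) refl (plain u (suc (toℕ i))) (plain u′ (suc (toℕ i))) (c * plain u (suc (toℕ i)))))

    operation : (A *ᴹ transvection p v) ≡ᴹ repl A u′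
    operation i j = trans (transvection-*ʳ p v A i j) (decide (j Finₚ.≟ p))
      where
      decide : Dec (j ≡ p) → A i j + Σᶠ (λ t → A i t * v t) * Iᴹ p j ≡ repl A u′ i j
      decide (yes refl) = trans (𝔽.+-congˡ (trans (cong (Σᶠ (λ t → A i t * v t) *_) (I-diag p)) (𝔽.*-identityʳ _))) (trans (new-column i) (sym (repl-p A u′ i)))
      decide (no ne) = trans (𝔽.+-congˡ (trans (cong (Σᶠ (λ t → A i t * v t) *_) (I-off (ne ∘ sym))) (𝔽.zeroʳ _))) (trans (𝔽.+-identityʳ _) (sym (repl-other A u′ i j ne)))

    repl-unit : 1# + c ≢ 0# → Unit A → Unit (repl A u′)
    repl-unit ne unit = Unit-cong {g = A *ᴹ transvection p v} {g′ = repl A u′} operation (Unit-* {g = A} {g′ = transvection p v} unit (transvection p (transvection⁻ p v) , transvection-inverse p v (λ z → ne (trans (𝔽.+-congˡ (sym v-p)) z))))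

  -- If u₀ = 0, the column operation could replace column p by zeros while keeping the matrix
  -- invertible.
  constant≢0 : ∀ A u → State p (ext u) A → plain u 0 ≢ 0#
  constant≢0 A u (invertible , s , k) u₀≡0 = 0≢1 (trans (sym column-0) (trans (proj₂ (proj₂ unit) p p) (I-diag p)))
    where
    open ColumnOperation A s u (zeros (suc e)) k 0# (sym (trans (cong (_* (1# + 0#)) u₀≡0) (𝔽.zeroˡ _)))
    unit : Unit (repl A (zeros (suc e)))
    unit = repl-unit (λ z → 0≢1 (sym (trans (sym (𝔽.+-identityʳ 1#)) z))) (Invertible⇒Unit {g = A} invertible)
    column-0 : (proj₁ unit *ᴹ repl A (zeros (suc e))) p p ≡ 0#
    column-0 = trans (Σᶠ-cong (λ t → trans (cong (proj₁ unit p t *_) (trans (repl-p A (zeros (suc e)) t) (plain-zeros (suc e) (toℕ t)))) (𝔽.zeroʳ _))) (Σᶠ-0 {suc e ℕ.+ r})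

  repl-state : ∀ A u u′ → plain u′ 0 ≢ 0# → State p (ext u) A → State p (ext u′) (repl A u′)
  repl-state A u u′ u′₀≢0 st@(invertible , s , k) = Unit⇒Invertible {g = repl A u′} (repl-unit nonzero (Invertible⇒Unit {g = A} invertible)) , repl-shift u′ s , repl-column A u′
    where
    u₀≢0 = constant≢0 A u st
    -- Chosen so that 1 + c = u′₀/u₀, the only scaling compatible with the first row, where the
    -- earlier companion columns vanish.
    c = plain u′ 0 * inv (plain u 0) - 1#
    1+c : 1# + c ≡ plain u′ 0 * inv (plain u 0)
    1+c = 𝔽.solve 2 (λ o x → o 𝔽.:+ (x 𝔽.:- o) 𝔽.:= x) refl 1# (plain u′ 0 * inv (plain u 0))
    h₀ : plain u′ 0 ≡ plain u 0 * (1# + c)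
    h₀ = sym (trans (cong (plain u 0 *_) 1+c) (trans (𝔽.solve 3 (λ a b i → a 𝔽.:* (b 𝔽.:* i) 𝔽.:= b 𝔽.:* (a 𝔽.:* i)) refl (plain u 0) (plain u′ 0) (inv (plain u 0))) (trans (cong (plain u′ 0 *_) (𝔽.*-inv u₀≢0)) (𝔽.*-identityʳ _))))
    nonzero : 1# + c ≢ 0#
    nonzero z = u′₀≢0 (trans h₀ (trans (cong (plain u 0 *_) z) (𝔽.zeroʳ _)))
    open ColumnOperation A s u u′ k c h₀ using (repl-unit)

  one : Vec F (suc e)
  one = 1# ∷ zeros e

  nz? : ∀ (u : Vec F (suc e)) → Dec (plain u 0 ≢ 0#)
  nz? u = ¬? (plain u 0 𝔽E.≟ 0#)

  -- Replacing column p is a bijection between the states with column u and those with the fixed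
  -- column `one`. This is the independence of the block's polynomial from the rest of the matrix.
  count-ext : ∀ (Φ : ClassFunction (suc e ℕ.+ r)) u →
              count Φ p (ext u) ≡ ⟦ nz? u ⟧ *ᶻ Enum.sum (𝕄s (suc e ℕ.+ r)) (λ g → ⟦ state? p (ext one) (toMat g) ⟧ *ᶻ ClassFunction.φ Φ (repl (toMat g) u))
  count-ext Φ u = decide (plain u 0 𝔽E.≟ 0#)
    where
    open ClassFunction Φ
    M = 𝕄s (suc e ℕ.+ r)
    decide : (d : Dec (plain u 0 ≡ 0#)) → count Φ p (ext u) ≡ ⟦ ¬? d ⟧ *ᶻ Enum.sum M (λ g → ⟦ state? p (ext one) (toMat g) ⟧ *ᶻ φ (repl (toMat g) u))
    decide (yes z) = trans (∑-cong (Enum.list M) (λ g → trans (cong (_*ᶻ φ (toMat g)) (⟦⟧-no (state? p (ext u) (toMat g)) (λ st → constant≢0 (toMat g) u st z))) (ℤₚ.*-zeroˡ (φ (toMat g))))) (trans (∑-0 (Enum.list M)) (sym (ℤₚ.*-zeroˡ (Enum.sum M (λ g → ⟦ state? p (ext one) (toMat g) ⟧ *ᶻ φ (repl (toMat g) u))))))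
    decide (no nz) = trans (∑-bij M M (λ g → state? p (ext u) (toMat g)) (λ g → state? p (ext one) (toMat g)) (λ g → fromMat (repl (toMat g) one)) (λ g → fromMat (repl (toMat g) u))
        (λ g st → State-cong {c = ext one} (≡ᴹ-sym (toMat-fromMat _)) (repl-state (toMat g) u one (λ z → 0≢1 (sym z)) st) , back one u g (proj₂ (proj₂ st)))
        (λ g st → State-cong {c = ext u} (≡ᴹ-sym (toMat-fromMat _)) (repl-state (toMat g) one u nz st) , back u one g (proj₂ (proj₂ st))) (λ g → φ (toMat g)))
      (trans (∑-cong (Enum.list M) (λ g → cong (⟦ state? p (ext one) (toMat g) ⟧ *ᶻ_) (φ-cong _ _ (toMat-fromMat (repl (toMat g) u))))) (sym (ℤₚ.*-identityˡ _)))
      where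
      back : ∀ a b g → Column p (ext b) (toMat g) → fromMat (repl (toMat (fromMat (repl (toMat g) a))) b) ≡ g
      back a b g k = fromMat-≡ _ g (≡ᴹ-trans (repl-cong b (λ i j ne → trans (toMat-fromMat (repl (toMat g) a) i j) (repl-other (toMat g) a i j ne))) (repl-id (toMat g) b k))

  junk-value : ∀ (Φ : ClassFunction (suc e ℕ.+ r)) →
               junk Φ p ≡ Enum.sum (𝕄s (suc e ℕ.+ r)) (λ g → ⟦ state? p (ext one) (toMat g) ⟧ *ᶻ Enum.sum (Vecs (suc e)) (λ u → ⟦ nz? u ⟧ *ᶻ ClassFunction.φ Φ (repl (toMat g) u)))
  junk-value Φ = trans (junk-sum Φ) (trans (∑-cong (Enum.list (Vecs (suc e))) (λ u → trans (count-ext Φ u) (sym (∑-*ˡ (Enum.list (𝕄s (suc e ℕ.+ r))) ⟦ nz? u ⟧ _))))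
    (trans (∑-swap (Enum.list (Vecs (suc e))) (Enum.list (𝕄s (suc e ℕ.+ r))) _) (∑-cong (Enum.list (𝕄s (suc e ℕ.+ r))) (λ g → trans (∑-cong (Enum.list (Vecs (suc e))) (λ u → swap ⟦ nz? u ⟧ ⟦ state? p (ext one) (toMat g) ⟧ _)) (∑-*ˡ (Enum.list (Vecs (suc e))) ⟦ state? p (ext one) (toMat g) ⟧ _)))))
    where
    swap : ∀ a b c → a *ᶻ (b *ᶻ c) ≡ b *ᶻ (a *ᶻ c)
    swap = ℤ-solve-∀

module ClassFunctions (𝔽 : FiniteField) where
  open FieldFacts 𝔽 using (F)
  open MatrixFacts 𝔽
  open Characteristic 𝔽
  open GLRecursion 𝔽

  One : ∀ n → ClassFunction n
  One n = record { φ = λ _ → 1ℤ ; similar = λ _ _ _ _ _ _ _ → refl }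

  Trace : ∀ n → ℕ → F → ClassFunction n
  Trace n k a = record { φ = λ A → ψ a (Tr (A ^ᴹ k)) ; similar = λ E E′ A B h l r → cong (ψ a) (Tr-similar E E′ A B h l r k) }

-- Bounds for the contribution of closing columns

module JunkBounds (𝔽 : FiniteField) (e r : ℕ) where
  private
    module 𝔽 = FieldFacts 𝔽
    module 𝔽E = Sums.Enum 𝔽.F-Enum
  open FieldFacts 𝔽 using (F; 0#; 1#; _+_; _*_; -_; _-_; inv; 0≢1; 2≤q)
  open MatrixFacts 𝔽
  open Blocks (suc e) r
  open Polynomials 𝔽 using (plain; mono; plain-deg)
  open PrimeCount 𝔽 using (Vecs; Vecs-size)
  open SeparablePrime 𝔽 using (0≤Q^)
  open Characteristic 𝔽
  open Weights 𝔽
  open RootPowerSums 𝔽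
  open GLRecursion 𝔽
  open ClassFunctions 𝔽
  open Junk 𝔽 e r
  open Sums
  open import Data.Integer using () renaming (_+_ to _+ᶻ_; _*_ to _*ᶻ_; _-_ to _-ᶻ_; _≤_ to _≤ᶻ_; -_ to -ᶻ_)

  private
    M = 𝕄s (suc e ℕ.+ r)
    V = Vecs (suc e)

  private
    negate : ∀ {m} → Vec F m → Vec F m
    negate = Vec.map (λ x → - x)

    neg0 : - 0# ≡ 0#
    neg0 = trans (sym (𝔽.+-identityˡ (- 0#))) (𝔽.-‿inverseʳ 0#)

  module TraceOfBlocks (A : Mat (suc e ℕ.+ r)) (shift : Shift p A) (u : Vec F (suc e)) where
    private
      -- The last column of a companion matrix holds the negated coefficients of its polynomial.
      R : Vec F (suc e)
      R = negate u

      cases : ∀ (j : Fin (suc e)) → toℕ j < e ⊎ j ≡ Fin.fromℕ e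
      cases j with ℕₚ.m≤n⇒m<n∨m≡n (ℕₚ.≤-pred (Finₚ.toℕ<n j))
      ... | inj₁ lt = inj₁ lt
      ... | inj₂ eq = inj₂ (Finₚ.toℕ-injective (trans eq (sym (Finₚ.toℕ-fromℕ e))))

      early : ∀ i (j : Fin (suc e)) → toℕ j < e → repl A u i (j Fin.↑ˡ r) ≡ mono 1# (suc (toℕ j)) (toℕ i)
      early i j lt = trans (repl-shift u shift i (j Fin.↑ˡ r) (subst₂ _<_ (sym (Finₚ.toℕ-↑ˡ j r)) (sym toℕ-p) lt)) (cong (λ m → mono 1# (suc m) (toℕ i)) (Finₚ.toℕ-↑ˡ j r))

      plain-neg : ∀ {m} (v : Vec F m) i → - plain (negate v) i ≡ plain v i
      plain-neg []      i       = neg0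
      plain-neg (x ∷ v) zero    = 𝔽.solve 1 (λ x → 𝔽.:- (𝔽.:- x) 𝔽.:= x) refl x
      plain-neg (x ∷ v) (suc i) = plain-neg v i

    triangular : BlockTriangular (repl A u)
    triangular i j = decide (cases j)
      where
      below : suc e ≤ toℕ (suc e Fin.↑ʳ i)
      below = ℕₚ.≤-trans (ℕₚ.m≤m+n (suc e) (toℕ i)) (ℕₚ.≤-reflexive (sym (Finₚ.toℕ-↑ʳ (suc e) i)))
      decide : toℕ j < e ⊎ j ≡ Fin.fromℕ e → repl A u (suc e Fin.↑ʳ i) (j Fin.↑ˡ r) ≡ 0#
      decide (inj₁ lt)   = trans (early (suc e Fin.↑ʳ i) j lt) (mono-< 1# (ℕₚ.<⇒≢ (ℕₚ.≤-trans (s≤s lt) below)))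
      decide (inj₂ refl) = trans (repl-p A u (suc e Fin.↑ʳ i)) (plain-deg u (toℕ (suc e Fin.↑ʳ i)) below)

    companion : upperLeft (repl A u) ≡ᴹ QuotientTrace.mulMat 𝔽 R (Quotient.X 𝔽 R)
    companion i j = decide (cases j)
      where
      decide : toℕ j < e ⊎ j ≡ Fin.fromℕ e → repl A u (i Fin.↑ˡ r) (j Fin.↑ˡ r) ≡ QuotientTrace.mulMat 𝔽 R (Quotient.X 𝔽 R) i j
      decide (inj₁ lt)   = trans (early (i Fin.↑ˡ r) j lt) (trans (cong (mono 1# (suc (toℕ j))) (Finₚ.toℕ-↑ˡ i r)) (sym (QuotientTrace.mulMat-X-shift 𝔽 R i j (s≤s lt))))
      decide (inj₂ refl) = trans (repl-p A u (i Fin.↑ˡ r)) (trans (cong (plain u) (Finₚ.toℕ-↑ˡ i r))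
        (trans (sym (plain-neg u (toℕ i))) (sym (QuotientTrace.mulMat-X-last 𝔽 R i (Fin.fromℕ e) (cong suc (Finₚ.toℕ-fromℕ e))))))

    Tr-repl : ∀ k → Tr (repl A u ^ᴹ k) ≡ τ k R + Tr (lowerRight A ^ᴹ k)
    Tr-repl k = trans (Tr-^-blocks {g = repl A u} triangular k) (cong₂ _+_
      (trans (Tr-cong {A = upperLeft (repl A u) ^ᴹ k} (^ᴹ-cong {A = upperLeft (repl A u)} companion k)) (τ-companion k R))
      (Tr-cong {A = lowerRight (repl A u) ^ᴹ k} (^ᴹ-cong {A = lowerRight (repl A u)} {B = lowerRight A} (λ i j → repl-other A u (suc e Fin.↑ʳ i) (suc e Fin.↑ʳ j) (λ eq → ↑ˡ≢↑ʳ (Fin.fromℕ e) j (sym eq))) k)))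

  blockSum : (Φ : ClassFunction (suc e ℕ.+ r)) → Mat (suc e ℕ.+ r) → ℤ
  blockSum Φ A = Enum.sum V (λ u → ⟦ nz? u ⟧ *ᶻ ClassFunction.φ Φ (repl A u))

  #nz : ℤ
  #nz = Enum.sum V (λ u → ⟦ nz? u ⟧ *ᶻ 1ℤ)

  -- In block triangular form the trace is τ_k of the block plus the trace of the lower right part,
  -- which u does not affect. The latter is moved into the target of ψ.
  blockSum-Trace : ∀ k a A → Shift p A → blockSum (Trace (suc e ℕ.+ r) k a) A ≡ Enum.sum V (weight k (a - Tr (lowerRight A ^ᴹ k)))
  blockSum-Trace k a A shift = sym (trans (∑-reindex V V negate negate map-neg map-neg (weight k (a - t))) (∑-cong (Enum.list V) each))
    where
    t = Tr (lowerRight A ^ᴹ k)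
    map-neg : ∀ {m} (v : Vec F m) → negate (negate v) ≡ v
    map-neg []      = refl
    map-neg (x ∷ v) = cong₂ _∷_ (𝔽.solve 1 (λ x → 𝔽.:- (𝔽.:- x) 𝔽.:= x) refl x) (map-neg v)
    each : ∀ u → weight k (a - t) (negate u) ≡ ⟦ nz? u ⟧ *ᶻ ψ a (Tr (repl A u ^ᴹ k))
    each u@(x ∷ v) = cong₂ _*ᶻ_
      (⟦⟧-cong (¬? ((- x) 𝔽.≟ 0#)) (nz? u) (λ ne z → ne (trans (cong (λ y → - y) z) neg0)) (λ ne z → ne (trans (𝔽.solve 1 (λ x → x 𝔽.:= 𝔽.:- (𝔽.:- x)) refl x) (trans (cong (λ y → - y) z) neg0))))
      (sym (trans (cong (ψ a) (TraceOfBlocks.Tr-repl A shift u k)) (ψ-shift a (τ k (negate u)) t)))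

  -- Both sides are sums over the same base matrices by `junk-value`, so a bound for each fixed base
  -- matrix suffices.
  junk-≤ : ∀ Φ s C → 0ℤ ≤ᶻ s → (∀ A → Shift p A → s *ᶻ abs (blockSum Φ A) ≤ᶻ C *ᶻ #nz) → s *ᶻ abs (junk Φ p) ≤ᶻ C *ᶻ junk (One (suc e ℕ.+ r)) p
  junk-≤ Φ s C 0≤s bound = begin
    s *ᶻ abs (junk Φ p)                                                      ≡⟨ cong (λ z → s *ᶻ abs z) (junk-value Φ) ⟩
    s *ᶻ abs (Enum.sum M (λ g → st g *ᶻ blockSum Φ (toMat g)))               ≤⟨ *-monoˡ 0≤s (∑-abs (Enum.list M) _) ⟩
    s *ᶻ Enum.sum M (λ g → abs (st g *ᶻ blockSum Φ (toMat g)))               ≡⟨ ∑-*ˡ (Enum.list M) s _ ⟨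
    Enum.sum M (λ g → s *ᶻ abs (st g *ᶻ blockSum Φ (toMat g)))               ≤⟨ ∑-mono (Enum.list M) each ⟩
    Enum.sum M (λ g → C *ᶻ (st g *ᶻ #nz))                                    ≡⟨ ∑-*ˡ (Enum.list M) C _ ⟩
    C *ᶻ Enum.sum M (λ g → st g *ᶻ #nz)                                      ≡⟨ cong (C *ᶻ_) (junk-value (One (suc e ℕ.+ r))) ⟨
    C *ᶻ junk (One (suc e ℕ.+ r)) p                                          ∎
    where
    open ℤₚ.≤-Reasoning
    st : 𝕄 (suc e ℕ.+ r) → ℤ
    st g = ⟦ state? p (ext one) (toMat g) ⟧
    pull : ∀ s t x → s *ᶻ (t *ᶻ x) ≡ t *ᶻ (s *ᶻ x)
    pull = ℤ-solve-∀
    each : ∀ g → s *ᶻ abs (st g *ᶻ blockSum Φ (toMat g)) ≤ᶻ C *ᶻ (st g *ᶻ #nz)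
    each g = begin
      s *ᶻ abs (st g *ᶻ blockSum Φ (toMat g))     ≡⟨ cong (s *ᶻ_) (trans (abs-* (st g) (blockSum Φ (toMat g))) (cong (_*ᶻ abs (blockSum Φ (toMat g))) (abs-nonneg (⟦⟧-nonneg (state? p (ext one) (toMat g)))))) ⟩
      s *ᶻ (st g *ᶻ abs (blockSum Φ (toMat g)))   ≡⟨ pull s (st g) (abs (blockSum Φ (toMat g))) ⟩
      st g *ᶻ (s *ᶻ abs (blockSum Φ (toMat g)))   ≤⟨ ⟦⟧*-mono (state? p (ext one) (toMat g)) (λ (_ , shift , _) → bound (toMat g) shift) ⟩
      st g *ᶻ (C *ᶻ #nz)                          ≡⟨ pull (st g) C #nz ⟩
      C *ᶻ (st g *ᶻ #nz)                          ∎

  junk-law : ∀ k a s C → 0ℤ ≤ᶻ s → (∀ b → s *ᶻ abs (Enum.sum V (weight k b)) ≤ᶻ C *ᶻ #nz) → s *ᶻ abs (junk (Trace (suc e ℕ.+ r) k a) p) ≤ᶻ C *ᶻ junk (One (suc e ℕ.+ r)) p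
  junk-law k a s C 0≤s law = junk-≤ (Trace (suc e ℕ.+ r) k a) s C 0≤s (λ A shift → subst (λ z → s *ᶻ abs z ≤ᶻ C *ᶻ #nz) (sym (blockSum-Trace k a A shift)) (law (a - Tr (lowerRight A ^ᴹ k))))

  junk-trivial : ∀ k a → abs (junk (Trace (suc e ℕ.+ r) k a) p) ≤ᶻ Q *ᶻ junk (One (suc e ℕ.+ r)) p
  junk-trivial k a = subst (_≤ᶻ Q *ᶻ junk (One (suc e ℕ.+ r)) p) (ℤₚ.*-identityˡ _) (junk-≤ (Trace (suc e ℕ.+ r) k a) 1ℤ Q (ℤ.+≤+ z≤n) (λ A _ → begin
      1ℤ *ᶻ abs (blockSum (Trace (suc e ℕ.+ r) k a) A)                     ≡⟨ ℤₚ.*-identityˡ _ ⟩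
      abs (blockSum (Trace (suc e ℕ.+ r) k a) A)                           ≤⟨ ∑-abs (Enum.list V) _ ⟩
      Enum.sum V (λ u → abs (⟦ nz? u ⟧ *ᶻ ψ a (Tr (repl A u ^ᴹ k))))       ≤⟨ ∑-mono (Enum.list V) (λ u → each (nz? u) (Tr (repl A u ^ᴹ k))) ⟩
      Enum.sum V (λ u → Q *ᶻ (⟦ nz? u ⟧ *ᶻ 1ℤ))                            ≡⟨ ∑-*ˡ (Enum.list V) Q _ ⟩
      Q *ᶻ #nz                                                             ∎))
    where
    open ℤₚ.≤-Reasoning
    rearrange : ∀ x y → x *ᶻ y ≡ y *ᶻ (x *ᶻ 1ℤ)
    rearrange = ℤ-solve-∀
    each : ∀ {P : Set} (d : Dec P) t → abs (⟦ d ⟧ *ᶻ ψ a t) ≤ᶻ Q *ᶻ (⟦ d ⟧ *ᶻ 1ℤ)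
    each d t = begin
      abs (⟦ d ⟧ *ᶻ ψ a t)       ≡⟨ trans (abs-* ⟦ d ⟧ (ψ a t)) (cong (_*ᶻ abs (ψ a t)) (abs-nonneg (⟦⟧-nonneg d))) ⟩
      ⟦ d ⟧ *ᶻ abs (ψ a t)       ≤⟨ *-monoˡ (⟦⟧-nonneg d) (abs-ψ a t) ⟩
      ⟦ d ⟧ *ᶻ Q                 ≡⟨ rearrange ⟦ d ⟧ Q ⟩
      Q *ᶻ (⟦ d ⟧ *ᶻ 1ℤ)         ∎

  -- A proportion 1 - 1/q ≥ 1/2 of the polynomials has nonzero constant term. The 2 is what turns
  -- the bound 2q + 1 into 4q + 2.
  Q^≤2#nz : Q ℤ.^ suc e ≤ᶻ + 2 *ᶻ #nz
  Q^≤2#nz = begin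
    Q *ᶻ Q ℤ.^ e                             ≤⟨ *-monoʳ (0≤Q^ e) Q≤ ⟩
    + 2 *ᶻ (Q -ᶻ 1ℤ) *ᶻ Q ℤ.^ e              ≡⟨ ℤₚ.*-assoc (+ 2) (Q -ᶻ 1ℤ) (Q ℤ.^ e) ⟩
    + 2 *ᶻ ((Q -ᶻ 1ℤ) *ᶻ Q ℤ.^ e)            ≡⟨ cong (+ 2 *ᶻ_) value ⟨
    + 2 *ᶻ #nz                               ∎
    where
    open ℤₚ.≤-Reasoning
    double : ∀ x → + 2 *ᶻ (x -ᶻ 1ℤ) ≡ x +ᶻ (x -ᶻ + 2)
    double = ℤ-solve-∀
    Q≤ : Q ≤ᶻ + 2 *ᶻ (Q -ᶻ 1ℤ)
    Q≤ = ℤₚ.≤-trans (ℤₚ.≤-reflexive (sym (ℤₚ.+-identityʳ Q))) (ℤₚ.≤-trans (ℤₚ.+-monoʳ-≤ Q (ℤₚ.i≤j⇒0≤j-i (ℤ.+≤+ 2≤q))) (ℤₚ.≤-reflexive (sym (double Q))))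
    value : #nz ≡ (Q -ᶻ 1ℤ) *ᶻ Q ℤ.^ e
    value = trans (Vec-sum 𝔽.F-Enum e _) (trans (∑-cong 𝔽.elems (λ x → trans (∑-*ˡ (Enum.list (Vecs e)) ⟦ ¬? (x 𝔽E.≟ 0#) ⟧ (λ _ → 1ℤ)) (cong (⟦ ¬? (x 𝔽E.≟ 0#) ⟧ *ᶻ_) (Vecs-size e))))
      (trans (∑-*ʳ 𝔽.elems (Q ℤ.^ e) _) (cong (_*ᶻ Q ℤ.^ e) (trans (∑-cong 𝔽.elems (λ x → ⟦⟧-¬ (x 𝔽E.≟ 0#))) (trans (∑-- 𝔽.elems _ _) (cong₂ _-ᶻ_ F-size (𝔽E.once 0#)))))))

  private
    move : ∀ (v v′ : Fin (suc e ℕ.+ r) → F) → (transvection zero v *ᴹ transvection zero v′) ≡ᴹ Iᴹ × (transvection zero v′ *ᴹ transvection zero v) ≡ᴹ Iᴹ → ∀ c c′ →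
           (∀ i → plain c′ (toℕ i) ≡ plain c (toℕ i) + v i * plain c 0) → ∀ A → State p c A → State p c′ (transvection zero v *ᴹ (A *ᴹ Iᴹ))
    move v v′ inverses c c′ h A (unit , shift , column) = State-cong {c = c′} {A = T *ᴹ A} {B = T *ᴹ (A *ᴹ Iᴹ)} (*ᴹ-cong {A = T} {A′ = T} {B = A} (λ _ _ → refl) (≡ᴹ-sym (*ᴹ-identityʳ A)))
      ( Unit⇒Invertible {g = T *ᴹ A} (Unit-* {g = T} {g′ = A} (transvection zero v′ , inverses) (Invertible⇒Unit {g = A} unit))
      , (λ i j lt → trans (entry i j) (trans (cong₂ (λ x y → x + v i * y) (shift i j lt) (shift zero j lt)) (trans (𝔽.+-congˡ (𝔽.zeroʳ (v i))) (𝔽.+-identityʳ _))))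
      , (λ i → trans (entry i p) (trans (cong₂ (λ x y → x + v i * y) (column i) (column zero)) (sym (h i)))))
      where
      T = transvection {suc e ℕ.+ r} zero v
      entry : ∀ i j → (T *ᴹ A) i j ≡ A i j + v i * A zero j
      entry = transvection-*ˡ zero v A

  -- If u₀ ≠ 0, left multiplication by I + v e₀ᵀ changes the entries w of column p at will, and it
  -- keeps the earlier columns because their first entries are 0. If u₀ = 0, no invertible matrix
  -- has the column on the left.
  count-≤ : ∀ u w → count (One (suc e ℕ.+ r)) p (ext u) ≤ᶻ count (One (suc e ℕ.+ r)) p (u Vec.++ w)
  count-≤ u@(x ∷ _) w = decide (x 𝔽E.≟ 0#)
    where
    c = ext u
    c′ = u Vec.++ w
    decide : Dec (x ≡ 0#) → count (One (suc e ℕ.+ r)) p c ≤ᶻ count (One (suc e ℕ.+ r)) p c′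
    decide (yes z) = ℤₚ.≤-trans (ℤₚ.≤-reflexive (trans (count-ext (One (suc e ℕ.+ r)) u) (trans (cong (_*ᶻ Enum.sum M (λ g → ⟦ state? p (ext one) (toMat g) ⟧ *ᶻ 1ℤ)) (⟦⟧-no (nz? u) (λ ne → ne z))) (ℤₚ.*-zeroˡ (Enum.sum M (λ g → ⟦ state? p (ext one) (toMat g) ⟧ *ᶻ 1ℤ))))))
      (∑-nonneg (Enum.list M) (λ g → *-nonneg (⟦⟧-nonneg (state? p c′ (toMat g))) (ℤ.+≤+ z≤n)))
    decide (no nz) = ℤₚ.≤-reflexive (count-transport (One (suc e ℕ.+ r)) p c c′ (transvection zero v) (transvection zero v⁻) Iᴹ Iᴹ (proj₁ inverses) (proj₂ inverses) (*ᴹ-identityˡ Iᴹ) (*ᴹ-identityˡ Iᴹ)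
        (move v v⁻ inverses c c′ h) (move v⁻ v (proj₂ inverses , proj₁ inverses) c′ c (transvection⁻-undo zero v ne (λ i → plain c (toℕ i)) (λ i → plain c′ (toℕ i)) h)) (λ _ → refl))
      where
      v : Fin (suc e ℕ.+ r) → F
      v i = (plain c′ (toℕ i) - plain c (toℕ i)) * inv x
      v⁻ = transvection⁻ zero v
      ne : 1# + v zero ≢ 0#
      ne z = 0≢1 (sym (trans (𝔽.solve 3 (λ o x i → o 𝔽.:= o 𝔽.:+ (x 𝔽.:- x) 𝔽.:* i) refl 1# x (inv x)) z))
      inverses = transvection-inverse zero v ne
      h : ∀ i → plain c′ (toℕ i) ≡ plain c (toℕ i) + v i * x
      h i = sym (trans (𝔽.+-congˡ (trans (𝔽.solve 3 (λ d i x → d 𝔽.:* i 𝔽.:* x 𝔽.:= d 𝔽.:* (x 𝔽.:* i)) refl (plain c′ (toℕ i) - plain c (toℕ i)) (inv x) x) (trans (cong ((plain c′ (toℕ i) - plain c (toℕ i)) *_) (𝔽.*-inv nz)) (𝔽.*-identityʳ _))))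
        (𝔽.solve 2 (λ a b → a 𝔽.:+ (b 𝔽.:- a) 𝔽.:= b) refl (plain c (toℕ i)) (plain c′ (toℕ i))))

  -- Only the fraction q⁻ʳ of the columns ends the companion block.
  junk-rare : Q ℤ.^ r *ᶻ junk (One (suc e ℕ.+ r)) p ≤ᶻ total (One (suc e ℕ.+ r)) p
  junk-rare = begin
    Q ℤ.^ r *ᶻ junk (One (suc e ℕ.+ r)) p                                                      ≡⟨ cong₂ _*ᶻ_ (sym (Vecs-size r)) (junk-sum (One (suc e ℕ.+ r))) ⟩
    Enum.size (Vecs r) *ᶻ Enum.sum V (λ u → count (One (suc e ℕ.+ r)) p (ext u))                ≡⟨ ∑-*ˡ (Enum.list V) (Enum.size (Vecs r)) _ ⟨
    Enum.sum V (λ u → Enum.size (Vecs r) *ᶻ count (One (suc e ℕ.+ r)) p (ext u))                ≡⟨ ∑-cong (Enum.list V) (λ u → Enum.sum-*1 (Vecs r) (count (One (suc e ℕ.+ r)) p (ext u))) ⟨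
    Enum.sum V (λ u → Enum.sum (Vecs r) (λ w → count (One (suc e ℕ.+ r)) p (ext u)))            ≤⟨ ∑-mono (Enum.list V) (λ u → ∑-mono (Enum.list (Vecs r)) (count-≤ u)) ⟩
    Enum.sum V (λ u → Enum.sum (Vecs r) (λ w → count (One (suc e ℕ.+ r)) p (u Vec.++ w)))       ≡⟨ sum-++ (suc e) r (count (One (suc e ℕ.+ r)) p) ⟨
    Enum.sum (Vecs (suc e ℕ.+ r)) (count (One (suc e ℕ.+ r)) p)                                 ≡⟨ total-fibre (One (suc e ℕ.+ r)) p ⟨
    total (One (suc e ℕ.+ r)) p                                                                ∎
    where open ℤₚ.≤-Reasoning

-- From the law for polynomials to the law on GL_n

module TraceLaw (𝔽 : FiniteField) where
  open FieldFacts 𝔽 using (F; q)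
  open MatrixFacts 𝔽
  open PrimeCount 𝔽 using (Vecs)
  open Characteristic 𝔽
  open Weights 𝔽
  open GLRecursion 𝔽
  open ClassFunctions 𝔽
  open Sums
  open import Data.Integer using (_*_; _+_; _-_) renaming (_≤_ to _≤ᶻ_)

  PolynomialBound : ℕ → ℕ → ℕ → Set
  PolynomialBound k s e = ∀ b → + s * abs (Enum.sum (Vecs (suc e)) (weight k b)) ≤ᶻ (+ 2 * Q + 1ℤ) * Q ℤ.^ suc e

  -- The bounds restated for a position in `Fin n`, where n = e + 1 + r holds only up to a proof.
  record JunkFacts {n : ℕ} (k : ℕ) (a : F) (p : Fin n) (e r : ℕ) : Set where
    field
      rare    : Q ℤ.^ r * junk (One n) p ≤ᶻ total (One n) p
      trivial : abs (junk (Trace n k a) p) ≤ᶻ Q * junk (One n) p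
      law     : ∀ s → PolynomialBound k s e → + s * abs (junk (Trace n k a) p) ≤ᶻ (+ 4 * Q + + 2) * junk (One n) p

  junkFacts : ∀ {n} k a (p : Fin n) e r → suc e ℕ.+ r ≡ n → toℕ p ≡ e → JunkFacts k a p e r
  junkFacts k a p e r refl toℕ≡ = subst (λ p → JunkFacts k a p e r) (Finₚ.toℕ-injective (trans (Junk.toℕ-p 𝔽 e r) (sym toℕ≡))) (record
    { rare    = JunkBounds.junk-rare 𝔽 e r
    ; trivial = JunkBounds.junk-trivial 𝔽 e r k a
    ; law     = λ s bound → JunkBounds.junk-law 𝔽 e r k a (+ s) (+ 4 * Q + + 2) (ℤ.+≤+ z≤n) (λ b → ℤₚ.≤-trans (bound b)
        (ℤₚ.≤-trans (*-monoˡ 0≤2Q+1 (JunkBounds.Q^≤2#nz 𝔽 e r)) (ℤₚ.≤-reflexive (double Q (JunkBounds.#nz 𝔽 e r)))))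
    })
    where
    0≤2Q+1 : 0ℤ ≤ᶻ + 2 * Q + 1ℤ
    0≤2Q+1 = ℤₚ.+-mono-≤ (*-nonneg {+ 2} (ℤ.+≤+ z≤n) 0≤Q) (ℤ.+≤+ z≤n)
    double : ∀ x z → (+ 2 * x + 1ℤ) * (+ 2 * z) ≡ (+ 4 * x + + 2) * z
    double = ℤ-solve-∀

  module _ (n k : ℕ) (a : F) (s : ℕ) (hypothesis : ∀ e r → suc e ℕ.+ r ≡ n → PolynomialBound k s e ⊎ + s * + n * Q ≤ᶻ Q ℤ.^ r) where
    private
      Ψ = Trace n k a
      𝟙 = One n
      L N : ℤ
      L = + 4 * Q + + 2
      N = + n

      0≤L : 0ℤ ≤ᶻ L
      0≤L = ℤₚ.+-mono-≤ (*-nonneg {+ 4} (ℤ.+≤+ z≤n) 0≤Q) (ℤ.+≤+ z≤n)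

      0≤N : 0ℤ ≤ᶻ N
      0≤N = ℤ.+≤+ z≤n

      0≤sN : 0ℤ ≤ᶻ + s * N
      0≤sN = *-nonneg {+ s} (ℤ.+≤+ z≤n) 0≤N

      0≤total : ∀ p → 0ℤ ≤ᶻ total 𝟙 p
      0≤total p = ∑-nonneg (Enum.list (𝕄s n)) (λ g → *-nonneg (⟦⟧-nonneg (invertible? (toMat g) ×-dec shift? p (toMat g))) (ℤ.+≤+ z≤n))

      0≤junk : ∀ p → 0ℤ ≤ᶻ junk 𝟙 p
      0≤junk p = ∑-nonneg (Enum.list (Vecs n)) (λ c → *-nonneg (⟦⟧-nonneg (low? p c)) (∑-nonneg (Enum.list (𝕄s n)) (λ g → *-nonneg (⟦⟧-nonneg (state? p c (toMat g))) (ℤ.+≤+ z≤n))))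

      0≤#generic : ∀ p → 0ℤ ≤ᶻ #generic 𝟙 p
      0≤#generic p = ∑-nonneg (Enum.list (Vecs n)) (λ c → ⟦⟧-nonneg (¬? (low? p c)))

      junk-bound : ∀ p e r → suc e ℕ.+ r ≡ n → toℕ p ≡ e → + s * N * abs (junk Ψ p) ≤ᶻ N * L * junk 𝟙 p + total 𝟙 p
      junk-bound p e r n≡ toℕ≡ = decide (hypothesis e r n≡)
        where
        open JunkFacts (junkFacts k a p e r n≡ toℕ≡)
        open ℤₚ.≤-Reasoning
        swap : ∀ s n x → s * n * x ≡ n * (s * x)
        swap = ℤ-solve-∀
        decide : PolynomialBound k s e ⊎ + s * N * Q ≤ᶻ Q ℤ.^ r → + s * N * abs (junk Ψ p) ≤ᶻ N * L * junk 𝟙 p + total 𝟙 p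
        decide (inj₁ bound) = begin
          + s * N * abs (junk Ψ p)          ≡⟨ swap (+ s) N (abs (junk Ψ p)) ⟩
          N * (+ s * abs (junk Ψ p))        ≤⟨ *-monoˡ 0≤N (law s bound) ⟩
          N * (L * junk 𝟙 p)                ≡⟨ ℤₚ.*-assoc N L (junk 𝟙 p) ⟨
          N * L * junk 𝟙 p                  ≡⟨ ℤₚ.+-identityʳ _ ⟨
          N * L * junk 𝟙 p + 0ℤ             ≤⟨ ℤₚ.+-monoʳ-≤ (N * L * junk 𝟙 p) (0≤total p) ⟩
          N * L * junk 𝟙 p + total 𝟙 p      ∎
        decide (inj₂ bound) = begin
          + s * N * abs (junk Ψ p)          ≤⟨ *-monoˡ 0≤sN trivial ⟩
          + s * N * (Q * junk 𝟙 p)          ≡⟨ ℤₚ.*-assoc (+ s * N) Q (junk 𝟙 p) ⟨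
          + s * N * Q * junk 𝟙 p            ≤⟨ *-monoʳ (0≤junk p) bound ⟩
          Q ℤ.^ r * junk 𝟙 p                ≤⟨ rare ⟩
          total 𝟙 p                         ≡⟨ ℤₚ.+-identityˡ _ ⟨
          0ℤ + total 𝟙 p                    ≤⟨ ℤₚ.+-monoˡ-≤ (total 𝟙 p) (*-nonneg (*-nonneg 0≤N 0≤L) (0≤junk p)) ⟩
          N * L * junk 𝟙 p + total 𝟙 p      ∎

      -- After scaling by s n, a block covered by the polynomial law adds n L times its own junk,
      -- and these parts together do not exceed the total. Any other block adds at most the total of
      -- the current step, and at most r + 1 steps remain.
      total-bound : ∀ r e (p : Fin n) → suc e ℕ.+ r ≡ n → toℕ p ≡ e → + s * N * abs (total Ψ p) ≤ᶻ N * L * total 𝟙 p + + suc r * total 𝟙 p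
      total-bound zero e p n≡ toℕ≡ = subst₂ _≤ᶻ_ (cong (λ z → + s * N * abs z) (sym (total-last Ψ p last))) (cong₂ _+_ (cong (λ z → N * L * z) (sym (total-last 𝟙 p last))) (sym (ℤₚ.*-identityˡ (total 𝟙 p)))) (junk-bound p e zero n≡ toℕ≡)
        where
        last : suc (toℕ p) ≡ n
        last = trans (cong suc toℕ≡) (trans (sym (ℕₚ.+-identityʳ (suc e))) n≡)
      total-bound (suc r) e p n≡ toℕ≡ = begin
          + s * N * abs (total Ψ p)                                                       ≡⟨ cong (λ z → + s * N * abs z) (total-step Ψ p p′ p′≡) ⟩
          + s * N * abs (junk Ψ p + G * total Ψ p′)                                       ≤⟨ *-monoˡ 0≤sN (abs-+ (junk Ψ p) (G * total Ψ p′)) ⟩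
          + s * N * (abs (junk Ψ p) + abs (G * total Ψ p′))                               ≡⟨ cong (λ z → + s * N * (abs (junk Ψ p) + z)) (trans (abs-* G (total Ψ p′)) (cong (_* abs (total Ψ p′)) (abs-nonneg (0≤#generic p)))) ⟩
          + s * N * (abs (junk Ψ p) + G * abs (total Ψ p′))                               ≡⟨ expand (+ s * N) (abs (junk Ψ p)) G (abs (total Ψ p′)) ⟩
          + s * N * abs (junk Ψ p) + G * (+ s * N * abs (total Ψ p′))                     ≤⟨ ℤₚ.+-mono-≤ (junk-bound p e (suc r) n≡ toℕ≡) (*-monoˡ (0≤#generic p) (total-bound r (suc e) p′ n≡′ (trans p′≡ (cong suc toℕ≡)))) ⟩
          N * L * junk 𝟙 p + total 𝟙 p + G * (N * L * total 𝟙 p′ + + suc r * total 𝟙 p′)  ≡⟨ collect (N * L) (junk 𝟙 p) (total 𝟙 p) G (total 𝟙 p′) (+ suc r) ⟩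
          N * L * (junk 𝟙 p + G * total 𝟙 p′) + (total 𝟙 p + + suc r * (G * total 𝟙 p′))  ≤⟨ ℤₚ.+-mono-≤ (ℤₚ.≤-reflexive (cong (λ z → N * L * z) (sym (total-step 𝟙 p p′ p′≡)))) (ℤₚ.+-monoʳ-≤ (total 𝟙 p) (*-monoˡ {+ suc r} (ℤ.+≤+ z≤n) part)) ⟩
          N * L * total 𝟙 p + (total 𝟙 p + + suc r * total 𝟙 p)                           ≡⟨ cong (λ z → N * L * total 𝟙 p + z) (sym (ℤₚ.suc-* (+ suc r) (total 𝟙 p))) ⟩
          N * L * total 𝟙 p + + suc (suc r) * total 𝟙 p                                   ∎
        where
        open ℤₚ.≤-Reasoning
        G = #generic 𝟙 p
        n≡′ : suc (suc e) ℕ.+ r ≡ n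
        n≡′ = trans (sym (ℕₚ.+-suc (suc e) r)) n≡
        e<n : suc e < n
        e<n = ℕₚ.≤-trans (ℕₚ.m≤m+n (suc (suc e)) r) (ℕₚ.≤-reflexive n≡′)
        p′ : Fin n
        p′ = Fin.fromℕ< e<n
        p′≡ : toℕ p′ ≡ suc (toℕ p)
        p′≡ = trans (Finₚ.toℕ-fromℕ< e<n) (cong suc (sym toℕ≡))
        expand : ∀ c x g y → c * (x + g * y) ≡ c * x + g * (c * y)
        expand = ℤ-solve-∀
        collect : ∀ c j t g o m → c * j + t + g * (c * o + m * o) ≡ c * (j + g * o) + (t + m * (g * o))
        collect = ℤ-solve-∀
        part : G * total 𝟙 p′ ≤ᶻ total 𝟙 p
        part = ℤₚ.≤-trans (ℤₚ.≤-reflexive (sym (ℤₚ.+-identityˡ _))) (ℤₚ.≤-trans (ℤₚ.+-monoˡ-≤ (G * total 𝟙 p′) (0≤junk p)) (ℤₚ.≤-reflexive (sym (total-step 𝟙 p p′ p′≡))))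

    -- At the first column r + 1 = n, so n cancels and the accumulated error of the rare closings
    -- adds 1 to the constant 4q + 2.
    total-law : ∀ m (p : Fin n) → suc m ≡ n → toℕ p ≡ 0 → + s * abs (total Ψ p) ≤ᶻ (+ 4 * Q + + 3) * total 𝟙 p
    total-law m p refl toℕ≡ = ℤₚ.*-cancelˡ-≤-pos (+ s * abs (total Ψ p)) ((+ 4 * Q + + 3) * total 𝟙 p) (+ suc m)
      (ℤₚ.≤-trans (ℤₚ.≤-reflexive (swap (+ s) N (abs (total Ψ p)))) (ℤₚ.≤-trans (total-bound m 0 p refl toℕ≡) (ℤₚ.≤-reflexive (collect N Q (total 𝟙 p)))))
      where
      swap : ∀ s n x → n * (s * x) ≡ s * n * x
      swap = ℤ-solve-∀
      collect : ∀ n x y → n * (+ 4 * x + + 2) * y + n * y ≡ n * ((+ 4 * x + + 3) * y)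
      collect = ℤ-solve-∀

  total-GL : ∀ {n} (Φ : ClassFunction n) p → toℕ p ≡ 0 → total Φ p ≡ ∑ (GL n) (ClassFunction.φ Φ)
  total-GL {n} Φ p toℕ≡ = sym (trans (∑-filter invertible? (allMat n) φ) (trans (∑-allMat n _ (λ A B h → cong₂ _*_ (⟦⟧-cong (invertible? A) (invertible? B) (transport A B h) (transport B A (≡ᴹ-sym h))) (φ-cong A B h)))
      (∑-cong (Enum.list (𝕄s n)) (λ g → cong (_* φ (toMat g)) (⟦⟧-cong (invertible? (toMat g)) (invertible? (toMat g) ×-dec shift? p (toMat g)) (λ u → u , (λ i j lt → ⊥-elim (none j lt))) proj₁)))))
    where
    open ClassFunction Φ
    transport : ∀ A B → A ≡ᴹ B → Invertible A → Invertible B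
    transport A B h u = Unit⇒Invertible {g = B} (Unit-cong {g = A} {g′ = B} h (Invertible⇒Unit {g = A} u))
    none : ∀ (j : Fin n) → ¬ toℕ j < toℕ p
    none j lt = ℕₚ.n≮0 (ℕₚ.≤-trans lt (ℕₚ.≤-reflexive toℕ≡))

  GL-law : ∀ m k a s → (∀ e r → suc e ℕ.+ r ≡ suc m → PolynomialBound k s e ⊎ + s * + suc m * Q ≤ᶻ Q ℤ.^ r) →
           s ℕ.* ℕ.∣ q ℕ.* #TrPow (suc m) k a - #GL (suc m) ∣ ≤ (4 ℕ.* q ℕ.+ 3) ℕ.* #GL (suc m)
  GL-law m k a s hypothesis = ℤₚ.drop‿+≤+ (subst₂ _≤ᶻ_ left right (total-law n k a s hypothesis m zero refl refl))
    where
    n = suc m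
    ∣⊖∣ : ∀ i j → ∣ i ℤ.⊖ j ∣ ≡ ℕ.∣ i - j ∣
    ∣⊖∣ zero    zero    = refl
    ∣⊖∣ zero    (suc j) = refl
    ∣⊖∣ (suc i) zero    = refl
    ∣⊖∣ (suc i) (suc j) = trans (cong ∣_∣ (ℤₚ.[1+m]⊖[1+n]≡m⊖n i j)) (∣⊖∣ i j)
    GL-total : total (One n) zero ≡ + #GL n
    GL-total = trans (total-GL (One n) zero refl) (trans (∑-const (GL n) 1ℤ) (ℤₚ.*-identityʳ (+ #GL n)))
    Trace-total : total (Trace n k a) zero ≡ + (q ℕ.* #TrPow n k a) - + #GL n
    Trace-total = trans (total-GL (Trace n k a) zero refl) (trans (∑-- (GL n) _ _) (cong₂ _-_
      (trans (∑-*ˡ (GL n) Q _) (trans (cong (Q *_) (sym (length-filter (λ g → FiniteField._≟_ 𝔽 (Tr (g ^ᴹ k)) a) (GL n)))) (sym (ℤₚ.pos-* q (#TrPow n k a)))))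
      (trans (∑-const (GL n) 1ℤ) (ℤₚ.*-identityʳ (+ #GL n)))))
    left : + s * abs (total (Trace n k a) zero) ≡ + (s ℕ.* ℕ.∣ q ℕ.* #TrPow n k a - #GL n ∣)
    left = trans (cong (λ z → + s * + z) (trans (cong ∣_∣ (trans Trace-total (ℤₚ.m-n≡m⊖n (q ℕ.* #TrPow n k a) (#GL n)))) (∣⊖∣ (q ℕ.* #TrPow n k a) (#GL n)))) (sym (ℤₚ.pos-* s _))
    right : (+ 4 * Q + + 3) * total (One n) zero ≡ + ((4 ℕ.* q ℕ.+ 3) ℕ.* #GL n)
    right = trans (cong₂ _*_ (trans (cong (_+ + 3) (sym (ℤₚ.pos-* 4 q))) (sym (ℤₚ.pos-+ (4 ℕ.* q) 3))) GL-total) (sym (ℤₚ.pos-* (4 ℕ.* q ℕ.+ 3) (#GL n)))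

  1≤#GL : ∀ n → 1 ≤ #GL n
  1≤#GL n = nonempty (GL n) invertible∈
    where
    open import Data.List.Membership.Propositional.Properties using (∈-filter⁺)
    nonempty : ∀ {A : Set} (xs : List A) → ∃ (_∈ xs) → 1 ≤ length xs
    nonempty (x ∷ xs) _ = s≤s z≤n
    invertible∈ : ∃ (_∈ GL n)
    invertible∈ with find (Unit⇒Invertible {g = Iᴹ {n}} (Iᴹ , *ᴹ-identityˡ Iᴹ , *ᴹ-identityˡ Iᴹ))
    ... | h , h∈ , l , r = h , ∈-filter⁺ invertible? h∈ (Unit⇒Invertible {g = h} (Iᴹ , r , l))

-- Numerical estimates for good degrees

module Numerics where
  open import Data.Nat using (_+_; _*_; _^_; _/_; NonZero)
  open import Data.Nat.DivMod using (m*n/n≡m; m/n*n≤m; /-monoˡ-≤)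
  open import Data.Nat.Tactic.RingSolver using (solve-∀)

  square-cancel : ∀ {a b} → a * a ≤ b * b → a ≤ b
  square-cancel h = ℕₚ.≮⇒≥ (λ lt → ℕₚ.<⇒≱ (ℕₚ.*-mono-< lt lt) h)

  cube-cancel : ∀ {a b} → a * a * a ≤ b * b * b → a ≤ b
  cube-cancel h = ℕₚ.≮⇒≥ (λ lt → ℕₚ.<⇒≱ (ℕₚ.*-mono-< (ℕₚ.*-mono-< lt lt) lt) h)

  root-product : ∀ {a b x} → a * a < x → b * b ≤ x → a * b < x
  root-product {a} {b} {x@(suc _)} lt le = ℕₚ.≰⇒> (λ ge → ℕₚ.<⇒≱ (ℕₚ.*-monoˡ-< x lt) (begin
    x * x              ≤⟨ ℕₚ.*-mono-≤ ge ge ⟩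
    a * b * (a * b)    ≡⟨ swap a b ⟩
    a * a * (b * b)    ≤⟨ ℕₚ.*-monoʳ-≤ (a * a) le ⟩
    a * a * x          ∎))
    where
    open ℕₚ.≤-Reasoning
    swap : ∀ a b → a * b * (a * b) ≡ a * a * (b * b)
    swap = solve-∀

  floor-bound : ∀ t {g x} .{{_ : NonZero t}} → t * g ≤ x → g ≤ x / t
  floor-bound t {g} {x} le = ℕₚ.≤-trans (ℕₚ.≤-reflexive (sym (trans (cong (_/ t) (ℕₚ.*-comm t g)) (m*n/n≡m g t)))) (/-monoˡ-≤ t le)

  floor-≤ : ∀ t x .{{_ : NonZero t}} → t * (x / t) ≤ x
  floor-≤ t x = ℕₚ.≤-trans (ℕₚ.≤-reflexive (ℕₚ.*-comm t (x / t))) (m/n*n≤m x t)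

  halve : ∀ e → ∃ λ h → e ≤ h + h × h + h ≤ suc e
  halve zero          = 0 , z≤n , z≤n
  halve (suc zero)    = 1 , s≤s z≤n , ℕₚ.≤-refl
  halve (suc (suc e)) = let (h , lo , hi) = halve e in
    suc h , s≤s (ℕₚ.≤-trans (s≤s lo) (ℕₚ.≤-reflexive (sym (ℕₚ.+-suc h h)))) , s≤s (ℕₚ.≤-trans (ℕₚ.≤-reflexive (ℕₚ.+-suc h h)) (s≤s hi))

  -- Since n ≥ 2 t q², each of q, t and 2 t q is at most n, so every polynomial factor is bounded by
  -- a power of n, and a power up to n¹² is below x = q^d.
  module LargeDegree {q n t : ℕ} (2≤q : 2 ≤ q) (1≤t : 1 ≤ t) (n-large : 2 * t * (q * q) ≤ n) {e : ℕ} (d≤n : suc e ≤ n) (good : n ^ 12 < q ^ suc e) where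
    private
      instance
        q≢0 : NonZero q
        q≢0 = ℕ.>-nonZero (ℕₚ.≤-trans (s≤s z≤n) 2≤q)
        t≢0 : NonZero t
        t≢0 = ℕ.>-nonZero 1≤t
        n≢0 : NonZero n
        n≢0 = ℕ.>-nonZero (ℕₚ.≤-trans (s≤s z≤n) d≤n)

    x : ℕ
    x = q ^ suc e

    n^≤ : ∀ j → j ≤ 12 → n ^ j < x
    n^≤ j le = ℕₚ.≤-<-trans (ℕₚ.^-monoʳ-≤ n le) good

    2tq≤n : 2 * t * q ≤ n
    2tq≤n = ℕₚ.≤-trans (ℕₚ.*-monoʳ-≤ (2 * t) (ℕₚ.m≤m*n q q)) n-large

    q≤n : q ≤ n
    q≤n = ℕₚ.≤-trans (ℕₚ.m≤n*m q (2 * t) {{ℕₚ.m*n≢0 2 t}}) 2tq≤n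

    t≤n : t ≤ n
    t≤n = ℕₚ.≤-trans (ℕₚ.m≤n*m t 2) (ℕₚ.≤-trans (ℕₚ.m≤m*n (2 * t) q) 2tq≤n)

    2q≤n : 2 * q ≤ n
    2q≤n = ℕₚ.≤-trans (ℕₚ.*-monoˡ-≤ q (ℕₚ.m≤m*n 2 t)) 2tq≤n

    1≤e : 1 ≤ e
    1≤e = positive e good
      where
      positive : ∀ e → n ^ 12 < q ^ suc e → 1 ≤ e
      positive zero    lt = contradiction q≤n (ℕₚ.<⇒≱ (ℕₚ.≤-<-trans (ℕₚ.m≤m*n n (n ^ 11) {{ℕₚ.m^n≢0 n 11}}) (ℕₚ.<-≤-trans lt (ℕₚ.≤-reflexive (ℕₚ.*-identityʳ q)))))
      positive (suc e) lt = s≤s z≤n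

    module _ {h : ℕ} (h≤ : h + h ≤ suc e) where
      h≤n : h ≤ n
      h≤n = ℕₚ.≤-trans (ℕₚ.m≤m+n h h) (ℕₚ.≤-trans h≤ d≤n)

      -- Both factors are compared with the square root of x: a² ≤ n⁴ < x, and q^{2h} ≤ q^d = x.
      beats : ∀ a → a ≤ n * n → a * q ^ h < x
      beats a a≤ = root-product {a} {q ^ h} (ℕₚ.≤-<-trans (ℕₚ.≤-trans (ℕₚ.*-mono-≤ a≤ a≤) (ℕₚ.≤-reflexive (fourth n))) (n^≤ 4 (s≤s (s≤s (s≤s (s≤s z≤n))))))
          (ℕₚ.≤-trans (ℕₚ.≤-reflexive (sym (ℕₚ.^-distribˡ-+-* q h h))) (ℕₚ.^-monoʳ-≤ q h≤))
        where
        fourth : ∀ n → n * n * (n * n) ≡ n * (n * (n * (n * 1)))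
        fourth = solve-∀

      few-reducible : suc e * q ^ suc h + e * q ^ h < x
      few-reducible = ℕₚ.≤-<-trans (ℕₚ.≤-reflexive (collect (suc e) e q (q ^ h))) (beats (suc e * q + e) (ℕₚ.≤-trans (ℕₚ.+-monoʳ-≤ (suc e * q) (ℕₚ.≤-trans (ℕₚ.n≤1+n e) (ℕₚ.m≤m*n (suc e) q)))
          (ℕₚ.≤-trans (ℕₚ.≤-reflexive (double (suc e) q)) (ℕₚ.*-mono-≤ d≤n 2q≤n))))
        where
        collect : ∀ d e q p → d * (q * p) + e * p ≡ (d * q + e) * p
        collect = solve-∀
        double : ∀ d q → d * q + d * q ≡ d * (2 * q)
        double = solve-∀

      t-nonGenerators : t * (q ^ h * h) ≤ x
      t-nonGenerators = ℕₚ.<⇒≤ (ℕₚ.≤-<-trans (ℕₚ.≤-reflexive (swap t (q ^ h) h)) (beats (t * h) (ℕₚ.*-mono-≤ t≤n h≤n)))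
        where
        swap : ∀ t p h → t * (p * h) ≡ t * h * p
        swap = solve-∀

      2tq-nonGenerators : 2 * t * (q * (q ^ h * h)) ≤ x
      2tq-nonGenerators = ℕₚ.<⇒≤ (ℕₚ.≤-<-trans (ℕₚ.≤-reflexive (swap t q (q ^ h) h)) (beats (2 * t * q * h) (ℕₚ.*-mono-≤ 2tq≤n h≤n)))
        where
        swap : ∀ t q p h → 2 * t * (q * (p * h)) ≡ 2 * t * q * h * p
        swap = solve-∀

    -- With c = 2tq², the hypotheses c⁶ ≤ n¹² < qᵈ and γ³ < qᵈ give (c²γ²)³ ≤ q³ᵈ.
    powerSum-small : ∀ {γ g} → γ ^ 3 < x → g * g ≤ γ * (q * q * x * (q * γ)) → 2 * t * g ≤ x
    powerSum-small {γ} {g} γ-small g² = square-cancel (begin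
        2 * t * g * (2 * t * g)                                 ≡⟨ square (2 * t) g ⟩
        2 * t * (2 * t) * (g * g)                               ≤⟨ ℕₚ.*-monoʳ-≤ (2 * t * (2 * t)) g² ⟩
        2 * t * (2 * t) * (γ * (q * q * x * (q * γ)))           ≤⟨ ℕₚ.m≤m*n _ q ⟩
        2 * t * (2 * t) * (γ * (q * q * x * (q * γ))) * q       ≡⟨ collect t q x γ ⟩
        c * c * (γ * γ) * x                                     ≤⟨ ℕₚ.*-monoˡ-≤ x small ⟩
        x * x                                                   ∎)
      where
      open ℕₚ.≤-Reasoning
      c = 2 * t * (q * q)
      square : ∀ a g → a * g * (a * g) ≡ a * a * (g * g)
      square = solve-∀
      collect : ∀ t q x γ → 2 * t * (2 * t) * (γ * (q * q * x * (q * γ))) * q ≡ 2 * t * (q * q) * (2 * t * (q * q)) * (γ * γ) * x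
      collect = solve-∀
      sixth : ∀ c → c * c * (c * c) * (c * c) ≡ c * (c * (c * (c * (c * (c * 1)))))
      sixth = solve-∀
      cube : ∀ a γ → a * (γ * γ) * (a * (γ * γ)) * (a * (γ * γ)) ≡ a * a * a * (γ * (γ * (γ * 1)) * (γ * (γ * (γ * 1))))
      cube = solve-∀
      small : c * c * (γ * γ) ≤ x
      small = cube-cancel (begin
        c * c * (γ * γ) * (c * c * (γ * γ)) * (c * c * (γ * γ))   ≡⟨ cube (c * c) γ ⟩
        c * c * (c * c) * (c * c) * (γ ^ 3 * γ ^ 3)               ≡⟨ cong (_* (γ ^ 3 * γ ^ 3)) (sixth c) ⟩
        c ^ 6 * (γ ^ 3 * γ ^ 3)                                   ≤⟨ ℕₚ.*-mono-≤ (ℕₚ.≤-trans (ℕₚ.^-monoˡ-≤ 6 n-large) (ℕₚ.<⇒≤ (n^≤ 6 (s≤s (s≤s (s≤s (s≤s (s≤s (s≤s z≤n))))))))) (ℕₚ.*-mono-≤ (ℕₚ.<⇒≤ γ-small) (ℕₚ.<⇒≤ γ-small)) ⟩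
        x * (x * x)                                               ≡⟨ ℕₚ.*-assoc x x x ⟨
        x * x * x                                                 ∎)

    -- Each of the three factors is at most n, and n³ ≤ n¹² < q^d ≤ q^r.
    tail-small : ∀ {s r} → s ≤ t → suc e ≤ r → s * n * q ≤ q ^ r
    tail-small {s} {r} s≤t d≤r = ℕₚ.≤-trans (ℕₚ.*-mono-≤ (ℕₚ.*-monoˡ-≤ n (ℕₚ.≤-trans s≤t t≤n)) q≤n) (ℕₚ.≤-trans (ℕₚ.≤-reflexive (cube n)) (ℕₚ.≤-trans (ℕₚ.<⇒≤ (n^≤ 3 (s≤s (s≤s (s≤s z≤n))))) (ℕₚ.^-monoʳ-≤ q d≤r)))
      where
      cube : ∀ n → n * n * n ≡ n * (n * (n * 1))
      cube = solve-∀

-- The harmonic sum over a common denominator f + 1, where c e = (f + 1)/(e + 1).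
module Harmonic (q k n f : ℕ) (c : ℕ → ℕ) (c-spec : ∀ e → suc e ≤ n → c e ℕ.* suc e ≡ suc f) where
  open Sums
  open import Data.Integer using (_+_; _*_) renaming (_≤_ to _≤ᶻ_; _<_ to _<ᶻ_)
  open import Data.Rational.Unnormalised as ℚᵘ using (mkℚᵘ; *≡*) renaming (_≃_ to _≃ᵘ_)
  import Data.Rational.Unnormalised.Properties as ℚᵘₚ

  near? : ∀ d → Dec (GoodD q k n d × 4 ℕ.* d ≤ n)
  near? d = goodD? q k n d ×-dec (4 ℕ.* d ℕ.≤? n)

  allGood nearGood : ℕ → ℤ
  allGood zero    = 0ℤ
  allGood (suc e) = ⟦ goodD? q k n (suc e) ⟧ * + c e + allGood e
  nearGood zero    = 0ℤ
  nearGood (suc e) = ⟦ near? (suc e) ⟧ * + c e + nearGood e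

  harmonic-value : ∀ D → D ≤ n → harmonicGood q k n D ≃ᵘ mkℚᵘ (allGood D) f
  harmonic-value zero    le = *≡* (trans (ℤₚ.*-zeroˡ (+ suc f)) (sym (ℤₚ.*-zeroˡ 1ℤ)))
  harmonic-value (suc D) le with goodD? q k n (suc D)
  ... | yes _ = ℚᵘₚ.≃-trans (ℚᵘₚ.+-congˡ (mkℚᵘ 1ℤ D) (harmonic-value D (ℕₚ.≤-trans (ℕₚ.n≤1+n D) le))) (*≡* (identity (allGood D) (+ c D) (+ suc D) (+ suc f) (trans (sym (ℤₚ.pos-* (c D) (suc D))) (cong +_ (c-spec D le)))))
    where
    ring : ∀ a c d → (a * d + 1ℤ * (c * d)) * (c * d) ≡ (1ℤ * c + a) * ((c * d) * d)
    ring = ℤ-solve-∀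
    identity : ∀ a c d b → c * d ≡ b → (a * d + 1ℤ * b) * b ≡ (1ℤ * c + a) * (b * d)
    identity a c d b refl = ring a c d
  ... | no _ = ℚᵘₚ.≃-trans (harmonic-value D (ℕₚ.≤-trans (ℕₚ.n≤1+n D) le)) (*≡* (cong (_* + suc f) (sym (trans (cong (_+ allGood D) (ℤₚ.*-zeroˡ (+ c D))) (ℤₚ.+-identityˡ (allGood D))))))

  -- Each d > n/4 contributes at most 4/n.
  allGood-≤ : ∀ D → D ≤ n → + n * allGood D ≤ᶻ + n * nearGood D + + 4 * + suc f * + D
  allGood-≤ zero    le = ℤₚ.≤-reflexive (sym (trans (cong (λ z → + n * 0ℤ + z) (ℤₚ.*-zeroʳ (+ 4 * + suc f))) (ℤₚ.+-identityʳ _)))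
  allGood-≤ (suc e) le = begin
      + n * (⟦ good ⟧ * + c e + allGood e)                                                                  ≡⟨ ℤₚ.*-distribˡ-+ (+ n) (⟦ good ⟧ * + c e) (allGood e) ⟩
      + n * (⟦ good ⟧ * + c e) + + n * allGood e                                                            ≤⟨ ℤₚ.+-mono-≤ (split (goodD? q k n (suc e)) (4 ℕ.* suc e ℕ.≤? n)) (allGood-≤ e (ℕₚ.≤-trans (ℕₚ.n≤1+n e) le)) ⟩
      + n * (⟦ near? (suc e) ⟧ * + c e) + + 4 * + suc f + (+ n * nearGood e + + 4 * + suc f * + e)          ≡⟨ collect (+ n) (⟦ near? (suc e) ⟧ * + c e) (+ 4 * + suc f) (nearGood e) (+ e) ⟩
      + n * (⟦ near? (suc e) ⟧ * + c e + nearGood e) + + 4 * + suc f * (1ℤ + + e)                           ∎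
    where
    open ℤₚ.≤-Reasoning
    good = goodD? q k n (suc e)
    collect : ∀ n a b m e → n * a + b + (n * m + b * e) ≡ n * (a + m) + b * (1ℤ + e)
    collect = ℤ-solve-∀
    0≤rest : 0ℤ ≤ᶻ + 4 * + suc f
    0≤rest = *-nonneg {+ 4} {+ suc f} (ℤ.+≤+ z≤n) (ℤ.+≤+ z≤n)
    more : ∀ i → i ≤ᶻ i + + 4 * + suc f
    more i = ℤₚ.≤-trans (ℤₚ.≤-reflexive (sym (ℤₚ.+-identityʳ i))) (ℤₚ.+-monoʳ-≤ i 0≤rest)
    far : ¬ 4 ℕ.* suc e ≤ n → + n * (1ℤ * + c e) ≤ᶻ + 4 * + suc f
    far 4d≰n = begin
      + n * (1ℤ * + c e)        ≡⟨ cong (+ n *_) (ℤₚ.*-identityˡ (+ c e)) ⟩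
      + n * + c e               ≡⟨ ℤₚ.pos-* n (c e) ⟨
      + (n ℕ.* c e)             ≤⟨ ℤ.+≤+ (ℕₚ.*-monoˡ-≤ (c e) (ℕₚ.<⇒≤ (ℕₚ.≰⇒> 4d≰n))) ⟩
      + (4 ℕ.* suc e ℕ.* c e)   ≡⟨ cong +_ (trans (ℕₚ.*-assoc 4 (suc e) (c e)) (cong (4 ℕ.*_) (trans (ℕₚ.*-comm (suc e) (c e)) (c-spec e le)))) ⟩
      + (4 ℕ.* suc f)           ≡⟨ ℤₚ.pos-* 4 (suc f) ⟩
      + 4 * + suc f             ∎
    split : ∀ {A : Set} (d : Dec A) (d′ : Dec (4 ℕ.* suc e ≤ n)) → + n * (⟦ d ⟧ * + c e) ≤ᶻ + n * (⟦ d ×-dec d′ ⟧ * + c e) + + 4 * + suc f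
    split (yes _) (yes _) = more (+ n * (1ℤ * + c e))
    split (yes _) (no ¬p) = ℤₚ.≤-trans (far ¬p) (ℤₚ.≤-reflexive (sym (trans (cong (λ z → + n * z + + 4 * + suc f) (ℤₚ.*-zeroˡ (+ c e))) (trans (cong (_+ + 4 * + suc f) (ℤₚ.*-zeroʳ (+ n))) (ℤₚ.+-identityˡ _)))))
    split (no _)  (yes _) = more (+ n * (0ℤ * + c e))
    split (no _)  (no _)  = more (+ n * (0ℤ * + c e))

  -- The 4 pays for the degrees d > n/4, at most n terms of size at most 4/n each.
  nearGood-large : ∀ t → 1 ≤ n → (+ (t ℕ.+ 4) ℚᵘ./ 1) ℚᵘ.< harmonicGood q k n n → + t * + suc f ≤ᶻ nearGood n
  nearGood-large t 1≤n lt = +-cancelʳ (+ 4 * + suc f) (+ t * + suc f) (nearGood n) (ℤₚ.≤-trans (ℤₚ.≤-reflexive (sym (trans (cong (_* + suc f) (ℤₚ.pos-+ t 4)) (ℤₚ.*-distribʳ-+ (+ suc f) (+ t) (+ 4)))))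
      (ℤₚ.≤-trans (ℤₚ.<⇒≤ below) (cancel 1≤n (allGood-≤ n ℕₚ.≤-refl))))
    where
    undo : ∀ x z → x + z + ℤ.- z ≡ x
    undo = ℤ-solve-∀
    +-cancelʳ : ∀ z x y → x + z ≤ᶻ y + z → x ≤ᶻ y
    +-cancelʳ z x y h = subst₂ _≤ᶻ_ (undo x z) (undo y z) (ℤₚ.+-monoˡ-≤ (ℤ.- z) h)
    below : + (t ℕ.+ 4) * + suc f <ᶻ allGood n
    below = ℤₚ.<-≤-trans (ℚᵘₚ.drop-*<* (ℚᵘₚ.<-respʳ-≃ (harmonic-value n ℕₚ.≤-refl) lt)) (ℤₚ.≤-reflexive (ℤₚ.*-identityʳ (allGood n)))
    factor : ∀ n a b → n * a + b * n ≡ n * (a + b)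
    factor = ℤ-solve-∀
    cancel : ∀ {m} → 1 ≤ m → + m * allGood n ≤ᶻ + m * nearGood n + + 4 * + suc f * + m → allGood n ≤ᶻ nearGood n + + 4 * + suc f
    cancel {suc m} (s≤s _) h = ℤₚ.*-cancelˡ-≤-pos (allGood n) (nearGood n + + 4 * + suc f) (+ suc m) (ℤₚ.≤-trans h (ℤₚ.≤-reflexive (factor (+ suc m) (nearGood n) (+ 4 * + suc f))))

-- The extensions of good degree and their estimates

module GoodDegrees (𝔽 : FiniteField) (k n s : ℕ) (1≤k : 1 ≤ k) (1≤s : 1 ≤ s)
                   (n-large : 2 ℕ.* (s ℕ.* s) ℕ.* (FiniteField.q 𝔽 ℕ.* FiniteField.q 𝔽) ≤ n) where
  open FieldFacts 𝔽 using (q; 2≤q)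
  open Characteristic 𝔽
  open SeparablePrime 𝔽 using (exists-extension)
  open TraceLaw 𝔽 using (PolynomialBound)
  open Numerics
  open Sums
  open import Data.Nat using (_!)
  open import Data.Nat.DivMod using (m/n*n≡m)
  open import Data.Nat.Divisibility using (∣-trans; m≤n⇒m!∣n!; m∣m*n)
  open import Data.Nat.GCD using (gcd[m,n]≡0⇒m≡0)
  open import Data.Integer using (_+_; _*_) renaming (_≤_ to _≤ᶻ_; _<_ to _<ᶻ_)
  import Data.Rational.Unnormalised as ℚᵘ

  private
    t = s ℕ.* s

    1≤t : 1 ≤ t
    1≤t = ℕₚ.*-mono-≤ 1≤s 1≤s

    instance
      t≢0 : ℕ.NonZero t
      t≢0 = ℕ.>-nonZero 1≤t
      n!≢0 : ℕ.NonZero (n !)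
      n!≢0 = n ℕₚ.!≢0
      q≢0 : ℕ.NonZero q
      q≢0 = ℕ.>-nonZero (ℕₚ.≤-trans (s≤s z≤n) 2≤q)

    f : ℕ
    f = ℕ.pred (n !)

    -- The factorial is a common denominator of all 1/d with d ≤ n, so these integers are the
    -- fractions 1/(e + 1) times one constant.
    c : ℕ → ℕ
    c e = n ! ℕ./ suc e

    c-spec : ∀ e → suc e ≤ n → c e ℕ.* suc e ≡ suc f
    c-spec e le = trans (m/n*n≡m (∣-trans (m∣m*n (e !)) (m≤n⇒m!∣n! le))) (sym (ℕₚ.suc-pred (n !)))

    Q^ : ∀ j → + (q ℕ.^ j) ≡ Q ℤ.^ j
    Q^ zero    = refl
    Q^ (suc j) = trans (ℤₚ.pos-* q (q ℕ.^ j)) (cong (Q *_) (Q^ j))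

  open Harmonic q k n f c c-spec

  private
    Near : ℕ → Set
    Near d = GoodD q k n d × 4 ℕ.* d ≤ n

    deg : FieldExtension 𝔽 → ℕ
    deg = FieldExtension.e

    near⇒≤ : ∀ {d} → Near d → d ≤ n
    near⇒≤ {d} (_ , 4d≤n) = ℕₚ.≤-trans (ℕₚ.m≤n*m d 4) 4d≤n

    extension : ∀ e → Near (suc e) → ∃ λ 𝕃 → deg 𝕃 ≡ e
    extension e near@((good , _) , _) = exists-extension e h lo (subst₂ _<ᶻ_
        (trans (ℤₚ.pos-+ (suc e ℕ.* q ℕ.^ suc h) (e ℕ.* q ℕ.^ h)) (cong₂ _+_ (trans (ℤₚ.pos-* (suc e) (q ℕ.^ suc h)) (cong (+ suc e *_) (Q^ (suc h)))) (trans (ℤₚ.pos-* e (q ℕ.^ h)) (cong (+ e *_) (Q^ h)))))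
        (Q^ (suc e)) (ℤ.+<+ (LargeDegree.few-reducible 2≤q 1≤t n-large (near⇒≤ near) good {h} hi)))
      where
      h = proj₁ (halve e)
      lo = proj₁ (proj₂ (halve e))
      hi = proj₂ (proj₂ (halve e))

    add : ∀ e → Dec (Near (suc e)) → List (FieldExtension 𝔽) → List (FieldExtension 𝔽)
    add e (yes near) 𝕃s = proj₁ (extension e near) ∷ 𝕃s
    add e (no _)     𝕃s = 𝕃s

  extensions : ℕ → List (FieldExtension 𝔽)
  extensions zero    = []
  extensions (suc e) = add e (near? (suc e)) (extensions e)

  private
    all-near : ∀ D → All (λ 𝕃 → Near (suc (deg 𝕃))) (extensions D)
    all-near zero    = []
    all-near (suc e) = step (near? (suc e)) (all-near e)
      where
      step : ∀ d {𝕃s} → All (λ 𝕃 → Near (suc (deg 𝕃))) 𝕃s → All (λ 𝕃 → Near (suc (deg 𝕃))) (add e d 𝕃s)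
      step (yes near) all = subst (λ x → Near (suc x)) (sym (proj₂ (extension e near))) near ∷ all
      step (no _)     all = all

    sum-extensions : ∀ D → ∑ (extensions D) (λ 𝕃 → + c (deg 𝕃)) ≡ nearGood D
    sum-extensions zero    = refl
    sum-extensions (suc e) = trans (step (near? (suc e)) (extensions e)) (cong (λ z → ⟦ near? (suc e) ⟧ * + c e + z) (sum-extensions e))
      where
      step : ∀ d 𝕃s → ∑ (add e d 𝕃s) (λ 𝕃 → + c (deg 𝕃)) ≡ ⟦ d ⟧ * + c e + ∑ 𝕃s (λ 𝕃 → + c (deg 𝕃))
      step (yes near) 𝕃s = cong (λ z → z + ∑ 𝕃s (λ 𝕃 → + c (deg 𝕃))) (trans (cong (λ x → + c x) (proj₂ (extension e near))) (sym (ℤₚ.*-identityˡ (+ c e))))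
      step (no _)     𝕃s = sym (trans (cong (λ z → z + ∑ 𝕃s (λ 𝕃 → + c (deg 𝕃))) (ℤₚ.*-zeroˡ (+ c e))) (ℤₚ.+-identityˡ _))

    ofDegree : List (FieldExtension 𝔽) → ℕ → ℤ
    ofDegree 𝕃s x = ∑ 𝕃s (λ 𝕃 → ⟦ x ℕ.≟ deg 𝕃 ⟧ * + c (deg 𝕃))

    -- The degrees are distinct, because the list is built by increasing degree.
    ofDegree≤ : ∀ D x → ofDegree (extensions D) x ≤ᶻ + c x × (D ≤ x → ofDegree (extensions D) x ≤ᶻ 0ℤ)
    ofDegree≤ zero    x = ℤ.+≤+ z≤n , (λ _ → ℤₚ.≤-refl)
    ofDegree≤ (suc e) x = step (near? (suc e)) (extensions e) (ofDegree≤ e x)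
      where
      head : ∀ y (d : Dec (x ≡ y)) rest → y ≡ e → rest ≤ᶻ + c x × (e ≤ x → rest ≤ᶻ 0ℤ) → ⟦ d ⟧ * + c y + rest ≤ᶻ + c x × (suc e ≤ x → ⟦ d ⟧ * + c y + rest ≤ᶻ 0ℤ)
      head y (yes refl) rest refl (_ , none) = ℤₚ.≤-trans (ℤₚ.+-monoʳ-≤ (1ℤ * + c y) (none ℕₚ.≤-refl)) (ℤₚ.≤-reflexive (trans (ℤₚ.+-identityʳ _) (ℤₚ.*-identityˡ (+ c y)))) , (λ lt → contradiction lt (ℕₚ.<-irrefl refl))
      head y (no _) rest refl (le , none) = ℤₚ.≤-trans (ℤₚ.≤-reflexive drop) le , (λ lt → ℤₚ.≤-trans (ℤₚ.≤-reflexive drop) (none (ℕₚ.<⇒≤ lt)))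
        where
        drop : 0ℤ * + c y + rest ≡ rest
        drop = trans (cong (_+ rest) (ℤₚ.*-zeroˡ (+ c y))) (ℤₚ.+-identityˡ rest)
      step : ∀ d 𝕃s → ofDegree 𝕃s x ≤ᶻ + c x × (e ≤ x → ofDegree 𝕃s x ≤ᶻ 0ℤ) → ofDegree (add e d 𝕃s) x ≤ᶻ + c x × (suc e ≤ x → ofDegree (add e d 𝕃s) x ≤ᶻ 0ℤ)
      step (yes near) 𝕃s ih         = head (deg (proj₁ (extension e near))) (x ℕ.≟ deg (proj₁ (extension e near))) (ofDegree 𝕃s x) (proj₂ (extension e near)) ih
      step (no _)     𝕃s (le , none) = le , (λ lt → none (ℕₚ.<⇒≤ lt))

    module Estimates (𝕃 : FieldExtension 𝔽) (near : Near (suc (deg 𝕃))) where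
      open LargeDegree 2≤q 1≤t n-large (near⇒≤ near) (proj₁ (proj₁ near)) public
      module L = Moments 𝕃

      h : ℕ
      h = proj₁ (halve (deg 𝕃))

      h≤ : h ℕ.+ h ≤ suc (deg 𝕃)
      h≤ = proj₂ (proj₂ (halve (deg 𝕃)))

      2≤x : 2 ≤ x
      2≤x = ℕₚ.≤-trans 2≤q (ℕₚ.m≤m*n q (q ℕ.^ deg 𝕃) {{ℕₚ.m^n≢0 q (deg 𝕃)}})

      size : + x ≡ L.E.size
      size = trans (Q^ (suc (deg 𝕃))) (sym L.K-size)

      #nonGenerators≤ : L.#nonGenerators ≤ᶻ + (q ℕ.^ h ℕ.* h)
      #nonGenerators≤ = ℤₚ.≤-trans (L.nonGenerators≤ {h} {x ∸ 2} (proj₁ (proj₂ (halve (deg 𝕃)))) (trans (cong +_ (ℕₚ.m+[n∸m]≡n 2≤x)) size))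
        (ℤₚ.≤-reflexive (trans (cong (_* + h) (sym (Q^ h))) (sym (ℤₚ.pos-* (q ℕ.^ h) h))))

      few : + s * + s * L.#nonGenerators ≤ᶻ Q ℤ.^ suc (deg 𝕃)
      few = ℤₚ.≤-trans (*-monoˡ (*-nonneg {+ s} {+ s} (ℤ.+≤+ z≤n) (ℤ.+≤+ z≤n)) #nonGenerators≤)
        (ℤₚ.≤-trans (ℤₚ.≤-reflexive (trans (cong (_* + (q ℕ.^ h ℕ.* h)) (sym (ℤₚ.pos-* s s))) (sym (ℤₚ.pos-* t (q ℕ.^ h ℕ.* h)))))
        (ℤₚ.≤-trans (ℤ.+≤+ (t-nonGenerators {h} h≤)) (ℤₚ.≤-reflexive (Q^ (suc (deg 𝕃))))))

      γ : ℕ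
      γ = gcd k (x ∸ 1)

      0≤D : 0ℤ ≤ᶻ L.#roots-of-unity k
      0≤D = ∑-nonneg L.E.list (λ ζ → *-nonneg (⟦⟧-nonneg (L.nonzero? ζ)) (⟦⟧-nonneg (ζ L.^ k L.E.≟ L.1#)))

      D≤γ : L.#roots-of-unity k ≤ᶻ + γ
      D≤γ = L.#roots-of-unity≤gcd {x ∸ 1} (trans (cong +_ (ℕₚ.m+[n∸m]≡n (ℕₚ.≤-trans (s≤s z≤n) 2≤x))) size) k
        (λ γ≡0 → contradiction 1≤k (ℕₚ.<⇒≱ (s≤s (ℕₚ.≤-reflexive (gcd[m,n]≡0⇒m≡0 γ≡0)))))

      powerSum≤ : ∀ b → 2 ℕ.* t ℕ.* ∣ L.powerSum k b L.1# ∣ ≤ x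
      powerSum≤ b = powerSum-small {γ} {∣ w ∣} (proj₂ (proj₁ near)) (ℤₚ.drop‿+≤+ (begin
          + (∣ w ∣ ℕ.* ∣ w ∣)                                        ≡⟨ ℤₚ.pos-* ∣ w ∣ ∣ w ∣ ⟩
          abs w * abs w                                              ≡⟨ abs-square w ⟩
          w * w                                                      ≤⟨ L.powerSum² k b ⟩
          D * (Q * Q * L.E.size * (Q * D))                           ≡⟨ cong (λ z → D * (Q * Q * z * (Q * D))) (sym size) ⟩
          D * (Q * Q * + x * (Q * D))                                ≤⟨ *-mono {D} {+ γ} (*-nonneg 0≤QQx (*-nonneg 0≤Q 0≤D)) (ℤ.+≤+ z≤n) D≤γ (*-monoˡ 0≤QQx (*-monoˡ 0≤Q D≤γ)) ⟩
          + γ * (Q * Q * + x * (Q * + γ))                            ≡⟨ pos ⟨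
          + (γ ℕ.* (q ℕ.* q ℕ.* x ℕ.* (q ℕ.* γ)))                    ∎))
        where
        open ℤₚ.≤-Reasoning
        w = L.powerSum k b L.1#
        D = L.#roots-of-unity k
        0≤QQx : 0ℤ ≤ᶻ Q * Q * + x
        0≤QQx = *-nonneg (*-nonneg 0≤Q 0≤Q) (ℤ.+≤+ z≤n)
        pos : + (γ ℕ.* (q ℕ.* q ℕ.* x ℕ.* (q ℕ.* γ))) ≡ + γ * (Q * Q * + x * (Q * + γ))
        pos = trans (ℤₚ.pos-* γ _) (cong (+ γ *_) (trans (ℤₚ.pos-* (q ℕ.* q ℕ.* x) (q ℕ.* γ)) (cong₂ _*_ (trans (ℤₚ.pos-* (q ℕ.* q) x) (cong (_* + x) (ℤₚ.pos-* q q))) (ℤₚ.pos-* q γ))))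

      -- The power sum over all units and the non-generators each use half of the allowance x/t;
      -- this is the origin of the factor 2 in the bound on n.
      generatorSum≤ : ∀ b → t ℕ.* ∣ L.generatorSum k b ∣ ≤ x
      generatorSum≤ b = ℕₚ.*-cancelˡ-≤ 2 (begin
          2 ℕ.* (t ℕ.* ∣ g ∣)                                                    ≡⟨ ℕₚ.*-assoc 2 t ∣ g ∣ ⟨
          2 ℕ.* t ℕ.* ∣ g ∣                                                      ≤⟨ ℕₚ.*-monoʳ-≤ (2 ℕ.* t) split ⟩
          2 ℕ.* t ℕ.* (∣ w ∣ ℕ.+ q ℕ.* (q ℕ.^ h ℕ.* h))                          ≡⟨ ℕₚ.*-distribˡ-+ (2 ℕ.* t) ∣ w ∣ _ ⟩
          2 ℕ.* t ℕ.* ∣ w ∣ ℕ.+ 2 ℕ.* t ℕ.* (q ℕ.* (q ℕ.^ h ℕ.* h))              ≤⟨ ℕₚ.+-mono-≤ (powerSum≤ b) (2tq-nonGenerators {h} h≤) ⟩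
          x ℕ.+ x                                                                ≡⟨ cong (x ℕ.+_) (ℕₚ.+-identityʳ x) ⟨
          2 ℕ.* x                                                                ∎)
        where
        open ℕₚ.≤-Reasoning
        g = L.generatorSum k b
        w = L.powerSum k b L.1#
        split : ∣ g ∣ ≤ ∣ w ∣ ℕ.+ q ℕ.* (q ℕ.^ h ℕ.* h)
        split = ℤₚ.drop‿+≤+ (ℤₚ.≤-trans (L.generatorSum≤ 1≤e k b) (ℤₚ.≤-trans (ℤₚ.+-monoʳ-≤ (abs w) (*-monoˡ 0≤Q #nonGenerators≤))
          (ℤₚ.≤-reflexive (sym (trans (ℤₚ.pos-+ ∣ w ∣ _) (cong (λ z → + ∣ w ∣ + z) (ℤₚ.pos-* q (q ℕ.^ h ℕ.* h))))))))

      suitable : ∀ m b → n ≤ suc m ℕ.+ suc m → PolynomialLaw.Suitable m k b (extensions n) (λ e → + c e) (+ suc f) (+ s) 𝕃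
      suitable m b n≤ = record
        { 1≤e          = 1≤e
        -- From 4d ≤ n ≤ 2(m + 1) it follows that 2d ≤ m + 1.
        ; degree≤      = ℕₚ.*-cancelˡ-≤ 2 (ℕₚ.≤-trans (ℕₚ.≤-reflexive (quadruple (suc (deg 𝕃)))) (ℕₚ.≤-trans (proj₂ near) (ℕₚ.≤-trans n≤ (ℕₚ.≤-reflexive (cong (suc m ℕ.+_) (sym (ℕₚ.+-identityʳ (suc m))))))))
        ; 0≤c          = ℤ.+≤+ z≤n
        ; c-normalised = trans (sym (ℤₚ.pos-* (c (deg 𝕃)) (suc (deg 𝕃)))) (cong +_ (c-spec (deg 𝕃) (near⇒≤ near)))
        ; few          = few
        ; B            = + (x ℕ./ t)
        ; generatorSum = λ b′ → ℤ.+≤+ (floor-bound t (generatorSum≤ b′))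
        ; B-small      = ℤₚ.≤-trans (ℤₚ.≤-reflexive (trans (cong (_* + (x ℕ./ t)) (sym (ℤₚ.pos-* s s))) (sym (ℤₚ.pos-* t (x ℕ./ t))))) (ℤₚ.≤-trans (ℤ.+≤+ (floor-≤ t x)) (ℤₚ.≤-reflexive (Q^ (suc (deg 𝕃)))))
        }
        where
        open import Data.Nat.Tactic.RingSolver using (solve-∀)
        quadruple : ∀ d → 2 ℕ.* (d ℕ.+ d) ≡ 4 ℕ.* d
        quadruple = solve-∀

  module _ (diverging : (+ (t ℕ.+ 4) ℚᵘ./ 1) ℚᵘ.< harmonicGood q k n n) where
    private
      1≤n : 1 ≤ n
      1≤n = ℕₚ.≤-trans (ℕₚ.*-mono-≤ (ℕₚ.*-mono-≤ {1} {2} (s≤s z≤n) 1≤t) (ℕₚ.*-mono-≤ (ℕₚ.<⇒≤ 2≤q) (ℕₚ.<⇒≤ 2≤q))) n-large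

      μ : ℤ
      μ = ∑ (extensions n) (λ 𝕃 → + c (deg 𝕃))

      large : + s * + s * + suc f ≤ᶻ μ
      large = ℤₚ.≤-trans (ℤₚ.≤-reflexive (cong (_* + suc f) (sym (ℤₚ.pos-* s s)))) (ℤₚ.≤-trans (nearGood-large t 1≤n diverging) (ℤₚ.≤-reflexive (sym (sum-extensions n))))

      1≤μ : 1ℤ ≤ᶻ μ
      1≤μ = ℤₚ.≤-trans (ℤ.+≤+ (ℕₚ.*-mono-≤ 1≤t (s≤s (z≤n {f})))) (ℤₚ.≤-trans (ℤₚ.≤-reflexive (trans (ℤₚ.pos-* t (suc f)) (cong (_* + suc f) (ℤₚ.pos-* s s)))) large)

      -- The weighted sum over near degrees is positive, so there is one; its d satisfies n¹² < q^d
      -- and d ≤ n/4, which is how n is compared with powers of q.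
      someNear : ∃ λ e → Near (suc e)
      someNear = first (extensions n) (all-near n) 1≤μ
        where
        first : ∀ 𝕃s → All (λ 𝕃 → Near (suc (deg 𝕃))) 𝕃s → 1ℤ ≤ᶻ ∑ 𝕃s (λ 𝕃 → + c (deg 𝕃)) → ∃ λ e → Near (suc e)
        first []       _          (ℤ.+≤+ ())
        first (𝕃 ∷ 𝕃s) (near ∷ _) _          = deg 𝕃 , near

      polynomialBound : ∀ m → n ≤ suc m ℕ.+ suc m → PolynomialBound k s m
      polynomialBound m n≤ b = PolynomialLaw.law m k b (extensions n) (λ e → + c e) (+ suc f) (+ s)
        (All.map (λ {𝕃} near → Estimates.suitable 𝕃 near m b n≤) (all-near n))
        (All.universal (λ 𝕃 → proj₁ (ofDegree≤ n (deg 𝕃))) (extensions n)) (ℤ.+≤+ 1≤s) (ℤ.+≤+ z≤n) 1≤μ large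

    -- A block of at least half the size leaves room for every near degree, so the polynomial law
    -- applies. Otherwise r > n/2, which exceeds a near degree d, and q^r ≥ q^d dominates s n q.
    dichotomy : ∀ e r → suc e ℕ.+ r ≡ n → PolynomialBound k s e ⊎ + s * + n * Q ≤ᶻ Q ℤ.^ r
    dichotomy e r n≡ = decide (r ℕ.≤? suc e)
      where
      d = proj₁ someNear
      near = proj₂ someNear
      decide : Dec (r ≤ suc e) → PolynomialBound k s e ⊎ + s * + n * Q ≤ᶻ Q ℤ.^ r
      decide (yes r≤) = inj₁ (polynomialBound e (ℕₚ.≤-trans (ℕₚ.≤-reflexive (sym n≡)) (ℕₚ.+-monoʳ-≤ (suc e) r≤)))
      decide (no r≰)  = inj₂ (ℤₚ.≤-trans (ℤₚ.≤-reflexive (sym (trans (ℤₚ.pos-* (s ℕ.* n) q) (cong (_* Q) (ℤₚ.pos-* s n)))))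
          (ℤₚ.≤-trans (ℤ.+≤+ (LargeDegree.tail-small 2≤q 1≤t n-large (near⇒≤ near) (proj₁ (proj₁ near)) {s} {r} (ℕₚ.m≤m*n s s {{ℕ.>-nonZero 1≤s}}) d≤r)) (ℤₚ.≤-reflexive (Q^ r))))
        where
        d≤r : suc d ≤ r
        d≤r = ℕₚ.*-cancelˡ-≤ 2 (ℕₚ.≤-trans (ℕₚ.*-monoˡ-≤ (suc d) {2} {4} (s≤s (s≤s z≤n))) (ℕₚ.≤-trans (proj₂ near) (ℕₚ.≤-trans (ℕₚ.≤-reflexive (sym n≡))
          (ℕₚ.≤-trans (ℕₚ.+-monoˡ-≤ r (ℕₚ.<⇒≤ (ℕₚ.≰⇒> r≰))) (ℕₚ.≤-reflexive (cong (r ℕ.+_) (sym (ℕₚ.+-identityʳ r))))))))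

theorem1p3 :
    (𝔽 : FiniteField) (k : ℕ → ℕ) →
    (∀ n → 1 ≤ n → 1 ≤ k n) →
    DivergesToInfinity (S (FiniteField.q 𝔽) k) →
    Matrices.TraceLawTendsToUniform 𝔽 k
theorem1p3 𝔽 k 1≤k diverges M = N ℕ.+ C , bound
  where
  open FieldFacts 𝔽 using (q; 2≤q)
  open Matrices 𝔽 using (#GL; #TrPow)
  s t C N : ℕ
  -- The bound obtained has the constant 4q + 3, and 4q + 3 < 6q because q ≥ 2; dividing by 6 leaves
  -- the required accuracy 1/(M + 1).
  s = 6 ℕ.* suc M
  t = s ℕ.* s
  C = 2 ℕ.* t ℕ.* (q ℕ.* q)
  -- Beyond this index the degrees up to n/4 still have harmonic sum at least t = s², once 4 is
  -- given up for the larger ones.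
  N = proj₁ (diverges (t ℕ.+ 4))

  1≤C : 1 ≤ C
  1≤C = ℕₚ.*-mono-≤ (ℕₚ.*-mono-≤ {1} {2} (s≤s z≤n) (ℕₚ.*-mono-≤ {1} {s} {1} {s} (s≤s z≤n) (s≤s z≤n))) (ℕₚ.*-mono-≤ (ℕₚ.<⇒≤ 2≤q) (ℕₚ.<⇒≤ 2≤q))

  4q+3<6q : 4 ℕ.* q ℕ.+ 3 < 6 ℕ.* q
  4q+3<6q = ℕₚ.≤-trans (ℕₚ.≤-reflexive (sym (ℕₚ.+-suc (4 ℕ.* q) 3))) (ℕₚ.≤-trans (ℕₚ.+-monoʳ-≤ (4 ℕ.* q) (ℕₚ.*-monoʳ-≤ 2 2≤q)) (ℕₚ.≤-reflexive (sym (ℕₚ.*-distribʳ-+ q 4 2))))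

  finish : ∀ Δ G → 1 ≤ G → s ℕ.* Δ ≤ (4 ℕ.* q ℕ.+ 3) ℕ.* G → suc M ℕ.* Δ < q ℕ.* G
  finish Δ G@(suc _) _ h = ℕₚ.*-cancelˡ-< 6 _ _ (ℕₚ.≤-<-trans (ℕₚ.≤-trans (ℕₚ.≤-reflexive (sym (ℕₚ.*-assoc 6 (suc M) Δ))) h)
    (ℕₚ.<-≤-trans (ℕₚ.*-monoˡ-< G 4q+3<6q) (ℕₚ.≤-reflexive (ℕₚ.*-assoc 6 q G))))

  bound : ∀ n → N ℕ.+ C ≤ n → ∀ a → suc M ℕ.* ℕ.∣ q ℕ.* #TrPow n (k n) a - #GL n ∣ < q ℕ.* #GL n
  bound zero    le a = contradiction (ℕₚ.≤-trans 1≤C (ℕₚ.≤-trans (ℕₚ.m≤n+m C N) le)) (λ ())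
  bound (suc m) le a = finish _ _ (TraceLaw.1≤#GL 𝔽 (suc m)) (TraceLaw.GL-law 𝔽 m (k (suc m)) a s
    (GoodDegrees.dichotomy 𝔽 (k (suc m)) (suc m) s (1≤k (suc m) (s≤s z≤n)) (s≤s z≤n) (ℕₚ.≤-trans (ℕₚ.m≤n+m C N) le)
      (proj₂ (diverges (t ℕ.+ 4)) (suc m) (ℕₚ.≤-trans (ℕₚ.m≤m+n N C) le))))
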